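{- For every $\alpha>0$ there exists a constant $\beta>0$ such that for every cyclically $4$-edge-connected cubic graph $G$ with $n$ vertices and every edge $e$ of $G$, the number of perfect matchings of $G$ not containing $e$ is at least $\alpha n-\beta$.
   Context: Graphs may have parallel edges. For a partition $\{A,B\}$ of $V(G)$, $E(A,B)$ denotes the set of edges with one end in $A$ and the other in $B$; it is a $k$-edge-cut if it has $k$ edges. An edge-cut $E(A,B)$ is cyclic if both $G[A]$ and $G[B]$ contain a cycle. A graph is cyclically $k$-edge-connected if it has no cyclic edge-cut with fewer than $k$ edges. -}

module Defs where

open import Data.Nat using (ℕ; zero; suc; _≤_; _<_)
open import Data.Nat.DivMod using (_%_; m%n<n)
open import Data.Fin using (Fin; toℕ; fromℕ<)
open import Data.Fin.Properties using (_≟_; all?)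
open import Data.Bool using (Bool; true; false; T; not)
open import Data.Vec using (Vec; []; _∷_; lookup)
open import Data.List using (List; []; _∷_; map; _++_; filter; length; allFin)
open import Data.Product using (Σ; _×_; _,_; ∃)
open import Data.Sum using (_⊎_)
open import Relation.Binary.PropositionalEquality using (_≡_; _≢_)
open import Relation.Nullary using (¬_; Dec; yes; no)
open import Relation.Nullary.Decidable using (_×-dec_; _⊎-dec_; ¬?)
open import Function.Definitions using (Injective)

record Multigraph : Set where
  field
    n    : ℕ
    m    : ℕ
    src  : Fin m → Fin n
    tgt  : Fin m → Fin n
    noLoop : ∀ e → src e ≢ tgt e

open Multigraph public

Incident : (G : Multigraph) → Fin (n G) → Fin (m G) → Set
Incident G v e = (src G e ≡ v) ⊎ (tgt G e ≡ v)

incident? : (G : Multigraph) → (v : Fin (n G)) → (e : Fin (m G)) → Dec (Incident G v e)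
incident? G v e = (src G e ≟ v) ⊎-dec (tgt G e ≟ v)

Joins : (G : Multigraph) → Fin (m G) → Fin (n G) → Fin (n G) → Set
Joins G e u v = ((src G e ≡ u) × (tgt G e ≡ v)) ⊎ ((src G e ≡ v) × (tgt G e ≡ u))

-- degree (no loops, so each incident edge counts once)
degree : (G : Multigraph) → Fin (n G) → ℕ
degree G v = length (filter (incident? G v) (allFin (m G)))

Cubic : Multigraph → Set
Cubic G = ∀ v → degree G v ≡ 3

VSet : Multigraph → Set
VSet G = Fin (n G) → Bool

cycSucc : ∀ {k} → Fin (suc k) → Fin (suc k)
cycSucc {k} i = fromℕ< (m%n<n (suc (toℕ i)) (suc k))

-- G[A] contains a cycle: distinct vertices v_0..v_{k+1} of A and distinct
-- edges e_0..e_{k+1}, e_i joining v_i and v_{i+1 mod (k+2)} (length ≥ 2;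
-- length-2 cycles are pairs of parallel edges).
HasCycleIn : (G : Multigraph) → VSet G → Set
HasCycleIn G A =
  Σ ℕ λ k →
  Σ (Fin (suc (suc k)) → Fin (n G)) λ vs →
  Σ (Fin (suc (suc k)) → Fin (m G)) λ es →
    Injective _≡_ _≡_ vs × Injective _≡_ _≡_ es ×
    (∀ i → T (A (vs i))) ×
    (∀ i → Joins G (es i) (vs i) (vs (cycSucc i)))

complement : (G : Multigraph) → VSet G → VSet G
complement G A v = not (A v)

Crosses : (G : Multigraph) → VSet G → Fin (m G) → Set
Crosses G A e = ¬ (A (src G e) ≡ A (tgt G e))

crosses? : (G : Multigraph) → (A : VSet G) → (e : Fin (m G)) → Dec (Crosses G A e)
crosses? G A e = ¬? (Data.Bool._≟_ (A (src G e)) (A (tgt G e)))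
  where import Data.Bool

cutSize : (G : Multigraph) → VSet G → ℕ
cutSize G A = length (filter (crosses? G A) (allFin (m G)))

CyclicCut : (G : Multigraph) → VSet G → Set
CyclicCut G A = HasCycleIn G A × HasCycleIn G (complement G A)

CyclicallyEdgeConnected : ℕ → Multigraph → Set
CyclicallyEdgeConnected k G = ∀ A → CyclicCut G A → k ≤ cutSize G A

ESet : Multigraph → Set
ESet G = Vec Bool (m G)

allVecs : (k : ℕ) → List (Vec Bool k)
allVecs zero = [] ∷ []
allVecs (suc k) = map (true ∷_) (allVecs k) ++ map (false ∷_) (allVecs k)

InM : (G : Multigraph) → ESet G → Fin (m G) → Set
InM G M e = T (lookup M e)

inM? : (G : Multigraph) → (M : ESet G) → (e : Fin (m G)) → Dec (InM G M e)
inM? G M e = Data.Bool.T? (lookup M e)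
  where import Data.Bool

mdeg : (G : Multigraph) → ESet G → Fin (n G) → ℕ
mdeg G M v = length (filter (λ e → inM? G M e ×-dec incident? G v e) (allFin (m G)))

IsPerfectMatching : (G : Multigraph) → ESet G → Set
IsPerfectMatching G M = ∀ v → mdeg G M v ≡ 1

isPM? : (G : Multigraph) → (M : ESet G) → Dec (IsPerfectMatching G M)
isPM? G M = all? (λ v → Data.Nat._≟_ (mdeg G M v) 1)
  where import Data.Nat

pmAvoidingCount : (G : Multigraph) → Fin (m G) → ℕ
pmAvoidingCount G e =
  length (filter (λ M → isPM? G M ×-dec ¬? (inM? G M e)) (allVecs (m G)))

{-# OPTIONS --safe #-}
module Submission where

-- Voorhoeve's identity 3 f(G , e) = Σ f(Gᵢ , eᵢ) reduces the number f of perfect matchings that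
-- avoid e = ux to four graphs Gᵢ, obtained by splitting at the edges uv and uw. In Gᵢ every small cut
-- away from x contains a fixed vertex w, so Gᵢ is a chain of layers, separated by 3-edge-cuts, from x
-- to w. Passing a layer maps the weights of the three strands that cross a cut. A layer with at least
-- three vertices contracts to a smaller cyclically 4-edge-connected graph, which contributes its
-- own surplus f − 2; a layer with two vertices costs a constant. So f(Gᵢ , eᵢ) is about the linear
-- bound for the smaller graphs, less a constant per layer, and four such terms divided by three
-- improve the slope by nearly 4 / 3, provided that there are few layers. Many layers force large
-- weights, hence large f, unless the layers form a long ladder; and a long ladder of G already gives
-- exponentially many perfect matchings avoiding e, since matchings of a ladder satisfy the Fibonacci
-- recursion. Iterating makes the slope arbitrarily large.

open import Defs
open import Data.Nat using (ℕ; zero; suc; _+_; _*_; _∸_; _≤_; _<_; z≤n; s≤s; _^_)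
open import Data.Nat.Properties hiding (_≟_)
open import Data.Nat.DivMod using (_%_; m<n⇒m%n≡m; n%n≡0)
open import Data.Nat.Tactic.RingSolver using (solve-∀)
import Data.Integer as ℤ
import Data.Integer.Properties as ℤₚ
import Data.Rational as ℚ
import Data.Rational.Properties as ℚₚ
open import Data.Rational using (ℚ; 0ℚ; mkℚ)
open import Data.Rational.Unnormalised using (ℚᵘ; mkℚᵘ; *≡*) renaming (*≤* to *≤*ᵘ; _≃_ to _≃ᵘ_)
import Data.Rational.Unnormalised.Properties as ℚᵘₚ
open import Data.Fin using (Fin; zero; suc; toℕ; fromℕ<)
open import Data.Fin.Properties using (_≟_; any?; all?; toℕ<n; toℕ-injective; toℕ-fromℕ<; pigeonhole)
open import Data.Fin.Subset.Properties using (anySubset?)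
import Data.Bool as Bool
open import Data.Bool using (Bool; true; false; not; _∧_; _∨_; _xor_)
import Data.Bool.Properties as Boolₚ
open import Data.Bool.Properties using (∧-comm)
import Data.List as List
open import Data.List using (List; []; _∷_; _++_; map; length; filter)
open import Data.List.Properties using (++-assoc; ++-identityʳ)
open import Data.List.Relation.Unary.All using (All; []; _∷_)
import Data.List.Relation.Unary.All as All
open import Data.Vec using (Vec; []; _∷_; lookup; tabulate)
open import Data.Vec.Properties using (lookup∘tabulate)
open import Data.Product using (Σ; ∃; _×_; _,_; proj₁; proj₂)
open import Data.Sum using (_⊎_; inj₁; inj₂; [_,_]′)
open import Data.Empty using (⊥; ⊥-elim)
open import Data.Unit using (⊤; tt)
open import Relation.Nullary using (¬_; Dec; yes; no; does)
open import Relation.Nullary.Decidable using (dec-true; dec-false; _×-dec_; _→-dec_; ¬?)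
open import Relation.Binary.Definitions using (tri<; tri≈; tri>)
open import Relation.Binary.PropositionalEquality
open import Function using (_∘_; id)

-- Each 3-edge-cut between root and target separates two odd vertex sets, so a matching uses one or
-- all three of its strands; the state of the chain is therefore three weights and a fourth number
-- s. In a contracted layer the inductive bound speaks of a sum of two rows of a transfer matrix,
-- whereas the total weight after the layer mixes products of weights and rows. The inequality a + r
-- ≤ a r + 1 passes from one to the other and loses 1 for each of two rows, which is why the surplus
-- f - 2 and not f is carried along. It requires rows of size at least two; these come from
-- Plesník's theorem (any two edges of a bridgeless cubic graph can be avoided together), proved
-- here by Frink's reduction. The main obstacle is a layer with two vertices, which brings no gain
-- of its own: when one weight is zero, a whole ladder of such layers leaves all weights fixed, so
-- ladders need a separate argument. In the absence of long ladders the total grows quadratically in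
-- the number of layers between doublings, so that a linear threshold is reached after about √n log
-- n layers, and a linear term absorbs their cost.

private variable
  N : ℕ

-- Booleans, finite sums and vertex sets

χ : Bool → ℕ
χ true = 1
χ false = 0

true≢false : ∀ {b} → b ≡ true → b ≡ false → ⊥
true≢false refl ()

bool-cases : ∀ b → (b ≡ true) ⊎ (b ≡ false)
bool-cases true = inj₁ refl
bool-cases false = inj₂ refl

¬true⇒false : ∀ {b} → (b ≡ true → ⊥) → b ≡ false
¬true⇒false {true} h = ⊥-elim (h refl)
¬true⇒false {false} h = refl

∧-true : ∀ {a b} → a ≡ true → b ≡ true → a ∧ b ≡ true
∧-true refl refl = refl

∧-left : ∀ {a b} → a ∧ b ≡ true → a ≡ true
∧-left {true} _ = refl

∧-right : ∀ {a b} → a ∧ b ≡ true → b ≡ true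
∧-right {true} e = e

∧-false₁ : ∀ {a b} → a ≡ false → a ∧ b ≡ false
∧-false₁ refl = refl

∧-false₂ : ∀ {a b} → b ≡ false → a ∧ b ≡ false
∧-false₂ {true} e = e
∧-false₂ {false} _ = refl

bool-ext : ∀ {a b} → (a ≡ true → b ≡ true) → (b ≡ true → a ≡ true) → a ≡ b
bool-ext {true} f g = sym (f refl)
bool-ext {false} {true} f g = g refl
bool-ext {false} {false} f g = refl

not-true : ∀ {a} → a ≡ false → not a ≡ true
not-true refl = refl

not-false : ∀ {a} → a ≡ true → not a ≡ false
not-false refl = refl

not-true⁻ : ∀ {a} → not a ≡ true → a ≡ false
not-true⁻ {false} _ = refl

-- Certificates for linear arithmetic: a combination A ≤ B of hypotheses proves
-- X ≤ Y as soon as the semiring identity X + B + r ≡ Y + A holds.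
lin : ∀ {A B X Y} r → A ≤ B → X + B + r ≡ Y + A → X ≤ Y
lin {A} {B} {X} {Y} r h eq = +-cancelʳ-≤ A X Y (begin
  X + A      ≤⟨ +-monoʳ-≤ X h ⟩
  X + B      ≤⟨ m≤m+n (X + B) r ⟩
  X + B + r  ≡⟨ eq ⟩
  Y + A      ∎)
  where open ≤-Reasoning

sumF : (Fin N → ℕ) → ℕ
sumF {zero} f = 0
sumF {suc N} f = f zero + sumF (f ∘ suc)

sumF-cong : {f g : Fin N → ℕ} → (∀ i → f i ≡ g i) → sumF f ≡ sumF g
sumF-cong {zero} h = refl
sumF-cong {suc N} h = cong₂ _+_ (h zero) (sumF-cong (h ∘ suc))

interchange : ∀ a b c d → (a + b) + (c + d) ≡ (a + c) + (b + d)
interchange = solve-∀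

sumF-+ : (f g : Fin N → ℕ) → sumF (λ i → f i + g i) ≡ sumF f + sumF g
sumF-+ {zero} f g = refl
sumF-+ {suc N} f g rewrite sumF-+ (f ∘ suc) (g ∘ suc) =
  interchange (f zero) (g zero) (sumF (f ∘ suc)) (sumF (g ∘ suc))

sumF-mono : {f g : Fin N → ℕ} → (∀ i → f i ≤ g i) → sumF f ≤ sumF g
sumF-mono {zero} h = z≤n
sumF-mono {suc N} h = +-mono-≤ (h zero) (sumF-mono (h ∘ suc))

-- A graph is an edge list together with such a set. Deletion, splitting and contraction change the
-- set and the list but never the ambient type `Fin N`, so one induction ranges over all graphs that
-- arise.
VSub : ℕ → Set
VSub N = Fin N → Bool

_==_ : Fin N → Fin N → Bool
a == b = does (a ≟ b)

==-refl : (a : Fin N) → (a == a) ≡ true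
==-refl a = dec-true (a ≟ a) refl

==-≢ : {a b : Fin N} → a ≢ b → (a == b) ≡ false
==-≢ {a = a} {b} h = dec-false (a ≟ b) h

==-≡ : {a b : Fin N} → (a == b) ≡ true → a ≡ b
==-≡ {a = a} {b} h with a ≟ b
... | yes e = e

∁ : VSub N → VSub N
∁ X v = not (X v)

infixl 6 _⊖_
infix 4 _≐_

opaque
  _⊖_ : VSub N → Fin N → VSub N
  (U ⊖ a) v = U v ∧ not (v == a)

_≐_ : VSub N → VSub N → Set
U ≐ U′ = ∀ v → U v ≡ U′ v

≐-sym : {U U′ : VSub N} → U ≐ U′ → U′ ≐ U
≐-sym h v = sym (h v)

opaque
  unfolding _⊖_
  ⊖-in : {U : VSub N} {a c : Fin N} → U c ≡ true → c ≢ a → (U ⊖ a) c ≡ true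
  ⊖-in h ne = ∧-true h (not-true (==-≢ ne))

  ⊖-mem : {U : VSub N} {a c : Fin N} → (U ⊖ a) c ≡ true → U c ≡ true
  ⊖-mem = ∧-left

  ⊖-≢ : {U : VSub N} {a c : Fin N} → (U ⊖ a) c ≡ true → c ≢ a
  ⊖-≢ {U = U} {a} {c} h refl with U c | c ≟ c
  ⊖-≢ () refl | true | yes _
  ⊖-≢ () refl | false | yes _
  ... | _ | no k = k refl

  ⊖-self : (U : VSub N) (a : Fin N) → (U ⊖ a) a ≡ false
  ⊖-self U a = ∧-false₂ (not-false (==-refl a))

  ⊖-out : {U : VSub N} {a c : Fin N} → U c ≡ false → (U ⊖ a) c ≡ false
  ⊖-out = ∧-false₁

  ⊖-keep : (U : VSub N) {a c : Fin N} → c ≢ a → (U ⊖ a) c ≡ U c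
  ⊖-keep U {a} {c} ne rewrite ==-≢ ne with U c
  ... | true = refl
  ... | false = refl

  ⊖-cong : {U U′ : VSub N} (a : Fin N) → U ≐ U′ → U ⊖ a ≐ U′ ⊖ a
  ⊖-cong a h v = cong (_∧ not (v == a)) (h v)

  ⊖-comm : (U : VSub N) (a b : Fin N) → U ⊖ a ⊖ b ≐ U ⊖ b ⊖ a
  ⊖-comm U a b v with U v | not (v == a) | not (v == b)
  ... | false | _ | _ = refl
  ... | true | true | true = refl
  ... | true | true | false = refl
  ... | true | false | true = refl
  ... | true | false | false = refl

opaque
  size : VSub N → ℕ
  size U = sumF (χ ∘ U)

opaque
  unfolding size _⊖_
  size-cong : {U U′ : VSub N} → U ≐ U′ → size U ≡ size U′
  size-cong h = sumF-cong (cong χ ∘ h)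

  size-⊖ : (U : VSub N) (a : Fin N) → U a ≡ true → size U ≡ suc (size (U ⊖ a))
  size-⊖ {suc N} U zero h rewrite h =
    cong suc (size-cong {U = U ∘ suc} (λ v → sym (∧-idʳ (U (suc v)))))
    where ∧-idʳ : ∀ b → b ∧ true ≡ b
          ∧-idʳ true = refl
          ∧-idʳ false = refl
  size-⊖ {suc N} U (suc a) h with size-⊖ (U ∘ suc) a h | U zero
  ... | ih | true = cong suc ih
  ... | ih | false = ih

  size-pos : {U : VSub N} {a : Fin N} → U a ≡ true → 1 ≤ size U
  size-pos {U = U} {a} h rewrite size-⊖ U a h = s≤s z≤n

  size-two : {U : VSub N} {a b : Fin N} → a ≢ b → U a ≡ true → U b ≡ true → 2 ≤ size U
  size-two {U = U} {a} {b} ne ha hb rewrite size-⊖ U a ha =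
    s≤s (size-pos {U = U ⊖ a} {b} (⊖-in {U = U} hb (ne ∘ sym)))

  size-mono : {U U′ : VSub N} → (∀ v → U v ≡ true → U′ v ≡ true) → size U ≤ size U′
  size-mono {U = U} {U′} h = sumF-mono λ v → go v (U v) refl
    where go : ∀ v b → U v ≡ b → χ b ≤ χ (U′ v)
          go v true e rewrite h v e = ≤-refl
          go v false e = z≤n

  size-split : (U X : VSub N) → size U ≡ size (λ v → U v ∧ X v) + size (λ v → U v ∧ not (X v))
  size-split U X = trans (sumF-cong λ v → go (U v) (X v))
    (sumF-+ (λ v → χ (U v ∧ X v)) (λ v → χ (U v ∧ not (X v))))
    where go : ∀ a b → χ a ≡ χ (a ∧ b) + χ (a ∧ not b)
          go true true = refl
          go true false = refl
          go false b = refl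

  size-zero : {U : VSub N} → size U ≡ 0 → ∀ v → U v ≡ false
  size-zero {U = U} h v with bool-cases (U v)
  ... | inj₂ e = e
  ... | inj₁ e with U | size-pos {U = U} e
  ... | U | le rewrite h with le
  ... | ()

  size-pick : (U : VSub N) → 1 ≤ size U → ∃ λ v → U v ≡ true
  size-pick {suc N} U h with bool-cases (U zero)
  ... | inj₁ e = zero , e
  ... | inj₂ e rewrite e with size-pick (U ∘ suc) h
  ... | v , hv = suc v , hv

  size-pick≢ : (U : VSub N) (a : Fin N) → 2 ≤ size U → ∃ λ v → U v ≡ true × v ≢ a
  size-pick≢ U a h with bool-cases (U a)
  ... | inj₁ e rewrite size-⊖ U a e with size-pick (U ⊖ a) (≤-pred h)
  ... | v , hv = v , ⊖-mem {U = U} hv , ⊖-≢ {U = U} hv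
  size-pick≢ U a h | inj₂ e with size-pick U (≤-trans (s≤s z≤n) h)
  ... | v , hv = v , hv , λ { refl → true≢false hv e }

  size-⊖≥ : (U : VSub N) (a : Fin N) {k : ℕ} → suc k ≤ size U → k ≤ size (U ⊖ a)
  size-⊖≥ U a h with bool-cases (U a)
  ... | inj₁ e rewrite size-⊖ U a e = ≤-pred h
  ... | inj₂ e = ≤-trans (n≤1+n _) (≤-trans h (≤-reflexive (size-cong {U = U} λ v → go v)))
    where go : ∀ v → U v ≡ U v ∧ not (v == a)
          go v with v ≟ a
          ... | yes refl rewrite e = refl
          ... | no _ with U v
          ... | true = refl
          ... | false = refl

-- Edge lists up to reordering and reversal

Edge : ℕ → Set
Edge N = Fin N × Fin N

EList : ℕ → Set
EList N = List (Edge N)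

infix 4 _≋_

-- Equality of undirected multigraphs, multiplicities included. A hypothesis `E ≋ e ∷ R` both says
-- that `e` is an edge and names the graph left after deleting one copy of it.
data _≋_ {N : ℕ} : EList N → EList N → Set where
  ≋-refl  : ∀ {E} → E ≋ E
  ≋-prep  : ∀ e {E F} → E ≋ F → e ∷ E ≋ e ∷ F
  ≋-swap  : ∀ e f {E} → e ∷ f ∷ E ≋ f ∷ e ∷ E
  ≋-flip  : ∀ a b {E} → (a , b) ∷ E ≋ (b , a) ∷ E
  ≋-trans : ∀ {E F G} → E ≋ F → F ≋ G → E ≋ G

≋-sym : {E F : EList N} → E ≋ F → F ≋ E
≋-sym ≋-refl = ≋-refl
≋-sym (≋-prep e h) = ≋-prep e (≋-sym h)
≋-sym (≋-swap e f) = ≋-swap f e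
≋-sym (≋-flip a b) = ≋-flip b a
≋-sym (≋-trans h k) = ≋-trans (≋-sym k) (≋-sym h)

≡⇒≋ : {E F : EList N} → E ≡ F → E ≋ F
≡⇒≋ refl = ≋-refl

≋-++ʳ : {E F : EList N} (G : EList N) → E ≋ F → E ++ G ≋ F ++ G
≋-++ʳ G ≋-refl = ≋-refl
≋-++ʳ G (≋-prep e h) = ≋-prep e (≋-++ʳ G h)
≋-++ʳ G (≋-swap e f) = ≋-swap e f
≋-++ʳ G (≋-flip a b) = ≋-flip a b
≋-++ʳ G (≋-trans h k) = ≋-trans (≋-++ʳ G h) (≋-++ʳ G k)

≋-++ˡ : (G : EList N) {E F : EList N} → E ≋ F → G ++ E ≋ G ++ F
≋-++ˡ [] h = h
≋-++ˡ (e ∷ G) h = ≋-prep e (≋-++ˡ G h)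

≋-shift : (E : EList N) (e : Edge N) (F : EList N) → E ++ e ∷ F ≋ e ∷ E ++ F
≋-shift [] e F = ≋-refl
≋-shift (f ∷ E) e F = ≋-trans (≋-prep f (≋-shift E e F)) (≋-swap f e)

≋-++-comm : (E F : EList N) → E ++ F ≋ F ++ E
≋-++-comm [] F = ≡⇒≋ (sym (++-identityʳ F))
≋-++-comm (e ∷ E) F = ≋-trans (≋-prep e (≋-++-comm E F)) (≋-sym (≋-shift F e E))

infixr 2 _≋⟨_⟩_
infix 3 _≋∎

_≋⟨_⟩_ : (E : EList N) {F G : EList N} → E ≋ F → F ≋ G → E ≋ G
E ≋⟨ h ⟩ k = ≋-trans h k

_≋∎ : (E : EList N) → E ≋ E
E ≋∎ = ≋-refl

≋-third : ∀ e f g {E : EList N} → e ∷ f ∷ g ∷ E ≋ g ∷ e ∷ f ∷ E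
≋-third e f g = ≋-trans (≋-prep e (≋-swap f g)) (≋-swap e g)

≋-prep₂ : ∀ e f {E F : EList N} → E ≋ F → e ∷ f ∷ E ≋ e ∷ f ∷ F
≋-prep₂ e f h = ≋-prep e (≋-prep f h)

≋-prep₃ : ∀ e f g {E F : EList N} → E ≋ F → e ∷ f ∷ g ∷ E ≋ e ∷ f ∷ g ∷ F
≋-prep₃ e f g h = ≋-prep e (≋-prep₂ f g h)

sumE : (Edge N → ℕ) → EList N → ℕ
sumE φ [] = 0
sumE φ (e ∷ E) = φ e + sumE φ E

Symmetric : (Edge N → ℕ) → Set
Symmetric φ = ∀ a b → φ (a , b) ≡ φ (b , a)

-- Degrees and cut sizes are both of the form `sumE φ` with symmetric `φ`, so this one invariance
-- serves `deg` and `δ`.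
sumE-≋ : {φ : Edge N → ℕ} → Symmetric φ → {E F : EList N} → E ≋ F → sumE φ E ≡ sumE φ F
sumE-≋ s ≋-refl = refl
sumE-≋ {φ = φ} s (≋-prep e h) = cong (φ e +_) (sumE-≋ s h)
sumE-≋ {φ = φ} s (≋-swap e f {E}) = swap₃ (φ e) (φ f) (sumE φ E)
  where swap₃ : ∀ a b c → a + (b + c) ≡ b + (a + c)
        swap₃ = solve-∀
sumE-≋ {φ = φ} s (≋-flip a b {E}) = cong (_+ sumE φ E) (s a b)
sumE-≋ s (≋-trans h k) = trans (sumE-≋ s h) (sumE-≋ s k)

sumE-++ : (φ : Edge N → ℕ) (E F : EList N) → sumE φ (E ++ F) ≡ sumE φ E + sumE φ F
sumE-++ φ [] F = refl
sumE-++ φ (e ∷ E) F rewrite sumE-++ φ E F = sym (+-assoc (φ e) _ _)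

sumE-cong : {φ ψ : Edge N → ℕ} {E : EList N} → All (λ e → φ e ≡ ψ e) E → sumE φ E ≡ sumE ψ E
sumE-cong [] = refl
sumE-cong (p ∷ ps) = cong₂ _+_ p (sumE-cong ps)

sumE-cong′ : {φ ψ : Edge N → ℕ} → (∀ e → φ e ≡ ψ e) → (E : EList N) → sumE φ E ≡ sumE ψ E
sumE-cong′ h E = sumE-cong (All.universal h E)

sumE-mono : {φ ψ : Edge N → ℕ} {E : EList N} → All (λ e → φ e ≤ ψ e) E → sumE φ E ≤ sumE ψ E
sumE-mono [] = z≤n
sumE-mono (p ∷ ps) = +-mono-≤ p (sumE-mono ps)

sumE-+ : (φ ψ : Edge N → ℕ) (E : EList N) → sumE (λ e → φ e + ψ e) E ≡ sumE φ E + sumE ψ E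
sumE-+ φ ψ [] = refl
sumE-+ φ ψ (e ∷ E) rewrite sumE-+ φ ψ E = interchange (φ e) (ψ e) _ _

All-≋ : {P : Edge N → Set} → (∀ a b → P (a , b) → P (b , a)) → {E F : EList N} → E ≋ F → All P E → All P F
All-≋ s ≋-refl ps = ps
All-≋ s (≋-prep e h) (p ∷ ps) = p ∷ All-≋ s h ps
All-≋ s (≋-swap e f) (p ∷ q ∷ ps) = q ∷ p ∷ ps
All-≋ s (≋-flip a b) (p ∷ ps) = s a b p ∷ ps
All-≋ s (≋-trans h k) ps = All-≋ s k (All-≋ s h ps)

-- A loop counts twice; `δ-loop` relies on this when loops are excluded by their small cuts.
inc : Fin N → Edge N → ℕ
inc v (a , b) = χ (a == v) + χ (b == v)

opaque
  deg : EList N → Fin N → ℕ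
  deg E v = sumE (inc v) E

  deg-[] : (v : Fin N) → deg [] v ≡ 0
  deg-[] v = refl

  inc-sym : (v : Fin N) → Symmetric (inc v)
  inc-sym v a b = +-comm (χ (a == v)) _

  deg-≋ : {E F : EList N} (v : Fin N) → E ≋ F → deg E v ≡ deg F v
  deg-≋ v = sumE-≋ (inc-sym v)

cr : VSub N → Edge N → ℕ
cr X (a , b) = χ (X a xor X b)

xor-comm : ∀ a b → a xor b ≡ b xor a
xor-comm true true = refl
xor-comm true false = refl
xor-comm false true = refl
xor-comm false false = refl

cr-sym : (X : VSub N) → Symmetric (cr X)
cr-sym X a b = cong χ (xor-comm (X a) (X b))

opaque
  δ : EList N → VSub N → ℕ
  δ E X = sumE (cr X) E

  δ-≋ : {E F : EList N} (X : VSub N) → E ≋ F → δ E X ≡ δ F X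
  δ-≋ X = sumE-≋ (cr-sym X)

  δ-cong : (E : EList N) {X Y : VSub N} → X ≐ Y → δ E X ≡ δ E Y
  δ-cong E h = sumE-cong′ (λ { (a , b) → cong₂ (λ p q → χ (p xor q)) (h a) (h b) }) E

  δ-∁ : (E : EList N) (X : VSub N) → δ E (∁ X) ≡ δ E X
  δ-∁ E X = sumE-cong′ (λ { (a , b) → cong χ (go (X a) (X b)) }) E
    where go : ∀ a b → not a xor not b ≡ a xor b
          go true true = refl
          go true false = refl
          go false true = refl
          go false false = refl

-- Counting perfect matchings

ifn : Bool → ℕ → ℕ
ifn true n = n
ifn false n = 0

ifn-ext : ∀ {p q x y} → (p ≡ true → q ≡ true) → (q ≡ true → p ≡ true) → (p ≡ true → x ≡ y) → ifn p x ≡ ifn q y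
ifn-ext {true} f g h rewrite f refl = h refl
ifn-ext {false} {true} f g h with g refl
... | ()
ifn-ext {false} {false} f g h = refl

ifn-+ : ∀ p x y → ifn p (x + y) ≡ ifn p x + ifn p y
ifn-+ true x y = refl
ifn-+ false x y = refl

ifn-∧ : ∀ p q x → ifn p (ifn q x) ≡ ifn (p ∧ q) x
ifn-∧ true q x = refl
ifn-∧ false q x = refl

ifn-true : ∀ {p} x → p ≡ true → ifn p x ≡ x
ifn-true x refl = refl

ifn-false : ∀ {p} x → p ≡ false → ifn p x ≡ 0
ifn-false x refl = refl

isz : ℕ → ℕ
isz zero = 1
isz (suc _) = 0

isz-+ : ∀ a b → isz (a + b) ≡ isz a * isz b
isz-+ zero b = sym (+-identityʳ (isz b))
isz-+ (suc a) b = refl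

opaque
  unfolding _⊖_ size deg
  -- The number of perfect matchings of the vertex set U by edges from E.
  μ : EList N → VSub N → ℕ
  μ [] U = isz (size U)
  μ ((a , b) ∷ E) U = μ E U + ifn (U a ∧ U b) (μ E (U ⊖ a ⊖ b))

  -- The matchings that contain an extra edge `e` besides edges of `E`: the second summand in the
  -- recursion of `μ`, kept separate so that the expansion at a vertex becomes a sum of such terms.
  μₑ : Edge N → EList N → VSub N → ℕ
  μₑ (a , b) E U = ifn (U a ∧ U b) (μ E (U ⊖ a ⊖ b))

  μₑ-def : (a b : Fin N) (E : EList N) (U : VSub N) → μₑ (a , b) E U ≡ ifn (U a ∧ U b) (μ E (U ⊖ a ⊖ b))
  μₑ-def a b E U = refl

  μ-[] : (U : VSub N) → μ [] U ≡ isz (size U)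
  μ-[] U = refl

  μ-step : (a b : Fin N) (E : EList N) (U : VSub N) → μ ((a , b) ∷ E) U ≡ μ E U + ifn (U a ∧ U b) (μ E (U ⊖ a ⊖ b))
  μ-step a b E U = refl

  μ-∷ : (e : Edge N) (E : EList N) (U : VSub N) → μ (e ∷ E) U ≡ μ E U + μₑ e E U
  μ-∷ (a , b) E U = refl

  μ-cong : (E : EList N) {U U′ : VSub N} → U ≐ U′ → μ E U ≡ μ E U′
  μ-cong [] {U} {U′} h = cong isz (size-cong {U = U} {U′} h)
  μ-cong ((a , b) ∷ E) {U} {U′} h =
    cong₂ _+_ (μ-cong E h) (cong₂ ifn (cong₂ _∧_ (h a) (h b))
      (μ-cong E (⊖-cong {U = U ⊖ a} {U′ ⊖ a} b (⊖-cong {U = U} {U′} a h))))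

  ⊖₂-mem : (U : VSub N) {a b c : Fin N} → (U ⊖ a ⊖ b) c ≡ true → U c ≡ true × c ≢ a × c ≢ b
  ⊖₂-mem U {a} {b} {c} h =
    ⊖-mem {U = U} {a} {c} (⊖-mem {U = U ⊖ a} {b} {c} h) ,
    ⊖-≢ {U = U} (⊖-mem {U = U ⊖ a} {b} {c} h) , ⊖-≢ {U = U ⊖ a} h

  ⊖₂-in : (U : VSub N) {a b c : Fin N} → U c ≡ true → c ≢ a → c ≢ b → (U ⊖ a ⊖ b) c ≡ true
  ⊖₂-in U h na nb = ⊖-in {U = U ⊖ _} (⊖-in {U = U} h na) nb

  ⊖₄-comm : (U : VSub N) (a b c d : Fin N) → U ⊖ a ⊖ b ⊖ c ⊖ d ≐ U ⊖ c ⊖ d ⊖ a ⊖ b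
  ⊖₄-comm U a b c d v = go (U v) (not (v == a)) (not (v == b)) (not (v == c)) (not (v == d))
    where go : ∀ u x y z w → (((u ∧ x) ∧ y) ∧ z) ∧ w ≡ (((u ∧ z) ∧ w) ∧ x) ∧ y
          go false x y z w = refl
          go true false y true true = refl
          go true false y true false = refl
          go true false y false w = refl
          go true true false true true = refl
          go true true false true false = refl
          go true true false false w = refl
          go true true true true true = refl
          go true true true true false = refl
          go true true true false w = refl

  -- Only the matchings that use both edges need an argument: the two edges must be disjoint, a
  -- condition symmetric in them, and the same four vertices disappear in either order.
  μ-swap : (e f : Edge N) (E : EList N) (U : VSub N) → μ (e ∷ f ∷ E) U ≡ μ (f ∷ e ∷ E) U
  μ-swap (a , b) (c , d) E U = begin
    (μ E U + ifn (U c ∧ U d) (μ E (U ⊖ c ⊖ d))) + ifn (U a ∧ U b) ((μ E (U ⊖ a ⊖ b)) + ifn ((U ⊖ a ⊖ b) c ∧ (U ⊖ a ⊖ b) d) (μ E (U ⊖ a ⊖ b ⊖ c ⊖ d)))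
      ≡⟨ cong ((μ E U + ifn (U c ∧ U d) (μ E (U ⊖ c ⊖ d))) +_) (trans (ifn-+ (U a ∧ U b) (μ E (U ⊖ a ⊖ b)) _) (cong (ifn (U a ∧ U b) (μ E (U ⊖ a ⊖ b)) +_) both)) ⟩
    (μ E U + ifn (U c ∧ U d) (μ E (U ⊖ c ⊖ d))) + (ifn (U a ∧ U b) (μ E (U ⊖ a ⊖ b)) + ifn (U c ∧ U d) (ifn ((U ⊖ c ⊖ d) a ∧ (U ⊖ c ⊖ d) b) (μ E (U ⊖ c ⊖ d ⊖ a ⊖ b))))
      ≡⟨ shuffle (μ E U) _ _ _ ⟩
    (μ E U + ifn (U a ∧ U b) (μ E (U ⊖ a ⊖ b))) + (ifn (U c ∧ U d) (μ E (U ⊖ c ⊖ d)) + ifn (U c ∧ U d) (ifn ((U ⊖ c ⊖ d) a ∧ (U ⊖ c ⊖ d) b) (μ E (U ⊖ c ⊖ d ⊖ a ⊖ b))))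
      ≡⟨ cong ((μ E U + ifn (U a ∧ U b) (μ E (U ⊖ a ⊖ b))) +_) (sym (ifn-+ (U c ∧ U d) (μ E (U ⊖ c ⊖ d)) _)) ⟩
    (μ E U + ifn (U a ∧ U b) (μ E (U ⊖ a ⊖ b))) + ifn (U c ∧ U d) ((μ E (U ⊖ c ⊖ d)) + ifn ((U ⊖ c ⊖ d) a ∧ (U ⊖ c ⊖ d) b) (μ E (U ⊖ c ⊖ d ⊖ a ⊖ b))) ∎
    where
    open ≡-Reasoning
    shuffle : ∀ p q r s → (p + q) + (r + s) ≡ (p + r) + (q + s)
    shuffle = solve-∀
    to : ∀ {a b c d} → (U a ∧ U b) ∧ ((U ⊖ a ⊖ b) c ∧ (U ⊖ a ⊖ b) d) ≡ true →
         (U c ∧ U d) ∧ ((U ⊖ c ⊖ d) a ∧ (U ⊖ c ⊖ d) b) ≡ true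
    to {a} {b} {c} {d} h with ∧-left {U a ∧ U b} h | ∧-right {U a ∧ U b} h
    ... | hab | hcd with ⊖₂-mem U {a} {b} {c} (∧-left hcd)
                       | ⊖₂-mem U {a} {b} {d} (∧-right {(U ⊖ a ⊖ b) c} hcd)
    ... | uc , ca , cb | ud , da , db =
      ∧-true (∧-true uc ud)
        (∧-true (⊖₂-in U (∧-left hab) (ca ∘ sym) (da ∘ sym))
                (⊖₂-in U (∧-right {U a} hab) (cb ∘ sym) (db ∘ sym)))
    both : ifn (U a ∧ U b) (ifn ((U ⊖ a ⊖ b) c ∧ (U ⊖ a ⊖ b) d) (μ E (U ⊖ a ⊖ b ⊖ c ⊖ d))) ≡ ifn (U c ∧ U d) (ifn ((U ⊖ c ⊖ d) a ∧ (U ⊖ c ⊖ d) b) (μ E (U ⊖ c ⊖ d ⊖ a ⊖ b)))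
    both = begin
      ifn (U a ∧ U b) (ifn ((U ⊖ a ⊖ b) c ∧ (U ⊖ a ⊖ b) d) (μ E (U ⊖ a ⊖ b ⊖ c ⊖ d))) ≡⟨ ifn-∧ (U a ∧ U b) _ (μ E (U ⊖ a ⊖ b ⊖ c ⊖ d)) ⟩
      ifn ((U a ∧ U b) ∧ ((U ⊖ a ⊖ b) c ∧ (U ⊖ a ⊖ b) d)) (μ E (U ⊖ a ⊖ b ⊖ c ⊖ d))
        ≡⟨ ifn-ext (to {a} {b} {c} {d}) (to {c} {d} {a} {b}) (λ _ → μ-cong E (⊖₄-comm U a b c d)) ⟩
      ifn ((U c ∧ U d) ∧ ((U ⊖ c ⊖ d) a ∧ (U ⊖ c ⊖ d) b)) (μ E (U ⊖ c ⊖ d ⊖ a ⊖ b)) ≡⟨ ifn-∧ (U c ∧ U d) _ (μ E (U ⊖ c ⊖ d ⊖ a ⊖ b)) ⟨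
      ifn (U c ∧ U d) (ifn ((U ⊖ c ⊖ d) a ∧ (U ⊖ c ⊖ d) b) (μ E (U ⊖ c ⊖ d ⊖ a ⊖ b))) ∎

  μ-≋ : {E F : EList N} → E ≋ F → (U : VSub N) → μ E U ≡ μ F U
  μ-≋ ≋-refl U = refl
  μ-≋ (≋-prep (a , b) h) U = cong₂ _+_ (μ-≋ h U) (cong (ifn (U a ∧ U b)) (μ-≋ h (U ⊖ a ⊖ b)))
  μ-≋ (≋-swap e f {E}) U = μ-swap e f E U
  μ-≋ (≋-flip a b {E}) U = cong (μ E U +_)
    (cong₂ ifn (∧-comm (U a) (U b)) (μ-cong E (⊖-comm U a b)))
  μ-≋ (≋-trans h k) U = trans (μ-≋ h U) (μ-≋ k U)

  μₑ-≋ : (e : Edge N) {E F : EList N} → E ≋ F → (U : VSub N) → μₑ e E U ≡ μₑ e F U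
  μₑ-≋ (a , b) h U = cong (ifn (U a ∧ U b)) (μ-≋ h (U ⊖ a ⊖ b))

  μ-dead : {U : VSub N} {a b : Fin N} (E : EList N) → U a ≡ false → μ ((a , b) ∷ E) U ≡ μ E U
  μ-dead {U = U} {a} E h rewrite h = +-identityʳ (μ E U)

  μ-deadʳ : {U : VSub N} {a b : Fin N} (E : EList N) → U b ≡ false → μ ((a , b) ∷ E) U ≡ μ E U
  μ-deadʳ {U = U} {a} {b} E h = trans (μ-≋ (≋-flip a b {E}) U) (μ-dead {U = U} {b} {a} E h)

  μ-live : {U : VSub N} {a b : Fin N} (E : EList N) → U a ≡ true → U b ≡ true →
           μ ((a , b) ∷ E) U ≡ μ E U + μ E (U ⊖ a ⊖ b)
  μ-live E ha hb rewrite ha | hb = refl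

  μₑ-live : {U : VSub N} {a b : Fin N} (E : EList N) → U a ≡ true → U b ≡ true →
           μₑ (a , b) E U ≡ μ E (U ⊖ a ⊖ b)
  μₑ-live E ha hb rewrite ha | hb = refl

  μ-∷-≥ : (e : Edge N) (E : EList N) (U : VSub N) → μ E U ≤ μ (e ∷ E) U
  μ-∷-≥ (a , b) E U = m≤m+n _ _

  μ-mono-++ : (F E : EList N) (U : VSub N) → μ E U ≤ μ (F ++ E) U
  μ-mono-++ [] E U = ≤-refl
  μ-mono-++ (e ∷ F) E U = ≤-trans (μ-mono-++ F E U) (μ-∷-≥ e (F ++ E) U)

  χ-zero : ∀ {b n} → χ b + n ≡ 0 → b ≡ false
  χ-zero {false} _ = refl

  inc-zero : {v a b : Fin N} → inc v (a , b) ≡ 0 → a ≢ v × b ≢ v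
  inc-zero {v = v} {a} {b} h = (λ { refl → true≢false (==-refl v) (χ-zero h) }) ,
    (λ { refl → true≢false (==-refl v) (χ-zero (trans (+-comm (χ (v == v)) (χ (a == v))) h)) })

  deg-∷-zero : {v : Fin N} (e : Edge N) {E : EList N} → deg (e ∷ E) v ≡ 0 → inc v e ≡ 0 × deg E v ≡ 0
  deg-∷-zero {v = v} e h = m+n≡0⇒m≡0 (inc v e) h , m+n≡0⇒n≡0 (inc v e) h

  -- A vertex without edges stays in the vertex set along every branch of the recursion, so no
  -- branch ends with the empty set.
  μ-isolated : (E : EList N) {U : VSub N} {v : Fin N} → deg E v ≡ 0 → U v ≡ true → μ E U ≡ 0
  μ-isolated [] {U} h hv with size U | size-pos {U = U} hv
  ... | suc _ | _ = refl
  μ-isolated ((a , b) ∷ E) {U} {v} h hv with deg-∷-zero (a , b) {E} h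
  ... | h₁ , h₂ with inc-zero {v = v} h₁
  ... | av , bv rewrite μ-isolated E {U} h₂ hv
                      | μ-isolated E {U ⊖ a ⊖ b} h₂ (⊖₂-in U hv (av ∘ sym) (bv ∘ sym)) with U a ∧ U b
  ... | true = refl
  ... | false = refl

  μₑ-dead : (u v w : Fin N) (R : EList N) (U : VSub N) → μₑ (u , v) ((u , w) ∷ R) U ≡ μₑ (u , v) R U
  μₑ-dead u v w R U = cong (ifn (U u ∧ U v))
    (μ-dead R (⊖-out {U = U ⊖ u} {v} (⊖-self U u)))

  -- The star expansions: `u` has no edge in `R`, so exactly one of the listed edges covers it, and
  -- once one of them is used the others are dead.
  μ-star₁ : (u v : Fin N) (R : EList N) {U : VSub N} → deg R u ≡ 0 → U u ≡ true →
            μ ((u , v) ∷ R) U ≡ μₑ (u , v) R U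
  μ-star₁ u v R {U} d hu rewrite μ-isolated R {U} d hu = refl

  μ-star₂ : (u v w : Fin N) (R : EList N) {U : VSub N} → deg R u ≡ 0 → U u ≡ true →
            μ ((u , v) ∷ (u , w) ∷ R) U ≡ μₑ (u , v) R U + μₑ (u , w) R U
  μ-star₂ u v w R {U} d hu = trans
    (cong₂ _+_ (μ-star₁ u w R d hu) (μₑ-dead u v w R U))
    (+-comm (μₑ (u , w) R U) _)

  μ-star₃ : (u v w x : Fin N) (R : EList N) {U : VSub N} → deg R u ≡ 0 → U u ≡ true →
            μ ((u , v) ∷ (u , w) ∷ (u , x) ∷ R) U ≡ μₑ (u , v) R U + (μₑ (u , w) R U + μₑ (u , x) R U)
  μ-star₃ u v w x R {U} d hu = trans
    (cong₂ _+_ (μ-star₂ u w x R d hu) (trans (μₑ-dead u v w ((u , x) ∷ R) U) (μₑ-dead u v x R U)))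
    (+-comm (μₑ (u , w) R U + μₑ (u , x) R U) _)

-- Matchings across a vertex partition, and the edges at a vertex

infixl 7 _∩_

_∩_ : VSub N → VSub N → VSub N
(U ∩ X) v = U v ∧ X v

opaque
  unfolding _⊖_
  ∩-⊖ : (U X : VSub N) (a : Fin N) → (U ⊖ a) ∩ X ≐ (U ∩ X) ⊖ a
  ∩-⊖ U X a v with U v | X v | not (v == a)
  ... | false | _ | _ = refl
  ... | true | true | true = refl
  ... | true | true | false = refl
  ... | true | false | true = refl
  ... | true | false | false = refl

  ∩-⊖-out : (U X : VSub N) {a : Fin N} → X a ≡ false → (U ⊖ a) ∩ X ≐ U ∩ X
  ∩-⊖-out U X {a} h v with v ≟ a
  ... | yes refl rewrite h with U v
  ... | true = refl
  ... | false = refl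
  ∩-⊖-out U X {a} h v | no _ with U v
  ... | true = refl
  ... | false = refl

∩-⊖₂ : (U X : VSub N) (a b : Fin N) → (U ⊖ a ⊖ b) ∩ X ≐ (U ∩ X) ⊖ a ⊖ b
∩-⊖₂ U X a b v = trans (∩-⊖ (U ⊖ a) X b v) (⊖-cong {U = (U ⊖ a) ∩ X} {(U ∩ X) ⊖ a} b (∩-⊖ U X a) v)

∩-⊖₂-out : (U X : VSub N) {a b : Fin N} → X a ≡ false → X b ≡ false → (U ⊖ a ⊖ b) ∩ X ≐ U ∩ X
∩-⊖₂-out U X {a} ha hb v = trans (∩-⊖-out (U ⊖ a) X hb v) (∩-⊖-out U X ha v)

Inside Outside : VSub N → EList N → Set
Inside X = All (λ { (a , b) → X a ≡ true × X b ≡ true })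
Outside X = All (λ { (a , b) → X a ≡ false × X b ≡ false })

∧-true-eq : ∀ {a b x y} → x ≡ true → y ≡ true → a ∧ b ≡ (a ∧ x) ∧ (b ∧ y)
∧-true-eq {true} {true} refl refl = refl
∧-true-eq {true} {false} refl refl = refl
∧-true-eq {false} refl refl = refl

ifn-*ˡ : ∀ p z t → ifn p (z * t) ≡ z * ifn p t
ifn-*ˡ true z t = refl
ifn-*ˡ false z t = sym (*-zeroʳ z)

ifn-*ʳ : ∀ p t z → ifn p (t * z) ≡ ifn p t * z
ifn-*ʳ true t z = refl
ifn-*ʳ false t z = refl

private
  both-in : (U X : VSub N) {a b : Fin N} → X a ≡ true → X b ≡ true → U a ∧ U b ≡ (U ∩ X) a ∧ (U ∩ X) b
  both-in U X {a} {b} ha hb = ∧-true-eq {U a} {U b} ha hb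

  μ-[]-out : (U X : VSub N) {a b : Fin N} → X a ≡ false → X b ≡ false → μ [] ((U ⊖ a ⊖ b) ∩ X) ≡ μ [] (U ∩ X)
  μ-[]-out U X ha hb = μ-cong [] (∩-⊖₂-out U X ha hb)

-- Every edge lies on one side of `X`, so the two sides are matched independently. In the base case,
-- a set is empty exactly when both of its parts are.
μ-++ : (X : VSub N) (E F : EList N) (U : VSub N) → Inside X E → Outside X F →
       μ (E ++ F) U ≡ μ E (U ∩ X) * μ F (U ∩ ∁ X)
μ-++ X [] [] U [] [] = trans (μ-[] U) (trans (cong isz (size-split U X)) (trans (isz-+ (size (U ∩ X)) (size (U ∩ ∁ X)))
  (cong₂ _*_ (sym (μ-[] (U ∩ X))) (sym (μ-[] (U ∩ ∁ X))))))
μ-++ X [] ((a , b) ∷ F) U [] ((ha , hb) ∷ hs) = trans (μ-step a b F U) (trans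
  (cong₂ _+_ (μ-++ X [] F U [] hs) (trans
    (cong₂ ifn (both-in U (∁ X) {a} {b} (not-true ha) (not-true hb))
      (trans (μ-++ X [] F (U ⊖ a ⊖ b) [] hs) (cong₂ _*_ (μ-[]-out U X ha hb) (μ-cong F (∩-⊖₂ U (∁ X) a b)))))
    (ifn-*ˡ ((U ∩ ∁ X) a ∧ (U ∩ ∁ X) b) (μ [] (U ∩ X)) (μ F ((U ∩ ∁ X) ⊖ a ⊖ b)))))
  (trans (sym (*-distribˡ-+ (μ [] (U ∩ X)) (μ F (U ∩ ∁ X)) _)) (cong (μ [] (U ∩ X) *_) (sym (μ-step a b F (U ∩ ∁ X))))))
μ-++ X ((a , b) ∷ E) F U ((ha , hb) ∷ hs) ks = trans (μ-step a b (E ++ F) U) (trans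
  (cong₂ _+_ (μ-++ X E F U hs ks) (trans
    (cong₂ ifn (both-in U X {a} {b} ha hb)
      (trans (μ-++ X E F (U ⊖ a ⊖ b) hs ks)
        (cong₂ _*_ (μ-cong E (∩-⊖₂ U X a b)) (μ-cong F (∩-⊖₂-out U (∁ X) (not-false ha) (not-false hb))))))
    (ifn-*ʳ ((U ∩ X) a ∧ (U ∩ X) b) (μ E ((U ∩ X) ⊖ a ⊖ b)) (μ F (U ∩ ∁ X)))))
  (trans (sym (*-distribʳ-+ (μ F (U ∩ ∁ X)) (μ E (U ∩ X)) _)) (cong (_* μ F (U ∩ ∁ X)) (sym (μ-step a b E (U ∩ X))))))

NL : EList N → Set
NL = All (λ { (a , b) → a ≢ b })

NL-≋ : {E F : EList N} → E ≋ F → NL E → NL F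
NL-≋ = All-≋ λ a b ne → ne ∘ sym

opaque
  unfolding deg
  extract : (E : EList N) (v : Fin N) → 1 ≤ deg E v → ∃ λ y → ∃ λ R → E ≋ (v , y) ∷ R
  extract ((a , b) ∷ E) v h with a ≟ v
  ... | yes refl = b , E , ≋-refl
  ... | no _ with b ≟ v
  ... | yes refl = a , E , ≋-flip a b
  ... | no _ with extract E v h
  ... | y , R , eq = y , (a , b) ∷ R , ≋-trans (≋-prep (a , b) eq) (≋-swap (a , b) (v , y))

  inc-self : {v y : Fin N} → y ≢ v → inc v (v , y) ≡ 1
  inc-self {v = v} ne rewrite ==-refl v | ==-≢ ne = refl

  inc-other : {v a b : Fin N} → a ≢ v → b ≢ v → inc v (a , b) ≡ 0
  inc-other na nb rewrite ==-≢ na | ==-≢ nb = refl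

  extract′ : (E : EList N) (v : Fin N) {k : ℕ} → NL E → deg E v ≡ suc k →
             ∃ λ y → ∃ λ R → E ≋ (v , y) ∷ R × y ≢ v × NL R × deg R v ≡ k
  extract′ E v {k} nl d with extract E v (≤-trans (s≤s z≤n) (≤-reflexive (sym d)))
  ... | y , R , eq with NL-≋ eq nl
  ... | vy ∷ nlR = y , R , eq , vy ∘ sym , nlR ,
    suc-injective (trans (sym (trans (deg-≋ v eq) (cong (_+ deg R v) (inc-self (vy ∘ sym))))) d)

record Star₂ (E : EList N) (v : Fin N) : Set where
  constructor mk₂
  field
    y₁ y₂ : Fin N
    R : EList N
    eq : E ≋ (v , y₁) ∷ (v , y₂) ∷ R
    n₁ : y₁ ≢ v
    n₂ : y₂ ≢ v
    d₀ : deg R v ≡ 0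

star₂ : (E : EList N) (v : Fin N) → NL E → deg E v ≡ 2 → Star₂ E v
star₂ E v nl d with extract′ E v nl d
... | y₁ , R₁ , e₁ , n₁ , nl₁ , d₁ with extract′ R₁ v nl₁ d₁
... | y₂ , R₂ , e₂ , n₂ , nl₂ , d₂ = mk₂ y₁ y₂ R₂ (≋-trans e₁ (≋-prep _ e₂)) n₁ n₂ d₂

-- Splitting off a pair of adjacent vertices

opaque
  unfolding deg
  deg-other : {z a b : Fin N} (E : EList N) → a ≢ z → b ≢ z → deg ((a , b) ∷ E) z ≡ deg E z
  deg-other {z = z} E na nb = cong (_+ deg E z) (inc-other na nb)

  deg-one : {z y : Fin N} (E : EList N) → y ≢ z → deg ((z , y) ∷ E) z ≡ suc (deg E z)
  deg-one {z = z} E ny = cong (_+ deg E z) (inc-self ny)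

  deg-oneʳ : {z y : Fin N} (E : EList N) → y ≢ z → deg ((y , z) ∷ E) z ≡ suc (deg E z)
  deg-oneʳ {z = z} {y} E ny = trans (deg-≋ z (≋-flip y z {E})) (deg-one E ny)

  deg-zero-∷ : {z a b : Fin N} {E : EList N} → a ≢ z → b ≢ z → deg E z ≡ 0 → deg ((a , b) ∷ E) z ≡ 0
  deg-zero-∷ {E = E} na nb h = trans (deg-other E na nb) h

  deg-++ : (E F : EList N) (z : Fin N) → deg (E ++ F) z ≡ deg E z + deg F z
  deg-++ E F z = sumE-++ (inc z) E F

  deg-avoid : (R : EList N) {v : Fin N} → deg R v ≡ 0 → All (λ { (a , b) → a ≢ v × b ≢ v }) R
  deg-avoid [] h = []
  deg-avoid ((a , b) ∷ R) {v} h with deg-∷-zero (a , b) {R} h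
  ... | h₁ , h₂ = inc-zero {v = v} h₁ ∷ deg-avoid R h₂

  avoid-deg : (R : EList N) {v : Fin N} → All (λ { (a , b) → a ≢ v × b ≢ v }) R → deg R v ≡ 0
  avoid-deg [] [] = refl
  avoid-deg ((a , b) ∷ R) ((na , nb) ∷ h) = deg-zero-∷ {E = R} na nb (avoid-deg R h)

record Cubic′ (E : EList N) (U : VSub N) : Set where
  field
    inU : Inside U E
    nl  : NL E
    d3  : ∀ v → U v ≡ true → deg E v ≡ 3

open Cubic′ public

Inside-≋ : {X : VSub N} {E F : EList N} → E ≋ F → Inside X E → Inside X F
Inside-≋ = All-≋ λ { a b (p , q) → q , p }

Cubic-≋ : {E F : EList N} {U : VSub N} → E ≋ F → Cubic′ E U → Cubic′ F U
Cubic-≋ h G = record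
  { inU = Inside-≋ h (inU G) ; nl = NL-≋ h (nl G)
  ; d3 = λ v hv → trans (sym (deg-≋ v h)) (d3 G v hv) }

Some Two : VSub N → Set
Some X = ∃ λ a → X a ≡ true
Two X = ∃ λ a → ∃ λ b → a ≢ b × X a ≡ true × X b ≡ true

-- The bound concerns all proper cuts, so connectedness is included.
Bridgeless : EList N → VSub N → Set
Bridgeless E U = ∀ X → Some (U ∩ X) → Some (U ∩ ∁ X) → 2 ≤ δ E X

-- The form in which cyclic 4-edge-connectedness enters: in a cubic graph a side with at least two
-- vertices and at most three leaving edges contains a cycle (`has-cycle`). Stated for cuts alone,
-- it can be checked for contracted graphs without following cycles.
Essential4 : EList N → VSub N → Set
Essential4 E U = ∀ X → Two (U ∩ X) → Two (U ∩ ∁ X) → 4 ≤ δ E X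

two-of-size : {X : VSub N} → 2 ≤ size X → Two X
two-of-size {X = X} h with size-pick X (≤-trans (s≤s z≤n) h)
... | a , ha with size-pick≢ X a h
... | b , hb , ne = a , b , ne ∘ sym , ha , hb

two-mono : {X Y : VSub N} → (∀ v → X v ≡ true → Y v ≡ true) → Two X → Two Y
two-mono h (a , b , ne , ha , hb) = a , b , ne , h a ha , h b hb

two-or-one : (X : VSub N) (a : Fin N) → X a ≡ true → Two X ⊎ (∀ v → X v ≡ true → v ≡ a)
two-or-one X a ha with 2 ≤? size X
... | yes h = inj₁ (two-of-size h)
... | no h = inj₂ λ v hv → go v hv (v ≟ a)
  where go : ∀ v → X v ≡ true → Dec (v ≡ a) → v ≡ a
        go v hv (yes e) = e
        go v hv (no ne) = ⊥-elim (h (size-two {U = X} ne hv ha))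

opaque
  unfolding δ deg size
  δ-single : {E : EList N} {U : VSub N} → Cubic′ E U → (X : VSub N) (a : Fin N) → U a ≡ true → X a ≡ true →
             (∀ v → (U ∩ X) v ≡ true → v ≡ a) → δ E X ≡ 3
  δ-single {E = E} {U} G X a ua xa h = trans (go (inU G) (nl G)) (d3 G a ua)
    where
    mem : ∀ v → U v ≡ true → X v ≡ (v == a)
    mem v hv with v ≟ a
    ... | yes refl = xa
    ... | no ne = ¬true⇒false λ e → ne (h v (∧-true hv e))
    pt : ∀ p q → p ≢ q → χ ((p == a) xor (q == a)) ≡ χ (p == a) + χ (q == a)
    pt p q ne with p ≟ a | q ≟ a
    ... | yes refl | yes refl = ⊥-elim (ne refl)
    ... | yes _ | no _ = refl
    ... | no _ | yes _ = refl
    ... | no _ | no _ = refl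
    go : {E : EList _} → Inside U E → NL E → δ E X ≡ deg E a
    go [] [] = refl
    go {(p , q) ∷ E} ((hp , hq) ∷ hs) (ne ∷ nes) rewrite mem p hp | mem q hq = cong₂ _+_ (pt p q ne) (go hs nes)

essential4⇒bridgeless : {E : EList N} {U : VSub N} → Cubic′ E U → Essential4 E U → Bridgeless E U
essential4⇒bridgeless {E = E} {U} G C X (a , ha) (b , hb)
  with two-or-one (U ∩ X) a ha | two-or-one (U ∩ ∁ X) b hb
... | inj₂ h | _ = ≤-trans (s≤s (s≤s z≤n)) (≤-reflexive (sym (δ-single G X a (∧-left ha) (∧-right {U a} ha) h)))
... | inj₁ _ | inj₂ h = ≤-trans (s≤s (s≤s z≤n))
  (≤-reflexive (trans (sym (δ-single G (∁ X) b (∧-left hb) (∧-right {U b} hb) h)) (δ-∁ E X)))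
... | inj₁ h | inj₁ k = ≤-trans (s≤s (s≤s z≤n)) (C X h k)

-- Lifts a vertex set of the split graph to the graph with `u` and `v`, putting both on the side
-- `b`.
assign : VSub N → Fin N → Fin N → Bool → VSub N
assign X u v b z with z ≟ u | z ≟ v
... | yes _ | _ = b
... | no _ | yes _ = b
... | no _ | no _ = X z

assign₁ : (X : VSub N) (u v : Fin N) (b : Bool) → assign X u v b u ≡ b
assign₁ X u v b with u ≟ u | u ≟ v
... | yes _ | _ = refl
... | no k | _ = ⊥-elim (k refl)

assign₂ : (X : VSub N) (u v : Fin N) (b : Bool) → assign X u v b v ≡ b
assign₂ X u v b with v ≟ u | v ≟ v
... | yes _ | _ = refl
... | no _ | yes _ = refl
... | no _ | no k = ⊥-elim (k refl)

assign₃ : (X : VSub N) {u v z : Fin N} (b : Bool) → z ≢ u → z ≢ v → assign X u v b z ≡ X z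
assign₃ X {u} {v} {z} b nu nv with z ≟ u | z ≟ v
... | yes e | _ = ⊥-elim (nu e)
... | no _ | yes e = ⊥-elim (nv e)
... | no _ | no _ = refl

opaque
  unfolding δ deg
  δ-cong-on : {E : EList N} {X Y : VSub N} → All (λ { (a , b) → X a ≡ Y a × X b ≡ Y b }) E → δ E X ≡ δ E Y
  δ-cong-on {X = X} {Y} h = sumE-cong (All.map (λ { {a , b} (p , q) → cong₂ (λ s t → χ (s xor t)) p q }) h)

  δ-avoid₂ : (R : EList N) {u v : Fin N} (X : VSub N) (b : Bool) → deg R u ≡ 0 → deg R v ≡ 0 →
             δ R (assign X u v b) ≡ δ R X
  δ-avoid₂ R X b hu hv = δ-cong-on (All.zipWith
    (λ { {p , q} ((pu , qu) , (pv , qv)) → assign₃ X b pu pv , assign₃ X b qu qv }) (deg-avoid R hu , deg-avoid R hv))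

-- The pair `u`, `v` is to be deleted and its outer neighbours joined as x-c and w-d. The hypotheses
-- keep these four ends away from the pair; they may still coincide among themselves, so loops have
-- to be excluded at each use.
record Splittable (E : EList N) (U : VSub N) (u v x w c d : Fin N) (R : EList N) : Set where
  field
    cubic : Cubic′ E U
    eq : E ≋ (u , x) ∷ (u , v) ∷ (u , w) ∷ (v , c) ∷ (v , d) ∷ R
    du : deg R u ≡ 0
    dv : deg R v ≡ 0
    x≢v : x ≢ v
    w≢v : w ≢ v
    c≢u : c ≢ u
    d≢u : d ≢ u

opaque
  unfolding deg
  deg-resplit : (u v x w c d : Fin N) (R : EList N) (z : Fin N) → z ≢ u → z ≢ v →
    deg ((x , c) ∷ (w , d) ∷ R) z ≡ deg ((u , x) ∷ (u , v) ∷ (u , w) ∷ (v , c) ∷ (v , d) ∷ R) z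
  deg-resplit u v x w c d R z zu zv = trans (shuffle (χ (x == z)) (χ (w == z)) (χ (c == z)) (χ (d == z)) (deg R z))
    (cong₂ (λ p q → (p + χ (x == z)) + ((p + q) + ((p + χ (w == z)) + ((q + χ (c == z)) + ((q + χ (d == z)) + deg R z)))))
      (cong χ (sym (==-≢ (zu ∘ sym)))) (cong χ (sym (==-≢ (zv ∘ sym)))))
    where
    shuffle : ∀ x w c d r → (x + c) + ((w + d) + r) ≡ (0 + x) + ((0 + 0) + ((0 + w) + ((0 + c) + ((0 + d) + r))))
    shuffle = solve-∀

opaque
  unfolding δ
  δ-five : (u v x w c d : Fin N) (R : EList N) (X : VSub N) →
    δ ((u , x) ∷ (u , v) ∷ (u , w) ∷ (v , c) ∷ (v , d) ∷ R) X ≡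
    cr X (u , x) + (cr X (u , v) + (cr X (u , w) + (cr X (v , c) + (cr X (v , d) + δ R X))))
  δ-five u v x w c d R X = refl

  δ-two : (e f : Edge N) (R : EList N) (X : VSub N) → δ (e ∷ f ∷ R) X ≡ cr X e + (cr X f + δ R X)
  δ-two e f R X = refl

module Split {N} {E : EList N} {U : VSub N} {u v x w c d : Fin N} {R : EList N}
             (S : Splittable E U u v x w c d R) where
  open Splittable S using (cubic; eq; du; dv; x≢v; w≢v; c≢u; d≢u)

  E₅ : EList N
  E₅ = (u , x) ∷ (u , v) ∷ (u , w) ∷ (v , c) ∷ (v , d) ∷ R

  G₅ : Cubic′ E₅ U
  G₅ = Cubic-≋ eq cubic

  ends : (U u ≡ true × U x ≡ true) × (U v ≡ true) × (U w ≡ true) × (U c ≡ true) × (U d ≡ true)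
  ends with inU G₅
  ... | ux ∷ (_ , hv) ∷ (_ , hw) ∷ (_ , hc) ∷ (_ , hd) ∷ _ = ux , hv , hw , hc , hd

  hu = proj₁ (proj₁ ends)
  hx = proj₂ (proj₁ ends)
  hv = proj₁ (proj₂ ends)
  hw = proj₁ (proj₂ (proj₂ ends))
  hc = proj₁ (proj₂ (proj₂ (proj₂ ends)))
  hd = proj₂ (proj₂ (proj₂ (proj₂ ends)))

  loops : (u ≢ x) × (u ≢ v) × (u ≢ w) × (v ≢ c) × (v ≢ d) × NL R
  loops with nl G₅
  ... | a ∷ b ∷ c ∷ d ∷ e ∷ f = a , b , c , d , e , f

  u≢x = proj₁ loops
  u≢v = proj₁ (proj₂ loops)
  u≢w = proj₁ (proj₂ (proj₂ loops))
  v≢c = proj₁ (proj₂ (proj₂ (proj₂ loops)))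
  v≢d = proj₁ (proj₂ (proj₂ (proj₂ (proj₂ loops))))
  nlR = proj₂ (proj₂ (proj₂ (proj₂ (proj₂ loops))))

  inR : Inside U R
  inR with inU G₅
  ... | _ ∷ _ ∷ _ ∷ _ ∷ _ ∷ h = h

  E′ : EList N
  E′ = (x , c) ∷ (w , d) ∷ R

  U′ : VSub N
  U′ = U ⊖ u ⊖ v

  deg′ : ∀ z → U′ z ≡ true → deg E′ z ≡ 3
  deg′ z hz with ⊖₂-mem U {u} {v} {z} hz
  ... | uz , zu , zv = trans (deg-resplit u v x w c d R z zu zv) (d3 G₅ z uz)

  cubic′ : x ≢ c → w ≢ d → Cubic′ E′ U′
  cubic′ xc wd = record
    { inU = (⊖₂-in U hx (u≢x ∘ sym) x≢v , ⊖₂-in U hc c≢u (v≢c ∘ sym))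
          ∷ (⊖₂-in U hw (u≢w ∘ sym) w≢v , ⊖₂-in U hd d≢u (v≢d ∘ sym))
          ∷ All.zipWith (λ { {a , b} ((ha , hb) , ((au , bu) , (av , bv))) → ⊖₂-in U ha au av , ⊖₂-in U hb bu bv })
              (inR , All.zipWith id (deg-avoid R du , deg-avoid R dv))
    ; nl = xc ∷ wd ∷ nlR
    ; d3 = deg′ }

  δ-assign : (X : VSub N) (b : Bool) →
    δ E (assign X u v b) ≡ χ (b xor X x) + (χ (b xor X w) + (χ (b xor X c) + (χ (b xor X d) + δ R X)))
  δ-assign X b = trans (δ-≋ (assign X u v b) eq) (trans (δ-five u v x w c d R (assign X u v b)) go)
    where
    same : ∀ b k l → k + (χ (b xor b) + l) ≡ k + l
    same true k l = refl
    same false k l = refl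
    go : cr (assign X u v b) (u , x) + (cr (assign X u v b) (u , v) + (cr (assign X u v b) (u , w) +
         (cr (assign X u v b) (v , c) + (cr (assign X u v b) (v , d) + δ R (assign X u v b))))) ≡ _
    go rewrite assign₁ X u v b | assign₂ X u v b | assign₃ X b (u≢x ∘ sym) x≢v | assign₃ X b (u≢w ∘ sym) w≢v
             | assign₃ X b c≢u (v≢c ∘ sym) | assign₃ X b d≢u (v≢d ∘ sym) | δ-avoid₂ R X b du dv =
      same b (χ (b xor X x)) _

  -- Each of `x`, `w`, `c`, `d` sees the pair across the cut in exactly one of the two placements,
  -- which gives the 4; edges of `R` are counted in both.
  both-sides : (X : VSub N) → δ E (assign X u v true) + δ E (assign X u v false) ≡ 4 + (δ R X + δ R X)
  both-sides X rewrite δ-assign X true | δ-assign X false = trans (regroup (χ (not (X x))) (χ (not (X w))) (χ (not (X c))) (χ (not (X d))) (χ (X x)) (χ (X w)) (χ (X c)) (χ (X d)) (δ R X))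
    (cong₂ _+_ (cong₂ _+_ (one (X x)) (one (X w))) (cong₂ _+_ (cong₂ _+_ (one (X c)) (one (X d))) refl))
    where
    one : ∀ b → χ (not b) + χ b ≡ 1
    one true = refl
    one false = refl
    regroup : ∀ a b c d a′ b′ c′ d′ r → (a + (b + (c + (d + r)))) + (a′ + (b′ + (c′ + (d′ + r)))) ≡
      ((a + a′) + (b + b′)) + (((c + c′) + (d + d′)) + (r + r))
    regroup = solve-∀

  mem₁ : (X : VSub N) (b : Bool) → ∀ z → (U′ ∩ X) z ≡ true → (U ∩ assign X u v b) z ≡ true
  mem₁ X b z h with ⊖₂-mem U {u} {v} {z} (∧-left h)
  ... | uz , zu , zv = ∧-true uz (trans (assign₃ X b zu zv) (∧-right {U′ z} h))

  mem₂ : (X : VSub N) (b : Bool) → ∀ z → (U′ ∩ ∁ X) z ≡ true → (U ∩ ∁ (assign X u v b)) z ≡ true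
  mem₂ X b z h with ⊖₂-mem U {u} {v} {z} (∧-left h)
  ... | uz , zu , zv = ∧-true uz (trans (cong not (assign₃ X b zu zv)) (∧-right {U′ z} h))

  -- Both placements of the pair are cuts of size at least 4, so `both-sides` gives 8 ≤ 4 + 2 δ R X
  -- and the edges of `R` alone supply 2. A side with one vertex has cut size 3.
  bridgeless′ : Essential4 E U → x ≢ c → w ≢ d → Bridgeless E′ U′
  bridgeless′ C xc wd X (a , ha) (b , hb)
    with two-or-one (U′ ∩ X) a ha | two-or-one (U′ ∩ ∁ X) b hb
  ... | inj₂ h | _ = ≤-trans (s≤s (s≤s z≤n))
    (≤-reflexive (sym (δ-single (cubic′ xc wd) X a (∧-left ha) (∧-right {U′ a} ha) h)))
  ... | inj₁ _ | inj₂ h = ≤-trans (s≤s (s≤s z≤n))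
    (≤-reflexive (trans (sym (δ-single (cubic′ xc wd) (∁ X) b (∧-left hb) (∧-right {U′ b} hb) h)) (δ-∁ E′ X)))
  ... | inj₁ h | inj₁ k = ≤-trans (half (δ R X) (≤-trans (+-mono-≤ (side true) (side false)) (≤-reflexive (both-sides X))))
      (≤-trans (m≤n+m (δ R X) (cr X (w , d))) (≤-trans (m≤n+m _ (cr X (x , c))) (≤-reflexive (sym (δ-two (x , c) (w , d) R X)))))
    where
    side : ∀ b → 4 ≤ δ E (assign X u v b)
    side b = C (assign X u v b) (two-mono (mem₁ X b) h) (two-mono (mem₂ X b) k)
    half : ∀ r → 8 ≤ 4 + (r + r) → 2 ≤ r
    half zero (s≤s (s≤s (s≤s (s≤s ()))))
    half (suc zero) (s≤s (s≤s (s≤s (s≤s (s≤s (s≤s ()))))))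
    half (suc (suc r)) _ = s≤s (s≤s z≤n)

-- No digons or triangles

triple : Fin N → Fin N → Fin N → VSub N
triple a b c z = (z == a) ∨ ((z == b) ∨ (z == c))

∨-left : ∀ {a b} → a ≡ true → a ∨ b ≡ true
∨-left refl = refl

∨-right : ∀ {a b} → b ≡ true → a ∨ b ≡ true
∨-right {true} _ = refl
∨-right {false} h = h

∨-false : ∀ {a b} → a ≡ false → b ≡ false → a ∨ b ≡ false
∨-false refl refl = refl

triple₁ : (a b c : Fin N) → triple a b c a ≡ true
triple₁ a b c = ∨-left (==-refl a)

triple₂ : (a b c : Fin N) → triple a b c b ≡ true
triple₂ a b c = ∨-right {b == a} (∨-left (==-refl b))

triple₃ : (a b c : Fin N) → triple a b c c ≡ true
triple₃ a b c = ∨-right {c == a} (∨-right {c == b} (==-refl c))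

opaque
  unfolding δ deg
  δ-triple : (R : EList N) (a b c : Fin N) → δ R (triple a b c) ≤ deg R a + (deg R b + deg R c)
  δ-triple R a b c = ≤-trans (sumE-mono (All.universal (λ { (p , q) → pt p q }) R))
    (≤-reflexive (trans (sumE-+ (inc a) (λ e → inc b e + inc c e) R) (cong (deg R a +_) (sumE-+ (inc b) (inc c) R))))
    where
    χ-xor : ∀ s t → χ (s xor t) ≤ χ s + χ t
    χ-xor true true = z≤n
    χ-xor true false = ≤-refl
    χ-xor false t = ≤-refl
    χ-∨ : ∀ x y z → χ (x ∨ (y ∨ z)) ≤ χ x + (χ y + χ z)
    χ-∨ true y z = s≤s z≤n
    χ-∨ false true z = s≤s z≤n
    χ-∨ false false z = ≤-refl
    shuffle : ∀ a b c d e f → (a + (b + c)) + (d + (e + f)) ≡ (a + d) + ((b + e) + (c + f))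
    shuffle = solve-∀
    pt : ∀ p q → cr (triple a b c) (p , q) ≤ inc a (p , q) + (inc b (p , q) + inc c (p , q))
    pt p q = ≤-trans (χ-xor (triple a b c p) _) (≤-trans
      (+-mono-≤ (χ-∨ (p == a) (p == b) (p == c)) (χ-∨ (q == a) (q == b) (q == c)))
      (≤-reflexive (shuffle (χ (p == a)) (χ (p == b)) _ _ _ _)))

-- Five vertices leave two outside the triple. Since `c` may equal `b`, the lemma serves digons as
-- well as triangles.
no-small-cut : {E : EList N} {U : VSub N} → Essential4 E U → 5 ≤ size U → {a b c : Fin N} → a ≢ b →
               U a ≡ true → U b ≡ true → δ E (triple a b c) ≤ 3 → ⊥
no-small-cut {U = U} C h {a} {b} {c} ab ha hb le =
  <-irrefl refl (≤-trans (C (triple a b c) ins out) le)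
  where
  ins : Two (U ∩ triple a b c)
  ins = a , b , ab , ∧-true ha (triple₁ a b c) , ∧-true hb (triple₂ a b c)
  out : Two (U ∩ ∁ (triple a b c))
  out = two-mono (λ v hv → let (hv₂ , va , vb) = ⊖₂-mem U (⊖-mem {U = U ⊖ a ⊖ b} hv) in
          ∧-true hv₂ (not-true (∨-false (==-≢ va) (∨-false (==-≢ vb) (==-≢ (⊖-≢ {U = U ⊖ a ⊖ b} hv))))))
        (two-of-size (size-⊖≥ (U ⊖ a ⊖ b) c (size-⊖≥ (U ⊖ a) b (size-⊖≥ U a h))))

χ-same : ∀ {a b} → a ≡ true → b ≡ true → χ (a xor b) ≡ 0
χ-same refl refl = refl

opaque
  unfolding δ deg
  no-parallel : {E R : EList N} {U : VSub N} → Cubic′ E U → Essential4 E U → 5 ≤ size U → {a b : Fin N} →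
                E ≋ (a , b) ∷ (a , b) ∷ R → ⊥
  no-parallel {E = E} {R} {U} G C h {a} {b} eq with Cubic-≋ eq G
  ... | G′ with inU G′ | nl G′
  ... | (ha , hb) ∷ _ | ab ∷ _ = no-small-cut {E = E} C h {a} {b} {b} ab ha hb
    (≤-trans (≤-reflexive (δ-≋ (triple a b b) eq)) (≤-trans (≤-reflexive
       (cong₂ (λ s t → s + (t + δ R (triple a b b))) (χ-same (triple₁ a b b) (triple₂ a b b)) (χ-same (triple₁ a b b) (triple₂ a b b))))
     -- `b` is counted twice in `triple a b b`; the bound 1 + (1 + 1) is still small enough.
     (≤-trans (δ-triple R a b b) (≤-reflexive (cong₂ (λ s t → s + (t + t)) da db)))))
    where
    da : deg R a ≡ 1
    da = suc-injective (suc-injective (trans (sym (trans (deg-one ((a , b) ∷ R) (ab ∘ sym)) (cong suc (deg-one R (ab ∘ sym))))) (d3 G′ a ha)))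
    db : deg R b ≡ 1
    db = suc-injective (suc-injective (trans (sym (trans (deg-oneʳ ((a , b) ∷ R) ab) (cong suc (deg-oneʳ R ab)))) (d3 G′ b hb)))

  no-triangle : {E R : EList N} {U : VSub N} → Cubic′ E U → Essential4 E U → 5 ≤ size U → {a b c : Fin N} →
                E ≋ (a , b) ∷ (b , c) ∷ (c , a) ∷ R → ⊥
  no-triangle {E = E} {R} {U} G C h {a} {b} {c} eq with Cubic-≋ eq G
  ... | G′ with inU G′ | nl G′
  ... | (ha , hb) ∷ (_ , hc) ∷ _ | ab ∷ bc ∷ ca ∷ _ = no-small-cut {E = E} C h {a} {b} {c} ab ha hb
    (≤-trans (≤-reflexive (δ-≋ (triple a b c) eq)) (≤-trans (≤-reflexive
       (trans (cong₂ (λ s t → s + (t + (cr (triple a b c) (c , a) + δ R (triple a b c)))) (χ-same (triple₁ a b c) (triple₂ a b c)) (χ-same (triple₂ a b c) (triple₃ a b c)))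
        (cong (_+ δ R (triple a b c)) (χ-same (triple₃ a b c) (triple₁ a b c)))))
     (≤-trans (δ-triple R a b c) (≤-reflexive (cong₂ (λ s t → s + t) da (cong₂ _+_ db dc))))))
    where
    da : deg R a ≡ 1
    da = go (d3 G′ a ha)
      where go : deg ((a , b) ∷ (b , c) ∷ (c , a) ∷ R) a ≡ 3 → deg R a ≡ 1
            go k rewrite ==-refl a | ==-≢ (ab ∘ sym) | ==-≢ ca = suc-injective (suc-injective k)
    db : deg R b ≡ 1
    db = go (d3 G′ b hb)
      where go : deg ((a , b) ∷ (b , c) ∷ (c , a) ∷ R) b ≡ 3 → deg R b ≡ 1
            go k rewrite ==-refl b | ==-≢ ab | ==-≢ (bc ∘ sym) = suc-injective (suc-injective k)
    dc : deg R c ≡ 1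
    dc = go (d3 G′ c hc)
      where go : deg ((a , b) ∷ (b , c) ∷ (c , a) ∷ R) c ≡ 3 → deg R c ≡ 1
            go k rewrite ==-refl c | ==-≢ bc | ==-≢ (ca ∘ sym) = suc-injective (suc-injective k)

-- The neighbourhood of u away from the edge ux; S is a list of further edges
-- that are left out of all matchings and do not meet u, v, w.
record Nbhd (E : EList N) (U : VSub N) (u x : Fin N) (S F : EList N) : Set where
  field
    v w c d p q : Fin N
    R : EList N
    eqF : F ≋ (u , v) ∷ (u , w) ∷ (v , c) ∷ (v , d) ∷ (w , p) ∷ (w , q) ∷ R
    Su : deg S u ≡ 0
    Sv : deg S v ≡ 0
    Sw : deg S w ≡ 0
    du : deg R u ≡ 0
    dv : deg R v ≡ 0
    dw : deg R w ≡ 0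
    hu : U u ≡ true
    hv : U v ≡ true
    hw : U w ≡ true
    v≢u : v ≢ u
    w≢u : w ≢ u
    x≢u : x ≢ u
    v≢w : v ≢ w
    x≢v : x ≢ v
    x≢w : x ≢ w
    c≢u : c ≢ u
    d≢u : d ≢ u
    c≢v : c ≢ v
    d≢v : d ≢ v
    c≢w : c ≢ w
    d≢w : d ≢ w
    p≢u : p ≢ u
    q≢u : q ≢ u
    p≢v : p ≢ v
    q≢v : q ≢ v
    p≢w : p ≢ w
    q≢w : q ≢ w
    x≢c : x ≢ c
    x≢d : x ≢ d
    x≢p : x ≢ p
    x≢q : x ≢ q

all-++ʳ : {P : Edge N → Set} (S : EList N) {F : EList N} → All P (S ++ F) → All P F
all-++ʳ [] h = h
all-++ʳ (e ∷ S) (_ ∷ h) = all-++ʳ S h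

opaque
  unfolding deg
  deg-step₀ : (u x : Fin N) (S F : EList N) → u ≢ x → deg S u ≡ 0 →
              deg ((u , x) ∷ S ++ F) u ≡ 3 → deg F u ≡ 2
  deg-step₀ u x S F ux Su k rewrite ==-refl u | ==-≢ (ux ∘ sym) | deg-++ S F u | Su = suc-injective k

  deg-step₁ : (u x v w : Fin N) (S F : EList N) → v ≢ u → x ≢ v → v ≢ w → deg S v ≡ 0 →
              deg ((u , x) ∷ (u , v) ∷ (u , w) ∷ S ++ F) v ≡ 3 → deg F v ≡ 2
  deg-step₁ u x v w S F vu xv vw Sv k
    rewrite ==-≢ (vu ∘ sym) | ==-≢ xv | ==-refl v | ==-≢ (vw ∘ sym) | deg-++ S F v | Sv = suc-injective k

  deg-step₂ : (u x v w c d : Fin N) (S F : EList N) → w ≢ u → x ≢ w → v ≢ w → c ≢ w → d ≢ w → deg S w ≡ 0 →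
              deg ((u , x) ∷ (u , v) ∷ (u , w) ∷ (v , c) ∷ (v , d) ∷ S ++ F) w ≡ 3 → deg F w ≡ 2
  deg-step₂ u x v w c d S F wu xw vw cw dw Sw k
    rewrite ==-≢ (wu ∘ sym) | ==-≢ xw | ==-refl w | ==-≢ vw | ==-≢ cw | ==-≢ dw | deg-++ S F w | Sw = suc-injective k

deg-avoid₂ : {z a b c d : Fin N} (R : EList N) → deg ((a , b) ∷ (c , d) ∷ R) z ≡ 0 → (b ≢ z) × (d ≢ z) × deg R z ≡ 0
deg-avoid₂ {z = z} {a} {b} {c} {d} R h with deg-avoid ((a , b) ∷ (c , d) ∷ R) h
... | (_ , k) ∷ (_ , l) ∷ m = k , l , avoid-deg R m

-- The neighbours `v`, `w` of `u` come first: whether the passive edges `S` avoid them can only be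
-- stated once they are known, and `nbhd₂` needs it to read off the degrees at `v` and `w`.
record Nbhd₁ (E : EList N) (U : VSub N) (u x : Fin N) (S F : EList N) : Set where
  field
    v w : Fin N
    F₁ : EList N
    eqF : F ≋ (u , v) ∷ (u , w) ∷ F₁
    front : E ≋ (u , x) ∷ (u , v) ∷ (u , w) ∷ S ++ F₁
    hu : U u ≡ true
    v≢u : v ≢ u
    w≢u : w ≢ u
    x≢u : x ≢ u
    v≢w : v ≢ w
    x≢v : x ≢ v
    x≢w : x ≢ w
    nlF : NL F₁
    du : deg F₁ u ≡ 0

module _ {E : EList N} {U : VSub N} (G : Cubic′ E U) (C : Essential4 E U) (h : 5 ≤ size U) where

  nbhd₁ : (u x : Fin N) (S F : EList N) → E ≋ (u , x) ∷ S ++ F → deg S u ≡ 0 → Nbhd₁ E U u x S F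
  nbhd₁ u x S F eq Su = go (star₂ F u (all-++ʳ S (All.tail (nl G₁))) (deg-step₀ u x S F ux Su (d3 G₁ u hu)))
    where
    G₁ = Cubic-≋ eq G
    hu = proj₁ (All.head (inU G₁))
    ux : u ≢ x
    ux = All.head (nl G₁)
    go : Star₂ F u → Nbhd₁ E U u x S F
    go (mk₂ v w F₁ e₁ v≢u w≢u dF₁u) = record
      { v = v ; w = w ; F₁ = F₁ ; eqF = e₁ ; front = front ; hu = hu ; v≢u = v≢u ; w≢u = w≢u ; x≢u = ux ∘ sym
      ; v≢w = λ { refl → no-parallel G C h (≋-trans front (≋-trans (≋-swap _ _) (≋-prep _ (≋-swap _ _)))) }
      ; x≢v = λ { refl → no-parallel G C h front }
      ; x≢w = λ { refl → no-parallel G C h (≋-trans front (≋-prep _ (≋-swap _ _))) }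
      ; nlF = all-++ʳ ((u , v) ∷ (u , w) ∷ []) (NL-≋ e₁ (all-++ʳ S (All.tail (nl G₁)))) ; du = dF₁u }
      where
      front : E ≋ (u , x) ∷ (u , v) ∷ (u , w) ∷ S ++ F₁
      front = ≋-trans eq (≋-prep _ (≋-trans (≋-++ˡ S e₁)
        (≋-trans (≋-shift S _ _) (≋-prep _ (≋-shift S _ _)))))

  nbhd₂ : {u x : Fin N} {S F : EList N} → (M : Nbhd₁ E U u x S F) → deg S u ≡ 0 →
          deg S (Nbhd₁.v M) ≡ 0 → deg S (Nbhd₁.w M) ≡ 0 → Nbhd E U u x S F
  nbhd₂ {u} {x} {S} {F} M Su Sv Sw = go (star₂ F₁ v nlF (deg-step₁ u x v w S F₁ v≢u x≢v v≢w Sv (d3 G₂ v hv)))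
    where
    open Nbhd₁ M
    G₂ = Cubic-≋ front G
    hv : U v ≡ true
    hv = proj₂ (All.head (All.tail (inU G₂)))
    hw : U w ≡ true
    hw = proj₂ (All.head (All.tail (All.tail (inU G₂))))
    go : Star₂ F₁ v → Nbhd E U u x S F
    go (mk₂ c d F₂ e₂ c≢v d≢v dF₂v) = go′ (star₂ F₂ w (all-++ʳ ((v , c) ∷ (v , d) ∷ []) (NL-≋ e₂ nlF))
        (deg-step₂ u x v w c d S F₂ w≢u x≢w v≢w c≢w d≢w Sw (d3 (Cubic-≋ front₂ G) w hw)))
      where
      front₂ : E ≋ (u , x) ∷ (u , v) ∷ (u , w) ∷ (v , c) ∷ (v , d) ∷ S ++ F₂
      front₂ = ≋-trans front (≋-prep₃ _ _ _ (≋-trans (≋-++ˡ S e₂) (≋-trans (≋-shift S _ _) (≋-prep _ (≋-shift S _ _)))))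
      away : (c ≢ u) × (d ≢ u) × deg F₂ u ≡ 0
      away = deg-avoid₂ {a = v} {c} {v} {d} F₂ (trans (sym (deg-≋ u e₂)) du)
      c≢w : c ≢ w
      c≢w refl = no-triangle G C h {u} {v} {w}
        (≋-trans front₂ (≋-trans (≋-swap (u , x) (u , v)) (≋-prep (u , v) (≋-trans (≋-third (u , x) (u , w) (v , w))
          (≋-prep (v , w) (≋-trans (≋-swap (u , x) (u , w)) (≋-flip u w)))))))
      d≢w : d ≢ w
      d≢w refl = no-triangle G C h {u} {v} {w}
        (≋-trans front₂ (≋-trans (≋-swap (u , x) (u , v)) (≋-prep (u , v) (≋-trans (≋-prep₂ (u , x) (u , w) (≋-swap (v , c) (v , w)))
          (≋-trans (≋-third (u , x) (u , w) (v , w))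
          (≋-prep (v , w) (≋-trans (≋-swap (u , x) (u , w)) (≋-flip u w))))))))
      x≢c : x ≢ c
      x≢c refl = no-triangle G C h {u} {v} {x}
        (≋-trans front₂ (≋-trans (≋-swap (u , x) (u , v)) (≋-prep (u , v) (≋-trans (≋-third (u , x) (u , w) (v , x))
          (≋-prep (v , x) (≋-flip u x))))))
      x≢d : x ≢ d
      x≢d refl = no-triangle G C h {u} {v} {x}
        (≋-trans front₂ (≋-trans (≋-swap (u , x) (u , v)) (≋-prep (u , v) (≋-trans (≋-prep₂ (u , x) (u , w) (≋-swap (v , c) (v , x)))
          (≋-trans (≋-third (u , x) (u , w) (v , x)) (≋-prep (v , x) (≋-flip u x)))))))
      go′ : Star₂ F₂ w → Nbhd E U u x S F
      go′ (mk₂ p q R e₃ p≢w q≢w dRw) = record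
        { v = v ; w = w ; c = c ; d = d ; p = p ; q = q ; R = R
        ; eqF = ≋-trans eqF (≋-prep₂ _ _ (≋-trans e₂ (≋-prep₂ _ _ e₃)))
        ; Su = Su ; Sv = Sv ; Sw = Sw
        ; du = proj₂ (proj₂ awayu) ; dv = proj₂ (proj₂ awayv) ; dw = dRw ; hu = hu ; hv = hv ; hw = hw
        ; v≢u = v≢u ; w≢u = w≢u ; x≢u = x≢u ; v≢w = v≢w ; x≢v = x≢v ; x≢w = x≢w
        ; c≢u = proj₁ away ; d≢u = proj₁ (proj₂ away) ; c≢v = c≢v ; d≢v = d≢v ; c≢w = c≢w ; d≢w = d≢w
        ; p≢u = proj₁ awayu ; q≢u = proj₁ (proj₂ awayu)
        ; p≢v = proj₁ awayv ; q≢v = proj₁ (proj₂ awayv)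
        ; p≢w = p≢w ; q≢w = q≢w ; x≢c = x≢c ; x≢d = x≢d ; x≢p = x≢p ; x≢q = x≢q }
        where
        awayu : (p ≢ u) × (q ≢ u) × deg R u ≡ 0
        awayu = deg-avoid₂ {a = w} {p} {w} {q} R (trans (sym (deg-≋ u e₃)) (proj₂ (proj₂ away)))
        awayv : (p ≢ v) × (q ≢ v) × deg R v ≡ 0
        awayv = deg-avoid₂ {a = w} {p} {w} {q} R (trans (sym (deg-≋ v e₃)) dF₂v)
        front₃ : E ≋ (u , x) ∷ (w , p) ∷ (w , q) ∷ (u , w) ∷ (u , v) ∷ (v , c) ∷ (v , d) ∷ S ++ R
        front₃ = ≋-trans front₂ (≋-prep (u , x) (≋-trans
          (≋-++ˡ ((u , v) ∷ (u , w) ∷ (v , c) ∷ (v , d) ∷ []) (≋-trans (≋-++ˡ S e₃) (≋-trans (≋-shift S _ _) (≋-prep _ (≋-shift S _ _)))))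
          (≋-trans (≋-shift ((u , v) ∷ (u , w) ∷ (v , c) ∷ (v , d) ∷ []) (w , p) ((w , q) ∷ S ++ R))
            (≋-prep (w , p) (≋-trans (≋-shift ((u , v) ∷ (u , w) ∷ (v , c) ∷ (v , d) ∷ []) (w , q) (S ++ R))
              (≋-prep (w , q) (≋-swap _ _)))))))
        x≢p : x ≢ p
        x≢p refl = no-triangle G C h {x} {u} {w}
          (≋-trans front₃ (≋-trans (≋-flip u x) (≋-prep (x , u) (≋-trans (≋-third (w , x) (w , q) (u , w)) (≋-prep (u , w) ≋-refl)))))
        x≢q : x ≢ q
        x≢q refl = no-triangle G C h {x} {u} {w}
          (≋-trans front₃ (≋-trans (≋-flip u x) (≋-prep (x , u) (≋-trans (≋-swap (w , p) (w , x)) (≋-trans (≋-third (w , x) (w , p) (u , w)) (≋-prep (u , w) ≋-refl))))))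

-- Voorhoeve's identity

⊖-comm₃ : (U : VSub N) (a b c : Fin N) → U ⊖ a ⊖ b ⊖ c ≐ U ⊖ a ⊖ c ⊖ b
⊖-comm₃ U a b c = ⊖-comm (U ⊖ a) b c

-- Deleting u, v and then using wd removes the same four vertices as deleting u, w and then using
-- vd. This lets different split graphs share their terms.
exchange : {U : VSub N} {u v w d : Fin N} (R : EList N) → U v ≡ true → U w ≡ true →
           v ≢ u → w ≢ u → v ≢ w → d ≢ v → d ≢ w →
           μₑ (w , d) R (U ⊖ u ⊖ v) ≡ μₑ (v , d) R (U ⊖ u ⊖ w)
exchange {U = U} {u} {v} {w} {d} R hv hw vu wu vw dv dw = trans (μₑ-def w d R (U ⊖ u ⊖ v)) (trans (ifn-ext
  (λ h → ∧-true (⊖₂-in U hv vu vw) (trans (⊖-keep (U ⊖ u) dw) (trans (sym (⊖-keep (U ⊖ u) dv)) (∧-right {(U ⊖ u ⊖ v) w} h))))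
  (λ h → ∧-true (⊖₂-in U hw wu (vw ∘ sym)) (trans (⊖-keep (U ⊖ u) dv) (trans (sym (⊖-keep (U ⊖ u) dw)) (∧-right {(U ⊖ u ⊖ w) v} h))))
  (λ _ → μ-cong R (⊖-cong {U = U ⊖ u ⊖ v ⊖ w} {U ⊖ u ⊖ w ⊖ v} d (⊖-comm₃ U u v w))))
  (sym (μₑ-def v d R (U ⊖ u ⊖ w))))

private
  -- Once `uv` is used, both further edges of `v` are dead and `w` has to be covered by `wp` or
  -- `wq`.
  branch : {U : VSub N} {u v w c d p q : Fin N} (R : EList N) → deg R w ≡ 0 → U u ≡ true → U v ≡ true → U w ≡ true →
           v ≢ u → w ≢ u → v ≢ w →
           μₑ (u , v) ((v , c) ∷ (v , d) ∷ (w , p) ∷ (w , q) ∷ R) U ≡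
           μₑ (w , p) R (U ⊖ u ⊖ v) + μₑ (w , q) R (U ⊖ u ⊖ v)
  branch {U = U} {u} {v} {w} {c} {d} {p} {q} R dw hu hv hw vu wu vw = begin
    μₑ (u , v) ((v , c) ∷ (v , d) ∷ (w , p) ∷ (w , q) ∷ R) U
      ≡⟨ μₑ-live {U = U} {u} {v} _ hu hv ⟩
    μ ((v , c) ∷ (v , d) ∷ (w , p) ∷ (w , q) ∷ R) (U ⊖ u ⊖ v)
      ≡⟨ μ-dead {U = U ⊖ u ⊖ v} {v} {c} _ (⊖-self (U ⊖ u) v) ⟩
    μ ((v , d) ∷ (w , p) ∷ (w , q) ∷ R) (U ⊖ u ⊖ v)
      ≡⟨ μ-dead {U = U ⊖ u ⊖ v} {v} {d} _ (⊖-self (U ⊖ u) v) ⟩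
    μ ((w , p) ∷ (w , q) ∷ R) (U ⊖ u ⊖ v)
      ≡⟨ μ-star₂ w p q R dw (⊖₂-in U hw wu (vw ∘ sym)) ⟩
    μₑ (w , p) R (U ⊖ u ⊖ v) + μₑ (w , q) R (U ⊖ u ⊖ v) ∎
    where open ≡-Reasoning

  rotate₄ : ∀ e f g k {E : EList N} → e ∷ f ∷ g ∷ k ∷ E ≋ g ∷ k ∷ e ∷ f ∷ E
  rotate₄ e f g k = ≋-trans (≋-third e f g) (≋-prep g (≋-third e f k))

module Voorhoeve {N} {E : EList N} {U : VSub N} {u x : Fin N} {S F : EList N}
                 (G : Cubic′ E U) (C : Essential4 E U) (eq : E ≋ (u , x) ∷ S ++ F) (M : Nbhd E U u x S F) where
  open Nbhd M

  Rv Rw : EList N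
  Rv = (w , p) ∷ (w , q) ∷ R
  Rw = (v , c) ∷ (v , d) ∷ R

  private
    dRvu : deg (S ++ Rv) u ≡ 0
    dRvu = trans (deg-++ S Rv u) (cong₂ _+_ Su (deg-zero-∷ {E = (w , q) ∷ R} w≢u p≢u (deg-zero-∷ {E = R} w≢u q≢u du)))
    dRvv : deg (S ++ Rv) v ≡ 0
    dRvv = trans (deg-++ S Rv v) (cong₂ _+_ Sv (deg-zero-∷ {E = (w , q) ∷ R} (v≢w ∘ sym) p≢v (deg-zero-∷ {E = R} (v≢w ∘ sym) q≢v dv)))
    dRwu : deg (S ++ Rw) u ≡ 0
    dRwu = trans (deg-++ S Rw u) (cong₂ _+_ Su (deg-zero-∷ {E = (v , d) ∷ R} v≢u c≢u (deg-zero-∷ {E = R} v≢u d≢u du)))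
    dRww : deg (S ++ Rw) w ≡ 0
    dRww = trans (deg-++ S Rw w) (cong₂ _+_ Sw (deg-zero-∷ {E = (v , d) ∷ R} v≢w c≢w (deg-zero-∷ {E = R} v≢w d≢w dw)))

    eqv : E ≋ (u , x) ∷ (u , v) ∷ (u , w) ∷ (v , c) ∷ (v , d) ∷ S ++ Rv
    eqv = ≋-trans eq (≋-prep (u , x) (≋-trans (≋-++ˡ S eqF)
      (≋-trans (≋-shift S _ _) (≋-prep _ (≋-trans (≋-shift S _ _) (≋-prep _
        (≋-trans (≋-shift S _ _) (≋-prep _ (≋-shift S _ _)))))))))

    eqw : E ≋ (u , x) ∷ (u , w) ∷ (u , v) ∷ (w , p) ∷ (w , q) ∷ S ++ Rw
    eqw = ≋-trans eq (≋-prep (u , x) (≋-trans (≋-++ˡ S (≋-trans eqF (≋-trans (≋-swap _ _)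
        (≋-prep₂ _ _ (rotate₄ (v , c) (v , d) (w , p) (w , q))))))
      (≋-trans (≋-shift S _ _) (≋-prep _ (≋-trans (≋-shift S _ _) (≋-prep _
        (≋-trans (≋-shift S _ _) (≋-prep _ (≋-shift S _ _)))))))))

  split₁ : Splittable E U u v x w c d (S ++ Rv)
  split₁ = record { cubic = G ; eq = eqv ; du = dRvu ; dv = dRvv ; x≢v = x≢v ; w≢v = v≢w ∘ sym ; c≢u = c≢u ; d≢u = d≢u }

  split₂ : Splittable E U u v x w d c (S ++ Rv)
  split₂ = record { cubic = G ; eq = ≋-trans eqv (≋-prep₃ _ _ _ (≋-swap _ _)) ; du = dRvu ; dv = dRvv
                  ; x≢v = x≢v ; w≢v = v≢w ∘ sym ; c≢u = d≢u ; d≢u = c≢u }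

  split₃ : Splittable E U u w x v p q (S ++ Rw)
  split₃ = record { cubic = G ; eq = eqw ; du = dRwu ; dv = dRww ; x≢v = x≢w ; w≢v = v≢w ; c≢u = p≢u ; d≢u = q≢u }

  split₄ : Splittable E U u w x v q p (S ++ Rw)
  split₄ = record { cubic = G ; eq = ≋-trans eqw (≋-prep₃ _ _ _ (≋-swap _ _)) ; du = dRwu ; dv = dRww
                  ; x≢v = x≢w ; w≢v = v≢w ; c≢u = q≢u ; d≢u = p≢u }

  -- The matchings of the four split graphs that avoid the new edge at `x` and the passive edges
  -- `S`: of the two new edges only the one at `w`, respectively `v`, is listed.
  f₁ f₂ f₃ f₄ : ℕ
  f₁ = μ ((w , d) ∷ Rv) (U ⊖ u ⊖ v)
  f₂ = μ ((w , c) ∷ Rv) (U ⊖ u ⊖ v)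
  f₃ = μ ((v , q) ∷ Rw) (U ⊖ u ⊖ w)
  f₄ = μ ((v , p) ∷ Rw) (U ⊖ u ⊖ w)

  private
    Xp = μₑ (w , p) R (U ⊖ u ⊖ v)
    Xq = μₑ (w , q) R (U ⊖ u ⊖ v)
    Yc = μₑ (v , c) R (U ⊖ u ⊖ w)
    Yd = μₑ (v , d) R (U ⊖ u ⊖ w)

    total : μ F U ≡ (Xp + Xq) + (Yc + Yd)
    total = trans (μ-≋ eqF U) (trans
      (μ-star₂ u v w ((v , c) ∷ (v , d) ∷ Rv)
        (deg-zero-∷ {E = (v , d) ∷ Rv} v≢u c≢u (deg-zero-∷ {E = Rv} v≢u d≢u
          (deg-zero-∷ {E = (w , q) ∷ R} w≢u p≢u (deg-zero-∷ {E = R} w≢u q≢u du)))) hu)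
      (cong₂ _+_ (branch R dw hu hv hw v≢u w≢u v≢w)
        (trans (μₑ-≋ (u , w) (rotate₄ (v , c) (v , d) (w , p) (w , q)) U)
          (branch R dv hu hw hv w≢u v≢u (v≢w ∘ sym)))))

    eq₁ : f₁ ≡ Yd + (Xp + Xq)
    eq₁ = trans (μ-star₃ w d p q R dw (⊖₂-in U hw w≢u (v≢w ∘ sym)))
      (cong (_+ (Xp + Xq)) (exchange R hv hw v≢u w≢u v≢w d≢v d≢w))
    eq₂ : f₂ ≡ Yc + (Xp + Xq)
    eq₂ = trans (μ-star₃ w c p q R dw (⊖₂-in U hw w≢u (v≢w ∘ sym)))
      (cong (_+ (Xp + Xq)) (exchange R hv hw v≢u w≢u v≢w c≢v c≢w))
    eq₃ : f₃ ≡ Xq + (Yc + Yd)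
    eq₃ = trans (μ-star₃ v q c d R dv (⊖₂-in U hv v≢u v≢w))
      (cong (_+ (Yc + Yd)) (exchange R hw hv w≢u v≢u (v≢w ∘ sym) q≢w q≢v))
    eq₄ : f₄ ≡ Xp + (Yc + Yd)
    eq₄ = trans (μ-star₃ v p c d R dv (⊖₂-in U hv v≢u v≢w))
      (cong (_+ (Yc + Yd)) (exchange R hw hv w≢u v≢u (v≢w ∘ sym) p≢w p≢v))

  -- `Xp`, `Xq`, `Yc`, `Yd` classify the matchings by which of `uv`, `uw` they contain and how the
  -- other neighbour of `u` is covered. Each split graph misses exactly one class, so every class is
  -- counted three times.
  voorhoeve : 3 * μ F U ≡ (f₁ + f₂) + (f₃ + f₄)
  voorhoeve rewrite total | eq₁ | eq₂ | eq₃ | eq₄ = alg Xp Xq Yc Yd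
    where
    alg : ∀ a b c d → 3 * ((a + b) + (c + d)) ≡ ((d + (a + b)) + (c + (a + b))) + ((b + (c + d)) + (a + (c + d)))
    alg = solve-∀

-- Perfect matchings of bridgeless cubic graphs avoiding two edges

some? : (X : VSub N) → Dec (Some X)
some? X = any? λ v → X v Boolₚ.≟ true

some-cong : {X Y : VSub N} → X ≐ Y → Some X → Some Y
some-cong h (v , hv) = v , trans (sym (h v)) hv

-- Subsets are searched through their tables as vectors; a function need not equal the lookup in its
-- own table, so `P` has to respect `≐`.
search : {P : VSub N → Set} → (∀ {X Y} → X ≐ Y → P X → P Y) → (∀ X → Dec (P X)) → (∃ λ X → P X) ⊎ (∀ X → ¬ P X)
search {P = P} ext P? with anySubset? (λ s → P? (lookup s))
... | yes (s , p) = inj₁ (lookup s , p)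
... | no h = inj₂ λ X p → h (tabulate X , ext (λ v → sym (lookup∘tabulate X v)) p)

Cut : EList N → VSub N → VSub N → Set
Cut E U X = Some (U ∩ X) × Some (U ∩ ∁ X) × δ E X < 2

bridgeless? : (E : EList N) (U : VSub N) → (∃ λ X → Cut E U X) ⊎ Bridgeless E U
bridgeless? E U with search {P = Cut E U}
    (λ { {X} {Y} h (s , t , l) → some-cong (λ v → cong (U v ∧_) (h v)) s , some-cong (λ v → cong (λ b → U v ∧ not b) (h v)) t
       , subst (_< 2) (δ-cong E h) l })
    (λ X → some? (U ∩ X) ×-dec some? (U ∩ ∁ X) ×-dec (δ E X <? 2))
... | inj₁ c = inj₁ c
... | inj₂ h = inj₂ λ X s t → ≮⇒≥ λ l → h X (s , t , l)

opaque
  unfolding δ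
  -- Submodularity of cuts, with the union of `X` and `Y` represented by its complement.
  δ-sub₁ : (R : EList N) (X Y : VSub N) → δ R (X ∩ Y) + δ R (∁ X ∩ ∁ Y) ≤ δ R X + δ R Y
  δ-sub₁ R X Y = subst₂ _≤_ (sumE-+ (cr (X ∩ Y)) (cr (∁ X ∩ ∁ Y)) R) (sumE-+ (cr X) (cr Y) R)
    (sumE-mono (All.universal (λ { (a , b) → pt (X a) (Y a) (X b) (Y b) }) R))
    where
    pt : ∀ p q r s → χ ((p ∧ q) xor (r ∧ s)) + χ ((not p ∧ not q) xor (not r ∧ not s)) ≤ χ (p xor r) + χ (q xor s)
    pt true true true true = z≤n
    pt true true true false = ≤-refl
    pt true true false true = ≤-refl
    pt true true false false = ≤-refl
    pt true false true true = ≤-refl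
    pt true false true false = z≤n
    pt true false false true = z≤n
    pt true false false false = ≤-refl
    pt false true true true = ≤-refl
    pt false true true false = z≤n
    pt false true false true = z≤n
    pt false true false false = ≤-refl
    pt false false true true = ≤-refl
    pt false false true false = ≤-refl
    pt false false false true = ≤-refl
    pt false false false false = z≤n

  -- An edge inside `X` between its two halves is counted twice on the left and not at all in
  -- `δ R X`; every other edge counts equally on both sides.
  δ-parity : (R : EList N) (X Y : VSub N) → ∃ λ e → δ R (X ∩ Y) + δ R (X ∩ ∁ Y) ≡ δ R X + (e + e)
  δ-parity {N} R X Y = sumE ψ R , trans (sym (sumE-+ (cr (X ∩ Y)) (cr (X ∩ ∁ Y)) R))
    (trans (sumE-cong′ (λ { (a , b) → pt (X a) (Y a) (X b) (Y b) }) R)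
    (trans (sumE-+ (cr X) (λ e → ψ e + ψ e) R) (cong (δ R X +_) (sumE-+ ψ ψ R))))
    where
    ψ : Edge N → ℕ
    ψ (a , b) = χ ((X a ∧ X b) ∧ (Y a xor Y b))
    pt : ∀ p q r s → χ ((p ∧ q) xor (r ∧ s)) + χ ((p ∧ not q) xor (r ∧ not s)) ≡
         χ (p xor r) + (χ ((p ∧ r) ∧ (q xor s)) + χ ((p ∧ r) ∧ (q xor s)))
    pt true true true true = refl
    pt true true true false = refl
    pt true true false true = refl
    pt true true false false = refl
    pt true false true true = refl
    pt true false true false = refl
    pt true false false true = refl
    pt true false false false = refl
    pt false true true true = refl
    pt false true true false = refl
    pt false true false true = refl
    pt false true false false = refl
    pt false false true true = refl
    pt false false true false = refl
    pt false false false true = refl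
    pt false false false false = refl

-- Frink's reduction: one of two pairings stays bridgeless

module Frink {N} {E : EList N} {U : VSub N} {u v x w c d : Fin N} {R : EList N}
             (S : Splittable E U u v x w c d R) (B : Bridgeless E U) where
  open Split S

  -- A bad cut of the graph obtained by joining x–c and w–d.
  Bad : VSub N → Set
  Bad X = X x ≡ true × X c ≡ true × X w ≡ false × X d ≡ false × δ R X ≤ 1

  private
    side : (X : VSub N) → Some (U′ ∩ X) → Some (U′ ∩ ∁ X) → ∀ b → 2 ≤ δ E (assign X u v b)
    side X (a , ha) (a′ , ha′) b = B (assign X u v b) (a , mem₁ X b a ha) (a′ , mem₂ X b a′ ha′)

    -- If the four corners split 4-0 or 3-1, one of the lifts is as small as the cut itself; if both
    -- new edges cross, the cut already has size 2. This leaves `x`, `c` against `w`, `d`.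
    classify : ∀ p q r s n → 2 ≤ χ (true xor p) + (χ (true xor r) + (χ (true xor q) + (χ (true xor s) + n))) →
               2 ≤ χ (false xor p) + (χ (false xor r) + (χ (false xor q) + (χ (false xor s) + n))) →
               χ (p xor q) + (χ (r xor s) + n) < 2 →
               (p ≡ true × q ≡ true × r ≡ false × s ≡ false × n ≤ 1) ⊎ (p ≡ false × q ≡ false × r ≡ true × s ≡ true × n ≤ 1)
    classify true true true true n h k (s≤s l) = ⊥-elim (<-irrefl refl (≤-trans h l))
    classify true true true false n h k (s≤s l) = ⊥-elim (<-irrefl refl (≤-trans h l))
    classify true true false true n h k (s≤s l) = ⊥-elim (<-irrefl refl (≤-trans h l))
    classify true true false false n h k (s≤s l) = inj₁ (refl , refl , refl , refl , l)
    classify true false true true n h k (s≤s l) = ⊥-elim (<-irrefl refl (≤-trans h l))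
    classify true false true false n h k (s≤s (s≤s ()))
    classify true false false true n h k (s≤s (s≤s ()))
    classify true false false false n h k (s≤s l) = ⊥-elim (<-irrefl refl (≤-trans k l))
    classify false true true true n h k (s≤s l) = ⊥-elim (<-irrefl refl (≤-trans h l))
    classify false true true false n h k (s≤s (s≤s ()))
    classify false true false true n h k (s≤s (s≤s ()))
    classify false true false false n h k (s≤s l) = ⊥-elim (<-irrefl refl (≤-trans k l))
    classify false false true true n h k (s≤s l) = inj₂ (refl , refl , refl , refl , l)
    classify false false true false n h k (s≤s l) = ⊥-elim (<-irrefl refl (≤-trans k l))
    classify false false false true n h k (s≤s l) = ⊥-elim (<-irrefl refl (≤-trans k l))
    classify false false false false n h k (s≤s l) = ⊥-elim (<-irrefl refl (≤-trans k l))

  bad : (∃ λ X → Cut E′ U′ X) → ∃ Bad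
  bad (X , s , t , l) with classify (X x) (X c) (X w) (X d) (δ R X)
    (≤-trans (side X s t true) (≤-reflexive (δ-assign X true)))
    (≤-trans (side X s t false) (≤-reflexive (δ-assign X false)))
    (subst (_< 2) (δ-two (x , c) (w , d) R X) l)
  ... | inj₁ (p , q , r , z , n) = X , p , q , r , z , n
  ... | inj₂ (p , q , r , z , n) = ∁ X , cong not p , cong not q , cong not r , cong not z , ≤-trans (≤-reflexive (δ-∁ R X)) n

  -- With `u`, `v` outside, only the edge to the single corner in `Q` crosses besides edges of `R`,
  -- so bridgelessness leaves at least one for `R`.
  corner : (Q : VSub N) (y : Fin N) → U y ≡ true → y ≢ u → y ≢ v → Q y ≡ true →
           χ (Q x) + (χ (Q w) + (χ (Q c) + χ (Q d))) ≡ 1 → 1 ≤ δ R Q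
  corner Q y hy yu yv qy one = ≤-pred (≤-trans
    (B (assign Q u v false) (y , ∧-true hy (trans (assign₃ Q false yu yv) qy))
       (u , ∧-true hu (cong not (assign₁ Q u v false))))
    (≤-reflexive (trans (δ-assign Q false) (trans (assoc (χ (Q x)) (χ (Q w)) (χ (Q c)) (χ (Q d)) (δ R Q)) (cong (_+ δ R Q) one)))))
    where
    assoc : ∀ a b c d r → a + (b + (c + (d + r))) ≡ (a + (b + (c + d))) + r
    assoc = solve-∀

odd≢even : ∀ e → 2 ≡ 1 + (e + e) → ⊥
odd≢even zero ()
odd≢even (suc zero) ()
odd≢even (suc (suc e)) ()

squeeze : ∀ a b p q → 1 ≤ a → 1 ≤ b → p ≤ 1 → q ≤ 1 → a + b ≤ p + q → a ≡ 1 × p ≡ 1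
squeeze (suc a) (suc b) zero zero ha hb hp hq ()
squeeze (suc a) (suc b) zero (suc zero) ha hb hp hq (s≤s h) with ≤-trans (m≤n+m (suc b) a) h
... | ()
squeeze (suc a) (suc b) (suc zero) zero ha hb hp hq (s≤s h) with ≤-trans (m≤n+m (suc b) a) h
... | ()
squeeze (suc zero) (suc b) (suc zero) (suc zero) ha hb hp hq h = refl , refl
squeeze (suc (suc a)) (suc b) (suc zero) (suc zero) ha hb hp hq (s≤s (s≤s h)) with ≤-trans (m≤n+m (suc b) a) h
... | ()
squeeze (suc a) (suc b) (suc (suc p)) q ha hb (s≤s ()) hq h
squeeze (suc a) (suc b) p (suc (suc q)) ha hb hp (s≤s ()) h

swap-split : {E : EList N} {U : VSub N} {u v x w c d : Fin N} {R : EList N} →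
             Splittable E U u v x w c d R → Splittable E U u v x w d c R
swap-split S = record
  { cubic = cubic ; eq = ≋-trans eq (≋-prep₃ _ _ _ (≋-swap _ _)) ; du = du ; dv = dv
  ; x≢v = x≢v ; w≢v = w≢v ; c≢u = d≢u ; d≢u = c≢u }
  where open Splittable S

module Pairings {N} {E : EList N} {U : VSub N} {u v x w c d : Fin N} {R : EList N}
                (S : Splittable E U u v x w c d R) (B : Bridgeless E U) where
  open Split S
  module F₁ = Frink S B
  module F₂ = Frink (swap-split S) B

  -- The two bad cuts cross so that each quadrant contains exactly one corner and is left by an edge
  -- of `R`. Submodularity on both diagonals then forces X ∩ Y, X ∩ ∁ Y and X to have exactly one
  -- leaving edge each, against the parity of `δ-parity`.
  not-both-bad : ∃ F₁.Bad → ∃ F₂.Bad → ⊥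
  not-both-bad (X , Xx , Xc , Xw , Xd , X≤1) (Y , Yx , Yd , Yw , Yc , Y≤1) = odd≢even e
    (trans (sym (cong₂ _+_ (proj₁ s₁) (proj₁ s₂))) (trans par (cong (_+ (e + e)) (proj₂ s₁))))
    where
    open Splittable S using (x≢v; w≢v; c≢u; d≢u)
    ones : ∀ {a b c d} → a ≡ true → b ≡ false → c ≡ false → d ≡ false → χ a + (χ b + (χ c + χ d)) ≡ 1
    ones refl refl refl refl = refl
    ones₂ : ∀ {a b c d} → a ≡ false → b ≡ true → c ≡ false → d ≡ false → χ a + (χ b + (χ c + χ d)) ≡ 1
    ones₂ refl refl refl refl = refl
    ones₃ : ∀ {a b c d} → a ≡ false → b ≡ false → c ≡ true → d ≡ false → χ a + (χ b + (χ c + χ d)) ≡ 1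
    ones₃ refl refl refl refl = refl
    ones₄ : ∀ {a b c d} → a ≡ false → b ≡ false → c ≡ false → d ≡ true → χ a + (χ b + (χ c + χ d)) ≡ 1
    ones₄ refl refl refl refl = refl
    qx : 1 ≤ δ R (X ∩ Y)
    qx = F₁.corner (X ∩ Y) x hx (u≢x ∘ sym) x≢v (∧-true Xx Yx)
      (ones (∧-true Xx Yx) (∧-false₁ Xw) (∧-false₂ {X c} Yc) (∧-false₁ Xd))
    qw : 1 ≤ δ R (∁ X ∩ ∁ Y)
    qw = F₁.corner (∁ X ∩ ∁ Y) w hw (u≢w ∘ sym) w≢v (∧-true (cong not Xw) (cong not Yw))
      (ones₂ (∧-false₁ (cong not Xx)) (∧-true (cong not Xw) (cong not Yw)) (∧-false₁ (cong not Xc)) (∧-false₂ {not (X d)} (cong not Yd)))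
    qc : 1 ≤ δ R (X ∩ ∁ Y)
    qc = F₁.corner (X ∩ ∁ Y) c hc c≢u (v≢c ∘ sym) (∧-true Xc (cong not Yc))
      (ones₃ (∧-false₂ {X x} (cong not Yx)) (∧-false₁ Xw) (∧-true Xc (cong not Yc)) (∧-false₁ Xd))
    qd : 1 ≤ δ R (∁ X ∩ Y)
    qd = F₁.corner (∁ X ∩ Y) d hd d≢u (v≢d ∘ sym) (∧-true (cong not Xd) Yd)
      (ones₄ (∧-false₁ (cong not Xx)) (∧-false₂ {not (X w)} Yw) (∧-false₁ (cong not Xc)) (∧-true (cong not Xd) Yd))
    sub₂ : δ R (X ∩ ∁ Y) + δ R (∁ X ∩ Y) ≤ δ R X + δ R Y
    sub₂ = ≤-trans (≤-reflexive (cong (δ R (X ∩ ∁ Y) +_) (δ-cong R (λ z → cong (not (X z) ∧_) (sym (dn (Y z)))))))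
      (≤-trans (δ-sub₁ R X (∁ Y)) (≤-reflexive (cong (δ R X +_) (δ-∁ R Y))))
      where dn : ∀ b → not (not b) ≡ b
            dn true = refl
            dn false = refl
    s₁ = squeeze _ _ _ _ qx qw X≤1 Y≤1 (δ-sub₁ R X Y)
    s₂ = squeeze _ _ _ _ qc qd X≤1 Y≤1 sub₂
    e = proj₁ (δ-parity R X Y)
    par = proj₂ (δ-parity R X Y)

  one-good : Bridgeless ((x , c) ∷ (w , d) ∷ R) U′ ⊎ Bridgeless ((x , d) ∷ (w , c) ∷ R) U′
  one-good with bridgeless? ((x , c) ∷ (w , d) ∷ R) U′ | bridgeless? ((x , d) ∷ (w , c) ∷ R) U′
  ... | inj₂ b | _ = inj₁ b
  ... | inj₁ _ | inj₂ b = inj₂ b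
  ... | inj₁ p | inj₁ q = ⊥-elim (not-both-bad (F₁.bad p) (F₂.bad q))

single : Fin N → VSub N
single a z = z == a

opaque
  unfolding deg δ
  -- The loop takes two of the three degrees at `a`, so only one edge is left to cross.
  δ-loop : (a : Fin N) (R : EList N) → deg ((a , a) ∷ R) a ≡ 3 → δ ((a , a) ∷ R) (single a) < 2
  δ-loop a R h with sumE-mono (All.universal (λ { (p , q) → pt (p == a) (q == a) }) R)
    where
    pt : ∀ s t → χ (s xor t) ≤ χ s + χ t
    pt true true = z≤n
    pt true false = ≤-refl
    pt false t = ≤-refl
  ... | le rewrite ==-refl a = s≤s (≤-trans le (≤-reflexive (suc-injective (suc-injective h))))

  digon-deg : (a b s t : Fin N) (R : EList N) (z : Fin N) → z ≢ a → z ≢ b →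
              deg ((s , t) ∷ R) z ≡ deg ((a , b) ∷ (a , b) ∷ (a , s) ∷ (b , t) ∷ R) z
  digon-deg a b s t R z za zb rewrite ==-≢ (za ∘ sym) | ==-≢ (zb ∘ sym) = +-assoc (χ (s == z)) (χ (t == z)) (deg R z)

  digon-δ : (a b s t : Fin N) (R : EList N) (X : VSub N) → X a ≡ X s → X b ≡ X s →
            δ ((a , b) ∷ (a , b) ∷ (a , s) ∷ (b , t) ∷ R) X ≡ δ ((s , t) ∷ R) X
  digon-δ a b s t R X ha hb rewrite ha | hb with X s
  ... | true = refl
  ... | false = refl

  digon-degs : (a b s t : Fin N) (R : EList N) → a ≢ b → s ≢ a → s ≢ b → t ≢ b →
               deg ((a , b) ∷ (a , b) ∷ (a , s) ∷ (b , t) ∷ R) a ≡ 3 →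
               deg ((a , b) ∷ (a , b) ∷ (a , s) ∷ (b , t) ∷ R) b ≡ 3 → deg ((b , t) ∷ R) a ≡ 0 × deg R b ≡ 0
  digon-degs a b s t R ab sa sb tb h k rewrite ==-refl a | ==-refl b | ==-≢ ab | ==-≢ (ab ∘ sym) | ==-≢ sa | ==-≢ sb | ==-≢ tb =
    suc-injective (suc-injective (suc-injective h)) , suc-injective (suc-injective (suc-injective k))

  digon-deg-s : (a b s : Fin N) (R : EList N) → a ≢ s → b ≢ s →
               deg ((a , b) ∷ (a , b) ∷ (a , s) ∷ (b , s) ∷ R) s ≡ 3 → deg R s ≡ 1
  digon-deg-s a b s R sa sb h rewrite ==-refl s | ==-≢ sa | ==-≢ sb = suc-injective (suc-injective h)

  δ-four : (e f g k : Edge N) (R : EList N) (X : VSub N) → cr X e ≡ 0 → cr X f ≡ 0 → cr X g ≡ 0 → cr X k ≡ 0 →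
           δ (e ∷ f ∷ g ∷ k ∷ R) X ≡ δ R X
  δ-four e f g k R X p q r s rewrite p | q | r | s = refl

  tripled : (u b : Fin N) (R : EList N) → u ≢ b → deg ((u , b) ∷ (u , b) ∷ (u , b) ∷ R) u ≡ 3 →
            deg ((u , b) ∷ (u , b) ∷ (u , b) ∷ R) b ≡ 3 → deg R u ≡ 0 × deg R b ≡ 0
  tripled u b R ub h k rewrite ==-refl u | ==-refl b | ==-≢ ub | ==-≢ (ub ∘ sym) =
    suc-injective (suc-injective (suc-injective h)) , suc-injective (suc-injective (suc-injective k))

  δ-three : (e f g : Edge N) (R : EList N) (X : VSub N) → cr X e ≡ 0 → cr X f ≡ 0 → cr X g ≡ 0 →
           δ (e ∷ f ∷ g ∷ R) X ≡ δ R X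
  δ-three e f g R X p q r rewrite p | q | r = refl

module Digon {N} {E : EList N} {U : VSub N} (G : Cubic′ E U) (B : Bridgeless E U) (a b s t : Fin N) (R : EList N)
             (eq : E ≋ (a , b) ∷ (a , b) ∷ (a , s) ∷ (b , t) ∷ R) (s≢b : s ≢ b) where
  private
    G₄ = Cubic-≋ eq G
    a≢b : a ≢ b
    a≢b = All.head (nl G₄)
    a≢s : a ≢ s
    a≢s = All.head (All.tail (All.tail (nl G₄)))
    b≢t : b ≢ t
    b≢t = All.head (All.tail (All.tail (All.tail (nl G₄))))
    nlR : NL R
    nlR = All.tail (All.tail (All.tail (All.tail (nl G₄))))
    ha : U a ≡ true
    ha = proj₁ (All.head (inU G₄))
    hb : U b ≡ true
    hb = proj₂ (All.head (inU G₄))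
    hs : U s ≡ true
    hs = proj₂ (All.head (All.tail (All.tail (inU G₄))))
    ht : U t ≡ true
    ht = proj₂ (All.head (All.tail (All.tail (All.tail (inU G₄)))))
    inR : Inside U R
    inR = All.tail (All.tail (All.tail (All.tail (inU G₄))))
    degs = digon-degs a b s t R a≢b (a≢s ∘ sym) s≢b (b≢t ∘ sym) (d3 G₄ a ha) (d3 G₄ b hb)
    av : All (λ { (p , q) → p ≢ a × q ≢ a }) ((b , t) ∷ R)
    av = deg-avoid ((b , t) ∷ R) (proj₁ degs)
    t≢a : t ≢ a
    t≢a = proj₂ (All.head av)
    dRa : deg R a ≡ 0
    dRa = avoid-deg R (All.tail av)
    dRb : deg R b ≡ 0
    dRb = proj₂ degs

  -- Otherwise {a, b, s} is left by a single edge, a bridge.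
  s≢t : s ≢ t
  s≢t refl = <⇒≱ (s≤s (s≤s z≤n)) (≤-trans (B X (a , ∧-true ha (triple₁ a b s)) out) le)
    where
    X : VSub N
    X = triple a b s
    dRs : deg R s ≡ 1
    dRs = digon-deg-s a b s R a≢s b≢t (d3 G₄ s hs)
    le : δ E X ≤ 1
    le = ≤-trans (≤-reflexive (trans (δ-≋ X eq) (δ-four _ _ _ _ R X
           (χ-same (triple₁ a b s) (triple₂ a b s)) (χ-same (triple₁ a b s) (triple₂ a b s))
           (χ-same (triple₁ a b s) (triple₃ a b s)) (χ-same (triple₂ a b s) (triple₃ a b s)))))
         (≤-trans (δ-triple R a b s) (≤-reflexive (cong₂ _+_ dRa (cong₂ _+_ dRb dRs))))
    out : Some (U ∩ ∁ X)
    out with extract′ R s nlR dRs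
    ... | y , R′ , e , ys , _ , _ = y , ∧-true (proj₂ (All.head (Inside-≋ e inR)))
      (not-true (∨-false (==-≢ (proj₂ (All.head (deg-avoid ((s , y) ∷ R′) (trans (sym (deg-≋ a e)) dRa)))))
        (∨-false (==-≢ (proj₂ (All.head (deg-avoid ((s , y) ∷ R′) (trans (sym (deg-≋ b e)) dRb))))) (==-≢ ys))))

  U′ : VSub N
  U′ = U ⊖ a ⊖ b

  hs′ : U′ s ≡ true
  hs′ = ⊖₂-in U hs (a≢s ∘ sym) s≢b

  ht′ : U′ t ≡ true
  ht′ = ⊖₂-in U ht t≢a (b≢t ∘ sym)

  cubic′ : Cubic′ ((s , t) ∷ R) U′
  cubic′ = record
    { inU = (hs′ , ht′)
          ∷ All.zipWith (λ { {p , q} ((hp , hq) , ((pa , qa) , (pb , qb))) → ⊖₂-in U hp pa pb , ⊖₂-in U hq qa qb })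
              (inR , All.zipWith id (deg-avoid R dRa , deg-avoid R dRb))
    ; nl = s≢t ∷ nlR
    ; d3 = λ z hz → let (uz , za , zb) = ⊖₂-mem U hz in trans (digon-deg a b s t R z za zb) (d3 G₄ z uz) }

  -- With `a` and `b` on the side of `s`, the only edge at the digon that can cross is `bt`, and it
  -- does so exactly when `st` would.
  bridgeless′ : Bridgeless ((s , t) ∷ R) U′
  bridgeless′ X (p , hp) (q , hq) = ≤-trans (B Y (p , mem₁) (q , mem₂)) (≤-reflexive
    (trans (δ-≋ Y eq) (trans (digon-δ a b s t R Y (trans (assign₁ X a b (X s)) (sym Ys)) (trans (assign₂ X a b (X s)) (sym Ys)))
      (δ-avoid₂ ((s , t) ∷ R) X (X s) (deg-zero-∷ {E = R} (a≢s ∘ sym) t≢a dRa) (deg-zero-∷ {E = R} s≢b (b≢t ∘ sym) dRb)))))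
    where
    Y : VSub N
    Y = assign X a b (X s)
    Ys : Y s ≡ X s
    Ys = assign₃ X (X s) (a≢s ∘ sym) s≢b
    mem₁ : (U ∩ Y) p ≡ true
    mem₁ with ⊖₂-mem U {a} {b} {p} (∧-left hp)
    ... | up , pa , pb = ∧-true up (trans (assign₃ X (X s) pa pb) (∧-right {U′ p} hp))
    mem₂ : (U ∩ ∁ Y) q ≡ true
    mem₂ with ⊖₂-mem U {a} {b} {q} (∧-left hq)
    ... | uq , qa , qb = ∧-true uq (trans (cong not (assign₃ X (X s) qa qb)) (∧-right {U′ q} hq))

-- Plesník's theorem by induction on the number of vertices

size-⊖₂ : (U : VSub N) {a b : Fin N} → U a ≡ true → U b ≡ true → a ≢ b → size U ≡ 2 + size (U ⊖ a ⊖ b)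
size-⊖₂ U {a} {b} ha hb ab = trans (size-⊖ U a ha) (cong suc (size-⊖ (U ⊖ a) b (⊖-in {U = U} hb (ab ∘ sym))))

μ-use : {E R : EList N} {U : VSub N} {a b : Fin N} → E ≋ (a , b) ∷ R → U a ≡ true → U b ≡ true →
        μ R (U ⊖ a ⊖ b) ≤ μ E U
μ-use {R = R} {U} {a} {b} eq ha hb = ≤-trans (m≤n+m (μ R (U ⊖ a ⊖ b)) (μ R U))
  (≤-reflexive (trans (sym (μ-live R ha hb)) (sym (μ-≋ eq U))))

μ-sub : {E R : EList N} (F : EList N) (U : VSub N) → E ≋ F ++ R → μ R U ≤ μ E U
μ-sub {R = R} F U eq = ≤-trans (μ-mono-++ F R U) (≤-reflexive (sym (μ-≋ eq U)))

μ-empty : (E : EList N) {U : VSub N} → ¬ Some U → 1 ≤ μ E U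
μ-empty E {U} h = ≤-trans (≤-reflexive (sym (trans (μ-[] U) (zero-isz (size U) (λ l → h (size-pick U l))))))
  (μ-sub {R = []} E U (≡⇒≋ (sym (++-identityʳ E))))
  where zero-isz : ∀ n → (1 ≤ n → ⊥) → isz n ≡ 1
        zero-isz zero k = refl
        zero-isz (suc n) k = ⊥-elim (k (s≤s z≤n))

-- Lifts matchings of the split graph that avoid xc: one without `wd` receives `uv`, and in the
-- others `wd` is replaced by `uw` and `vd`. The lifts of the two kinds differ in the edge at `u`.
merge : {U : VSub N} {u v w c d : Fin N} (R : EList N) → deg R u ≡ 0 → deg R v ≡ 0 → U u ≡ true → U v ≡ true → U w ≡ true →
        v ≢ u → w ≢ u → v ≢ w → c ≢ u → d ≢ u → d ≢ v → d ≢ w →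
        μ ((w , d) ∷ R) (U ⊖ u ⊖ v) ≤ μ ((u , v) ∷ (u , w) ∷ (v , c) ∷ (v , d) ∷ R) U
merge {U = U} {u} {v} {w} {c} {d} R du dv hu hv hw vu wu vw cu dnu dnv dnw = begin
  μ ((w , d) ∷ R) (U ⊖ u ⊖ v) ≡⟨ μ-∷ (w , d) R (U ⊖ u ⊖ v) ⟩
  μ R (U ⊖ u ⊖ v) + μₑ (w , d) R (U ⊖ u ⊖ v)
    ≤⟨ +-mono-≤ (μ-mono-++ ((v , c) ∷ (v , d) ∷ []) R (U ⊖ u ⊖ v)) (≤-reflexive (exchange R hv hw vu wu vw dnv dnw)) ⟩
  μ Z (U ⊖ u ⊖ v) + μₑ (v , d) R (U ⊖ u ⊖ w)
    ≤⟨ +-monoʳ-≤ (μ Z (U ⊖ u ⊖ v)) (m≤n+m _ (μₑ (v , c) R (U ⊖ u ⊖ w))) ⟩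
  μ Z (U ⊖ u ⊖ v) + (μₑ (v , c) R (U ⊖ u ⊖ w) + μₑ (v , d) R (U ⊖ u ⊖ w))
    ≡⟨ cong (μ Z (U ⊖ u ⊖ v) +_) (sym (μ-star₂ v c d R dv (⊖₂-in U hv vu vw))) ⟩
  μ Z (U ⊖ u ⊖ v) + μ Z (U ⊖ u ⊖ w)
    ≡⟨ cong₂ _+_ (sym (μₑ-live Z hu hv)) (sym (μₑ-live Z hu hw)) ⟩
  μₑ (u , v) Z U + μₑ (u , w) Z U
    ≡⟨ sym (μ-star₂ u v w Z (deg-zero-∷ {E = (v , d) ∷ R} vu cu (deg-zero-∷ {E = R} vu dnu du)) hu) ⟩
  μ ((u , v) ∷ (u , w) ∷ Z) U ∎
  where
  open ≤-Reasoning
  Z = (v , c) ∷ (v , d) ∷ R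

-- Plesník's theorem for cubic graphs, with `k` as induction variable: after deletion of any two
-- edges a perfect matching remains.
Plesník : ℕ → ℕ → Set
Plesník N k = (E : EList N) (U : VSub N) → size U ≤ k → Cubic′ E U → Bridgeless E U →
              ∀ e₁ e₂ R → E ≋ e₁ ∷ e₂ ∷ R → 1 ≤ μ R U

meets? : (u : Fin N) (e : Edge N) → (∃ λ t → ∀ R → e ∷ R ≋ (u , t) ∷ R) ⊎ (proj₁ e ≢ u × proj₂ e ≢ u)
meets? u (a , b) with a ≟ u | b ≟ u
... | yes refl | _ = inj₁ (b , λ R → ≋-refl)
... | no _ | yes refl = inj₁ (a , λ R → ≋-flip a b)
... | no p | no q = inj₂ (p , q)

opaque
  unfolding deg
  deg-1-2 : {u x : Fin N} (e : Edge N) (R : EList N) → x ≢ u → proj₁ e ≢ u → proj₂ e ≢ u →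
            deg ((u , x) ∷ e ∷ R) u ≡ 3 → deg R u ≡ 2
  deg-1-2 {u = u} e R xu p q h rewrite ==-refl u | ==-≢ xu | ==-≢ p | ==-≢ q = suc-injective h

  deg-par : {u x : Fin N} (R : EList N) → x ≢ u → deg ((u , x) ∷ (u , x) ∷ R) u ≡ 3 → deg R u ≡ 1
  deg-par {u = u} R xu h rewrite ==-refl u | ==-≢ xu = suc-injective (suc-injective h)

  deg-par′ : {u x s : Fin N} (R : EList N) → u ≢ x → s ≢ x → deg ((u , x) ∷ (u , x) ∷ (u , s) ∷ R) x ≡ 3 → deg R x ≡ 1
  deg-par′ {x = x} R ux sx h rewrite ==-refl x | ==-≢ ux | ==-≢ sx = suc-injective (suc-injective h)

  deg-mid : {u v x w : Fin N} (R : EList N) → u ≢ v → x ≢ v → w ≢ v → deg ((u , x) ∷ (u , v) ∷ (u , w) ∷ R) v ≡ 3 → deg R v ≡ 2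
  deg-mid {v = v} R uv xv wv h rewrite ==-refl v | ==-≢ uv | ==-≢ xv | ==-≢ wv = suc-injective h

  deg-head : {a b z : Fin N} {k : ℕ} (R : EList N) → b ≢ a → deg ((a , b) ∷ R) a ≡ suc k → deg R a ≡ k
  deg-head {a = a} R ba h rewrite ==-refl a | ==-≢ ba = suc-injective h

one-edge : {E : EList N} {U : VSub N} → Cubic′ E U → (∀ e₁ e₂ R → E ≋ e₁ ∷ e₂ ∷ R → 1 ≤ μ R U) →
           {s t : Fin N} {R : EList N} → E ≋ (s , t) ∷ R → 1 ≤ μ R U
one-edge {U = U} G h {s} {t} {R} eq with Cubic-≋ eq G
... | G′ with extract′ R s (All.tail (nl G′))
               (deg-head {z = s} R (All.head (nl G′) ∘ sym) (d3 G′ s (proj₁ (All.head (inU G′)))))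
... | y , R′ , e , _ = ≤-trans (h (s , t) (s , y) R′ (≋-trans eq (≋-prep _ e))) (μ-sub {R = R′} ((s , y) ∷ []) U e)

module Step {N : ℕ} (k : ℕ) (IH : Plesník N k) where

  module _ {E : EList N} {U : VSub N} (le : size U ≤ suc k) (G : Cubic′ E U) (B : Bridgeless E U) where

    private
      smaller : {a b : Fin N} → U a ≡ true → U b ≡ true → a ≢ b → size (U ⊖ a ⊖ b) ≤ k
      smaller ha hb ab = ≤-trans (n≤1+n _) (≤-pred (≤-trans (≤-reflexive (sym (size-⊖₂ U ha hb ab))) le))

    -- The digon on `u`, `b` is replaced by the edge st; a matching avoiding st and `e` is wanted,
    -- to which `ub` can be added. If `e` is itself the edge bt, it has vanished with the digon and
    -- only st remains to be avoided.
    digon-case : (u b s : Fin N) (e : Edge N) (R : EList N) → proj₁ e ≢ u → proj₂ e ≢ u →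
                 E ≋ (u , b) ∷ (u , b) ∷ (u , s) ∷ e ∷ R → 1 ≤ μ R (U ⊖ u ⊖ b)
    digon-case u b s e R e₁ e₂ eq with s ≟ b
    ... | yes refl = ⊥-elim (<⇒≱ (s≤s z≤n) (≤-trans (B X (u , ∧-true hu (triple₁ u b b))
          (proj₁ e , ∧-true (proj₁ (All.head (All.tail (All.tail (All.tail (inU G₄))))))
            (not-true (∨-false (==-≢ e₁) (∨-false (==-≢ eb) (==-≢ eb)))))) le₀))
      where
      G₄ = Cubic-≋ eq G
      hu = proj₁ (All.head (inU G₄))
      hb = proj₂ (All.head (inU G₄))
      X : VSub N
      X = triple u b b
      degs = tripled u b (e ∷ R) (All.head (nl G₄)) (d3 G₄ u hu) (d3 G₄ b hb)
      eb : proj₁ e ≢ b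
      eb = proj₁ (All.head (deg-avoid (e ∷ R) (proj₂ degs)))
      cu : cr X (u , b) ≡ 0
      cu = χ-same (triple₁ u b b) (triple₂ u b b)
      le₀ : δ E X ≤ 0
      le₀ = ≤-trans (≤-reflexive (trans (δ-≋ X eq) (δ-three _ _ _ (e ∷ R) X cu cu cu)))
        (≤-trans (δ-triple (e ∷ R) u b b) (≤-reflexive (cong₂ _+_ (proj₁ degs) (cong₂ _+_ (proj₂ degs) (proj₂ degs)))))
    ... | no s≢b with meets? b e
    ... | inj₁ (t , flip) = one-edge D.cubic′ (IH _ _ (smaller hu hb (All.head (nl G₄))) D.cubic′ D.bridgeless′) ≋-refl
      where
      eq′ : E ≋ (u , b) ∷ (u , b) ∷ (u , s) ∷ (b , t) ∷ R
      eq′ = ≋-trans eq (≋-prep₃ _ _ _ (flip R))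
      G₄ = Cubic-≋ eq G
      hu = proj₁ (All.head (inU G₄))
      hb = proj₂ (All.head (inU G₄))
      module D = Digon G B u b s t R eq′ s≢b
    ... | inj₂ (p , q) = found (extract′ R b nlR dRb)
      where
      G₄ = Cubic-≋ eq G
      hu = proj₁ (All.head (inU G₄))
      hb = proj₂ (All.head (inU G₄))
      nlR : NL R
      nlR = All.tail (All.tail (All.tail (All.tail (nl G₄))))
      dRb : deg R b ≡ 1
      dRb = trans (sym (deg-other R p q)) (deg-par′ (e ∷ R) (All.head (nl G₄)) s≢b (d3 G₄ b hb))
      found : (∃ λ t → ∃ λ R′ → R ≋ (b , t) ∷ R′ × t ≢ b × NL R′ × deg R′ b ≡ 0) → 1 ≤ μ R (U ⊖ u ⊖ b)
      found (t , R′ , er , _) = ≤-trans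
        (IH _ _ (smaller hu hb (All.head (nl G₄))) D.cubic′ D.bridgeless′ (s , t) e R′ ≋-refl)
        (μ-sub {R = R′} ((b , t) ∷ []) (U ⊖ u ⊖ b) er)
        where
        module D = Digon G B u b s t (e ∷ R′) (≋-trans eq (≋-prep₃ _ _ _ (≋-trans (≋-prep e er) (≋-swap _ _)))) s≢b

    -- `one-good` yields bridgelessness of a graph that may still have loops. A loop at a vertex of
    -- degree 3 would leave a cut below 2, so the new edges join distinct vertices and the induction
    -- hypothesis applies.
    pairing : {u v x w c d : Fin N} {R : EList N} → Splittable E U u v x w c d R → x ≢ w →
              Bridgeless ((x , c) ∷ (w , d) ∷ R) (U ⊖ u ⊖ v) →
              ∀ e₁ e₂ R′ → (x , c) ∷ (w , d) ∷ R ≋ e₁ ∷ e₂ ∷ R′ → (1 ≤ μ R′ (U ⊖ u ⊖ v)) × (w ≢ d)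
    pairing {u} {v} {x} {w} {c} {d} {R} S x≢w Br e₁ e₂ R′ eq =
      IH _ _ (smaller hu hv u≢v) (cubic′ x≢c w≢d) Br e₁ e₂ R′ eq , w≢d
      where
      open Split S
      open Splittable S using (x≢v; w≢v)
      hx′ : U′ x ≡ true
      hx′ = ⊖₂-in U hx (u≢x ∘ sym) x≢v
      hw′ : U′ w ≡ true
      hw′ = ⊖₂-in U hw (u≢w ∘ sym) w≢v
      x≢c : x ≢ c
      x≢c refl = <⇒≱ (δ-loop x ((w , d) ∷ R) (deg′ x hx′))
        (Br (single x) (x , ∧-true hx′ (==-refl x)) (w , ∧-true hw′ (not-true (==-≢ (x≢w ∘ sym)))))
      w≢d : w ≢ d
      w≢d refl = <⇒≱ (δ-loop w ((x , c) ∷ R) (trans (deg-≋ w (≋-swap (w , w) (x , c))) (deg′ w hw′)))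
        (≤-trans (Br (single w) (w , ∧-true hw′ (==-refl w)) (x , ∧-true hx′ (not-true (==-≢ x≢w))))
          (≤-reflexive (δ-≋ (single w) (≋-swap (x , c) (w , w)))))

    main-case : (u x : Fin N) (e : Edge N) (R₀ : EList N) → E ≋ (u , x) ∷ e ∷ R₀ → proj₁ e ≢ u → proj₂ e ≢ u → 1 ≤ μ R₀ U
    main-case u x e R₀ eq e₁ e₂ = go (star₂ R₀ u (All.tail (All.tail (nl G₀))) (deg-1-2 e R₀ (u≢x ∘ sym) e₁ e₂ (d3 G₀ u hu)))
      where
      G₀ = Cubic-≋ eq G
      u≢x : u ≢ x
      u≢x = All.head (nl G₀)
      hu = proj₁ (All.head (inU G₀))
      hx = proj₂ (All.head (inU G₀))
      go : Star₂ R₀ u → 1 ≤ μ R₀ U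
      go (mk₂ v w R₁ e₃ v≢u w≢u dR₁) = cases (v ≟ x) (w ≟ x) (v ≟ w)
        where
        front : E ≋ (u , x) ∷ (u , v) ∷ (u , w) ∷ e ∷ R₁
        front = ≋-trans eq (≋-prep (u , x) (≋-trans (≋-prep e e₃) (≋-trans (≋-swap _ _) (≋-prep _ (≋-swap _ _)))))
        Gf = Cubic-≋ front G
        hv = proj₂ (All.head (All.tail (inU Gf)))
        hw = proj₂ (All.head (All.tail (All.tail (inU Gf))))
        cases : Dec (v ≡ x) → Dec (w ≡ x) → Dec (v ≡ w) → 1 ≤ μ R₀ U
        cases (yes refl) _ _ = ≤-trans (digon-case u x w e R₁ e₁ e₂ front)
          (≤-trans (μ-∷-≥ (u , w) R₁ (U ⊖ u ⊖ x)) (μ-use {R = (u , w) ∷ R₁} e₃ hu hx))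
        cases (no _) (yes refl) _ = ≤-trans (digon-case u x v e R₁ e₁ e₂ (≋-trans front (≋-prep (u , x) (≋-swap _ _))))
          (≤-trans (μ-∷-≥ (u , v) R₁ (U ⊖ u ⊖ x)) (μ-use {R = (u , v) ∷ R₁} (≋-trans e₃ (≋-swap _ _)) hu hx))
        cases (no _) (no _) (yes refl) = ≤-trans (digon-case u v x e R₁ e₁ e₂ (≋-trans front (≋-trans (≋-swap _ _) (≋-prep _ (≋-swap _ _)))))
          (≤-trans (μ-∷-≥ (u , v) R₁ (U ⊖ u ⊖ v)) (μ-use {R = (u , v) ∷ R₁} e₃ hu hv))
        cases (no v≢x) (no w≢x) (no v≢w) = at-v (meets? v e)
          where
          dv : deg (e ∷ R₁) v ≡ 2
          dv = deg-mid (e ∷ R₁) (v≢u ∘ sym) (v≢x ∘ sym) (v≢w ∘ sym) (d3 Gf v hv)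
          nlR₁ : NL R₁
          nlR₁ = All.tail (All.tail (All.tail (All.tail (nl Gf))))
          at-v : _ → 1 ≤ μ R₀ U
          -- `e` is the edge vc: avoid both new edges of the split graph and add `uv`.
          at-v (inj₁ (c , flip)) = found (extract′ R₁ v nlR₁
              (deg-head {z = v} R₁ c≢v (trans (sym (deg-≋ v (flip R₁))) dv)))
            where
            c≢v : c ≢ v
            c≢v = All.head (NL-≋ (flip R₁) (All.tail (All.tail (All.tail (nl Gf))))) ∘ sym
            c≢u : c ≢ u
            c≢u = proj₂ (All.head (deg-avoid ((v , c) ∷ []) (trans (sym (deg-≋ u (flip []))) (deg-zero-∷ {E = []} e₁ e₂ (deg-[] u)))))
            found : (∃ λ t → ∃ λ R′ → R₁ ≋ (v , t) ∷ R′ × t ≢ v × NL R′ × deg R′ v ≡ 0) → 1 ≤ μ R₀ U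
            found (d , R , er , d≢v , nlR , dR) = ≤-trans both
                (≤-trans (μ-sub {R = R} ((u , w) ∷ (v , d) ∷ []) (U ⊖ u ⊖ v) (≋-prep (u , w) er)) (μ-use {R = (u , w) ∷ R₁} e₃ hu hv))
              where
              aw : All (λ { (p , q) → p ≢ u × q ≢ u }) ((v , d) ∷ R)
              aw = deg-avoid ((v , d) ∷ R) (trans (sym (deg-≋ u er)) dR₁)
              S : Splittable E U u v x w c d R
              S = record { cubic = G ; eq = ≋-trans front (≋-prep₃ _ _ _ (≋-trans (flip R₁) (≋-prep (v , c) er)))
                         ; du = avoid-deg R (All.tail aw) ; dv = dR ; x≢v = v≢x ∘ sym ; w≢v = v≢w ∘ sym ; c≢u = c≢u ; d≢u = proj₂ (All.head aw) }
              both : 1 ≤ μ R (U ⊖ u ⊖ v)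
              both with Pairings.one-good S B
              ... | inj₁ Br = proj₁ (pairing S (w≢x ∘ sym) Br (x , c) (w , d) R ≋-refl)
              ... | inj₂ Br = proj₁ (pairing (swap-split S) (w≢x ∘ sym) Br (x , d) (w , c) R ≋-refl)
          -- `e` survives the splitting: avoid it together with the new edge at `x`, and lift by
          -- `merge`.
          at-v (inj₂ (p , q)) = found (star₂ R₁ v nlR₁ (trans (sym (deg-other R₁ p q)) dv))
            where
            found : Star₂ R₁ v → 1 ≤ μ R₀ U
            found (mk₂ c d R er c≢v d≢v dR) = both
              where
              aw : All (λ { (p , q) → p ≢ u × q ≢ u }) ((v , c) ∷ (v , d) ∷ R)
              aw = deg-avoid ((v , c) ∷ (v , d) ∷ R) (trans (sym (deg-≋ u er)) dR₁)
              c≢u = proj₂ (All.head aw)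
              d≢u = proj₂ (All.head (All.tail aw))
              dRu : deg R u ≡ 0
              dRu = avoid-deg R (All.tail (All.tail aw))
              S : Splittable E U u v x w c d (e ∷ R)
              S = record { cubic = G ; eq = ≋-trans front (≋-prep₃ _ _ _ (≋-trans (≋-prep e er) (≋-trans (≋-swap _ _) (≋-prep _ (≋-swap _ _)))))
                         ; du = deg-zero-∷ {E = R} e₁ e₂ dRu ; dv = deg-zero-∷ {E = R} p q dR
                         ; x≢v = v≢x ∘ sym ; w≢v = v≢w ∘ sym ; c≢u = c≢u ; d≢u = d≢u }
              rest : R₀ ≋ (u , v) ∷ (u , w) ∷ (v , c) ∷ (v , d) ∷ R
              rest = ≋-trans e₃ (≋-prep₂ _ _ er)
              both : 1 ≤ μ R₀ U
              both with Pairings.one-good S B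
              ... | inj₁ Br with pairing S (w≢x ∘ sym) Br (x , c) e ((w , d) ∷ R) (≋-prep _ (≋-swap _ _))
              ... | le₁ , w≢d = ≤-trans le₁ (≤-trans (merge R dRu dR hu hv hw v≢u w≢u v≢w c≢u d≢u d≢v (w≢d ∘ sym))
                  (≤-reflexive (sym (μ-≋ rest U))))
              both | inj₂ Br with pairing (swap-split S) (w≢x ∘ sym) Br (x , d) e ((w , c) ∷ R) (≋-prep _ (≋-swap _ _))
              ... | le₁ , w≢c = ≤-trans le₁ (≤-trans (merge R dRu dR hu hv hw v≢u w≢u v≢w d≢u c≢u c≢v (w≢c ∘ sym))
                  (≤-reflexive (sym (μ-≋ (≋-trans rest (≋-prep₂ _ _ (≋-swap _ _))) U))))

    -- Unless a third edge joins `u` and `x`, the edges `us` and `xt` have to be used, so a matching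
    -- containing st is wanted in the reduced graph. Avoiding the two other edges at `s` forces st.
    parallel-case : (u x : Fin N) (R₀ : EList N) → E ≋ (u , x) ∷ (u , x) ∷ R₀ → 1 ≤ μ R₀ U
    parallel-case u x R₀ eq = found (extract′ R₀ u (All.tail (All.tail (nl G₀))) (deg-par R₀ (u≢x ∘ sym) (d3 G₀ u hu)))
      where
      G₀ = Cubic-≋ eq G
      u≢x : u ≢ x
      u≢x = All.head (nl G₀)
      hu = proj₁ (All.head (inU G₀))
      hx = proj₂ (All.head (inU G₀))
      found : (∃ λ t → ∃ λ R′ → R₀ ≋ (u , t) ∷ R′ × t ≢ u × NL R′ × deg R′ u ≡ 0) → 1 ≤ μ R₀ U
      found (s , R₁ , er , s≢u , nlR₁ , dR₁u) with s ≟ x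
      ... | yes refl = ≤-trans (μ-empty R₁ empty) (μ-use {R = R₁} er hu hx)
        where
        front : E ≋ (u , x) ∷ (u , x) ∷ (u , x) ∷ R₁
        front = ≋-trans eq (≋-prep₂ _ _ er)
        G₃ = Cubic-≋ front G
        degs = tripled u x R₁ u≢x (d3 G₃ u hu) (d3 G₃ x hx)
        X : VSub N
        X = triple u x x
        cu : cr X (u , x) ≡ 0
        cu = χ-same (triple₁ u x x) (triple₂ u x x)
        empty : ¬ Some (U ⊖ u ⊖ x)
        empty (z , hz) with ⊖₂-mem U {u} {x} {z} hz
        ... | uz , zu , zx = <⇒≱ (s≤s z≤n) (≤-trans (B X (u , ∧-true hu (triple₁ u x x))
            (z , ∧-true uz (not-true (∨-false (==-≢ zu) (∨-false (==-≢ zx) (==-≢ zx))))))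
          (≤-trans (≤-reflexive (trans (δ-≋ X front) (δ-three _ _ _ R₁ X cu cu cu)))
            (≤-trans (δ-triple R₁ u x x) (≤-reflexive (cong₂ _+_ (proj₁ degs) (cong₂ _+_ (proj₂ degs) (proj₂ degs)))))))
      ... | no s≢x = found₂ (extract′ R₁ x nlR₁ (deg-par′ R₁ u≢x s≢x (d3 (Cubic-≋ (≋-trans eq (≋-prep₂ _ _ er)) G) x hx)))
        where
        found₂ : (∃ λ t → ∃ λ R′ → R₁ ≋ (x , t) ∷ R′ × t ≢ x × NL R′ × deg R′ x ≡ 0) → 1 ≤ μ R₀ U
        found₂ (t , R₂ , er₂ , t≢x , nlR₂ , _) = found₃ (star₂ R₂ s nlR₂ (deg-head {z = s} R₂ (D.s≢t ∘ sym) (d3 D.cubic′ s D.hs′)))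
          where
          module D = Digon G B u x s t R₂ (≋-trans eq (≋-prep₂ _ _ (≋-trans er (≋-prep _ er₂)))) s≢x
          hs : U s ≡ true
          hs = proj₁ (⊖₂-mem U {u} {x} {s} D.hs′)
          ht : U t ≡ true
          ht = proj₁ (⊖₂-mem U {u} {x} {t} D.ht′)
          found₃ : Star₂ R₂ s → 1 ≤ μ R₀ U
          found₃ (mk₂ α β R₃ er₃ _ _ dR₃) = begin
            1 ≤⟨ IH _ _ (smaller hu hx u≢x) D.cubic′ D.bridgeless′ (s , α) (s , β) ((s , t) ∷ R₃)
                   (≋-trans (≋-prep _ er₃) (≋-trans (≋-swap _ _) (≋-prep _ (≋-swap _ _)))) ⟩
            μ ((s , t) ∷ R₃) (U ⊖ u ⊖ x) ≡⟨ μ-star₁ s t R₃ dR₃ D.hs′ ⟩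
            μₑ (s , t) R₃ (U ⊖ u ⊖ x) ≡⟨ μₑ-live R₃ D.hs′ D.ht′ ⟩
            μ R₃ (U ⊖ u ⊖ x ⊖ s ⊖ t) ≤⟨ μ-sub {R = R₃} ((s , α) ∷ (s , β) ∷ []) _ er₃ ⟩
            μ R₂ (U ⊖ u ⊖ x ⊖ s ⊖ t) ≡⟨ μ-cong R₂ (⊖-cong {U = U ⊖ u ⊖ x ⊖ s} {U ⊖ u ⊖ s ⊖ x} t (⊖-comm₃ U u x s)) ⟩
            μ R₂ (U ⊖ u ⊖ s ⊖ x ⊖ t) ≤⟨ μ-use {R = R₂} ≋-refl (⊖₂-in U hx (u≢x ∘ sym) (s≢x ∘ sym))
                 (⊖₂-in U ht (proj₁ (proj₂ (⊖₂-mem U {u} {x} {t} D.ht′))) (D.s≢t ∘ sym)) ⟩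
            μ ((x , t) ∷ R₂) (U ⊖ u ⊖ s) ≤⟨ μ-use {R = (x , t) ∷ R₂} (≋-prep _ er₂) hu hs ⟩
            μ ((u , s) ∷ R₁) U ≡⟨ sym (μ-≋ er U) ⟩
            μ R₀ U ∎
            where open ≤-Reasoning

plesník : ∀ k → Plesník N k
plesník zero E U le G B (u , x) e₂ R eq = ⊥-elim (<⇒≱ (size-pos {U = U} {u} (proj₁ (All.head (inU (Cubic-≋ eq G))))) le)
plesník (suc k) E U le G B (u , x) e₂ R eq with meets? u e₂
... | inj₂ (p , q) = Step.main-case k (plesník k) le G B u x e₂ R eq p q
... | inj₁ (t , flip) with t ≟ x
... | yes refl = Step.parallel-case k (plesník k) le G B u x R (≋-trans eq (≋-prep (u , x) (flip R)))
-- `e₂` meets `u` but not `x`, so the ends of the first edge change roles.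
... | no t≢x = Step.main-case k (plesník k) le G B x u (u , t) R
  (≋-trans eq (≋-trans (≋-flip u x) (≋-prep (x , u) (flip R)))) (All.head (nl (Cubic-≋ eq G))) t≢x

two-avoidable : {E : EList N} {U : VSub N} → Cubic′ E U → Bridgeless E U → ∀ e₁ e₂ R → E ≋ e₁ ∷ e₂ ∷ R → 1 ≤ μ R U
two-avoidable {E = E} {U} G B = plesník (size U) E U ≤-refl G B

-- Two edges at a vertex x: by Voorhoeve's identity with one of them passive,
-- a third edge at x lies in at least two perfect matchings.
two-matchings : {E : EList N} {U : VSub N} → Cubic′ E U → Essential4 E U → 5 ≤ size U →
                (u x y : Fin N) (F : EList N) → E ≋ (u , x) ∷ (x , y) ∷ F → 2 ≤ μ F U
two-matchings {N} {E} {U} G C h u x y F eq = two (μ F U) (≤-trans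
    (+-mono-≤ (+-mono-≤ le₁ le₂) (+-mono-≤ le₃ le₄)) (≤-reflexive (sym V.voorhoeve)))
  where
  S : EList N
  S = (x , y) ∷ []
  G₂ = Cubic-≋ eq G
  x≢u : x ≢ u
  x≢u = All.head (nl G₂) ∘ sym
  y≢u : y ≢ u
  y≢u refl = no-parallel G C h (≋-trans eq (≋-trans (≋-swap _ _) (≋-trans (≋-flip x u) (≋-prep _ ≋-refl))))
  Su : deg S u ≡ 0
  Su = deg-zero-∷ {E = []} x≢u y≢u (deg-[] u)
  Sz : ∀ z F′ → F ≋ (u , z) ∷ F′ → deg S z ≡ 0
  Sz z F′ e = deg-zero-∷ {E = []} x≢z y≢z (deg-[] z)
    where
    x≢z : x ≢ z
    x≢z refl = no-parallel G C h (≋-trans eq (≋-prep _ (≋-trans (≋-prep _ e) (≋-swap _ _))))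
    y≢z : y ≢ z
    y≢z refl = no-triangle G C h {u} {x} {y} (≋-trans eq (≋-prep₂ _ _ (≋-trans e (≋-flip u y))))
  M : Nbhd E U u x S F
  M = nbhd₂ G C h M₁ Su (Sz _ _ (Nbhd₁.eqF M₁)) (Sz _ _ (≋-trans (Nbhd₁.eqF M₁) (≋-swap _ _)))
    where M₁ = nbhd₁ G C h u x S F eq Su
  open Nbhd M using (v; w; c; d; p; q; x≢c; x≢d; x≢p; x≢q; c≢w; d≢w; p≢v; q≢v)
  module V = Voorhoeve G C eq M
  -- Each split graph has to avoid just two edges at `x`, the new one and `xy`, so each of the four
  -- terms is positive; 3 μ ≥ 4 then gives μ ≥ 2.
  pos : {v w c d : Fin N} {R : EList N} → Splittable E U u v x w c d (S ++ R) → x ≢ c → w ≢ d →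
        1 ≤ μ ((w , d) ∷ R) (U ⊖ u ⊖ v)
  pos {v} {w} {c} {d} {R} sp xc wd = two-avoidable (Split.cubic′ sp xc wd) (Split.bridgeless′ sp C xc wd) (x , c) (x , y) ((w , d) ∷ R)
    (≋-prep _ (≋-swap _ _))
  le₁ : 1 ≤ V.f₁
  le₁ = pos V.split₁ x≢c (d≢w ∘ sym)
  le₂ : 1 ≤ V.f₂
  le₂ = pos V.split₂ x≢d (c≢w ∘ sym)
  le₃ : 1 ≤ V.f₃
  le₃ = pos V.split₃ x≢p (q≢v ∘ sym)
  le₄ : 1 ≤ V.f₄
  le₄ = pos V.split₄ x≢q (p≢v ∘ sym)
  two : ∀ m → 4 ≤ 3 * m → 2 ≤ m
  two zero ()
  two (suc zero) (s≤s (s≤s (s≤s ())))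
  two (suc (suc m)) _ = s≤s (s≤s z≤n)

-- Three strands

-- Three strands leave the part of the graph that has been processed; strand i is
-- attached to bᵢ and carries the weight aᵢ.
record Strands (N : ℕ) : Set where
  constructor strands
  field
    b₁ b₂ b₃ : Fin N
    a₁ a₂ a₃ : ℕ

data Rot : Set where
  r₀ r₁ r₂ : Rot

rot : Rot → Strands N → Strands N
rot r₀ σ = σ
rot r₁ (strands b₁ b₂ b₃ a₁ a₂ a₃) = strands b₂ b₃ b₁ a₂ a₃ a₁
rot r₂ (strands b₁ b₂ b₃ a₁ a₂ a₃) = strands b₃ b₁ b₂ a₃ a₁ a₂

total : Strands N → ℕ
total σ = Strands.a₁ σ + Strands.a₂ σ + Strands.a₃ σ

-- At most one of the three weights vanishes.
Supported : ℕ → ℕ → ℕ → Set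
Supported a b c = 1 ≤ a + b × 1 ≤ b + c × 1 ≤ c + a

Support : Strands N → Set
Support σ = Supported (Strands.a₁ σ) (Strands.a₂ σ) (Strands.a₃ σ)

-- The next rung is listed as `q′`, `p′`: if `p` is covered from before, `q` has to go on to `q′`,
-- so with this order the weights stay in place along a ladder. `K` confines the rungs to a part of
-- the graph.
data Ladder {N : ℕ} (K : Fin N → Set) : EList N → Fin N → Fin N → ℕ → Set where
  []   : ∀ {R p q} → Ladder K R p q 0
  rung : ∀ {R R′ p q p′ q′ j} → R ≋ (p , q) ∷ (p , p′) ∷ (q , q′) ∷ R′ → K p → K q →
         Ladder K R′ q′ p′ j → Ladder K R p q (suc j)

module Game {N : ℕ} (K : Fin N → Set) (P Q c : ℕ) where

  -- s is the number of partial matchings that use all three strands, m the number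
  -- of vertices still to be processed, z the total weight at the end.
  mutual
    data Play (R : EList N) (σ : Strands N) (s : ℕ) : ℕ → ℕ → Set where
      end  : Play R σ s 0 (total σ)
      step : ∀ {m z} (i : Rot) → Move R (rot i σ) s m z → Play R σ s m z

    data Move : EList N → Strands N → ℕ → ℕ → ℕ → Set where
      -- If only the strand at `p` is used, `q` goes to `q′`; if only the one at `q`, `p` goes to
      -- `p′`. If only `g` is used, the matching has `pq` or both links; if all three are used, only
      -- `g` goes on. Hence the weight a₃ + s and the new s = a₃.
      rung : ∀ {R R′ p q p′ q′ g a₁ a₂ a₃ s m z} →
             R ≋ (p , q) ∷ (p , p′) ∷ (q , q′) ∷ R′ → K p → K q →
             Play R′ (strands q′ p′ g a₁ a₂ (a₃ + s)) a₃ m z → Move R (strands p q g a₁ a₂ a₃) s (2 + m) z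
      -- Made for layers in which two strands enter at one vertex and two leave from the other:
      -- either entering strand leaves two continuations, and no matching uses all three leaving
      -- strands.
      neck : ∀ {R R′ X p q g p′ q′ g′ a₁ a₂ a₃ s m z} → R ≋ X ++ R′ →
             Play R′ (strands p′ q′ g′ (a₁ + a₂) (a₁ + a₂) a₃) 0 m z → Move R (strands p q g a₁ a₂ a₃) s (2 + m) z
      -- The last inequality is what the induction hypothesis provides for the contracted layer,
      -- which has k + 2 vertices. Matchings through all three strands are dropped.
      big  : ∀ {R R′ X σ σ′ s k m z} → R ≋ X ++ R′ → Support σ′ → total σ + total σ ≤ total σ′ →
             Q * total σ + P * (k + 2) ≤ Q * total σ′ + c →
             Play R′ σ′ 0 m z → Move R σ s (k + m) z

  mutual
    len : ∀ {R σ s m z} → Play R σ s m z → ℕ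
    len end = 0
    len (step i M) = suc (lenM M)

    lenM : ∀ {R σ s m z} → Move R σ s m z → ℕ
    lenM (rung _ _ _ Π) = len Π
    lenM (neck _ Π) = len Π
    lenM (big _ _ _ _ Π) = len Π

  total-rot : ∀ i (σ : Strands N) → total (rot i σ) ≡ total σ
  total-rot r₀ σ = refl
  total-rot r₁ (strands _ _ _ a b c) = cyc a b c
    where cyc : ∀ a b c → b + c + a ≡ a + b + c
          cyc = solve-∀
  total-rot r₂ (strands _ _ _ a b c) = cyc a b c
    where cyc : ∀ a b c → c + a + b ≡ a + b + c
          cyc = solve-∀

  mutual
    total≤ : ∀ {R σ s m z} → Play R σ s m z → total σ ≤ z
    total≤ end = ≤-refl
    total≤ {σ = σ} (step i M) = ≤-trans (≤-reflexive (sym (total-rot i σ))) (totalM≤ M)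

    totalM≤ : ∀ {R σ s m z} → Move R σ s m z → total σ ≤ z
    totalM≤ (rung {a₁ = a₁} {a₂} {a₃} {s} _ _ _ Π) = ≤-trans (+-monoʳ-≤ (a₁ + a₂) (m≤m+n a₃ s)) (total≤ Π)
    totalM≤ (neck {a₁ = a₁} {a₂} {a₃} _ Π) = ≤-trans (+-monoˡ-≤ a₃ (m≤m+n (a₁ + a₂) (a₁ + a₂))) (total≤ Π)
    totalM≤ (big {σ = σ} _ _ d _ Π) = ≤-trans (≤-trans (m≤m+n _ (total σ)) d) (total≤ Π)

  mutual
    -- Each layer costs at most c + 2 P: a big one pays `c`, and one with two vertices pays 2 P for
    -- vertices processed without gain.
    value : ∀ {R σ s m z} (Π : Play R σ s m z) → Q * total σ + P * m ≤ Q * z + (c + 2 * P) * len Π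
    value {σ = σ} end = ≤-reflexive (trans (cong (Q * total σ +_) (*-zeroʳ P)) (cong (Q * total σ +_) (sym (*-zeroʳ (c + 2 * P)))))
    value {σ = σ} {m = m} {z} (step i M) = ≤-trans (≤-reflexive (cong (λ t → Q * t + P * m) (sym (total-rot i σ))))
      (valueM M)

    valueM : ∀ {R σ s m z} (M : Move R σ s m z) → Q * total σ + P * m ≤ Q * z + (c + 2 * P) * suc (lenM M)
    valueM (rung {a₁ = a₁} {a₂} {a₃} {s} {m} {z} _ _ _ Π) = small (len Π) (+-monoʳ-≤ (a₁ + a₂) (m≤m+n a₃ s)) (value Π)
    valueM (neck {a₁ = a₁} {a₂} {a₃} {s} {m} {z} _ Π) = small (len Π) (+-monoˡ-≤ a₃ (m≤m+n (a₁ + a₂) (a₁ + a₂))) (value Π)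
    valueM (big {σ = σ} {σ′} {s} {k} {m} {z} _ _ _ h Π) = lin {Q * total σ + P * (k + 2) + (Q * total σ′ + P * m)}
      {Q * total σ′ + c + (Q * z + (c + 2 * P) * len Π)} (4 * P) (+-mono-≤ h (value Π)) (e Q P c (total σ) (total σ′) k m z (len Π))
      where e : ∀ Q P c t t′ k m z l → Q * t + P * (k + m) + (Q * t′ + c + (Q * z + (c + 2 * P) * l)) + 4 * P ≡
                Q * z + (c + 2 * P) * suc l + (Q * t + P * (k + 2) + (Q * t′ + P * m))
            e = solve-∀

    small : ∀ {t t′ m z} l → t ≤ t′ → Q * t′ + P * m ≤ Q * z + (c + 2 * P) * l →
            Q * t + P * (2 + m) ≤ Q * z + (c + 2 * P) * suc l
    small {t} {t′} {m} {z} l h k = lin {Q * t + (Q * t′ + P * m)} {Q * t′ + (Q * z + (c + 2 * P) * l)} c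
      (+-mono-≤ (*-monoʳ-≤ Q h) k) (e Q P c t t′ m z l)
      where e : ∀ Q P c t t′ m z l → Q * t + P * (2 + m) + (Q * t′ + (Q * z + (c + 2 * P) * l)) + c ≡
                Q * z + (c + 2 * P) * suc l + (Q * t + (Q * t′ + P * m))
            e = solve-∀

-- c (c - 1) / 2: raising a counter from value c costs c.
tri : ℕ → ℕ
tri zero = 0
tri (suc c) = tri c + c

tri-mono : ∀ {a b} → a ≤ b → tri a ≤ tri b
tri-mono z≤n = z≤n
tri-mono (s≤s h) = +-mono-≤ (tri-mono h) h

Sub : EList N → EList N → Set
Sub R₀ R = ∃ λ Y → R₀ ≋ Y ++ R

sub-refl : (R : EList N) → Sub R R
sub-refl R = [] , ≋-refl

sub-step : {R₀ R R′ : EList N} (X : EList N) → Sub R₀ R → R ≋ X ++ R′ → Sub R₀ R′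
sub-step {R′ = R′} X (Y , e) h = Y ++ X , ≋-trans e (≋-trans (≋-++ˡ Y h) (≡⇒≋ (sym (++-assoc Y X R′))))

-- A bound for the number of layers when the total weight stays below M. Layers at
-- which the total doubles are few. Between two of them the weights first stay put along
-- a ladder and then grow quadratically: cᵢ counts increments of aᵢ, so aᵢ ≥ cᵢ, and
-- every increment is eventually paid for in the total, whence total ≥ Σ tri cᵢ.
module Bound {N : ℕ} (K : Fin N → Set) (P Q c : ℕ) (R₀ : EList N) (M λ′ κ : ℕ)
             (bigκ : 2 * M ≤ tri κ)
             (ladder-free : ∀ R p q → Sub R₀ R → Ladder K R p q (suc λ′) → ⊥) where
  open Game K P Q c

  -- `W` bounds a phase of growth: 2 (c₁ + c₂ + c₃) + 3 with every counter at most κ. `B` bounds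
  -- what one doubling of the total may cost: a ladder, a phase of growth and the steps between.
  W B : ℕ
  W = 6 * κ + 3
  B = suc λ′ + W + 2

  -- Rungs are taken from the front of the list, so the ladder climbed so far is kept as a function
  -- that prolongs any ladder starting at the current strands.
  record Run (R : EList N) (σ : Strands N) (j : ℕ) : Set where
    constructor run
    field
      {Rs} : EList N
      {ps qs} : Fin N
      sub : Sub R₀ Rs
      prefix : ∀ i → Ladder K R (Strands.b₁ σ) (Strands.b₂ σ) i → Ladder K Rs ps qs (j + i)
      j≤ : j ≤ λ′

  -- `pr` is the part of the potential `tri c₁ + tri c₂ + tri c₃` that the total has not yet paid
  -- for.
  record Counts (σ : Strands N) (pr : ℕ) : Set where
    constructor counts
    open Strands σ
    field
      c₁ c₂ c₃ : ℕ
      h₁ : c₁ ≤ a₁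
      h₂ : c₂ ≤ a₂
      h₃ : c₃ ≤ a₃
      paid : tri c₁ + tri c₂ + tri c₃ ≤ total σ + pr
    C : ℕ
    C = c₁ + c₂ + c₃

  AllPos : Strands N → Set
  AllPos σ = 1 ≤ Strands.a₁ σ × 1 ≤ Strands.a₂ σ × 1 ≤ Strands.a₃ σ

  record Growing (σ : Strands N) (t : ℕ) : Set where
    constructor growing
    field
      pos : AllPos σ
      cnt : Counts σ 0
      time : t ≤ 2 * Counts.C cnt + 2

  -- The counter raised last went from pr to pr + 1, at cost pr, which falls due at the next step. A
  -- rung then pays it out of s ≥ pr; a neck pays it out of the merged weights or revokes the
  -- increment.
  data PendingAt (pr c₁ c₂ c₃ : ℕ) : Set where
    none : pr ≡ 0 → PendingAt pr c₁ c₂ c₃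
    at₁ : c₁ ≡ suc pr → PendingAt pr c₁ c₂ c₃
    at₂ : c₂ ≡ suc pr → PendingAt pr c₁ c₂ c₃
    at₃ : c₃ ≡ suc pr → PendingAt pr c₁ c₂ c₃

  -- As long as a weight may be zero the sharper time bound 2 C + 1 is kept, since a neck may then
  -- fail to raise C.
  record Pending (σ : Strands N) (s t : ℕ) : Set where
    constructor pending
    field
      {pr} : ℕ
      sup : Support σ
      s≥1 : 1 ≤ s
      pr≤s : pr ≤ s
      cnt : Counts σ pr
    open Counts cnt
    field
      at : PendingAt pr c₁ c₂ c₃
      time : (AllPos σ × t ≤ 2 * C + 3) ⊎ (t ≤ 2 * C + 1)

  sup-rot : ∀ i {σ : Strands N} → Support σ → Support (rot i σ)
  sup-rot r₀ h = h
  sup-rot r₁ (p , q , r) = q , r , p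
  sup-rot r₂ (p , q , r) = r , p , q

  pos-rot : ∀ i {σ : Strands N} → AllPos σ → AllPos (rot i σ)
  pos-rot r₀ h = h
  pos-rot r₁ (p , q , r) = q , r , p
  pos-rot r₂ (p , q , r) = r , p , q

  cyc₁ : ∀ a b c → b + c + a ≡ a + b + c
  cyc₁ = solve-∀
  cyc₂ : ∀ a b c → c + a + b ≡ a + b + c
  cyc₂ = solve-∀

  counts-rot : ∀ i {σ pr} → Counts σ pr → Counts (rot i σ) pr
  counts-rot r₀ x = x
  counts-rot r₁ {σ} {pr} (counts c₁ c₂ c₃ h₁ h₂ h₃ p) = counts c₂ c₃ c₁ h₂ h₃ h₁
    (≤-trans (≤-reflexive (cyc₁ (tri c₁) (tri c₂) (tri c₃))) (≤-trans p (≤-reflexive (cong (_+ pr) (sym (total-rot r₁ σ))))))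
  counts-rot r₂ {σ} {pr} (counts c₁ c₂ c₃ h₁ h₂ h₃ p) = counts c₃ c₁ c₂ h₃ h₁ h₂
    (≤-trans (≤-reflexive (cyc₂ (tri c₁) (tri c₂) (tri c₃))) (≤-trans p (≤-reflexive (cong (_+ pr) (sym (total-rot r₂ σ))))))

  C-rot : ∀ i {σ pr} (x : Counts σ pr) → Counts.C (counts-rot i x) ≡ Counts.C x
  C-rot r₀ x = refl
  C-rot r₁ (counts c₁ c₂ c₃ _ _ _ _) = cyc₁ c₁ c₂ c₃
  C-rot r₂ (counts c₁ c₂ c₃ _ _ _ _) = cyc₂ c₁ c₂ c₃

  growing-rot : ∀ i {σ t} → Growing σ t → Growing (rot i σ) t
  growing-rot i {σ} (growing p x h) = growing (pos-rot i {σ} p) (counts-rot i x)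
    (≤-trans h (≤-reflexive (cong (λ C → 2 * C + 2) (sym (C-rot i x)))))

  at-rot : ∀ i {σ pr} (x : Counts σ pr) → PendingAt pr (Counts.c₁ x) (Counts.c₂ x) (Counts.c₃ x) →
           PendingAt pr (Counts.c₁ (counts-rot i x)) (Counts.c₂ (counts-rot i x)) (Counts.c₃ (counts-rot i x))
  at-rot r₀ x h = h
  at-rot r₁ x (none e) = none e
  at-rot r₁ x (at₁ e) = at₃ e
  at-rot r₁ x (at₂ e) = at₁ e
  at-rot r₁ x (at₃ e) = at₂ e
  at-rot r₂ x (none e) = none e
  at-rot r₂ x (at₁ e) = at₂ e
  at-rot r₂ x (at₂ e) = at₃ e
  at-rot r₂ x (at₃ e) = at₁ e

  pending-rot : ∀ i {σ s t} → Pending σ s t → Pending (rot i σ) s t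
  pending-rot i {σ} {s} {t} (pending sup s≥1 pr≤s x at time) =
    pending (sup-rot i {σ} sup) s≥1 pr≤s (counts-rot i x) (at-rot i x at) (time′ time)
    where
    time′ : (AllPos σ × t ≤ 2 * Counts.C x + 3) ⊎ (t ≤ 2 * Counts.C x + 1) → _
    time′ (inj₁ (p , h)) = inj₁ (pos-rot i {σ} p , ≤-trans h (≤-reflexive (cong (λ C → 2 * C + 3) (sym (C-rot i x)))))
    time′ (inj₂ h) = inj₂ (≤-trans h (≤-reflexive (cong (λ C → 2 * C + 1) (sym (C-rot i x)))))

  count<κ : ∀ {e} → tri e < 2 * M → e ≤ κ
  count<κ {e} h with e ≤? κ
  ... | yes p = p
  ... | no p = ⊥-elim (<-irrefl refl (<-≤-trans h (≤-trans bigκ (tri-mono (<⇒≤ (≰⇒> p))))))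

  -- Each tri cᵢ is at most total + pr < 2 M ≤ tri κ, whence cᵢ ≤ κ.
  time≤W : ∀ {σ pr t} (x : Counts σ pr) → pr ≤ total σ → total σ < M → t ≤ 2 * Counts.C x + 3 → t ≤ W
  time≤W {σ} {pr} {t} (counts c₁ c₂ c₃ _ _ _ p) pr≤ h k = ≤-trans k
    (≤-trans (+-monoˡ-≤ 3 (*-monoʳ-≤ 2 (+-mono-≤ (+-mono-≤ (count<κ {c₁} l₁) (count<κ {c₂} l₂)) (count<κ {c₃} l₃)))) (≤-reflexive (e κ)))
    where
    e : ∀ κ → 2 * (κ + κ + κ) + 3 ≡ 6 * κ + 3
    e = solve-∀
    le : tri c₁ + tri c₂ + tri c₃ < 2 * M
    le = ≤-<-trans p (<-≤-trans (+-mono-<-≤ h (≤-trans pr≤ (<⇒≤ h))) (≤-reflexive (cong (M +_) (sym (+-identityʳ M)))))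
    l₁ = ≤-<-trans (≤-trans (m≤m+n (tri c₁) (tri c₂)) (m≤m+n _ (tri c₃))) le
    l₂ = ≤-<-trans (≤-trans (m≤n+m (tri c₂) (tri c₁)) (m≤m+n _ (tri c₃))) le
    l₃ = ≤-<-trans (m≤n+m (tri c₃) (tri c₁ + tri c₂)) le

  growing≤W : ∀ {σ t} → Growing σ t → total σ < M → t ≤ W
  growing≤W (growing _ x h) l = time≤W x z≤n l (≤-trans h (+-monoʳ-≤ (2 * Counts.C x) (s≤s (s≤s z≤n))))

  pending≤W : ∀ {σ s t} → Pending σ s t → total σ < M → t ≤ W
  pending≤W {σ} {s} {t} (pending {pr} _ _ _ x at time) l = time≤W x (pr≤ at) l (t≤ time)
    where
    open Counts x
    open Strands σ
    pr≤ : PendingAt pr c₁ c₂ c₃ → pr ≤ total σ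
    pr≤ (none refl) = z≤n
    pr≤ (at₁ refl) = ≤-trans (n≤1+n _) (≤-trans h₁ (≤-trans (m≤m+n a₁ a₂) (m≤m+n _ a₃)))
    pr≤ (at₂ refl) = ≤-trans (n≤1+n _) (≤-trans h₂ (≤-trans (m≤n+m a₂ a₁) (m≤m+n _ a₃)))
    pr≤ (at₃ refl) = ≤-trans (n≤1+n _) (≤-trans h₃ (m≤n+m a₃ (a₁ + a₂)))
    t≤ : (AllPos σ × t ≤ 2 * C + 3) ⊎ (t ≤ 2 * C + 1) → t ≤ 2 * C + 3
    t≤ (inj₁ (_ , h)) = h
    t≤ (inj₂ h) = ≤-trans h (+-monoʳ-≤ (2 * C) (s≤s z≤n))

  -- With s = 0 a rung raises no weight and only loads s with a₃. It costs time without an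
  -- increment, which explains the step from 2 to 3 in the time bounds.
  grow-rung : ∀ {p q g q′ p′ a₁ a₂ a₃ t} → Growing (strands p q g a₁ a₂ a₃) t →
              Pending (strands q′ p′ g a₁ a₂ (a₃ + 0)) a₃ (suc t)
  grow-rung {a₁ = a₁} {a₂} {a₃} {t} (growing (p₁ , p₂ , p₃) (counts c₁ c₂ c₃ h₁ h₂ h₃ paid) time) =
    pending (≤-trans p₁ (m≤m+n a₁ a₂) , ≤-trans p₂ (m≤m+n a₂ _) , ≤-trans p₁ (m≤n+m a₁ (a₃ + 0))) p₃ z≤n
      (counts c₁ c₂ c₃ h₁ h₂ (≤-trans h₃ (m≤m+n a₃ 0)) (≤-trans paid (≤-reflexive (cong (λ t → a₁ + a₂ + t + 0) (sym (+-identityʳ a₃))))))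
      (none refl) (inj₁ ((p₁ , p₂ , ≤-trans p₃ (m≤m+n a₃ 0)) , ≤-trans (s≤s time) (≤-reflexive (sym (+-suc (2 * (c₁ + c₂ + c₃)) 2)))))

  -- The total rises by a₁ + a₂ ≥ c₁ + c₂, the cost of raising the first two counters; each may be
  -- raised because the other merged weight is positive.
  grow-neck : ∀ {p q g p′ q′ g′ a₁ a₂ a₃ t} → Growing (strands p q g a₁ a₂ a₃) t →
              Growing (strands p′ q′ g′ (a₁ + a₂) (a₁ + a₂) a₃) (suc t)
  grow-neck {a₁ = a₁} {a₂} {a₃} {t} (growing (p₁ , p₂ , p₃) (counts c₁ c₂ c₃ h₁ h₂ h₃ paid) time) =
    growing (≤-trans p₁ (m≤m+n a₁ a₂) , ≤-trans p₁ (m≤m+n a₁ a₂) , p₃)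
      (counts (suc c₁) (suc c₂) c₃ (≤-trans (≤-reflexive (+-comm 1 c₁)) (+-mono-≤ h₁ p₂)) (+-mono-≤ p₁ h₂) h₃
        (lin {tri c₁ + tri c₂ + tri c₃ + (c₁ + c₂)} {a₁ + a₂ + a₃ + 0 + (a₁ + a₂)} 0 (+-mono-≤ paid (+-mono-≤ h₁ h₂))
          (e₁ (tri c₁) (tri c₂) (tri c₃) c₁ c₂ a₁ a₂ a₃)))
      (≤-trans (s≤s time) (≤-trans (m≤m+n _ 3) (≤-reflexive (e₂ c₁ c₂ c₃))))
    where
    e₁ : ∀ x y z c d a b k → x + c + (y + d) + z + (a + b + k + 0 + (a + b)) + 0 ≡
         a + b + (a + b) + k + 0 + (x + y + z + (c + d))
    e₁ = solve-∀
    e₂ : ∀ c₁ c₂ c₃ → suc (2 * (c₁ + c₂ + c₃) + 2) + 3 ≡ 2 * (suc c₁ + suc c₂ + c₃) + 2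
    e₂ = solve-∀

  -- s ≥ 1 raises the third weight, hence c₃; s ≥ pr pays for the pending increment; the new cost c₃
  -- is at most the old third weight, which is the new s.
  pend-rung : ∀ {p q g q′ p′ a₁ a₂ a₃ s t} → Pending (strands p q g a₁ a₂ (suc a₃)) s t →
              Pending (strands q′ p′ g a₁ a₂ (suc a₃ + s)) (suc a₃) (suc t)
  pend-rung {a₁ = a₁} {a₂} {a₃} {s} {t} (pending {pr} (p₁ , p₂ , p₃) s≥1 pr≤s (counts c₁ c₂ c₃ h₁ h₂ h₃ paid) at time) =
    pending (p₁ , ≤-trans p₂ (+-monoʳ-≤ a₂ (m≤m+n (suc a₃) s)) , s≤s z≤n) (s≤s z≤n) h₃
      (counts c₁ c₂ (suc c₃) h₁ h₂ (≤-trans (≤-reflexive (+-comm 1 c₃)) (+-mono-≤ h₃ s≥1))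
        (lin {tri c₁ + tri c₂ + tri c₃ + pr} {a₁ + a₂ + suc a₃ + pr + s} 0 (+-mono-≤ paid pr≤s)
          (e₁ (tri c₁) (tri c₂) (tri c₃) c₃ pr a₁ a₂ (suc a₃) s)))
      (at₃ refl) (time′ time)
    where
    e₁ : ∀ x y z c pr a b k s → x + y + (z + c) + (a + b + k + pr + s) + 0 ≡ a + b + (k + s) + c + (x + y + z + pr)
    e₁ = solve-∀
    e₂ : ∀ c₁ c₂ c₃ k → suc (2 * (c₁ + c₂ + c₃) + k) + 1 ≡ 2 * (c₁ + c₂ + suc c₃) + k
    e₂ = solve-∀
    time′ : _ ⊎ _ → _ ⊎ _
    time′ (inj₁ ((q₁ , q₂ , q₃) , h)) = inj₁ ((q₁ , q₂ , s≤s z≤n) , ≤-trans (s≤s h) (≤-trans (m≤m+n _ 1) (≤-reflexive (e₂ c₁ c₂ c₃ 3))))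
    time′ (inj₂ h) = inj₂ (≤-trans (s≤s h) (≤-trans (m≤m+n _ 1) (≤-reflexive (e₂ c₁ c₂ c₃ 1))))

  -- The zero weight receives s and becomes positive, so all three are. Raising c₃ from 0 to 1 is
  -- free in `tri`.
  pend-rung₀ : ∀ {p q g q′ p′ a₁ a₂ s t} → Pending (strands p q g a₁ a₂ 0) s t →
               Growing (strands q′ p′ g a₁ a₂ (0 + s)) (suc t)
  pend-rung₀ {a₁ = a₁} {a₂} {s} {t} (pending {pr} (p₁ , p₂ , p₃) s≥1 pr≤s (counts c₁ c₂ zero h₁ h₂ h₃ paid) at time) =
    growing (p₃ , ≤-trans p₂ (≤-reflexive (+-identityʳ a₂)) , s≥1)
      (counts c₁ c₂ 1 h₁ h₂ s≥1
        (≤-trans paid (≤-trans (+-monoʳ-≤ (a₁ + a₂ + 0) pr≤s) (≤-reflexive (e₁ a₁ a₂ s))))) (time′ time)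
    where
    e₁ : ∀ a b s → a + b + 0 + s ≡ a + b + s + 0
    e₁ = solve-∀
    e₂ : ∀ c₁ c₂ → suc (2 * (c₁ + c₂ + 0) + 1) + 2 ≡ 2 * (c₁ + c₂ + 1) + 2
    e₂ = solve-∀
    time′ : _ ⊎ _ → _
    time′ (inj₁ ((_ , _ , ()) , h))
    time′ (inj₂ h) = ≤-trans (s≤s h) (≤-trans (m≤m+n _ 2) (≤-reflexive (e₂ c₁ c₂)))

  module _ {p q g p′ q′ g′ : Fin N} {a₁ a₂ a₃ s t : ℕ} where

    private
      σ′ : Strands N
      σ′ = strands p′ q′ g′ (a₁ + a₂) (a₁ + a₂) (suc a₃)

      total′ : ∀ a b k → a + b + (a + b) + k + 0 ≡ a + b + k + (a + b)
      total′ = solve-∀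

      result : (c₁ c₂ c₃ : ℕ) → 1 ≤ a₁ + a₂ → c₁ ≤ a₁ + a₂ → c₂ ≤ a₁ + a₂ → c₃ ≤ suc a₃ →
               tri c₁ + tri c₂ + tri c₃ ≤ a₁ + a₂ + suc a₃ + (a₁ + a₂) → suc t ≤ 2 * (c₁ + c₂ + c₃) + 2 → Growing σ′ (suc t)
      result c₁ c₂ c₃ pos h₁ h₂ h₃ paid time = growing (pos , pos , s≤s z≤n)
        (counts c₁ c₂ c₃ h₁ h₂ h₃ (≤-trans paid (≤-reflexive (sym (total′ a₁ a₂ (suc a₃)))))) time

      drop : ∀ {C} → AllPos (strands p q g a₁ a₂ (suc a₃)) × t ≤ 2 * C + 3 ⊎ t ≤ 2 * C + 1 → t ≤ 2 * C + 3
      drop (inj₁ (_ , h)) = h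
      drop {C = C} (inj₂ h) = ≤-trans h (+-monoʳ-≤ (2 * C) (s≤s z≤n))

      drop₀ : ∀ {C} → (a₁ ≡ 0) ⊎ (a₂ ≡ 0) → AllPos (strands p q g a₁ a₂ (suc a₃)) × t ≤ 2 * C + 3 ⊎ t ≤ 2 * C + 1 → t ≤ 2 * C + 1
      drop₀ _ (inj₂ h) = h
      drop₀ (inj₁ refl) (inj₁ ((() , _) , _))
      drop₀ (inj₂ refl) (inj₁ ((_ , () , _) , _))

    -- The gain a₁ + a₂ of the total is spent according to where the pending cost sits: if at a
    -- merged strand, only the other counter is raised; if at the third, its increment is revoked
    -- and both others are raised. With a zero among the merged weights, C need not grow, because 2
    -- C + 1 leaves a step to spare.
    pend-neck : Pending (strands p q g a₁ a₂ (suc a₃)) s t → Growing σ′ (suc t)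
    pend-neck (pending {pr} (p₁ , p₂ , p₃) s≥1 pr≤s x@(counts c₁ c₂ c₃ h₁ h₂ h₃ paid) at time) with a₁ ≟₀ | a₂ ≟₀
      where
      _≟₀ : ∀ n → (n ≡ 0) ⊎ (1 ≤ n)
      zero ≟₀ = inj₁ refl
      suc n ≟₀ = inj₂ (s≤s z≤n)
    ... | inj₂ q₁ | inj₂ q₂ = both at
      where
      t≤ : t ≤ 2 * (c₁ + c₂ + c₃) + 3
      t≤ = drop {c₁ + c₂ + c₃} time
      up₁ : suc c₁ ≤ a₁ + a₂
      up₁ = ≤-trans (≤-reflexive (+-comm 1 c₁)) (+-mono-≤ h₁ q₂)
      up₂ : suc c₂ ≤ a₁ + a₂
      up₂ = +-mono-≤ q₁ h₂
      both : PendingAt pr c₁ c₂ c₃ → Growing σ′ (suc t)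
      both (none refl) = result (suc c₁) (suc c₂) c₃ p₁ up₁ up₂ h₃
        (lin {tri c₁ + tri c₂ + tri c₃ + (c₁ + c₂)} {a₁ + a₂ + suc a₃ + 0 + (a₁ + a₂)} 0 (+-mono-≤ paid (+-mono-≤ h₁ h₂))
          (e (tri c₁) (tri c₂) (tri c₃) c₁ c₂ a₁ a₂ (suc a₃)))
        (≤-trans (s≤s t≤) (≤-trans (m≤m+n _ 2) (≤-reflexive (f c₁ c₂ c₃))))
        where
        e : ∀ x y z c d a b k → x + c + (y + d) + z + (a + b + k + 0 + (a + b)) + 0 ≡ a + b + k + (a + b) + (x + y + z + (c + d))
        e = solve-∀
        f : ∀ c₁ c₂ c₃ → suc (2 * (c₁ + c₂ + c₃) + 3) + 2 ≡ 2 * (suc c₁ + suc c₂ + c₃) + 2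
        f = solve-∀
      both (at₁ refl) = result c₁ (suc c₂) c₃ p₁ (≤-trans h₁ (m≤m+n a₁ a₂)) up₂ h₃
        (lin {tri c₁ + tri c₂ + tri c₃ + (suc pr + c₂)} {a₁ + a₂ + suc a₃ + pr + (a₁ + a₂)} 1 (+-mono-≤ paid (+-mono-≤ h₁ h₂))
          (e (tri c₁) (tri c₂) (tri c₃) pr c₂ a₁ a₂ (suc a₃)))
        (≤-trans (s≤s t≤) (≤-reflexive (f c₁ c₂ c₃)))
        where
        e : ∀ x y z pr d a b k → x + (y + d) + z + (a + b + k + pr + (a + b)) + 1 ≡ a + b + k + (a + b) + (x + y + z + (suc pr + d))
        e = solve-∀
        f : ∀ c₁ c₂ c₃ → suc (2 * (c₁ + c₂ + c₃) + 3) ≡ 2 * (c₁ + suc c₂ + c₃) + 2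
        f = solve-∀
      both (at₂ refl) = result (suc c₁) c₂ c₃ p₁ up₁ (≤-trans h₂ (m≤n+m a₂ a₁)) h₃
        (lin {tri c₁ + tri c₂ + tri c₃ + (c₁ + suc pr)} {a₁ + a₂ + suc a₃ + pr + (a₁ + a₂)} 1 (+-mono-≤ paid (+-mono-≤ h₁ h₂))
          (e (tri c₁) (tri c₂) (tri c₃) pr c₁ a₁ a₂ (suc a₃)))
        (≤-trans (s≤s t≤) (≤-reflexive (f c₁ c₂ c₃)))
        where
        e : ∀ x y z pr d a b k → x + d + y + z + (a + b + k + pr + (a + b)) + 1 ≡ a + b + k + (a + b) + (x + y + z + (d + suc pr))
        e = solve-∀
        f : ∀ c₁ c₂ c₃ → suc (2 * (c₁ + c₂ + c₃) + 3) ≡ 2 * (suc c₁ + c₂ + c₃) + 2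
        f = solve-∀
      both (at₃ refl) = result (suc c₁) (suc c₂) pr p₁ up₁ up₂ (≤-trans (n≤1+n pr) h₃)
        (lin {tri c₁ + tri c₂ + (tri pr + pr) + (c₁ + c₂)} {a₁ + a₂ + suc a₃ + pr + (a₁ + a₂)} 0 (+-mono-≤ paid (+-mono-≤ h₁ h₂))
          (e (tri c₁) (tri c₂) (tri pr) pr c₁ c₂ a₁ a₂ (suc a₃)))
        (≤-trans (s≤s t≤) (≤-reflexive (f c₁ c₂ pr)))
        where
        e : ∀ x y z pr c d a b k → x + c + (y + d) + z + (a + b + k + pr + (a + b)) + 0 ≡ a + b + k + (a + b) + (x + y + (z + pr) + (c + d))
        e = solve-∀
        f : ∀ c₁ c₂ c₃ → suc (2 * (c₁ + c₂ + suc c₃) + 3) ≡ 2 * (suc c₁ + suc c₂ + c₃) + 2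
        f = solve-∀
    ... | inj₁ refl | _ = left c₁ h₁ paid at (drop₀ {c₁ + c₂ + c₃} (inj₁ refl) time)
      where
      left : ∀ c₁ → c₁ ≤ 0 → tri c₁ + tri c₂ + tri c₃ ≤ a₂ + suc a₃ + pr → PendingAt pr c₁ c₂ c₃ → t ≤ 2 * (c₁ + c₂ + c₃) + 1 → Growing σ′ (suc t)
      left zero _ paid (none refl) h = result 0 c₂ c₃ p₁ z≤n h₂ h₃
        (≤-trans paid (+-monoʳ-≤ (a₂ + suc a₃) z≤n)) (≤-trans (s≤s h) (≤-reflexive (sym (+-suc (2 * (c₂ + c₃)) 1))))
      left zero _ paid (at₂ refl) h = result 0 c₂ c₃ p₁ z≤n h₂ h₃
        (≤-trans paid (+-monoʳ-≤ (a₂ + suc a₃) (≤-trans (n≤1+n pr) h₂))) (≤-trans (s≤s h) (≤-reflexive (sym (+-suc (2 * (suc pr + c₃)) 1))))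
      left zero _ paid (at₃ refl) h = result 1 c₂ pr p₁ p₁ h₂ (≤-trans (n≤1+n pr) h₃)
        (≤-trans (lin {tri c₂ + (tri pr + pr)} {a₂ + suc a₃ + pr} {tri c₂ + tri pr} {a₂ + suc a₃} 0 paid (e (tri c₂) (tri pr) pr (a₂ + suc a₃))) (m≤m+n _ a₂))
        (≤-trans (s≤s h) (≤-reflexive (f c₂ pr)))
        where
        e : ∀ y z pr k → y + z + (k + pr) + 0 ≡ k + (y + (z + pr))
        e = solve-∀
        f : ∀ c₂ pr → suc (2 * (0 + c₂ + suc pr) + 1) ≡ 2 * (1 + c₂ + pr) + 2
        f = solve-∀
    ... | inj₂ q₁ | inj₁ refl = right c₂ h₂ paid at (drop₀ {c₁ + c₂ + c₃} (inj₂ refl) time)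
      where
      h₁′ : c₁ ≤ a₁ + 0
      h₁′ = ≤-trans h₁ (m≤m+n a₁ 0)
      right : ∀ c₂ → c₂ ≤ 0 → tri c₁ + tri c₂ + tri c₃ ≤ a₁ + 0 + suc a₃ + pr → PendingAt pr c₁ c₂ c₃ → t ≤ 2 * (c₁ + c₂ + c₃) + 1 → Growing σ′ (suc t)
      right zero _ paid (none refl) h = result c₁ 0 c₃ p₁ h₁′ z≤n h₃
        (≤-trans paid (+-monoʳ-≤ (a₁ + 0 + suc a₃) z≤n)) (≤-trans (s≤s h) (≤-reflexive (sym (+-suc (2 * (c₁ + 0 + c₃)) 1))))
      right zero _ paid (at₁ refl) h = result c₁ 0 c₃ p₁ h₁′ z≤n h₃
        (≤-trans paid (+-monoʳ-≤ (a₁ + 0 + suc a₃) (≤-trans (n≤1+n pr) h₁′))) (≤-trans (s≤s h) (≤-reflexive (sym (+-suc (2 * (suc pr + 0 + c₃)) 1))))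
      right zero _ paid (at₃ refl) h = result c₁ 1 pr p₁ h₁′ p₁ (≤-trans (n≤1+n pr) h₃)
        (≤-trans (lin {tri c₁ + 0 + (tri pr + pr)} {a₁ + 0 + suc a₃ + pr} {tri c₁ + 0 + tri pr} {a₁ + 0 + suc a₃} 0 paid
          (e (tri c₁ + 0) (tri pr) pr (a₁ + 0 + suc a₃))) (m≤m+n _ (a₁ + 0)))
        (≤-trans (s≤s h) (≤-reflexive (f c₁ pr)))
        where
        e : ∀ y z pr k → y + z + (k + pr) + 0 ≡ k + (y + (z + pr))
        e = solve-∀
        f : ∀ c₁ pr → suc (2 * (c₁ + 0 + suc pr) + 1) ≡ 2 * (c₁ + 1 + pr) + 2
        f = solve-∀

  double : ∀ {t t′ d} → t + t ≤ t′ → M ≤ t * 2 ^ suc d → M ≤ t′ * 2 ^ d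
  double {t} {t′} {d} h k = ≤-trans k (≤-trans (≤-reflexive (e t (2 ^ d))) (*-monoˡ-≤ (2 ^ d) h))
    where e : ∀ t x → t * (x + (x + 0)) ≡ (t + t) * x
          e = solve-∀

  ZeroRun : EList N → Strands N → ℕ → Set
  ZeroRun R σ j = (j ≡ 0) ⊎ (Strands.a₃ σ ≡ 0 × Run R σ j)

  MoveRun : EList N → Strands N → ℕ → Set
  MoveRun R σ j = (j ≤ λ′ × 1 ≤ Strands.a₃ σ) ⊎ Run R σ j

  -- During a run the third weight is zero and the others are positive, so a proper rotation brings
  -- a positive weight into third place; only the identity continues the run.
  move-run : ∀ i {R σ j} → Sub R₀ R → Support σ → ZeroRun R σ j → MoveRun R (rot i σ) j
  move-run i sub _ (inj₁ refl) = inj₂ (run sub (λ _ l → l) z≤n)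
  move-run r₀ sub _ (inj₂ (_ , r)) = inj₂ r
  move-run r₁ sub (_ , _ , p) (inj₂ (refl , r)) = inj₁ (Run.j≤ r , p)
  move-run r₂ sub (_ , p , _) (inj₂ (refl , r)) = inj₁ (Run.j≤ r , ≤-trans p (≤-reflexive (+-identityʳ _)))

  run-j : ∀ {R σ j} → MoveRun R σ j → j ≤ λ′
  run-j (inj₁ (h , _)) = h
  run-j (inj₂ r) = Run.j≤ r

  after-double : ∀ {l j} d → l + 0 ≤ d * B + (λ′ + W + 1) → j ≤ λ′ → suc l + j ≤ suc d * B + (λ′ + W + 1)
  after-double {l} {j} d h k = lin {l + 0 + j} {d * B + (λ′ + W + 1) + λ′} (W + 2) (+-mono-≤ h k) (e l j (d * B) λ′ W)
    where e : ∀ l j x y w → suc l + j + (x + (y + w + 1) + y) + (w + 2) ≡ suc y + w + 2 + x + (y + w + 1) + (l + 0 + j)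
          e = solve-∀

  after-double′ : ∀ {l t} d → l + 0 ≤ d * B + (λ′ + W + 1) → t ≤ W → suc l + t ≤ suc d * B + W
  after-double′ {l} {t} d h k = lin {l + 0 + t} {d * B + (λ′ + W + 1) + W} 1 (+-mono-≤ h k) (e l t (d * B) λ′ W)
    where e : ∀ l j x y w → suc l + j + (x + (y + w + 1) + w) + 1 ≡ suc y + w + 2 + x + w + (l + 0 + j)
          e = solve-∀

  into-growth : ∀ {l j} d → l + 1 ≤ d * B + W → j ≤ λ′ → suc l + j ≤ d * B + (λ′ + W + 1)
  into-growth {l} {j} d h k = lin {l + 1 + j} {d * B + W + λ′} 1 (+-mono-≤ h k) (e l j (d * B) λ′ W)
    where e : ∀ l j x y w → suc l + j + (x + w + y) + 1 ≡ x + (y + w + 1) + (l + 1 + j)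
          e = solve-∀

  shift : ∀ {l t x} → l + suc t ≤ x → suc l + t ≤ x
  shift {l} {t} h = ≤-trans (≤-reflexive (sym (+-suc l t))) h

  too-large : ∀ {t z} → M ≤ t * 2 ^ 0 → t ≤ z → z < M → ⊥
  too-large {t} h k l = <-irrefl refl (<-≤-trans l (≤-trans h (≤-trans (≤-reflexive (*-identityʳ t)) k)))

  mutual
    -- `d` doublings take the total to `M`, and `j` is the length of the ladder that has left the
    -- weights fixed. With third weight zero a rung prolongs the ladder and a neck doubles the
    -- total; every other rung or neck starts a phase of growth.
    stuck : ∀ {R σ m z j} d (Π : Play R σ 0 m z) → z < M → Sub R₀ R → Support σ → M ≤ total σ * 2 ^ d →
            ZeroRun R σ j → len Π + j ≤ d * B + (λ′ + W + 1)
    stuck d end l sub sup h r = ≤-trans (go r) (m≤n+m _ (d * B))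
      where go : ∀ {R σ j} → ZeroRun R σ j → j ≤ λ′ + W + 1
            go (inj₁ refl) = z≤n
            go (inj₂ (_ , r)) = ≤-trans (Run.j≤ r) (≤-trans (m≤m+n λ′ W) (m≤m+n _ 1))
    stuck {σ = σ} d (step i X) l sub sup h r =
      stuckM d X l sub (sup-rot i {σ} sup) (≤-trans h (≤-reflexive (cong (_* 2 ^ d) (sym (total-rot i σ))))) (move-run i sub sup r)

    stuckM : ∀ {R σ m z j} d (X : Move R σ 0 m z) → z < M → Sub R₀ R → Support σ → M ≤ total σ * 2 ^ d →
             MoveRun R σ j → suc (lenM X) + j ≤ d * B + (λ′ + W + 1)
    stuckM d (rung {a₃ = zero} e kp kq Π) l sub sup h (inj₁ (_ , ()))
    stuckM {j = j} d (rung {R} {R′} {a₁ = a₁} {a₂} {a₃ = zero} e kp kq Π) l sub sup h (inj₂ (run {Rs} {ps} {qs} sub′ pre j≤)) with j <? λ′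
    ... | yes j< = shift {len Π} (stuck d Π l (sub-step (_ ∷ _ ∷ _ ∷ []) sub e) sup h
          (inj₂ (refl , run sub′ (λ i x → subst (Ladder K Rs ps qs) (+-suc j i) (pre (suc i) (rung e kp kq x))) j<)))
    ... | no j≮ = ⊥-elim (ladder-free Rs ps qs sub′ (subst (Ladder K Rs ps qs) full (pre 1 (rung e kp kq []))))
      where full : j + 1 ≡ suc λ′
            full = trans (+-comm j 1) (cong suc (≤-antisym j≤ (≮⇒≥ j≮)))
    stuckM d (rung {a₁ = a₁} {a₂} {a₃ = suc a₃} e kp kq Π) l sub sup@(p₁ , p₂ , p₃) h r = into-growth {len Π} d
      (pend d Π l (sub-step (_ ∷ _ ∷ _ ∷ []) sub e)
        (pending (p₁ , ≤-trans p₂ (+-monoʳ-≤ a₂ (m≤m+n (suc a₃) 0)) , s≤s z≤n) (s≤s z≤n) z≤n (counts 0 0 0 z≤n z≤n z≤n z≤n) (none refl) (inj₂ ≤-refl))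
        (≤-trans h (*-monoˡ-≤ (2 ^ d) (+-monoʳ-≤ (a₁ + a₂) (m≤m+n (suc a₃) 0))))) (run-j r)
    stuckM zero X@(neck {a₃ = zero} e Π) l sub sup h r = ⊥-elim (too-large h (totalM≤ X) l)
    stuckM (suc d) (neck {X = X} {a₁ = a₁} {a₂} {a₃ = zero} e Π) l sub sup@(p₁ , p₂ , p₃) h r = after-double {len Π} d
      (stuck d Π l (sub-step X sub e) (≤-trans p₁ (m≤m+n (a₁ + a₂) (a₁ + a₂)) , ≤-trans p₁ (m≤m+n (a₁ + a₂) 0) , p₁)
        (double {a₁ + a₂ + 0} {d = d} (≤-reflexive (sum a₁ a₂)) h) (inj₁ refl)) (run-j r)
      where sum : ∀ a b → a + b + 0 + (a + b + 0) ≡ a + b + (a + b) + 0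
            sum = solve-∀
    stuckM d (neck {X = X} {a₁ = a₁} {a₂} {a₃ = suc a₃} e Π) l sub sup@(p₁ , p₂ , p₃) h r = into-growth {len Π} d
      (grow d Π l (sub-step X sub e) (growing (p₁ , p₁ , s≤s z≤n) (counts 0 0 0 z≤n z≤n z≤n z≤n) (s≤s z≤n))
        (≤-trans h (*-monoˡ-≤ (2 ^ d) (+-monoˡ-≤ (suc a₃) (m≤m+n (a₁ + a₂) (a₁ + a₂)))))) (run-j r)
    stuckM zero X@(big _ _ _ _ Π) l sub sup h r = ⊥-elim (too-large h (totalM≤ X) l)
    stuckM {σ = σ} (suc d) (big {X = X} e sup′ dbl _ Π) l sub sup h r = after-double {len Π} d
      (stuck d Π l (sub-step X sub e) sup′ (double {total σ} {d = d} dbl h) (inj₁ refl)) (run-j r)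

    -- Within a phase `t` counts its layers. Only a big layer or a neck with third weight zero
    -- breaks it off, and both double the total.
    pend : ∀ {R σ s m z t} d (Π : Play R σ s m z) → z < M → Sub R₀ R → Pending σ s t → M ≤ total σ * 2 ^ d → len Π + t ≤ d * B + W
    pend d end l sub p h = ≤-trans (pending≤W p l) (m≤n+m W (d * B))
    pend {σ = σ} d (step i X) l sub p h =
      pendM d X l sub (pending-rot i p) (≤-trans h (≤-reflexive (cong (_* 2 ^ d) (sym (total-rot i σ)))))

    pendM : ∀ {R σ s m z t} d (X : Move R σ s m z) → z < M → Sub R₀ R → Pending σ s t → M ≤ total σ * 2 ^ d → suc (lenM X) + t ≤ d * B + W
    pendM d (rung {a₁ = a₁} {a₂} {a₃ = zero} {s} e kp kq Π) l sub p h = shift {len Π}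
      (grow d Π l (sub-step (_ ∷ _ ∷ _ ∷ []) sub e) (pend-rung₀ p) (≤-trans h (*-monoˡ-≤ (2 ^ d) (+-monoʳ-≤ (a₁ + a₂) z≤n))))
    pendM d (rung {a₁ = a₁} {a₂} {a₃ = suc a₃} {s} e kp kq Π) l sub p h = shift {len Π}
      (pend d Π l (sub-step (_ ∷ _ ∷ _ ∷ []) sub e) (pend-rung p) (≤-trans h (*-monoˡ-≤ (2 ^ d) (+-monoʳ-≤ (a₁ + a₂) (m≤m+n (suc a₃) s)))))
    pendM zero X@(neck {a₃ = zero} e Π) l sub p h = ⊥-elim (too-large h (totalM≤ X) l)
    pendM (suc d) Y@(neck {X = X} {a₁ = a₁} {a₂} {a₃ = zero} e Π) l sub p h with Pending.sup p
    ... | p₁ , _ = after-double′ {len Π} d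
      (stuck d Π l (sub-step X sub e) (≤-trans p₁ (m≤m+n (a₁ + a₂) (a₁ + a₂)) , ≤-trans p₁ (m≤m+n (a₁ + a₂) 0) , p₁)
        (double {a₁ + a₂ + 0} {d = d} (≤-reflexive (sum a₁ a₂)) h) (inj₁ refl)) (pending≤W p (≤-<-trans (totalM≤ Y) l))
      where sum : ∀ a b → a + b + 0 + (a + b + 0) ≡ a + b + (a + b) + 0
            sum = solve-∀
    pendM d (neck {X = X} {a₁ = a₁} {a₂} {a₃ = suc a₃} e Π) l sub p h = shift {len Π}
      (grow d Π l (sub-step X sub e) (pend-neck p) (≤-trans h (*-monoˡ-≤ (2 ^ d) (+-monoˡ-≤ (suc a₃) (m≤m+n (a₁ + a₂) (a₁ + a₂))))))
    pendM zero X@(big _ _ _ _ Π) l sub p h = ⊥-elim (too-large h (totalM≤ X) l)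
    pendM {σ = σ} (suc d) Y@(big {X = X} e sup′ dbl _ Π) l sub p h = after-double′ {len Π} d
      (stuck d Π l (sub-step X sub e) sup′ (double {total σ} {d = d} dbl h) (inj₁ refl)) (pending≤W p (≤-<-trans (totalM≤ Y) l))

    grow : ∀ {R σ m z t} d (Π : Play R σ 0 m z) → z < M → Sub R₀ R → Growing σ t → M ≤ total σ * 2 ^ d → len Π + t ≤ d * B + W
    grow d end l sub p h = ≤-trans (growing≤W p l) (m≤n+m W (d * B))
    grow {σ = σ} d (step i X) l sub p h =
      growM d X l sub (growing-rot i p) (≤-trans h (≤-reflexive (cong (_* 2 ^ d) (sym (total-rot i σ)))))

    growM : ∀ {R σ m z t} d (X : Move R σ 0 m z) → z < M → Sub R₀ R → Growing σ t → M ≤ total σ * 2 ^ d → suc (lenM X) + t ≤ d * B + W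
    growM d (rung {a₁ = a₁} {a₂} {a₃} e kp kq Π) l sub p h = shift {len Π}
      (pend d Π l (sub-step (_ ∷ _ ∷ _ ∷ []) sub e) (grow-rung p) (≤-trans h (*-monoˡ-≤ (2 ^ d) (+-monoʳ-≤ (a₁ + a₂) (m≤m+n a₃ 0)))))
    growM d (neck {X = X} {a₁ = a₁} {a₂} {a₃} e Π) l sub p h = shift {len Π}
      (grow d Π l (sub-step X sub e) (grow-neck p) (≤-trans h (*-monoˡ-≤ (2 ^ d) (+-monoˡ-≤ a₃ (m≤m+n (a₁ + a₂) (a₁ + a₂))))))
    growM zero X@(big _ _ _ _ Π) l sub p h = ⊥-elim (too-large h (totalM≤ X) l)
    growM {σ = σ} (suc d) Y@(big {X = X} e sup′ dbl _ Π) l sub p h = after-double′ {len Π} d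
      (stuck d Π l (sub-step X sub e) sup′ (double {total σ} {d = d} dbl h) (inj₁ refl)) (growing≤W p (≤-<-trans (totalM≤ Y) l))

  play-bound : ∀ {σ m z} d (Π : Play R₀ σ 0 m z) → z < M → Support σ → M ≤ total σ * 2 ^ d → len Π ≤ d * B + (λ′ + W + 1)
  play-bound d Π l sup h = ≤-trans (≤-reflexive (sym (+-identityʳ (len Π)))) (stuck d Π l (sub-refl R₀) sup h (inj₁ refl))

-- Rooted graphs and their layers

infixl 6 _⊕_

_⊕_ : VSub N → Fin N → VSub N
(W ⊕ x) v = W v ∨ (v == x)

⊕-new : (W : VSub N) (x : Fin N) → (W ⊕ x) x ≡ true
⊕-new W x = ∨-right {W x} (==-refl x)

⊕-old : {W : VSub N} {x v : Fin N} → W v ≡ true → (W ⊕ x) v ≡ true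
⊕-old = ∨-left

⊕-case : {W : VSub N} {x v : Fin N} → (W ⊕ x) v ≡ true → (W v ≡ true) ⊎ (v ≡ x)
⊕-case {W = W} {x} {v} h with W v
... | true = inj₁ refl
... | false = inj₂ (==-≡ h)

⊕-≢ : {W : VSub N} {x v : Fin N} → (W ⊕ x) v ≡ true → v ≢ x → W v ≡ true
⊕-≢ {W = W} {x} {v} h ne with ⊕-case {W = W} {x} {v} h
... | inj₁ e = e
... | inj₂ e = ⊥-elim (ne e)

⊕-⊖ : (W : VSub N) (x : Fin N) → W x ≡ false → W ⊕ x ⊖ x ≐ W
⊕-⊖ W x hx v with v ≟ x
... | yes refl = trans (⊖-self (W ⊕ x) x) (sym hx)
... | no ne = trans (⊖-keep (W ⊕ x) ne) (trans (cong (W v ∨_) (==-≢ ne)) (∨-idʳ (W v)))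
  where ∨-idʳ : ∀ b → b ∨ false ≡ b
        ∨-idʳ true = refl
        ∨-idʳ false = refl

size-⊕ : (W : VSub N) (x : Fin N) → W x ≡ false → size (W ⊕ x) ≡ suc (size W)
size-⊕ W x hx = trans (size-⊖ (W ⊕ x) x (⊕-new W x)) (cong suc (size-cong (⊕-⊖ W x hx)))

-- Small cuts away from the root x ∉ W contain the target w.
record Pole (x w : Fin N) (W : VSub N) (E : EList N) : Set where
  field
    xW : W x ≡ false
    wW : W w ≡ true
    cubic : Cubic′ E (W ⊕ x)
    far : ∀ X → X x ≡ false → X w ≡ false → Two (W ∩ X) → 4 ≤ δ E X
    near : ∀ X → X x ≡ false → X w ≡ true → 2 ≤ δ E X

-- An αᵢ may be the root itself, for a strand that passes the layer, and ends of different cut edges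
-- may coincide.
record Cut₃ (w : Fin N) (W S : VSub N) (E : EList N) : Set where
  field
    EA R′ : EList N
    α₁ α₂ α₃ β₁ β₂ β₃ : Fin N
    eq : E ≋ EA ++ (α₁ , β₁) ∷ (α₂ , β₂) ∷ (α₃ , β₃) ∷ R′
    outA : Outside S EA
    inR : Inside S R′
    hα₁ : S α₁ ≡ false
    hα₂ : S α₂ ≡ false
    hα₃ : S α₃ ≡ false
    hβ₁ : S β₁ ≡ true
    hβ₂ : S β₂ ≡ true
    hβ₃ : S β₃ ≡ true
    S⊆W : ∀ v → S v ≡ true → W v ≡ true
    wS : S w ≡ true

all-++ˡ : {P : Edge N → Set} (A : EList N) {B : EList N} → All P (A ++ B) → All P A
all-++ˡ [] h = []
all-++ˡ (e ∷ A) (p ∷ h) = p ∷ all-++ˡ A h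

all-++ : {P : Edge N → Set} {A B : EList N} → All P A → All P B → All P (A ++ B)
all-++ [] k = k
all-++ (p ∷ h) k = p ∷ all-++ h k

differ : {X : VSub N} {a b : Fin N} → X a ≡ true → X b ≡ false → a ≢ b
differ h k refl = true≢false h k

opaque
  unfolding deg
  outside-deg : {S : VSub N} {v : Fin N} → S v ≡ true → (EA : EList N) → Outside S EA → deg EA v ≡ 0
  outside-deg hv EA h = avoid-deg EA (All.map (λ { (p , q) → differ hv p ∘ sym , differ hv q ∘ sym }) h)

  inside-deg : {S : VSub N} {v : Fin N} → S v ≡ false → (R : EList N) → Inside S R → deg R v ≡ 0
  inside-deg hv R h = avoid-deg R (All.map (λ { (p , q) → differ p hv , differ q hv }) h)

  contract-deg : (EA R′ : EList N) (α₁ α₂ α₃ β₁ β₂ β₃ x v : Fin N) → deg EA v ≡ 0 →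
    α₁ ≢ v → α₂ ≢ v → α₃ ≢ v → x ≢ v →
    deg ((x , β₁) ∷ (x , β₂) ∷ (x , β₃) ∷ R′) v ≡ deg (EA ++ (α₁ , β₁) ∷ (α₂ , β₂) ∷ (α₃ , β₃) ∷ R′) v
  contract-deg EA R′ α₁ α₂ α₃ β₁ β₂ β₃ x v d n₁ n₂ n₃ n
    rewrite deg-++ EA ((α₁ , β₁) ∷ (α₂ , β₂) ∷ (α₃ , β₃) ∷ R′) v | d | ==-≢ n₁ | ==-≢ n₂ | ==-≢ n₃ | ==-≢ n = refl

  root-deg : (R′ : EList N) (β₁ β₂ β₃ x : Fin N) → β₁ ≢ x → β₂ ≢ x → β₃ ≢ x → deg R′ x ≡ 0 →
    deg ((x , β₁) ∷ (x , β₂) ∷ (x , β₃) ∷ R′) x ≡ 3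
  root-deg R′ β₁ β₂ β₃ x n₁ n₂ n₃ d rewrite ==-refl x | ==-≢ n₁ | ==-≢ n₂ | ==-≢ n₃ | d = refl

  piece-deg : (EA R′ : EList N) (α₁ α₂ α₃ β₁ β₂ β₃ w v : Fin N) → deg R′ v ≡ 0 →
    β₁ ≢ v → β₂ ≢ v → β₃ ≢ v → w ≢ v →
    deg (EA ++ (α₁ , w) ∷ (α₂ , w) ∷ (α₃ , w) ∷ []) v ≡ deg (EA ++ (α₁ , β₁) ∷ (α₂ , β₂) ∷ (α₃ , β₃) ∷ R′) v
  piece-deg EA R′ α₁ α₂ α₃ β₁ β₂ β₃ w v d n₁ n₂ n₃ n
    rewrite deg-++ EA ((α₁ , β₁) ∷ (α₂ , β₂) ∷ (α₃ , β₃) ∷ R′) v | deg-++ EA ((α₁ , w) ∷ (α₂ , w) ∷ (α₃ , w) ∷ []) v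
          | d | ==-≢ n₁ | ==-≢ n₂ | ==-≢ n₃ | ==-≢ n = refl

  target-deg : (EA : EList N) (α₁ α₂ α₃ w : Fin N) → deg EA w ≡ 0 → α₁ ≢ w → α₂ ≢ w → α₃ ≢ w →
    deg (EA ++ (α₁ , w) ∷ (α₂ , w) ∷ (α₃ , w) ∷ []) w ≡ 3
  target-deg EA α₁ α₂ α₃ w d n₁ n₂ n₃
    rewrite deg-++ EA ((α₁ , w) ∷ (α₂ , w) ∷ (α₃ , w) ∷ []) w | d | ==-refl w | ==-≢ n₁ | ==-≢ n₂ | ==-≢ n₃ = refl

opaque
  unfolding δ
  δ-zero : {X : VSub N} (b : Bool) (R : EList N) → All (λ { (p , q) → X p ≡ b × X q ≡ b }) R → δ R X ≡ 0
  δ-zero b [] [] = refl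
  δ-zero true ((p , q) ∷ R) ((hp , hq) ∷ h) rewrite hp | hq = δ-zero true R h
  δ-zero false ((p , q) ∷ R) ((hp , hq) ∷ h) rewrite hp | hq = δ-zero false R h

  contract-δ : (EA R′ : EList N) (α₁ α₂ α₃ β₁ β₂ β₃ x : Fin N) (X Y : VSub N) → δ EA Y ≡ 0 →
    Y α₁ ≡ X x → Y α₂ ≡ X x → Y α₃ ≡ X x → Y β₁ ≡ X β₁ → Y β₂ ≡ X β₂ → Y β₃ ≡ X β₃ → δ R′ Y ≡ δ R′ X →
    δ (EA ++ (α₁ , β₁) ∷ (α₂ , β₂) ∷ (α₃ , β₃) ∷ R′) Y ≡ δ ((x , β₁) ∷ (x , β₂) ∷ (x , β₃) ∷ R′) X
  contract-δ EA R′ α₁ α₂ α₃ β₁ β₂ β₃ x X Y d a₁ a₂ a₃ b₁ b₂ b₃ r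
    rewrite sumE-++ (cr Y) EA ((α₁ , β₁) ∷ (α₂ , β₂) ∷ (α₃ , β₃) ∷ R′) | d | a₁ | a₂ | a₃ | b₁ | b₂ | b₃ | r = refl

  piece-δ : (EA R′ : EList N) (α₁ α₂ α₃ β₁ β₂ β₃ w : Fin N) (X Y : VSub N) → δ EA Y ≡ δ EA X →
    Y α₁ ≡ X α₁ → Y α₂ ≡ X α₂ → Y α₃ ≡ X α₃ → Y β₁ ≡ X w → Y β₂ ≡ X w → Y β₃ ≡ X w → δ R′ Y ≡ 0 →
    δ (EA ++ (α₁ , β₁) ∷ (α₂ , β₂) ∷ (α₃ , β₃) ∷ R′) Y ≡ δ (EA ++ (α₁ , w) ∷ (α₂ , w) ∷ (α₃ , w) ∷ []) X
  piece-δ EA R′ α₁ α₂ α₃ β₁ β₂ β₃ w X Y d a₁ a₂ a₃ b₁ b₂ b₃ r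
    rewrite sumE-++ (cr Y) EA ((α₁ , β₁) ∷ (α₂ , β₂) ∷ (α₃ , β₃) ∷ R′) | sumE-++ (cr X) EA ((α₁ , w) ∷ (α₂ , w) ∷ (α₃ , w) ∷ [])
          | d | a₁ | a₂ | a₃ | b₁ | b₂ | b₃ | r = refl

module Contract {N} {x w : Fin N} {W S : VSub N} {E : EList N} (Π : Pole x w W E) (T : Cut₃ w W S E) where
  open Pole Π
  open Cut₃ T

  xS : S x ≡ false
  xS = ¬true⇒false λ h → true≢false (S⊆W x h) xW

  private
    G = Cubic-≋ eq cubic
    allIn : Inside (W ⊕ x) (EA ++ (α₁ , β₁) ∷ (α₂ , β₂) ∷ (α₃ , β₃) ∷ R′)
    allIn = inU G
    cutIn : Inside (W ⊕ x) ((α₁ , β₁) ∷ (α₂ , β₂) ∷ (α₃ , β₃) ∷ R′)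
    cutIn = all-++ʳ EA allIn
    iα₁ : (W ⊕ x) α₁ ≡ true
    iα₁ = proj₁ (All.head cutIn)
    iα₂ : (W ⊕ x) α₂ ≡ true
    iα₂ = proj₁ (All.head (All.tail cutIn))
    iα₃ : (W ⊕ x) α₃ ≡ true
    iα₃ = proj₁ (All.head (All.tail (All.tail cutIn)))

  E′ : EList N
  E′ = (x , β₁) ∷ (x , β₂) ∷ (x , β₃) ∷ R′

  private
    ⊕S : ∀ {v} → S v ≡ true → (S ⊕ x) v ≡ true
    ⊕S {v} = ⊕-old {W = S} {x} {v}

    -- The root side is contracted to `x`: a set avoiding `x` has the same cut there as its part in
    -- `S` has in `E`. Both cut conditions of `Pole` are inherited this way.
    δE′ : (X : VSub N) → X x ≡ false → δ E (X ∩ S) ≡ δ E′ X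
    δE′ X hx = trans (δ-≋ (X ∩ S) eq) (contract-δ EA R′ α₁ α₂ α₃ β₁ β₂ β₃ x X (X ∩ S)
      (δ-zero false EA (All.map (λ { {p , q} (hp , hq) → ∧-false₂ {X p} hp , ∧-false₂ {X q} hq }) outA))
      (trans (∧-false₂ {X α₁} hα₁) (sym hx)) (trans (∧-false₂ {X α₂} hα₂) (sym hx)) (trans (∧-false₂ {X α₃} hα₃) (sym hx))
      (keep hβ₁) (keep hβ₂) (keep hβ₃)
      (δ-cong-on (All.map (λ { (hp , hq) → keep hp , keep hq }) inR)))
      where
      keep : ∀ {v} → S v ≡ true → X v ∧ S v ≡ X v
      keep {v} h rewrite h with X v
      ... | true = refl
      ... | false = refl

  pole : Pole x w S E′
  pole = record
    { xW = xS ; wW = wS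
    ; cubic = record
      { inU = (⊕-new S x , ⊕S hβ₁) ∷ (⊕-new S x , ⊕S hβ₂) ∷ (⊕-new S x , ⊕S hβ₃)
            ∷ All.map (λ { (p , q) → ⊕S p , ⊕S q }) inR
      ; nl = (differ hβ₁ xS ∘ sym) ∷ (differ hβ₂ xS ∘ sym) ∷ (differ hβ₃ xS ∘ sym) ∷ All.tail (All.tail (All.tail (all-++ʳ EA (nl G))))
      ; d3 = λ v hv → d3′ v (⊕-case {W = S} {x} {v} hv) }
    ; far = λ X hx hw (a , b , ab , ha , hb) → ≤-trans
        (far (X ∩ S) (∧-false₁ hx) (∧-false₁ hw) (a , b , ab , mem {X} ha , mem {X} hb)) (≤-reflexive (δE′ X hx))
    ; near = λ X hx hw → ≤-trans (near (X ∩ S) (∧-false₁ hx) (∧-true hw wS)) (≤-reflexive (δE′ X hx)) }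
    where
    mem : ∀ {X : VSub N} {v} → (S ∩ X) v ≡ true → (W ∩ (X ∩ S)) v ≡ true
    mem {X} {v} h = ∧-true (S⊆W v (∧-left h)) (∧-true (∧-right {S v} h) (∧-left h))
    d3′ : ∀ v → (S v ≡ true) ⊎ (v ≡ x) → deg E′ v ≡ 3
    d3′ v (inj₁ h) = trans (contract-deg EA R′ α₁ α₂ α₃ β₁ β₂ β₃ x v (outside-deg h EA outA)
      (differ h hα₁ ∘ sym) (differ h hα₂ ∘ sym) (differ h hα₃ ∘ sym) (differ h xS ∘ sym)) (d3 G v (⊕-old {W = W} {x} {v} (S⊆W v h)))
    d3′ v (inj₂ refl) = root-deg R′ β₁ β₂ β₃ x (differ hβ₁ xS) (differ hβ₂ xS) (differ hβ₃ xS) (inside-deg xS R′ inR)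

  A : VSub N
  A = W ∩ ∁ S

  -- The layer as a graph of its own: the root side is kept and `S` is contracted to `w`.
  E″ : EList N
  E″ = EA ++ (α₁ , w) ∷ (α₂ , w) ∷ (α₃ , w) ∷ []

  U″ : VSub N
  U″ = A ⊕ w ⊕ x

  private
    intoA : ∀ {v} → (W ⊕ x) v ≡ true → S v ≡ false → U″ v ≡ true
    intoA {v} h k with ⊕-case {W = W} {x} {v} h
    ... | inj₁ e = ⊕-old {W = A ⊕ w} {x} {v} (⊕-old {W = A} {w} {v} (∧-true e (cong not k)))
    ... | inj₂ refl = ⊕-new (A ⊕ w) x

    wU : U″ w ≡ true
    wU = ⊕-old {W = A ⊕ w} {x} {w} (⊕-new A w)

    w≢x : w ≢ x
    w≢x = differ wS xS

  in-piece : ∀ {v} → U″ v ≡ true → v ≢ x → v ≢ w → A v ≡ true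
  in-piece {v} h nx nw = ⊕-≢ {W = A} {w} {v} (⊕-≢ {W = A ⊕ w} {x} {v} h nx) nw

  cubic″ : Cubic′ E″ U″
  cubic″ = record
    { inU = all-++ (All.zipWith (λ { {p , q} ((hp , hq) , (kp , kq)) → intoA hp kp , intoA hq kq }) (all-++ˡ EA allIn , outA))
        ((intoA iα₁ hα₁ , wU) ∷ (intoA iα₂ hα₂ , wU) ∷ (intoA iα₃ hα₃ , wU) ∷ [])
    ; nl = all-++ (all-++ˡ EA (nl G)) ((differ wS hα₁ ∘ sym) ∷ (differ wS hα₂ ∘ sym) ∷ (differ wS hα₃ ∘ sym) ∷ [])
    ; d3 = λ v hv → d3″ v hv (v ≟ w) }
    where
    old : ∀ v → (W ⊕ x) v ≡ true → S v ≡ false → deg E″ v ≡ 3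
    old v h k = trans (piece-deg EA R′ α₁ α₂ α₃ β₁ β₂ β₃ w v (inside-deg k R′ inR)
      (differ hβ₁ k) (differ hβ₂ k) (differ hβ₃ k) (differ wS k)) (d3 G v h)
    d3″ : ∀ v → U″ v ≡ true → Dec (v ≡ w) → deg E″ v ≡ 3
    d3″ v hv (yes refl) = target-deg EA α₁ α₂ α₃ w (outside-deg wS EA outA) (differ wS hα₁ ∘ sym) (differ wS hα₂ ∘ sym) (differ wS hα₃ ∘ sym)
    d3″ v hv (no ne) = rest (v ≟ x)
      where
      rest : Dec (v ≡ x) → deg E″ v ≡ 3
      rest (yes refl) = old v (⊕-new W x) xS
      rest (no nx) = old v (⊕-old {W = W} {x} {v} (∧-left a)) (not-true⁻ (∧-right {W v} a))
        where a = in-piece hv nx ne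

  size″ : size U″ ≡ 2 + size A
  size″ = trans (size-⊕ (A ⊕ w) x (∨-false (∧-false₁ xW) (==-≢ (w≢x ∘ sym)))) (cong suc (size-⊕ A w (∧-false₂ {W w} (cong not wS))))

  -- Pulls a cut of the contracted layer back to `E`, with all of `S` on the side of its
  -- representative `w`.
  extend : VSub N → VSub N
  extend X v with S v
  ... | true = X w
  ... | false = X v

  extend-in : (X : VSub N) {v : Fin N} → S v ≡ true → extend X v ≡ X w
  extend-in X {v} h with S v
  ... | true = refl
  extend-in X {v} () | false

  extend-out : (X : VSub N) {v : Fin N} → S v ≡ false → extend X v ≡ X v
  extend-out X {v} h with S v
  extend-out X {v} () | true
  ... | false = refl

  δE″ : (X : VSub N) → δ E (extend X) ≡ δ E″ X
  δE″ X = trans (δ-≋ (extend X) eq) (piece-δ EA R′ α₁ α₂ α₃ β₁ β₂ β₃ w X (extend X)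
    (δ-cong-on (All.map (λ { (p , q) → extend-out X p , extend-out X q }) outA))
    (extend-out X hα₁) (extend-out X hα₂) (extend-out X hα₃) (extend-in X hβ₁) (extend-in X hβ₂) (extend-in X hβ₃)
    (by-side (X w) refl))
    where
    by-side : ∀ b → X w ≡ b → δ R′ (extend X) ≡ 0
    by-side b e = δ-zero b R′ (All.map (λ { (p , q) → trans (extend-in X p) e , trans (extend-in X q) e }) inR)

  module _ (H : ∀ X → X x ≡ false → (∀ v → S v ≡ true → X v ≡ true) → Some (A ∩ X) → Some (A ∩ ∁ X) → 4 ≤ δ E X) where
    private
      go : ∀ X → X x ≡ false → Two (U″ ∩ X) → Two (U″ ∩ ∁ X) → 4 ≤ δ E″ X
      go X hx (a , b , ab , ha , hb) (c , d , cd , hc , hd) = ≤-trans (by-w (bool-cases (X w))) (≤-reflexive (δE″ X))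
        where
        ex : extend X x ≡ false
        ex = trans (extend-out X xS) hx
        inA : ∀ {v} → (U″ ∩ X) v ≡ true → v ≢ w → (A ∩ X) v ≡ true
        inA {v} h nw = ∧-true (in-piece (∧-left h) (differ (∧-right {U″ v} h) hx) nw) (∧-right {U″ v} h)
        ext : ∀ {v} → (A ∩ X) v ≡ true → (A ∩ extend X) v ≡ true
        ext {v} h = ∧-true (∧-left h) (trans (extend-out X (not-true⁻ (∧-right {W v} (∧-left h)))) (∧-right {A v} h))
        AW : ∀ {v} → (A ∩ extend X) v ≡ true → (W ∩ extend X) v ≡ true
        AW {v} h = ∧-true (∧-left (∧-left h)) (∧-right {A v} h)
        by-w : (X w ≡ true) ⊎ (X w ≡ false) → 4 ≤ δ E (extend X)
        by-w (inj₂ hw) = far (extend X) ex (trans (extend-in X wS) hw)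
          (a , b , ab , AW (ext (inA ha (differ (∧-right {U″ a} ha) hw))) , AW (ext (inA hb (differ (∧-right {U″ b} hb) hw))))
        by-w (inj₁ hw) = H (extend X) ex (λ v h → trans (extend-in X h) hw) some₁ some₂
          where
          some₁ : Some (A ∩ extend X)
          some₁ = pick (a ≟ w)
            where pick : Dec (a ≡ w) → Some (A ∩ extend X)
                  pick (no ne) = a , ext (inA ha ne)
                  pick (yes e) = b , ext (inA hb λ e′ → ab (trans e (sym e′)))
          out′ : ∀ {v} → (U″ ∩ ∁ X) v ≡ true → v ≢ x → (A ∩ ∁ (extend X)) v ≡ true
          out′ {v} h nx = ∧-true av (trans (cong not (extend-out X (not-true⁻ (∧-right {W v} av)))) (∧-right {U″ v} h))
            where av = in-piece (∧-left h) nx (λ { refl → true≢false (∧-right {U″ v} h) (cong not hw) })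
          some₂ : Some (A ∩ ∁ (extend X))
          some₂ = pick (c ≟ x)
            where pick : Dec (c ≡ x) → Some (A ∩ ∁ (extend X))
                  pick (no ne) = c , out′ hc ne
                  pick (yes e) = d , out′ hd λ e′ → cd (trans e (sym e′))

    -- By complementation `x` is outside. If `w` is outside too, `far` applies; otherwise the
    -- pulled-back set contains `S` and splits the layer, the case left to `H` and settled by
    -- maximality of `S`.
    essential″ : Essential4 E″ U″
    essential″ X ins out with bool-cases (X x)
    ... | inj₂ hx = go X hx ins out
    ... | inj₁ hx = ≤-trans (go (∁ X) (cong not hx) out
            (two-mono (λ v h → ∧-true (∧-left h) (trans (dn (X v)) (∧-right {U″ v} h))) ins)) (≤-reflexive (δ-∁ E″ X))
      where dn : ∀ b → not (not b) ≡ b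
            dn true = refl
            dn false = refl

-- Maximal 3-edge-cuts

toggle : VSub N → Fin N → VSub N
toggle X v z with z ≟ v
... | yes _ = not (X z)
... | no _ = X z

toggle-at : (X : VSub N) (v : Fin N) → toggle X v v ≡ not (X v)
toggle-at X v with v ≟ v
... | yes _ = refl
... | no k = ⊥-elim (k refl)

toggle-other : (X : VSub N) {v z : Fin N} → z ≢ v → toggle X v z ≡ X z
toggle-other X {v} {z} ne with z ≟ v
... | yes e = ⊥-elim (ne e)
... | no _ = refl

opaque
  unfolding δ
  -- Moving `v` exchanges crossing and non-crossing among its three edges: with k + 1 crossing
  -- before, 2 - k cross after.
  toggle-star : (X : VSub N) (v i y z : Fin N) (R : EList N) → deg R v ≡ 0 → i ≢ v → y ≢ v → z ≢ v → X v xor X i ≡ true →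
    ∃ λ k → δ ((v , i) ∷ (v , y) ∷ (v , z) ∷ R) (toggle X v) + 2 * suc k ≡ δ ((v , i) ∷ (v , y) ∷ (v , z) ∷ R) X + 3
  toggle-star X v i y z R d ni ny nz h
    rewrite toggle-at X v | toggle-other X ni | toggle-other X ny | toggle-other X nz
          | δ-cong-on {E = R} {toggle X v} {X} (All.map (λ { (p , q) → toggle-other X p , toggle-other X q }) (deg-avoid R d)) =
    _ , alg (X v) (X i) (X y) (X z) (sumE (cr X) R) h
    where
    alg : ∀ v i y z r → v xor i ≡ true →
      χ (not v xor i) + (χ (not v xor y) + (χ (not v xor z) + r)) + 2 * suc (χ (v xor y) + χ (v xor z)) ≡
      χ (v xor i) + (χ (v xor y) + (χ (v xor z) + r)) + 3
    alg true false true true r _ = s₁ r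
      where s₁ : ∀ r → 0 + (1 + (1 + r)) + 2 ≡ 1 + (0 + (0 + r)) + 3
            s₁ = solve-∀
    alg true false true false r _ = s₁ r
      where s₁ : ∀ r → 0 + (1 + (0 + r)) + 4 ≡ 1 + (0 + (1 + r)) + 3
            s₁ = solve-∀
    alg true false false true r _ = s₁ r
      where s₁ : ∀ r → 0 + (0 + (1 + r)) + 4 ≡ 1 + (1 + (0 + r)) + 3
            s₁ = solve-∀
    alg true false false false r _ = s₁ r
      where s₁ : ∀ r → 0 + (0 + (0 + r)) + 6 ≡ 1 + (1 + (1 + r)) + 3
            s₁ = solve-∀
    alg false true true true r _ = s₁ r
      where s₁ : ∀ r → 0 + (0 + (0 + r)) + 6 ≡ 1 + (1 + (1 + r)) + 3
            s₁ = solve-∀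
    alg false true true false r _ = s₁ r
      where s₁ : ∀ r → 0 + (0 + (1 + r)) + 4 ≡ 1 + (1 + (0 + r)) + 3
            s₁ = solve-∀
    alg false true false true r _ = s₁ r
      where s₁ : ∀ r → 0 + (1 + (0 + r)) + 4 ≡ 1 + (0 + (1 + r)) + 3
            s₁ = solve-∀
    alg false true false false r _ = s₁ r
      where s₁ : ∀ r → 0 + (1 + (1 + r)) + 2 ≡ 1 + (0 + (0 + r)) + 3
            s₁ = solve-∀

-- From size 2 the move leads to 5 - 2 (k + 1), which is 3 or at most 1.
toggle-cut : {E R : EList N} {U : VSub N} → Cubic′ E U → (X : VSub N) {v i : Fin N} → E ≋ (v , i) ∷ R → X v xor X i ≡ true →
             δ E X ≡ 2 → δ E (toggle X v) ≡ 3 ⊎ δ E (toggle X v) ≤ 1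
toggle-cut {E = E} {R} G X {v} {i} eq h d = go (star₂ R v (All.tail (nl G₁)) (deg-head {z = v} R i≢v (d3 G₁ v (proj₁ (All.head (inU G₁))))))
  where
  G₁ = Cubic-≋ eq G
  i≢v : i ≢ v
  i≢v = All.head (nl G₁) ∘ sym
  arith : ∀ m k → m + 2 * suc k ≡ 5 → m ≡ 3 ⊎ m ≤ 1
  arith 3 zero _ = inj₁ refl
  arith 0 k e = inj₂ z≤n
  arith 1 k e = inj₂ ≤-refl
  arith 2 zero ()
  arith 2 (suc zero) ()
  arith 2 (suc (suc k)) e with trans (sym (+-assoc 2 0 _)) e
  ... | e′ = ⊥-elim (odd k (suc-injective (suc-injective e′)))
    where odd : ∀ k → 2 * suc (suc (suc k)) ≡ 3 → ⊥
          odd zero ()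
          odd (suc k) ()
  arith (suc (suc (suc (suc m)))) k e with suc-injective (suc-injective (suc-injective (suc-injective e)))
  ... | e′ with trans (sym e′) (+-comm m (2 * suc k))
  ... | e″ = ⊥-elim (odd k m e″)
    where odd : ∀ k m → 1 ≡ 2 * suc k + m → ⊥
          odd zero m ()
          odd (suc k) m ()
  arith 3 (suc k) e = ⊥-elim (odd k (suc-injective (suc-injective (suc-injective e))))
    where odd : ∀ k → 2 * suc (suc k) ≡ 2 → ⊥
          odd zero ()
          odd (suc k) ()
  go : Star₂ R v → δ E (toggle X v) ≡ 3 ⊎ δ E (toggle X v) ≤ 1
  go (mk₂ y z R₂ e₂ ny nz dR) with toggle-star X v i y z R₂ dR i≢v ny nz h
  ... | k , id = arith (δ E (toggle X v)) k (trans (cong (_+ 2 * suc k) (δ-≋ (toggle X v) full)) (trans id (cong (_+ 3) (trans (sym (δ-≋ X full)) d))))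
    where full = ≋-trans eq (≋-prep _ e₂)

between : VSub N → VSub N → Edge N → ℕ
between O Y (a , b) = χ (O a ∧ Y b) + χ (Y a ∧ O b)

find-between : (O Y : VSub N) (E : EList N) → 1 ≤ sumE (between O Y) E →
               ∃ λ o → ∃ λ i → ∃ λ R → E ≋ (o , i) ∷ R × O o ≡ true × Y i ≡ true
find-between O Y ((a , b) ∷ E) h with bool-cases (O a ∧ Y b) | bool-cases (Y a ∧ O b)
... | inj₁ e | _ = a , b , E , ≋-refl , ∧-left e , ∧-right {O a} e
... | inj₂ _ | inj₁ e = b , a , E , ≋-flip a b , ∧-right {Y a} e , ∧-left e
... | inj₂ e | inj₂ f rewrite e | f with find-between O Y E h
... | o , i , R , eq , p , q = o , i , (a , b) ∷ R , ≋-trans (≋-prep _ eq) (≋-swap _ _) , p , q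

data Part (O Y : VSub N) (x v : Fin N) : Set where
  inO : O v ≡ true → Y v ≡ false → (v == x) ≡ false → Part O Y x v
  inY : O v ≡ false → Y v ≡ true → (v == x) ≡ false → Part O Y x v
  isx : O v ≡ false → Y v ≡ false → v ≡ x → Part O Y x v

opaque
  unfolding δ deg
  -- O, Y and {x} partition the vertices: an edge between O and Y is counted twice on the left, an
  -- edge at `x` once, any other never.
  three-parts : (O Y : VSub N) (x : Fin N) (E : EList N) → All (λ { (a , b) → Part O Y x a × Part O Y x b }) E → NL E →
                δ E O + δ E Y ≡ deg E x + (sumE (between O Y) E + sumE (between O Y) E)
  three-parts O Y x [] [] [] = refl
  three-parts O Y x ((a , b) ∷ E) ((pa , pb) ∷ ps) (ne ∷ nes) = trans (interchange (cr O (a , b)) _ _ _)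
    (trans (cong₂ _+_ (pt pa pb ne) (three-parts O Y x E ps nes)) (e (inc x (a , b)) (between O Y (a , b)) (deg E x) _))
    where
    e : ∀ i b d s → (i + (b + b)) + (d + (s + s)) ≡ (i + d) + ((b + s) + (b + s))
    e = solve-∀
    pt : ∀ {a b} → Part O Y x a → Part O Y x b → a ≢ b →
         cr O (a , b) + cr Y (a , b) ≡ inc x (a , b) + (between O Y (a , b) + between O Y (a , b))
    pt (inO p q r) (inO p′ q′ r′) ne rewrite p | q | r | p′ | q′ | r′ = refl
    pt (inO p q r) (inY p′ q′ r′) ne rewrite p | q | r | p′ | q′ | r′ = refl
    pt (inO p q r) (isx p′ q′ refl) ne rewrite p | q | r | p′ | q′ | ==-refl x = refl
    pt (inY p q r) (inO p′ q′ r′) ne rewrite p | q | r | p′ | q′ | r′ = refl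
    pt (inY p q r) (inY p′ q′ r′) ne rewrite p | q | r | p′ | q′ | r′ = refl
    pt (inY p q r) (isx p′ q′ refl) ne rewrite p | q | r | p′ | q′ | ==-refl x = refl
    pt (isx p q refl) (inO p′ q′ r′) ne rewrite p | q | p′ | q′ | r′ | ==-refl x = refl
    pt (isx p q refl) (inY p′ q′ r′) ne rewrite p | q | p′ | q′ | r′ | ==-refl x = refl
    pt (isx p q refl) (isx p′ q′ refl) ne = ⊥-elim (ne refl)

size-strict : {S Y : VSub N} {a : Fin N} → (∀ v → S v ≡ true → Y v ≡ true) → Y a ≡ true → S a ≡ false → size S < size Y
size-strict {S = S} {Y} {a} h ya sa = ≤-trans (s≤s (size-mono {U = S} {Y ⊖ a} λ v hv → ⊖-in {U = Y} (h v hv) (differ hv sa)))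
  (≤-reflexive (sym (size-⊖ Y a ya)))

-- The 3-edge-cuts between root and target. A largest such set lies behind the layer next to the
-- root; sizes rather than inclusions are compared, and `Maximal` exploits this.
Valid : Fin N → VSub N → EList N → VSub N → Set
Valid w W E T = (∀ v → T v ≡ true → W v ≡ true) × T w ≡ true × Some (W ∩ ∁ T) × δ E T ≡ 3

valid? : (w : Fin N) (W : VSub N) (E : EList N) (T : VSub N) → Dec (Valid w W E T)
valid? w W E T = all? (λ v → (T v Boolₚ.≟ true) →-dec (W v Boolₚ.≟ true)) ×-dec (T w Boolₚ.≟ true)
  ×-dec some? (W ∩ ∁ T) ×-dec (δ E T ≟ℕ 3)
  where open import Data.Nat.Properties using () renaming (_≟_ to _≟ℕ_)

valid-cong : (w : Fin N) (W : VSub N) (E : EList N) {T T′ : VSub N} → T ≐ T′ → Valid w W E T → Valid w W E T′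
valid-cong w W E h (p , q , r , s) = (λ v hv → p v (trans (h v) hv)) , trans (sym (h w)) q ,
  some-cong (λ v → cong (λ b → W v ∧ not b) (h v)) r , trans (sym (δ-cong E h)) s

size≤ : (X : VSub N) → size X ≤ size {N} (λ _ → true)
size≤ X = size-mono {U = X} λ v _ → refl

maximal : {P : VSub N → Set} → (∀ {X Y} → X ≐ Y → P X → P Y) → (∀ X → Dec (P X)) → ∃ P →
          ∃ λ X → P X × (∀ Y → P Y → size Y ≤ size X)
maximal {N} {P} ext P? (X , p) = go (size {N} (λ _ → true)) X p (m≤n+m _ (size X))
  where
  go : ∀ k X → P X → size {N} (λ _ → true) ≤ size X + k → ∃ λ X → P X × (∀ Y → P Y → size Y ≤ size X)
  go zero X p h = X , p , λ Y _ → ≤-trans (size≤ Y) (≤-trans h (≤-reflexive (+-identityʳ _)))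
  go (suc k) X p h with search {P = λ Y → P Y × size X < size Y} (λ e (q , l) → ext e q , ≤-trans l (≤-reflexive (size-cong e)))
                         (λ Y → P? Y ×-dec (size X <? size Y))
  ... | inj₁ (Y , q , l) = go k Y q (≤-trans h (≤-trans (≤-reflexive (+-suc (size X) k)) (+-monoˡ-≤ k l)))
  ... | inj₂ none = X , p , λ Y q → ≮⇒≥ λ l → none Y (q , l)

module Maximal {N} {x w : Fin N} {W S : VSub N} {E : EList N} (Π : Pole x w W E)
               (S⊆W : ∀ v → S v ≡ true → W v ≡ true) (wS : S w ≡ true)
               (max : ∀ T → Valid w W E T → size T ≤ size S) (large : 3 + size S ≤ size W) where
  open Pole Π

  module _ (X : VSub N) (hx : X x ≡ false) (S⊆X : ∀ v → S v ≡ true → X v ≡ true)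
           (sa : Some ((W ∩ ∁ S) ∩ X)) (sb : Some ((W ∩ ∁ S) ∩ ∁ X)) where

    private
      a = proj₁ sa
      ha = proj₂ sa
      b = proj₁ sb
      hb = proj₂ sb
      Y O : VSub N
      Y = W ∩ X
      O = W ∩ ∁ X

      δY : δ E Y ≡ δ E X
      δY = δ-cong-on (All.map (λ { {p , q} (hp , hq) → agree p (⊕-case {W = W} {x} {p} hp) , agree q (⊕-case {W = W} {x} {q} hq) }) (inU cubic))
        where
        agree : ∀ v → (W v ≡ true) ⊎ (v ≡ x) → Y v ≡ X v
        agree v (inj₁ e) rewrite e = refl
        agree v (inj₂ refl) rewrite xW = sym hx

      Yw : Y w ≡ true
      Yw = ∧-true wW (S⊆X w wS)
      Yx : Y x ≡ false
      Yx = ∧-false₁ xW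
      Ob : O b ≡ true
      Ob = ∧-true (∧-left (∧-left hb)) (∧-right {(W ∩ ∁ S) b} hb)
      S⊆Y : ∀ v → S v ≡ true → Y v ≡ true
      S⊆Y v h = ∧-true (S⊆W v h) (S⊆X v h)
      S<Y : size S < size Y
      S<Y = size-strict {S = S} {Y} {a} S⊆Y (∧-true (∧-left (∧-left ha)) (∧-right {(W ∩ ∁ S) a} ha)) (not-true⁻ (∧-right {W a} (∧-left ha)))

      no3 : δ E Y ≡ 3 → ⊥
      no3 d = <⇒≱ S<Y (max Y ((λ v → ∧-left) , Yw , (b , ∧-true (∧-left Ob) (cong not (∧-false₂ {W b} (not-true⁻ (∧-right {W b} Ob))))) , d))

      part : ∀ v → (W ⊕ x) v ≡ true → Part O Y x v
      part v h = go (⊕-case {W = W} {x} {v} h) (X v) refl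
        where
        go : (W v ≡ true) ⊎ (v ≡ x) → ∀ b → X v ≡ b → Part O Y x v
        go (inj₁ e) true f = inY (∧-false₂ {W v} (cong not f)) (∧-true e f) (==-≢ (differ {X = W} e xW))
        go (inj₁ e) false f = inO (∧-true e (cong not f)) (∧-false₂ {W v} f) (==-≢ (differ {X = W} e xW))
        go (inj₂ refl) b f = isx (∧-false₁ xW) Yx refl

      parts : δ E O + δ E Y ≡ 3 + (sumE (between O Y) E + sumE (between O Y) E)
      parts = trans (three-parts O Y x E (All.map (λ { {p , q} (hp , hq) → part p hp , part q hq }) (inU cubic)) (nl cubic))
        (cong (_+ (sumE (between O Y) E + sumE (between O Y) E)) (d3 cubic x (⊕-new W x)))

      Ow : O w ≡ false
      Ow = ∧-false₂ {W w} (cong not (S⊆X w wS))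
      Ox : O x ≡ false
      Ox = ∧-false₁ xW

      W∩O : ∀ v → O v ≡ true → (W ∩ O) v ≡ true
      W∩O v h = ∧-true (∧-left {W v} h) h

      pos : ∀ {d} e → 3 ≤ d → d + 2 ≡ 3 + (e + e) → 1 ≤ e
      pos zero h eq with ≤-trans (+-monoˡ-≤ 2 h) (≤-reflexive eq)
      ... | s≤s (s≤s (s≤s ()))
      pos (suc e) h eq = s≤s z≤n

      module Two-cut (d : δ E Y ≡ 2) where

        edge : 3 ≤ δ E O → ∃ λ o → ∃ λ i → ∃ λ R → E ≋ (o , i) ∷ R × O o ≡ true × Y i ≡ true
        edge h = find-between O Y E (pos _ h (trans (cong (δ E O +_) (sym d)) parts))

        Yo : ∀ {o} → O o ≡ true → Y o ≡ false
        Yo {o} h = ∧-false₂ {W o} (not-true⁻ (∧-right {W o} h))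

        -- Moving the end `o` of an edge between O and Y into Y gives a cut of size 3 that beats
        -- `S`, or one of size at most 1 that contradicts `near`.
        many : Two O → ⊥
        many t@(p , q , pq , hp , hq) with edge (≤-trans (n≤1+n 3) (far O Ox Ow (two-mono W∩O t)))
        ... | o , i , R , eq , ho , hi = bad (toggle-cut cubic Y eq (cong₂ _xor_ (Yo ho) hi) d)
          where
          T : VSub N
          T = toggle Y o
          keep : ∀ {v} → v ≢ o → T v ≡ Y v
          keep = toggle-other Y
          Tw : T w ≡ true
          Tw = trans (keep (differ Yw (Yo ho))) Yw
          Tx : T x ≡ false
          Tx = trans (keep (differ ho Ox ∘ sym)) Yx
          To : T o ≡ true
          To = trans (toggle-at Y o) (cong not (Yo ho))
          T⊆W : ∀ v → T v ≡ true → W v ≡ true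
          T⊆W v h = go (v ≟ o)
            where go : Dec (v ≡ o) → W v ≡ true
                  go (yes refl) = ∧-left ho
                  go (no ne) = ∧-left (trans (sym (keep ne)) h)
          other : Some (W ∩ ∁ T)
          other = go (p ≟ o)
            where go : Dec (p ≡ o) → Some (W ∩ ∁ T)
                  go (yes e) = q , ∧-true (∧-left hq) (cong not (trans (keep (λ e′ → pq (trans e (sym e′)))) (Yo hq)))
                  go (no ne) = p , ∧-true (∧-left hp) (cong not (trans (keep ne) (Yo hp)))
          S<T : size S < size T
          S<T = size-strict {S = S} {T} {o} (λ v h → trans (keep (differ (S⊆Y v h) (Yo ho))) (S⊆Y v h)) To
            (¬true⇒false λ h → true≢false (S⊆Y o h) (Yo ho))
          bad : δ E T ≡ 3 ⊎ δ E T ≤ 1 → ⊥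
          bad (inj₁ e) = <⇒≱ S<T (max T (T⊆W , Tw , other , e))
          bad (inj₂ e) = <⇒≱ (s≤s e) (near T Tx Tw)

        -- Moving the only vertex of O would empty it, so `i` is moved out of Y instead. The new set
        -- still has |W| - 2 > |S| vertices; it need not contain `S`. If `i` is `w`, the set avoids
        -- the target and `far` contradicts its cut size.
        few : (∀ v → O v ≡ true → v ≡ b) → ⊥
        few one with edge (≤-reflexive (sym (δ-single cubic O b (⊕-old {W = W} {x} {b} (∧-left Ob)) Ob (λ v h → one v (∧-right {(W ⊕ x) v} h)))))
        ... | o , i , R , eq , ho , hi = bad (i ≟ w) (toggle-cut cubic Y (≋-trans eq (≋-flip o i)) (cong₂ _xor_ hi (Yo ho)) d)
          where
          T : VSub N
          T = toggle Y i
          T≐ : T ≐ Y ⊖ i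
          T≐ v = go (v ≟ i)
            where go : Dec (v ≡ i) → T v ≡ (Y ⊖ i) v
                  go (yes refl) = trans (toggle-at Y i) (trans (cong not hi) (sym (⊖-self Y i)))
                  go (no ne) = trans (toggle-other Y ne) (sym (⊖-keep Y ne))
          sizeO : size O ≡ 1
          sizeO = trans (size-⊖ O b Ob) (cong suc (zero′ (size (O ⊖ b)) (λ l → let (z , hz) = size-pick (O ⊖ b) l in ⊖-≢ {U = O} hz (one z (⊖-mem {U = O} hz)))))
            where zero′ : ∀ n → (1 ≤ n → ⊥) → n ≡ 0
                  zero′ zero k = refl
                  zero′ (suc n) k = ⊥-elim (k (s≤s z≤n))
          sizeW : size W ≡ suc (suc (size T))
          sizeW = trans (size-split W X) (trans (cong₂ _+_ (trans (size-⊖ Y i hi) (cong suc (sym (size-cong T≐)))) sizeO) (cong suc (+-comm (size T) 1)))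
          big : suc (size S) ≤ size T
          big = ≤-pred (≤-pred (≤-trans large (≤-reflexive sizeW)))
          Tx : T x ≡ false
          Tx = trans (toggle-other Y (differ hi Yx ∘ sym)) Yx
          Ti : T i ≡ false
          Ti = trans (toggle-at Y i) (cong not hi)
          T⊆W : ∀ v → T v ≡ true → W v ≡ true
          T⊆W v h = ∧-left (⊖-mem {U = Y} (trans (sym (T≐ v)) h))
          bad : Dec (i ≡ w) → δ E T ≡ 3 ⊎ δ E T ≤ 1 → ⊥
          bad (no ne) (inj₁ e) = <⇒≱ big (max T (T⊆W , trans (toggle-other Y (ne ∘ sym)) Yw , (i , ∧-true (∧-left hi) (cong not Ti)) , e))
          bad (no ne) (inj₂ e) = <⇒≱ (s≤s e) (near T Tx (trans (toggle-other Y (ne ∘ sym)) Yw))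
          bad (yes refl) h = <⇒≱ (s≤s (le h)) (far T Tx Ti (two-mono (λ v hv → ∧-true (T⊆W v hv) hv)
              (two-of-size (≤-trans (s≤s (size-pos {U = S} {w} wS)) big))))
            where le : δ E T ≡ 3 ⊎ δ E T ≤ 1 → δ E T ≤ 3
                  le (inj₁ e) = ≤-reflexive e
                  le (inj₂ e) = ≤-trans e (s≤s z≤n)

        absurd : ⊥
        absurd with two-or-one O b Ob
        ... | inj₁ t = many t
        ... | inj₂ one = few one

    -- `near` leaves the sizes 2 and 3 below 4; size 3 contradicts maximality at once, size 2 after
    -- moving one vertex.
    no-small-extension : 4 ≤ δ E X
    no-small-extension = ≤-trans (go (δ E Y) refl (near Y Yx Yw)) (≤-reflexive δY)
      where
      go : ∀ m → δ E Y ≡ m → 2 ≤ m → 4 ≤ δ E Y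
      go 2 e _ = ⊥-elim (Two-cut.absurd e)
      go 3 e _ = ⊥-elim (no3 e)
      go (suc (suc (suc (suc m)))) e _ = ≤-trans (s≤s (s≤s (s≤s (s≤s z≤n)))) (≤-reflexive (sym e))
      go (suc zero) e (s≤s ())

-- Weighted counts across a layer of two vertices

m₁ : EList N → VSub N → Fin N → ℕ
m₁ R V b = μ R (V ⊖ b)

m₃ : EList N → VSub N → Fin N → Fin N → Fin N → ℕ
m₃ R V a b c = ifn (V a ∧ ((V ⊖ a) b ∧ (V ⊖ a ⊖ b) c)) (μ R (V ⊖ a ⊖ b ⊖ c))

-- The number of perfect matchings of the rest of the graph, weighted by the ways
-- in which they extend to the part already processed.
val : EList N → VSub N → Strands N → ℕ → ℕ
val R V (strands b₁ b₂ b₃ a₁ a₂ a₃) s = a₁ * m₁ R V b₁ + a₂ * m₁ R V b₂ + a₃ * m₁ R V b₃ + s * m₃ R V b₁ b₂ b₃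

m₁-cong : (R : EList N) {V V′ : VSub N} → V ≐ V′ → ∀ b → m₁ R V b ≡ m₁ R V′ b
m₁-cong R {V} {V′} h b = μ-cong R (⊖-cong {U = V} {V′} b h)

m₃-cong : (R : EList N) {V V′ : VSub N} → V ≐ V′ → ∀ a b c → m₃ R V a b c ≡ m₃ R V′ a b c
m₃-cong R {V} {V′} h a b c = cong₂ ifn (cong₂ _∧_ (h a) (cong₂ _∧_ (h₁ b) (h₂ c)))
  (μ-cong R (⊖-cong {U = V ⊖ a ⊖ b} {V′ ⊖ a ⊖ b} c h₂))
  where
  h₁ : V ⊖ a ≐ V′ ⊖ a
  h₁ = ⊖-cong {U = V} {V′} a h
  h₂ : V ⊖ a ⊖ b ≐ V′ ⊖ a ⊖ b
  h₂ = ⊖-cong {U = V ⊖ a} {V′ ⊖ a} b h₁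

val-cong : (R : EList N) {V V′ : VSub N} → V ≐ V′ → ∀ σ s → val R V σ s ≡ val R V′ σ s
val-cong R h (strands b₁ b₂ b₃ a₁ a₂ a₃) s
  rewrite m₁-cong R h b₁ | m₁-cong R h b₂ | m₁-cong R h b₃ | m₃-cong R h b₁ b₂ b₃ = refl

m₃-cycle : (R : EList N) (V : VSub N) (a b c : Fin N) → m₃ R V a b c ≡ m₃ R V b c a
m₃-cycle R V a b c = ifn-ext (λ h → to h) from (λ _ → μ-cong R λ v →
    trans (⊖-comm (V ⊖ a) b c v) (trans (⊖-cong {U = V ⊖ a ⊖ c} {V ⊖ c ⊖ a} b (⊖-comm V a c) v)
      (trans (⊖-comm (V ⊖ c) a b v) (⊖-cong {U = V ⊖ c ⊖ b} {V ⊖ b ⊖ c} a (⊖-comm V c b) v))))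
  where
  to : V a ∧ ((V ⊖ a) b ∧ (V ⊖ a ⊖ b) c) ≡ true → V b ∧ ((V ⊖ b) c ∧ (V ⊖ b ⊖ c) a) ≡ true
  to h with ∧-left {V a} h | ∧-left {(V ⊖ a) b} (∧-right {V a} h) | ⊖₂-mem V {a} {b} {c} (∧-right {(V ⊖ a) b} (∧-right {V a} h))
  ... | va | vb | vc , ca , cb = ∧-true (⊖-mem {U = V} vb) (∧-true (⊖-in {U = V} vc cb) (⊖₂-in V va (⊖-≢ {U = V} vb ∘ sym) (ca ∘ sym)))
  from : V b ∧ ((V ⊖ b) c ∧ (V ⊖ b ⊖ c) a) ≡ true → V a ∧ ((V ⊖ a) b ∧ (V ⊖ a ⊖ b) c) ≡ true
  from h with ∧-left {V b} h | ∧-left {(V ⊖ b) c} (∧-right {V b} h) | ⊖₂-mem V {b} {c} {a} (∧-right {(V ⊖ b) c} (∧-right {V b} h))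
  ... | vb | vc | va , ab , ac = ∧-true va (∧-true (⊖-in {U = V} vb (ab ∘ sym)) (⊖₂-in V (⊖-mem {U = V} vc) (ac ∘ sym) (⊖-≢ {U = V} vc)))

val-rot : ∀ i (R : EList N) (V : VSub N) σ s → val R V (rot i σ) s ≡ val R V σ s
val-rot r₀ R V σ s = refl
val-rot r₁ R V (strands b₁ b₂ b₃ a₁ a₂ a₃) s rewrite m₃-cycle R V b₁ b₂ b₃ =
  cyc (a₁ * m₁ R V b₁) (a₂ * m₁ R V b₂) (a₃ * m₁ R V b₃) _
  where cyc : ∀ a b c d → b + c + a + d ≡ a + b + c + d
        cyc = solve-∀
val-rot r₂ R V (strands b₁ b₂ b₃ a₁ a₂ a₃) s rewrite sym (m₃-cycle R V b₃ b₁ b₂) =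
  cyc (a₁ * m₁ R V b₁) (a₂ * m₁ R V b₂) (a₃ * m₁ R V b₃) _
  where cyc : ∀ a b c d → c + a + b + d ≡ a + b + c + d
        cyc = solve-∀

module _ {R R′ : EList N} {W : VSub N} {p q p′ q′ g : Fin N} (eq : R ≋ (p , q) ∷ (p , p′) ∷ (q , q′) ∷ R′)
         (hp : W p ≡ true) (hq : W q ≡ true) (p≢q : p ≢ q)
         (hp′ : (W ⊖ p ⊖ q) p′ ≡ true) (hq′ : (W ⊖ p ⊖ q) q′ ≡ true) (hg : (W ⊖ p ⊖ q) g ≡ true) where

  private
    S = W ⊖ p ⊖ q
    mp′ = ⊖₂-mem W {p} {q} {p′} hp′
    mq′ = ⊖₂-mem W {p} {q} {q′} hq′
    mg = ⊖₂-mem W {p} {q} {g} hg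

    first : m₁ R′ S q′ ≤ m₁ R W p
    first = ≤-trans (μ-use {R = R′} ≋-refl (⊖-in {U = W} hq (p≢q ∘ sym)) (⊖-in {U = W} (proj₁ mq′) (proj₁ (proj₂ mq′))))
      (μ-sub {R = (q , q′) ∷ R′} ((p , q) ∷ (p , p′) ∷ []) (W ⊖ p) eq)

    second : m₁ R′ S p′ ≤ m₁ R W q
    second = ≤-trans (≤-reflexive (m₁-cong R′ (⊖-comm W p q) p′))
      (≤-trans (μ-use {R = R′} ≋-refl (⊖-in {U = W} hp p≢q) (⊖-in {U = W} (proj₁ mp′) (proj₂ (proj₂ mp′))))
        (μ-sub {R = (p , p′) ∷ R′} ((p , q) ∷ (q , q′) ∷ []) (W ⊖ q) (≋-trans eq (≋-prep _ (≋-swap _ _)))))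

    gpq : W ⊖ g ⊖ p ⊖ q ≐ S ⊖ g
    gpq v = trans (⊖-cong {U = W ⊖ g ⊖ p} {W ⊖ p ⊖ g} q (⊖-comm W g p) v) (⊖-comm (W ⊖ p) g q v)

    hpg : (W ⊖ g) p ≡ true
    hpg = ⊖-in {U = W} hp (proj₁ (proj₂ mg) ∘ sym)
    hqg : (W ⊖ g) q ≡ true
    hqg = ⊖-in {U = W} hq (proj₂ (proj₂ mg) ∘ sym)

    all-three : m₃ R′ S q′ p′ g ≤ μ ((p , p′) ∷ (q , q′) ∷ R′) (W ⊖ g)
    all-three with bool-cases (S q′ ∧ ((S ⊖ q′) p′ ∧ (S ⊖ q′ ⊖ p′) g))
    ... | inj₂ e = ≤-trans (≤-reflexive (ifn-false _ e)) z≤n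
    ... | inj₁ e = ≤-trans (≤-reflexive (trans (ifn-true _ e) (μ-cong R′ perm)))
        (≤-trans (μ-use {R = R′} ≋-refl (⊖₂-in (W ⊖ g) hqg (p≢q ∘ sym) (proj₂ (proj₂ mp′) ∘ sym))
                   (⊖₂-in (W ⊖ g) (⊖-in {U = W} (proj₁ mq′) q′≢g) (proj₁ (proj₂ mq′)) q′≢p′))
          (μ-use {R = (q , q′) ∷ R′} ≋-refl hpg (⊖-in {U = W} (proj₁ mp′) p′≢g)))
      where
      g∉ : S g ≡ true × g ≢ q′ × g ≢ p′
      g∉ = ⊖₂-mem S {q′} {p′} {g} (∧-right {(S ⊖ q′) p′} (∧-right {S q′} e))
      q′≢g = proj₁ (proj₂ g∉) ∘ sym
      p′≢g = proj₂ (proj₂ g∉) ∘ sym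
      q′≢p′ : q′ ≢ p′
      q′≢p′ = ⊖-≢ {U = S} (∧-left (∧-right {S q′} e)) ∘ sym
      perm : S ⊖ q′ ⊖ p′ ⊖ g ≐ W ⊖ g ⊖ p ⊖ p′ ⊖ q ⊖ q′
      perm v = trans (⊖-comm (S ⊖ q′) p′ g v) (trans (⊖-cong {U = S ⊖ q′ ⊖ g} {S ⊖ g ⊖ q′} p′ (⊖-comm S q′ g) v)
        (trans (⊖-comm (S ⊖ g) q′ p′ v) (⊖-cong {U = S ⊖ g ⊖ p′} {W ⊖ g ⊖ p ⊖ p′ ⊖ q} q′ (λ v → trans
          (⊖-cong {U = S ⊖ g} {W ⊖ g ⊖ p ⊖ q} p′ (≐-sym {U = W ⊖ g ⊖ p ⊖ q} {S ⊖ g} gpq) v) (⊖-comm (W ⊖ g ⊖ p) q p′ v)) v)))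

    third : m₁ R′ S g + m₃ R′ S q′ p′ g ≤ m₁ R W g
    third = ≤-trans (≤-trans (≤-reflexive (+-comm (m₁ R′ S g) _)) (+-mono-≤ all-three (≤-trans (≤-reflexive (sym (μ-cong R′ gpq)))
        (≤-trans (μ-sub {R = R′} ((p , p′) ∷ (q , q′) ∷ []) _ ≋-refl) ≤-refl))))
      (≤-reflexive (trans (sym (μ-live ((p , p′) ∷ (q , q′) ∷ R′) hpg hqg)) (sym (μ-≋ eq (W ⊖ g)))))

    fourth : m₁ R′ S g ≤ m₃ R W p q g
    fourth = ≤-trans (μ-sub {R = R′} ((p , q) ∷ (p , p′) ∷ (q , q′) ∷ []) (S ⊖ g) eq)
      (≤-reflexive (sym (ifn-true _ (∧-true hp (∧-true (⊖-in {U = W} hq (p≢q ∘ sym)) hg)))))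

  -- `first` and `second` follow one strand past the rung, `third` counts both ways to cover `p` and
  -- `q` when `g` is used, and `fourth` treats the matchings that use all three strands.
  rung-val : ∀ a₁ a₂ a₃ s → val R′ (W ⊖ p ⊖ q) (strands q′ p′ g a₁ a₂ (a₃ + s)) a₃ ≤ val R W (strands p q g a₁ a₂ a₃) s
  rung-val a₁ a₂ a₃ s = ≤-trans (≤-reflexive (e a₁ a₂ a₃ s (m₁ R′ S q′) (m₁ R′ S p′) (m₁ R′ S g) (m₃ R′ S q′ p′ g)))
    (+-mono-≤ (+-mono-≤ (+-mono-≤ (*-monoʳ-≤ a₁ first) (*-monoʳ-≤ a₂ second)) (*-monoʳ-≤ a₃ third)) (*-monoʳ-≤ s fourth))
    where
    e : ∀ a b c s x y z t → a * x + b * y + (c + s) * z + c * t ≡ a * x + b * y + c * (z + t) + s * z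
    e = solve-∀

neck-arith : ∀ {A₁ A₂ A₃ X Y Z} a₁ a₂ a₃ k l → X + Y ≤ A₁ → X + Y ≤ A₂ → Z ≤ A₃ →
             (a₁ + a₂) * X + (a₁ + a₂) * Y + a₃ * Z + 0 * k ≤ a₁ * A₁ + a₂ * A₂ + a₃ * A₃ + l
neck-arith {A₁} {A₂} {A₃} {X} {Y} {Z} a₁ a₂ a₃ k l h₁ h₂ h₃ = ≤-trans (≤-reflexive (e a₁ a₂ a₃ X Y Z))
  (≤-trans (+-mono-≤ (+-mono-≤ (*-monoʳ-≤ a₁ h₁) (*-monoʳ-≤ a₂ h₂)) (*-monoʳ-≤ a₃ h₃)) (m≤m+n _ l))
  where
  e : ∀ a b c x y z → (a + b) * x + (a + b) * y + c * z + 0 ≡ a * (x + y) + b * (x + y) + c * z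
  e = solve-∀

-- A strand covering `p` leaves `q` to `β` or `γ`; the strand at `g` leaves `p` and `q` to each
-- other.
neck-val : {R R′ : EList N} {W : VSub N} {p q β γ g : Fin N} → R ≋ (p , q) ∷ (q , β) ∷ (q , γ) ∷ R′ → deg R′ q ≡ 0 →
           W p ≡ true → W q ≡ true → p ≢ q → (W ⊖ p ⊖ q) β ≡ true → (W ⊖ p ⊖ q) γ ≡ true → (W ⊖ p ⊖ q) g ≡ true →
           ∀ a₁ a₂ a₃ s → val R′ (W ⊖ p ⊖ q) (strands β γ g (a₁ + a₂) (a₁ + a₂) a₃) 0 ≤ val R W (strands p p g a₁ a₂ a₃) s
neck-val {R = R} {R′} {W} {p} {q} {β} {γ} {g} eq dq hp hq p≢q hβ hγ hg a₁ a₂ a₃ s = neck-arith a₁ a₂ a₃ 0 _ first first third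
  where
  S = W ⊖ p ⊖ q
  mg = ⊖₂-mem W {p} {q} {g} hg
  inWp : ∀ {v} → S v ≡ true → (W ⊖ p) v ≡ true
  inWp {v} h = ⊖-mem {U = W ⊖ p} {q} {v} h
  hq′ : (W ⊖ p) q ≡ true
  hq′ = ⊖-in {U = W} hq (p≢q ∘ sym)
  first : m₁ R′ S β + m₁ R′ S γ ≤ m₁ R W p
  first = ≤-trans (≤-reflexive (sym (trans (μ-star₂ q β γ R′ dq hq′) (cong₂ _+_ (μₑ-live R′ hq′ (inWp hβ)) (μₑ-live R′ hq′ (inWp hγ))))))
    (μ-sub {R = (q , β) ∷ (q , γ) ∷ R′} ((p , q) ∷ []) (W ⊖ p) eq)
  third : m₁ R′ S g ≤ m₁ R W g
  third = ≤-trans (≤-reflexive (μ-cong R′ λ v → sym (trans (⊖-cong {U = W ⊖ g ⊖ p} {W ⊖ p ⊖ g} q (⊖-comm W g p) v) (⊖-comm (W ⊖ p) g q v))))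
    (≤-trans (μ-sub {R = R′} ((q , β) ∷ (q , γ) ∷ []) (W ⊖ g ⊖ p ⊖ q) ≋-refl)
      (μ-use {R = (q , β) ∷ (q , γ) ∷ R′} eq (⊖-in {U = W} hp (proj₁ (proj₂ mg) ∘ sym)) (⊖-in {U = W} hq (proj₂ (proj₂ mg) ∘ sym))))

-- The variant in which the third strand enters at `q`: using it sends `p` to `α`.
neck-val′ : {R R′ : EList N} {W : VSub N} {p q α β γ : Fin N} → R ≋ (p , α) ∷ (q , β) ∷ (q , γ) ∷ R′ → deg R′ q ≡ 0 →
           W p ≡ true → W q ≡ true → p ≢ q → (W ⊖ p ⊖ q) α ≡ true → (W ⊖ p ⊖ q) β ≡ true → (W ⊖ p ⊖ q) γ ≡ true →
           ∀ a₁ a₂ a₃ s → val R′ (W ⊖ p ⊖ q) (strands β γ α (a₁ + a₂) (a₁ + a₂) a₃) 0 ≤ val R W (strands p p q a₁ a₂ a₃) s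
neck-val′ {R = R} {R′} {W} {p} {q} {α} {β} {γ} eq dq hp hq p≢q hα hβ hγ a₁ a₂ a₃ s = neck-arith a₁ a₂ a₃ 0 _ first first third
  where
  S = W ⊖ p ⊖ q
  mα = ⊖₂-mem W {p} {q} {α} hα
  inWp : ∀ {v} → S v ≡ true → (W ⊖ p) v ≡ true
  inWp {v} h = ⊖-mem {U = W ⊖ p} {q} {v} h
  hq′ : (W ⊖ p) q ≡ true
  hq′ = ⊖-in {U = W} hq (p≢q ∘ sym)
  first : m₁ R′ S β + m₁ R′ S γ ≤ m₁ R W p
  first = ≤-trans (≤-reflexive (sym (trans (μ-star₂ q β γ R′ dq hq′) (cong₂ _+_ (μₑ-live R′ hq′ (inWp hβ)) (μₑ-live R′ hq′ (inWp hγ))))))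
    (μ-sub {R = (q , β) ∷ (q , γ) ∷ R′} ((p , α) ∷ []) (W ⊖ p) eq)
  third : m₁ R′ S α ≤ m₁ R W q
  third = ≤-trans (≤-reflexive (m₁-cong R′ (⊖-comm W p q) α))
    (≤-trans (μ-sub {R = R′} ((q , β) ∷ (q , γ) ∷ []) (W ⊖ q ⊖ p ⊖ α) ≋-refl)
      (μ-use {R = (q , β) ∷ (q , γ) ∷ R′} eq (⊖-in {U = W} hp p≢q) (⊖-in {U = W} (proj₁ mα) (proj₂ (proj₂ mα)))))

-- Layers with at least three vertices: the transfer matrix

opaque
  unfolding deg
  root-deg⁻ : (R : EList N) (b₁ b₂ b₃ x : Fin N) → b₁ ≢ x → b₂ ≢ x → b₃ ≢ x → deg ((x , b₁) ∷ (x , b₂) ∷ (x , b₃) ∷ R) x ≡ 3 → deg R x ≡ 0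
  root-deg⁻ R b₁ b₂ b₃ x n₁ n₂ n₃ d rewrite ==-refl x | ==-≢ n₁ | ==-≢ n₂ | ==-≢ n₃ = suc-injective (suc-injective (suc-injective d))

-- The matchings of the contracted layer through the edge from the root to `φ`; for an end in the
-- layer this is a row sum of the transfer matrix.
row : Fin N → VSub N → EList N → Fin N → ℕ
row x U R φ = μ R (U ⊖ x ⊖ φ)

SmallerGraphs : ℕ → ℕ → ℕ → ℕ → ℕ → Set
SmallerGraphs N P Q c n = (E : EList N) (U : VSub N) → 5 ≤ size U → size U < n → Cubic′ E U → Essential4 E U →
  ∀ e R → E ≋ e ∷ R → P * size U + 2 * Q ≤ Q * μ R U + c

module Rows {N} {E : EList N} {U : VSub N} (G : Cubic′ E U) (C : Essential4 E U) (h : 5 ≤ size U) (x : Fin N) where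

  private
    deg-root : (b₁ b₂ b₃ : Fin N) (R : EList N) → E ≋ (x , b₁) ∷ (x , b₂) ∷ (x , b₃) ∷ R → deg R x ≡ 0
    deg-root b₁ b₂ b₃ R eq with Cubic-≋ eq G
    ... | G′ with nl G′ | inU G′
    ... | n₁ ∷ n₂ ∷ n₃ ∷ _ | (hx , _) ∷ _ = root-deg⁻ R b₁ b₂ b₃ x (n₁ ∘ sym) (n₂ ∘ sym) (n₃ ∘ sym) (d3 G′ x hx)

  pair : (b₁ b₂ b₃ : Fin N) (R : EList N) → E ≋ (x , b₁) ∷ (x , b₂) ∷ (x , b₃) ∷ R →
         μ ((x , b₂) ∷ (x , b₃) ∷ R) U ≡ row x U R b₂ + row x U R b₃
  pair b₁ b₂ b₃ R eq with inU (Cubic-≋ eq G)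
  ... | (hx , _) ∷ (_ , h₂) ∷ (_ , h₃) ∷ _ = trans (μ-star₂ x b₂ b₃ R (deg-root b₁ b₂ b₃ R eq) hx)
    (cong₂ _+_ (μₑ-live R hx h₂) (μₑ-live R hx h₃))

  -- `two-matchings` avoids two edges at the root, which forces the third.
  row≥2 : (b₁ b₂ b₃ : Fin N) (R : EList N) → E ≋ (x , b₁) ∷ (x , b₂) ∷ (x , b₃) ∷ R → 2 ≤ row x U R b₃
  row≥2 b₁ b₂ b₃ R eq with inU (Cubic-≋ eq G)
  ... | (hx , _) ∷ _ ∷ (_ , h₃) ∷ _ = ≤-trans
    (two-matchings G C h b₁ x b₂ ((x , b₃) ∷ R) (≋-trans eq (≋-flip x b₁)))
    (≤-reflexive (trans (μ-star₁ x b₃ R (deg-root b₁ b₂ b₃ R eq) hx) (μₑ-live R hx h₃)))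

  -- With a cut edge as `e` this shows that the other outgoing weights do not both vanish.
  row-pos : (b₁ b₂ b₃ : Fin N) (e : Edge N) (R : EList N) → E ≋ (x , b₁) ∷ e ∷ (x , b₂) ∷ (x , b₃) ∷ R →
            1 ≤ row x U R b₂ + row x U R b₃
  row-pos b₁ b₂ b₃ e R eq = ≤-trans (two-avoidable G (essential4⇒bridgeless G C) (x , b₁) e ((x , b₂) ∷ (x , b₃) ∷ R) eq)
    (≤-reflexive (trans (μ-star₂ x b₂ b₃ R dR hx) (cong₂ _+_ (μₑ-live R hx h₂) (μₑ-live R hx h₃))))
    where
    eq′ = ≋-trans eq (≋-prep _ (≋-trans (≋-swap _ _) (≋-prep _ (≋-swap _ _))))
    I = inU (Cubic-≋ eq′ G)
    hx = proj₁ (All.head I)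
    h₂ = proj₂ (All.head (All.tail I))
    h₃ = proj₂ (All.head (All.tail (All.tail I)))
    dR : deg R x ≡ 0
    dR = proj₂ (deg-∷-zero e {R} (deg-root b₁ b₂ b₃ (e ∷ R) eq′))

doubled : ∀ a₁ a₂ a₃ {ρ₁ ρ₂ ρ₃} → 2 ≤ ρ₁ → 2 ≤ ρ₂ → 2 ≤ ρ₃ → (a₁ + a₂ + a₃) + (a₁ + a₂ + a₃) ≤ a₁ * ρ₁ + a₂ * ρ₂ + a₃ * ρ₃
doubled a b c h₁ h₂ h₃ = ≤-trans (≤-reflexive (e a b c)) (+-mono-≤ (+-mono-≤ (*-monoʳ-≤ a h₁) (*-monoʳ-≤ b h₂)) (*-monoʳ-≤ c h₃))
  where e : ∀ a b c → (a + b + c) + (a + b + c) ≡ a * 2 + b * 2 + c * 2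
        e = solve-∀

-- a + r ≤ a r + 1 for positive a and r turns a sum of two rows into a summand.
gain : ∀ Q c X {a₁ a₂ a₃ ρ₁ ρ₂ ρ₃} → Supported a₁ a₂ a₃ → 2 ≤ ρ₁ → 2 ≤ ρ₂ → 2 ≤ ρ₃ →
  X + 2 * Q ≤ Q * (ρ₁ + ρ₂) + c → X + 2 * Q ≤ Q * (ρ₂ + ρ₃) + c → X + 2 * Q ≤ Q * (ρ₁ + ρ₃) + c →
  Q * (a₁ + a₂ + a₃) + X ≤ Q * (a₁ * ρ₁ + a₂ * ρ₂ + a₃ * ρ₃) + c
gain Q c X {a₁} {a₂} {a₃} {ρ₁} {ρ₂} {ρ₃} sup h₁ h₂ h₃ k₁₂ k₂₃ k₁₃ = cases a₁ a₂ a₃ sup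
  where
  up : ∀ {r} a → 2 ≤ r → suc a + r ≤ suc a * r + 1
  up {r} a h = ≤-trans (≤-reflexive (e a r)) (≤-trans (+-monoˡ-≤ 1 (+-monoʳ-≤ r (≤-trans (≤-reflexive (sym (*-identityʳ a))) (*-monoʳ-≤ a (≤-trans (s≤s z≤n) h))))) ≤-refl)
    where e : ∀ a r → suc a + r ≡ r + a + 1
          e = solve-∀
  flat : ∀ {r} a → 2 ≤ r → a ≤ a * r
  flat a h = ≤-trans (≤-reflexive (sym (*-identityʳ a))) (*-monoʳ-≤ a (≤-trans (s≤s z≤n) h))
  combine : ∀ {a b d r s A B D} → a + r ≤ A + 1 → b + s ≤ B + 1 → d ≤ D → X + 2 * Q ≤ Q * (r + s) + c →
            Q * (a + b + d) + X ≤ Q * (A + B + D) + c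
  combine {a} {b} {d} {r} {s} {A} {B} {D} p q t k = lin
    {Q * (a + r + (b + s) + d) + (X + 2 * Q)} {Q * (A + 1 + (B + 1) + D) + (Q * (r + s) + c)} 0
    (+-mono-≤ (*-monoʳ-≤ Q (+-mono-≤ (+-mono-≤ p q) t)) k) (e Q X c a b d r s A B D)
    where e : ∀ Q X c a b d r s A B D → Q * (a + b + d) + X + (Q * (A + 1 + (B + 1) + D) + (Q * (r + s) + c)) + 0 ≡
              Q * (A + B + D) + c + (Q * (a + r + (b + s) + d) + (X + 2 * Q))
          e = solve-∀
  perm : ∀ a b c → a + b + c ≡ b + c + a
  perm = solve-∀
  perm′ : ∀ a b c → a + b + c ≡ a + c + b
  perm′ = solve-∀
  cases : ∀ a₁ a₂ a₃ → Supported a₁ a₂ a₃ → Q * (a₁ + a₂ + a₃) + X ≤ Q * (a₁ * ρ₁ + a₂ * ρ₂ + a₃ * ρ₃) + c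
  cases (suc a) (suc b) d _ = combine {suc a} {suc b} {d} {ρ₁} {ρ₂} (up a h₁) (up b h₂) (flat d h₃) k₁₂
  cases zero (suc b) (suc d) _ = subst₂ (λ s t → Q * s + X ≤ Q * t + c) (sym (perm 0 (suc b) (suc d))) (sym (perm 0 (suc b * ρ₂) (suc d * ρ₃)))
    (combine {suc b} {suc d} {0} {ρ₂} {ρ₃} (up b h₂) (up d h₃) z≤n k₂₃)
  cases (suc a) zero (suc d) _ = subst₂ (λ s t → Q * s + X ≤ Q * t + c) (sym (perm′ (suc a) 0 (suc d))) (sym (perm′ (suc a * ρ₁) 0 (suc d * ρ₃)))
    (combine {suc a} {suc d} {0} {ρ₁} {ρ₃} (up a h₁) (up d h₃) z≤n k₁₃)
  cases zero zero a₃ (() , _)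
  cases a₁ zero zero (_ , () , _)
  cases zero a₂ zero (_ , _ , ())

module Transfer {N} (w : Fin N) (W S : VSub N) (S⊆W : ∀ v → S v ≡ true → W v ≡ true) (wS : S w ≡ true)
                (RA R′ : EList N) (inA : Inside (∁ S) RA) (inR : Inside S R′) where

  A : VSub N
  A = W ∩ ∁ S

  -- With `V` the layer without an entry vertex, this is an entry of the transfer matrix: `α` is
  -- covered by its outgoing edge and the rest is matched within.
  τ : VSub N → Fin N → ℕ
  τ V α = ifn (V α) (μ RA (V ⊖ α))

  rowsum : VSub N → List (Fin N) → ℕ
  rowsum V [] = 0
  rowsum V (α ∷ αs) = rowsum V αs + τ V α

  hang : List (Fin N) → EList N
  hang [] = RA
  hang (α ∷ αs) = (α , w) ∷ hang αs

  private
    dRAw : deg RA w ≡ 0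
    dRAw = avoid-deg RA (All.map (λ { (p , q) → differ wS (not-true⁻ p) ∘ sym , differ wS (not-true⁻ q) ∘ sym }) inA)

  hang-dead : (αs : List (Fin N)) {V : VSub N} → V w ≡ false → μ (hang αs) V ≡ μ RA V
  hang-dead [] h = refl
  hang-dead (α ∷ αs) {V} h = trans (μ-deadʳ {U = V} {α} {w} (hang αs) h) (hang-dead αs h)

  hang-row : (αs : List (Fin N)) {V : VSub N} → All (λ α → α ≢ w) αs → V w ≡ true → μ (hang αs) V ≡ rowsum (V ⊖ w) αs
  hang-row [] {V} _ h = μ-isolated RA dRAw h
  hang-row (α ∷ αs) {V} (ne ∷ nes) h = trans (μ-step α w (hang αs) V)
    (cong₂ _+_ (hang-row αs nes h) (ifn-ext
      (λ e → ⊖-in {U = V} (∧-left e) ne) (λ e → ∧-true (⊖-mem {U = V} e) h)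
      (λ _ → trans (hang-dead αs (⊖-self (V ⊖ α) w)) (μ-cong RA (⊖-comm V α w)))))

  rowsum-cong : (αs : List (Fin N)) {V V′ : VSub N} → V ≐ V′ → rowsum V αs ≡ rowsum V′ αs
  rowsum-cong [] h = refl
  rowsum-cong (α ∷ αs) {V} {V′} h = cong₂ _+_ (rowsum-cong αs h) (cong₂ ifn (h α) (μ-cong RA (⊖-cong {U = V} {V′} α h)))

  module Root (x : Fin N) (xW : W x ≡ false) where
    U : VSub N
    U = A ⊕ w ⊕ x

    private
      Aw : A w ≡ false
      Aw = ∧-false₂ {W w} (cong not wS)
      w≢x : w ≢ x
      w≢x = differ (S⊆W w wS) xW
      Ax : (A ⊕ w) x ≡ false
      Ax = ∨-false (∧-false₁ xW) (==-≢ (w≢x ∘ sym))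

    row-inner : (αs : List (Fin N)) (b : Fin N) → All (λ α → α ≢ w) αs → b ≢ w → row x U (hang αs) b ≡ rowsum (A ⊖ b) αs
    row-inner αs b nes ne = trans (μ-cong (hang αs) (⊖-cong {U = U ⊖ x} {A ⊕ w} b (⊕-⊖ (A ⊕ w) x Ax)))
      (trans (hang-row αs nes (⊖-in {U = A ⊕ w} (⊕-new A w) (ne ∘ sym)))
        (rowsum-cong αs λ v → trans (⊖-comm (A ⊕ w) b w v) (⊖-cong {U = A ⊕ w ⊖ w} {A} b (⊕-⊖ A w Aw) v)))

    row-passing : (αs : List (Fin N)) → row x U (hang αs) w ≡ μ RA A
    row-passing αs = trans (hang-dead αs (⊖-self (U ⊖ x) w))
      (μ-cong RA λ v → trans (⊖-cong {U = U ⊖ x} {A ⊕ w} w (⊕-⊖ (A ⊕ w) x Ax) v) (⊕-⊖ A w Aw v))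

  private
    factor : {V : VSub N} → μ (RA ++ R′) V ≡ μ RA (V ∩ ∁ S) * μ R′ (V ∩ ∁ (∁ S))
    factor {V} = μ-++ (∁ S) RA R′ V inA (All.map (λ { (p , q) → cong not p , cong not q }) inR)

    W∩S : W ∩ ∁ (∁ S) ≐ S
    W∩S v = bool-ext (λ h → trans (sym (dn (S v))) (∧-right {W v} h)) (λ h → ∧-true (S⊆W v h) (trans (dn (S v)) h))
      where dn : ∀ b → not (not b) ≡ b
            dn true = refl
            dn false = refl

  -- Only matchings that cross to `S` exactly once are counted; by `factor` each cut edge
  -- contributes a matrix entry times a count beyond the cut.
  cut-lower : (C : EList N) (b : Fin N) → All (λ { (α , β) → S α ≡ false × S β ≡ true }) C → S b ≡ false →
              sumE (λ { (α , β) → τ (A ⊖ b) α * m₁ R′ S β }) C ≤ μ (C ++ (RA ++ R′)) (W ⊖ b)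
  cut-lower [] b [] hb = z≤n
  cut-lower ((α , β) ∷ C) b ((hα , hβ) ∷ hs) hb = ≤-trans (+-mono-≤ term (cut-lower C b hs hb))
    (≤-reflexive (trans (+-comm (ifn ((W ⊖ b) α ∧ (W ⊖ b) β) (μ (C ++ (RA ++ R′)) (W ⊖ b ⊖ α ⊖ β))) (μ (C ++ (RA ++ R′)) (W ⊖ b))) (sym (μ-step α β (C ++ (RA ++ R′)) (W ⊖ b)))))
    where
    V : VSub N
    V = W ⊖ b
    term : τ (A ⊖ b) α * m₁ R′ S β ≤ ifn (V α ∧ V β) (μ (C ++ (RA ++ R′)) (V ⊖ α ⊖ β))
    term with bool-cases ((A ⊖ b) α)
    ... | inj₂ e rewrite e = z≤n
    ... | inj₁ e rewrite e = ≤-trans (≤-reflexive (sym (trans factor (cong₂ _*_ (μ-cong RA s₁) (μ-cong R′ s₂)))))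
      (≤-trans (μ-mono-++ C (RA ++ R′) _) (≤-reflexive (sym (ifn-true _
        (∧-true (⊖-in {U = W} (∧-left (⊖-mem {U = A} e)) (⊖-≢ {U = A} e)) (⊖-in {U = W} (S⊆W β hβ) (differ hβ hb)))))))
      where
      s₁ : (V ⊖ α ⊖ β) ∩ ∁ S ≐ A ⊖ b ⊖ α
      s₁ v = trans (∩-⊖-out (V ⊖ α) (∁ S) {β} (cong not hβ) v) (∩-⊖₂ W (∁ S) b α v)
      s₂ : (V ⊖ α ⊖ β) ∩ ∁ (∁ S) ≐ S ⊖ β
      s₂ v = trans (∩-⊖ (V ⊖ α) (∁ (∁ S)) β v) (⊖-cong {U = (V ⊖ α) ∩ ∁ (∁ S)} {S} β
        (λ v → trans (∩-⊖₂-out W (∁ (∁ S)) (cong (not ∘ not) hb) (cong (not ∘ not) hα) v) (W∩S v)) v)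

  pass-lower : (C : EList N) (b : Fin N) → S b ≡ true → μ RA A * m₁ R′ S b ≤ μ (C ++ (RA ++ R′)) (W ⊖ b)
  pass-lower C b hb = ≤-trans (≤-reflexive (sym (trans factor (cong₂ _*_ (μ-cong RA s₁) (μ-cong R′ s₂))))) (μ-mono-++ C (RA ++ R′) (W ⊖ b))
    where
    s₁ : (W ⊖ b) ∩ ∁ S ≐ A
    s₁ = ∩-⊖-out W (∁ S) (cong not hb)
    s₂ : (W ⊖ b) ∩ ∁ (∁ S) ≐ S ⊖ b
    s₂ v = trans (∩-⊖ W (∁ (∁ S)) b v) (⊖-cong {U = W ∩ ∁ (∁ S)} {S} b W∩S v)

record BigStep {N} (P Q c n : ℕ) (R R′ : EList N) (W S : VSub N) (σ : Strands N) (s : ℕ) (β₁ β₂ β₃ : Fin N) : Set where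
  field
    x₁ x₂ x₃ : ℕ
  σ′ : Strands N
  σ′ = strands β₁ β₂ β₃ x₁ x₂ x₃
  field
    support : Support σ′
    double : total σ + total σ ≤ total σ′
    profit : Q * total σ + P * n ≤ Q * total σ′ + c
    value : val R′ S σ′ 0 ≤ val R W σ s

-- At most one aᵢ vanishes, so two of the sᵢ enter with positive coefficients.
positive : ∀ a₁ a₂ a₃ {s₁ s₂ s₃} → Supported a₁ a₂ a₃ → 1 ≤ s₁ + s₂ → 1 ≤ s₂ + s₃ → 1 ≤ s₁ + s₃ → 1 ≤ a₁ * s₁ + a₂ * s₂ + a₃ * s₃
positive (suc a) (suc b) d {s₁} {s₂} _ h _ _ = ≤-trans h (≤-trans (+-mono-≤ (m≤m+n s₁ (a * s₁)) (m≤m+n s₂ (b * s₂))) (m≤m+n _ _))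
positive zero (suc b) (suc d) {s₁} {s₂} {s₃} _ _ h _ = ≤-trans h (+-mono-≤ (m≤m+n s₂ (b * s₂)) (m≤m+n s₃ (d * s₃)))
positive (suc a) zero (suc d) {s₁} {s₂} {s₃} _ _ _ h = ≤-trans h (+-mono-≤ (≤-trans (m≤m+n s₁ (a * s₁)) (m≤m+n _ 0)) (m≤m+n s₃ (d * s₃)))
positive zero zero a₃ (() , _)
positive a₁ zero zero (_ , () , _)
positive zero a₂ zero (_ , _ , ())

module BigSteps {N} (w : Fin N) (W S : VSub N) (S⊆W : ∀ v → S v ≡ true → W v ≡ true) (wS : S w ≡ true)
                (RA R′ : EList N) (inA : Inside (∁ S) RA) (inR : Inside S R′) (x : Fin N) (xW : W x ≡ false)
                (P Q c n : ℕ) (IH : SmallerGraphs N P Q c n)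
                {R EP : EList N} where
  open Transfer w W S S⊆W wS RA R′ inA inR
  open Root x xW

  module _ (G : Cubic′ EP U) (C : Essential4 EP U) (h₅ : 5 ≤ size U) (small : size U < n) where
    open Rows G C h₅ x

    private
      hyp : (b₁ b₂ b₃ : Fin N) (R : EList N) → EP ≋ (x , b₁) ∷ (x , b₂) ∷ (x , b₃) ∷ R →
            P * size U + 2 * Q ≤ Q * (row x U R b₂ + row x U R b₃) + c
      hyp b₁ b₂ b₃ R eq = ≤-trans (IH EP U h₅ small G C (x , b₁) ((x , b₂) ∷ (x , b₃) ∷ R) eq)
        (≤-reflexive (cong (λ t → Q * t + c) (pair b₁ b₂ b₃ R eq)))

      ≢w : ∀ {v} → S v ≡ false → v ≢ w
      ≢w h = differ wS h ∘ sym

    -- The new weights are the old ones times the transfer matrix, so their total is the sum of the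
    -- row sums weighted by the aᵢ, to which `doubled` and `gain` apply. For `support`, one cut edge
    -- is avoided together with one edge at the root.
    big₃ : ∀ {α₁ α₂ α₃ β₁ β₂ β₃ b₁ b₂ b₃ a₁ a₂ a₃} s → EP ≋ (x , b₁) ∷ (x , b₂) ∷ (x , b₃) ∷ hang (α₁ ∷ α₂ ∷ α₃ ∷ []) →
           R ≋ (α₁ , β₁) ∷ (α₂ , β₂) ∷ (α₃ , β₃) ∷ (RA ++ R′) →
           S α₁ ≡ false → S α₂ ≡ false → S α₃ ≡ false → S β₁ ≡ true → S β₂ ≡ true → S β₃ ≡ true →
           S b₁ ≡ false → S b₂ ≡ false → S b₃ ≡ false → Supported a₁ a₂ a₃ →
           BigStep P Q c (size U) R R′ W S (strands b₁ b₂ b₃ a₁ a₂ a₃) s β₁ β₂ β₃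
    big₃ {α₁} {α₂} {α₃} {β₁} {β₂} {β₃} {b₁} {b₂} {b₃} {a₁} {a₂} {a₃} s eq eqR hα₁ hα₂ hα₃ hβ₁ hβ₂ hβ₃ hb₁ hb₂ hb₃ sup = record
      { x₁ = a₁ * t b₁ α₁ + a₂ * t b₂ α₁ + a₃ * t b₃ α₁
      ; x₂ = a₁ * t b₁ α₂ + a₂ * t b₂ α₂ + a₃ * t b₃ α₂
      ; x₃ = a₁ * t b₁ α₃ + a₂ * t b₂ α₃ + a₃ * t b₃ α₃
      ; support = ≤-trans (spread α₁ α₂ (α₃ , w) (≢w hα₁) (≢w hα₂) (≋-third _ _ _)) (≤-reflexive (two a₁ a₂ a₃ (t b₁ α₁) (t b₁ α₂) (t b₂ α₁) (t b₂ α₂) (t b₃ α₁) (t b₃ α₂)))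
                , ≤-trans (spread α₂ α₃ (α₁ , w) (≢w hα₂) (≢w hα₃) ≋-refl) (≤-reflexive (two a₁ a₂ a₃ (t b₁ α₂) (t b₁ α₃) (t b₂ α₂) (t b₂ α₃) (t b₃ α₂) (t b₃ α₃)))
                , ≤-trans (spread α₃ α₁ (α₂ , w) (≢w hα₃) (≢w hα₁) (≋-trans (≋-swap _ _) (≋-prep _ (≋-swap _ _))))
                    (≤-reflexive (two a₁ a₂ a₃ (t b₁ α₃) (t b₁ α₁) (t b₂ α₃) (t b₂ α₁) (t b₃ α₃) (t b₃ α₁)))
      ; double = ≤-trans (doubled a₁ a₂ a₃ ρ₁ ρ₂ ρ₃) (≤-reflexive sum)
      ; profit = ≤-trans (gain Q c (P * size U) {a₁} {a₂} {a₃} sup ρ₁ ρ₂ ρ₃ k₁₂ k₂₃ k₁₃) (≤-reflexive (cong (λ t → Q * t + c) sum))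
      ; value = ≤-trans (≤-reflexive (rearrange a₁ a₂ a₃ (t b₁ α₁) (t b₁ α₂) (t b₁ α₃) (t b₂ α₁) (t b₂ α₂) (t b₂ α₃) (t b₃ α₁) (t b₃ α₂) (t b₃ α₃)
                   (m₁ R′ S β₁) (m₁ R′ S β₂) (m₁ R′ S β₃)))
          (≤-trans (+-mono-≤ (+-mono-≤ (*-monoʳ-≤ a₁ (low b₁ hb₁)) (*-monoʳ-≤ a₂ (low b₂ hb₂))) (*-monoʳ-≤ a₃ (low b₃ hb₃))) (m≤m+n _ _)) }
      where
      t : Fin N → Fin N → ℕ
      t b α = τ (A ⊖ b) α
      αs : List (Fin N)
      αs = α₁ ∷ α₂ ∷ α₃ ∷ []
      ≢αs : All (λ α → α ≢ w) αs
      ≢αs = ≢w hα₁ ∷ ≢w hα₂ ∷ ≢w hα₃ ∷ []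
      eq₂ : EP ≋ (x , b₂) ∷ (x , b₃) ∷ (x , b₁) ∷ hang αs
      eq₂ = ≋-trans eq (≋-trans (≋-swap _ _) (≋-prep _ (≋-swap _ _)))
      eq₃ : EP ≋ (x , b₃) ∷ (x , b₁) ∷ (x , b₂) ∷ hang αs
      eq₃ = ≋-trans eq (≋-third _ _ _)
      rw : ∀ b → S b ≡ false → row x U (hang αs) b ≡ rowsum (A ⊖ b) αs
      rw b hb = row-inner αs b ≢αs (≢w hb)
      ρ₁ : 2 ≤ rowsum (A ⊖ b₁) αs
      ρ₁ = ≤-trans (row≥2 b₂ b₃ b₁ _ eq₂) (≤-reflexive (rw b₁ hb₁))
      ρ₂ : 2 ≤ rowsum (A ⊖ b₂) αs
      ρ₂ = ≤-trans (row≥2 b₃ b₁ b₂ _ eq₃) (≤-reflexive (rw b₂ hb₂))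
      ρ₃ : 2 ≤ rowsum (A ⊖ b₃) αs
      ρ₃ = ≤-trans (row≥2 b₁ b₂ b₃ _ eq) (≤-reflexive (rw b₃ hb₃))
      k₁₂ = ≤-trans (hyp b₃ b₁ b₂ _ eq₃) (≤-reflexive (cong (λ t → Q * t + c) (cong₂ _+_ (rw b₁ hb₁) (rw b₂ hb₂))))
      k₂₃ = ≤-trans (hyp b₁ b₂ b₃ _ eq) (≤-reflexive (cong (λ t → Q * t + c) (cong₂ _+_ (rw b₂ hb₂) (rw b₃ hb₃))))
      k₁₃ = ≤-trans (hyp b₂ b₁ b₃ _ (≋-trans eq (≋-swap _ _))) (≤-reflexive (cong (λ t → Q * t + c) (cong₂ _+_ (rw b₁ hb₁) (rw b₃ hb₃))))
      spread : ∀ γ ε e → γ ≢ w → ε ≢ w → hang αs ≋ e ∷ hang (γ ∷ ε ∷ []) →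
               1 ≤ a₁ * rowsum (A ⊖ b₁) (γ ∷ ε ∷ []) + a₂ * rowsum (A ⊖ b₂) (γ ∷ ε ∷ []) + a₃ * rowsum (A ⊖ b₃) (γ ∷ ε ∷ [])
      spread γ ε e γw εw cut = positive a₁ a₂ a₃ sup (pos b₃ b₁ b₂ hb₁ hb₂ eq₃) (pos b₁ b₂ b₃ hb₂ hb₃ eq) (pos b₂ b₁ b₃ hb₁ hb₃ (≋-trans eq (≋-swap _ _)))
        where
        pos : ∀ b₁ b₂ b₃ → S b₂ ≡ false → S b₃ ≡ false → EP ≋ (x , b₁) ∷ (x , b₂) ∷ (x , b₃) ∷ hang αs →
              1 ≤ rowsum (A ⊖ b₂) (γ ∷ ε ∷ []) + rowsum (A ⊖ b₃) (γ ∷ ε ∷ [])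
        pos b₁ b₂ b₃ h₂ h₃ eq′ = ≤-trans
          (row-pos b₁ b₂ b₃ e (hang (γ ∷ ε ∷ [])) (≋-trans eq′ (≋-prep _ (≋-trans (≋-prep₂ _ _ cut) (≋-third _ _ _)))))
          (≤-reflexive (cong₂ _+_ (row-inner (γ ∷ ε ∷ []) b₂ (γw ∷ εw ∷ []) (≢w h₂)) (row-inner (γ ∷ ε ∷ []) b₃ (γw ∷ εw ∷ []) (≢w h₃))))
      two : ∀ a b c p q r s u v → a * (0 + q + p) + b * (0 + s + r) + c * (0 + v + u) ≡ (a * p + b * r + c * u) + (a * q + b * s + c * v)
      two = solve-∀
      sum₉ : ∀ a b c p q r s u v k l m → a * (0 + r + q + p) + b * (0 + v + u + s) + c * (0 + m + l + k) ≡
             (a * p + b * s + c * k) + (a * q + b * u + c * l) + (a * r + b * v + c * m)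
      sum₉ = solve-∀
      sum = sum₉ a₁ a₂ a₃ (t b₁ α₁) (t b₁ α₂) (t b₁ α₃) (t b₂ α₁) (t b₂ α₂) (t b₂ α₃) (t b₃ α₁) (t b₃ α₂) (t b₃ α₃)
      rearrange : ∀ a b c p q r s u v k l m x y z →
        (a * p + b * s + c * k) * x + (a * q + b * u + c * l) * y + (a * r + b * v + c * m) * z + 0 ≡
        a * (p * x + (q * y + (r * z + 0))) + b * (s * x + (u * y + (v * z + 0))) + c * (k * x + (l * y + (m * z + 0)))
      rearrange = solve-∀
      low : ∀ b → S b ≡ false → t b α₁ * m₁ R′ S β₁ + (t b α₂ * m₁ R′ S β₂ + (t b α₃ * m₁ R′ S β₃ + 0)) ≤ m₁ R W b
      low b hb = ≤-trans (cut-lower _ b ((hα₁ , hβ₁) ∷ (hα₂ , hβ₂) ∷ (hα₃ , hβ₃) ∷ []) hb) (≤-reflexive (sym (μ-≋ eqR (W ⊖ b))))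

    -- The third strand passes the layer and becomes the edge xw of the contraction; its row has the
    -- single entry `ρ`, the matchings of the layer within itself.
    big₂ : ∀ {α₁ α₂ β₁ β₂ b₁ b₂ b₃ a₁ a₂ a₃} s → EP ≋ (x , b₁) ∷ (x , b₂) ∷ (x , w) ∷ hang (α₁ ∷ α₂ ∷ []) →
           R ≋ (α₁ , β₁) ∷ (α₂ , β₂) ∷ (RA ++ R′) →
           S α₁ ≡ false → S α₂ ≡ false → S β₁ ≡ true → S β₂ ≡ true →
           S b₁ ≡ false → S b₂ ≡ false → S b₃ ≡ true → Supported a₁ a₂ a₃ →
           BigStep P Q c (size U) R R′ W S (strands b₁ b₂ b₃ a₁ a₂ a₃) s β₁ β₂ b₃
    big₂ {α₁} {α₂} {β₁} {β₂} {b₁} {b₂} {b₃} {a₁} {a₂} {a₃} s eq eqR hα₁ hα₂ hβ₁ hβ₂ hb₁ hb₂ hb₃ sup = record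
      { x₁ = a₁ * t b₁ α₁ + a₂ * t b₂ α₁
      ; x₂ = a₁ * t b₁ α₂ + a₂ * t b₂ α₂
      ; x₃ = a₃ * ρ
      ; support = ≤-trans (first a₁ a₂ (proj₁ sup)) (≤-reflexive (two a₁ a₂ (t b₁ α₁) (t b₁ α₂) (t b₂ α₁) (t b₂ α₂)))
                , spread α₂ (α₁ , w) (≢w hα₂) ≋-refl
                , ≤-trans (spread α₁ (α₂ , w) (≢w hα₁) (≋-swap _ _)) (≤-reflexive (+-comm (a₁ * t b₁ α₁ + a₂ * t b₂ α₁) (a₃ * ρ)))
      ; double = ≤-trans (doubled a₁ a₂ a₃ ρ₁ ρ₂ ρ₃) (≤-reflexive sum)
      ; profit = ≤-trans (gain Q c (P * size U) {a₁} {a₂} {a₃} sup ρ₁ ρ₂ ρ₃ k₁₂ k₂₃ k₁₃) (≤-reflexive (cong (λ t → Q * t + c) sum))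
      ; value = ≤-trans (≤-reflexive (rearrange a₁ a₂ a₃ (t b₁ α₁) (t b₁ α₂) (t b₂ α₁) (t b₂ α₂) ρ (m₁ R′ S β₁) (m₁ R′ S β₂) (m₁ R′ S b₃)))
          (≤-trans (+-mono-≤ (+-mono-≤ (*-monoʳ-≤ a₁ (low b₁ hb₁)) (*-monoʳ-≤ a₂ (low b₂ hb₂)))
             (*-monoʳ-≤ a₃ (≤-trans (pass-lower C₂ b₃ hb₃) (≤-reflexive (sym (μ-≋ eqR (W ⊖ b₃))))))) (m≤m+n _ _)) }
      where
      t : Fin N → Fin N → ℕ
      t b α = τ (A ⊖ b) α
      ρ : ℕ
      ρ = μ RA A
      αs : List (Fin N)
      αs = α₁ ∷ α₂ ∷ []
      C₂ : EList N
      C₂ = (α₁ , β₁) ∷ (α₂ , β₂) ∷ []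
      ≢αs : All (λ α → α ≢ w) αs
      ≢αs = ≢w hα₁ ∷ ≢w hα₂ ∷ []
      eq₂ : EP ≋ (x , b₂) ∷ (x , w) ∷ (x , b₁) ∷ hang αs
      eq₂ = ≋-trans eq (≋-trans (≋-swap _ _) (≋-prep _ (≋-swap _ _)))
      eq₃ : EP ≋ (x , w) ∷ (x , b₁) ∷ (x , b₂) ∷ hang αs
      eq₃ = ≋-trans eq (≋-third _ _ _)
      rw : ∀ b → S b ≡ false → row x U (hang αs) b ≡ rowsum (A ⊖ b) αs
      rw b hb = row-inner αs b ≢αs (≢w hb)
      ρ₁ : 2 ≤ rowsum (A ⊖ b₁) αs
      ρ₁ = ≤-trans (row≥2 b₂ w b₁ _ eq₂) (≤-reflexive (rw b₁ hb₁))
      ρ₂ : 2 ≤ rowsum (A ⊖ b₂) αs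
      ρ₂ = ≤-trans (row≥2 w b₁ b₂ _ eq₃) (≤-reflexive (rw b₂ hb₂))
      ρ₃ : 2 ≤ ρ
      ρ₃ = ≤-trans (row≥2 b₁ b₂ w _ eq) (≤-reflexive (row-passing αs))
      k₁₂ = ≤-trans (hyp w b₁ b₂ _ eq₃) (≤-reflexive (cong (λ t → Q * t + c) (cong₂ _+_ (rw b₁ hb₁) (rw b₂ hb₂))))
      k₂₃ = ≤-trans (hyp b₁ b₂ w _ eq) (≤-reflexive (cong (λ t → Q * t + c) (cong₂ _+_ (rw b₂ hb₂) (row-passing αs))))
      k₁₃ = ≤-trans (hyp b₂ b₁ w _ (≋-trans eq (≋-swap _ _))) (≤-reflexive (cong (λ t → Q * t + c) (cong₂ _+_ (rw b₁ hb₁) (row-passing αs))))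
      first : ∀ a₁ a₂ → 1 ≤ a₁ + a₂ → 1 ≤ a₁ * rowsum (A ⊖ b₁) αs + a₂ * rowsum (A ⊖ b₂) αs
      first (suc a) b _ = ≤-trans (≤-trans (n≤1+n 1) ρ₁) (≤-trans (m≤m+n _ _) (m≤m+n _ (b * rowsum (A ⊖ b₂) αs)))
      first zero (suc b) _ = ≤-trans (≤-trans (n≤1+n 1) ρ₂) (m≤m+n _ _)
      1≤ρ : 1 ≤ ρ
      1≤ρ = ≤-trans (n≤1+n 1) ρ₃
      spread : ∀ γ e → γ ≢ w → hang αs ≋ e ∷ hang (γ ∷ []) → 1 ≤ a₁ * t b₁ γ + a₂ * t b₂ γ + a₃ * ρ
      spread γ e γw cut = positive a₁ a₂ a₃ sup
        (≤-trans (row-pos w b₁ b₂ e (hang (γ ∷ [])) (≋-trans eq₃ (≋-prep _ (≋-trans (≋-prep₂ _ _ cut) (≋-third _ _ _)))))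
          (≤-reflexive (cong₂ _+_ (row-inner (γ ∷ []) b₁ (γw ∷ []) (≢w hb₁)) (row-inner (γ ∷ []) b₂ (γw ∷ []) (≢w hb₂)))))
        (≤-trans 1≤ρ (m≤n+m ρ (t b₂ γ))) (≤-trans 1≤ρ (m≤n+m ρ (t b₁ γ)))
      two : ∀ a b p q r s → a * (0 + q + p) + b * (0 + s + r) ≡ (a * p + b * r) + (a * q + b * s)
      two = solve-∀
      sum₄ : ∀ a b c p q r s u → a * (0 + q + p) + b * (0 + s + r) + c * u ≡ (a * p + b * r) + (a * q + b * s) + c * u
      sum₄ = solve-∀
      sum = sum₄ a₁ a₂ a₃ (t b₁ α₁) (t b₁ α₂) (t b₂ α₁) (t b₂ α₂) ρ
      rearrange : ∀ a b c p q r s u x y z → (a * p + b * r) * x + (a * q + b * s) * y + c * u * z + 0 ≡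
        a * (p * x + (q * y + 0)) + b * (r * x + (s * y + 0)) + c * (u * z)
      rearrange = solve-∀
      low : ∀ b → S b ≡ false → t b α₁ * m₁ R′ S β₁ + (t b α₂ * m₁ R′ S β₂ + 0) ≤ m₁ R W b
      low b hb = ≤-trans (cut-lower C₂ b ((hα₁ , hβ₁) ∷ (hα₂ , hβ₂) ∷ []) hb) (≤-reflexive (sym (μ-≋ eqR (W ⊖ b))))

-- The shape of a layer

Pole-≋ : {x w : Fin N} {W : VSub N} {E F : EList N} → E ≋ F → Pole x w W E → Pole x w W F
Pole-≋ h Π = record
  { xW = Pole.xW Π ; wW = Pole.wW Π ; cubic = Cubic-≋ h (Pole.cubic Π)
  ; far = λ X a b t → ≤-trans (Pole.far Π X a b t) (≤-reflexive (δ-≋ X h))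
  ; near = λ X a b → ≤-trans (Pole.near Π X a b) (≤-reflexive (δ-≋ X h)) }

record Partition (S : VSub N) (R : EList N) : Set where
  constructor partition
  field
    RA C R′ : EList N
    eq : R ≋ C ++ (RA ++ R′)
    inA : Inside (∁ S) RA
    inR : Inside S R′
    hC : All (λ { (α , β) → S α ≡ false × S β ≡ true }) C

partitioned : (S : VSub N) (R : EList N) → Partition S R
partitioned S [] = partition [] [] [] ≋-refl [] [] []
partitioned S ((a , b) ∷ R) with partitioned S R | bool-cases (S a) | bool-cases (S b)
... | partition RA C R′ eq inA inR hC | inj₁ p | inj₁ q = partition RA C ((a , b) ∷ R′)
  (≋-trans (≋-prep _ eq) (≋-sym (≋-trans (≋-++ˡ C (≋-shift RA (a , b) R′)) (≋-shift C (a , b) (RA ++ R′))))) inA ((p , q) ∷ inR) hC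
... | partition RA C R′ eq inA inR hC | inj₁ p | inj₂ q = partition RA ((b , a) ∷ C) R′ (≋-trans (≋-prep _ eq) (≋-flip a b)) inA inR ((q , p) ∷ hC)
... | partition RA C R′ eq inA inR hC | inj₂ p | inj₁ q = partition RA ((a , b) ∷ C) R′ (≋-prep _ eq) inA inR ((p , q) ∷ hC)
... | partition RA C R′ eq inA inR hC | inj₂ p | inj₂ q = partition ((a , b) ∷ RA) C R′
  (≋-trans (≋-prep _ eq) (≋-sym (≋-shift C (a , b) (RA ++ R′)))) ((cong not p , cong not q) ∷ inA) inR hC

opaque
  unfolding δ
  δ-++ : (E F : EList N) (X : VSub N) → δ (E ++ F) X ≡ δ E X + δ F X
  δ-++ E F X = sumE-++ (cr X) E F

  δ-all-cross : {X : VSub N} (C : EList N) → All (λ e → cr X e ≡ 1) C → δ C X ≡ length C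
  δ-all-cross [] [] = refl
  δ-all-cross {X = X} (e ∷ C) (h ∷ hs) rewrite h = cong suc (δ-all-cross {X = X} C hs)

  spokes-δ : (x b₁ b₂ b₃ : Fin N) (R : EList N) (X : VSub N) → X x ≡ false →
             δ ((x , b₁) ∷ (x , b₂) ∷ (x , b₃) ∷ R) X ≡ χ (X b₁) + (χ (X b₂) + (χ (X b₃) + δ R X))
  spokes-δ x b₁ b₂ b₃ R X h rewrite h = refl

-- In a layer with two vertices every inner edge joins them, so only the number of these edges
-- matters, and degree 3 leaves the cases of `Layer₂` and `Layer₃`.
copies : ℕ → Fin N → Fin N → EList N
copies zero p q = []
copies (suc j) p q = (p , q) ∷ copies j p q

all-copies : (p q : Fin N) (RA : EList N) → NL RA → All (λ { (a , b) → (a ≡ p ⊎ a ≡ q) × (b ≡ p ⊎ b ≡ q) }) RA →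
             ∃ λ j → RA ≋ copies j p q
all-copies p q [] _ _ = 0 , ≋-refl
all-copies p q ((a , b) ∷ RA) (ne ∷ nes) (h ∷ hs) with all-copies p q RA nes hs | h
... | j , eq | inj₁ refl , inj₁ refl = ⊥-elim (ne refl)
... | j , eq | inj₁ refl , inj₂ refl = suc j , ≋-prep _ eq
... | j , eq | inj₂ refl , inj₁ refl = suc j , ≋-trans (≋-flip q p) (≋-prep _ eq)
... | j , eq | inj₂ refl , inj₂ refl = ⊥-elim (ne refl)

opaque
  unfolding deg
  deg-copies : (j : ℕ) (p q v : Fin N) → deg (copies j p q) v ≡ j * inc v (p , q)
  deg-copies zero p q v = refl
  deg-copies (suc j) p q v = cong (inc v (p , q) +_) (deg-copies j p q v)

  deg-cut₂ : (x b₁ b₂ b₃ α₁ α₂ β₁ β₂ p q v : Fin N) (j : ℕ) (R′ : EList N) → x ≢ v → β₁ ≢ v → β₂ ≢ v → deg R′ v ≡ 0 →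
    deg ((x , b₁) ∷ (x , b₂) ∷ (x , b₃) ∷ (α₁ , β₁) ∷ (α₂ , β₂) ∷ (copies j p q ++ R′)) v ≡
    χ (b₁ == v) + (χ (b₂ == v) + (χ (b₃ == v) + (χ (α₁ == v) + (χ (α₂ == v) + j * inc v (p , q)))))
  deg-cut₂ x b₁ b₂ b₃ α₁ α₂ β₁ β₂ p q v j R′ nx n₁ n₂ d
    rewrite ==-≢ nx | ==-≢ n₁ | ==-≢ n₂ | deg-++ (copies j p q) R′ v | d | deg-copies j p q v
          | +-identityʳ (χ (α₁ == v)) | +-identityʳ (χ (α₂ == v)) | +-identityʳ (j * (χ (p == v) + χ (q == v))) = refl

  deg-cut₃ : (x b₁ b₂ b₃ α₁ α₂ α₃ β₁ β₂ β₃ p q v : Fin N) (j : ℕ) (R′ : EList N) → x ≢ v → β₁ ≢ v → β₂ ≢ v → β₃ ≢ v → deg R′ v ≡ 0 →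
    deg ((x , b₁) ∷ (x , b₂) ∷ (x , b₃) ∷ (α₁ , β₁) ∷ (α₂ , β₂) ∷ (α₃ , β₃) ∷ (copies j p q ++ R′)) v ≡
    χ (b₁ == v) + (χ (b₂ == v) + (χ (b₃ == v) + (χ (α₁ == v) + (χ (α₂ == v) + (χ (α₃ == v) + j * inc v (p , q))))))
  deg-cut₃ x b₁ b₂ b₃ α₁ α₂ α₃ β₁ β₂ β₃ p q v j R′ nx n₁ n₂ n₃ d
    rewrite ==-≢ nx | ==-≢ n₁ | ==-≢ n₂ | ==-≢ n₃ | deg-++ (copies j p q) R′ v | d | deg-copies j p q v
          | +-identityʳ (χ (α₁ == v)) | +-identityʳ (χ (α₂ == v)) | +-identityʳ (χ (α₃ == v)) | +-identityʳ (j * (χ (p == v) + χ (q == v))) = refl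

-- The part W ∖ S of a rooted graph that one step processes.
record Layer {N} (x w : Fin N) (W S : VSub N) (b₁ b₂ b₃ : Fin N) (RA C R R′ : EList N) : Set where
  field
    pole : Pole x w W ((x , b₁) ∷ (x , b₂) ∷ (x , b₃) ∷ R)
    S⊆W : ∀ v → S v ≡ true → W v ≡ true
    wS : S w ≡ true
    eqR : R ≋ C ++ (RA ++ R′)
    inA : Inside (∁ S) RA
    inR : Inside S R′
    hC : All (λ { (α , β) → S α ≡ false × S β ≡ true }) C

module Layers {N} {x w : Fin N} {W S : VSub N} {b₁ b₂ b₃ : Fin N} {RA R R′ : EList N} where

  outA : Inside (∁ S) RA → Outside S RA
  outA = All.map λ { (p , q) → not-true⁻ p , not-true⁻ q }

  cut₂ : {α₁ α₂ β₁ β₂ : Fin N} → Layer x w W S b₁ b₂ b₃ RA ((α₁ , β₁) ∷ (α₂ , β₂) ∷ []) R R′ →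
         S x ≡ false → S b₁ ≡ false → S b₂ ≡ false → S b₃ ≡ true →
         Cut₃ w W S ((x , b₁) ∷ (x , b₂) ∷ (x , b₃) ∷ R)
  cut₂ {α₁} {α₂} {β₁} {β₂} L hx h₁ h₂ h₃ = record
    { EA = (x , b₁) ∷ (x , b₂) ∷ RA ; R′ = R′ ; α₁ = α₁ ; α₂ = α₂ ; α₃ = x ; β₁ = β₁ ; β₂ = β₂ ; β₃ = b₃
    ; eq = ≋-prep₂ _ _ (≋-trans (≋-prep c₃ (Layer.eqR L)) (≋-trans (≋-sym (≋-third c₁ c₂ c₃))
        (≋-sym (≋-trans (≋-shift RA c₁ (c₂ ∷ c₃ ∷ R′)) (≋-prep c₁ (≋-trans (≋-shift RA c₂ (c₃ ∷ R′)) (≋-prep c₂ (≋-shift RA c₃ R′))))))))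
    ; outA = (hx , h₁) ∷ (hx , h₂) ∷ outA (Layer.inA L) ; inR = Layer.inR L
    ; hα₁ = proj₁ (All.head hC) ; hα₂ = proj₁ (All.head (All.tail hC)) ; hα₃ = hx
    ; hβ₁ = proj₂ (All.head hC) ; hβ₂ = proj₂ (All.head (All.tail hC)) ; hβ₃ = h₃ ; S⊆W = Layer.S⊆W L ; wS = Layer.wS L }
    where
    open Layer L using (hC)
    c₁ = α₁ , β₁
    c₂ = α₂ , β₂
    c₃ = x , b₃

  cut₃ : {α₁ α₂ α₃ β₁ β₂ β₃ : Fin N} → Layer x w W S b₁ b₂ b₃ RA ((α₁ , β₁) ∷ (α₂ , β₂) ∷ (α₃ , β₃) ∷ []) R R′ →
         S x ≡ false → S b₁ ≡ false → S b₂ ≡ false → S b₃ ≡ false →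
         Cut₃ w W S ((x , b₁) ∷ (x , b₂) ∷ (x , b₃) ∷ R)
  cut₃ {α₁} {α₂} {α₃} {β₁} {β₂} {β₃} L hx h₁ h₂ h₃ = record
    { EA = (x , b₁) ∷ (x , b₂) ∷ (x , b₃) ∷ RA ; R′ = R′ ; α₁ = α₁ ; α₂ = α₂ ; α₃ = α₃ ; β₁ = β₁ ; β₂ = β₂ ; β₃ = β₃
    ; eq = ≋-prep₃ _ _ _ (≋-trans (Layer.eqR L)
        (≋-sym (≋-trans (≋-shift RA c₁ (c₂ ∷ c₃ ∷ R′)) (≋-prep c₁ (≋-trans (≋-shift RA c₂ (c₃ ∷ R′)) (≋-prep c₂ (≋-shift RA c₃ R′)))))))
    ; outA = (hx , h₁) ∷ (hx , h₂) ∷ (hx , h₃) ∷ outA (Layer.inA L) ; inR = Layer.inR L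
    ; hα₁ = proj₁ (All.head hC) ; hα₂ = proj₁ (All.head (All.tail hC)) ; hα₃ = proj₁ (All.head (All.tail (All.tail hC)))
    ; hβ₁ = proj₂ (All.head hC) ; hβ₂ = proj₂ (All.head (All.tail hC)) ; hβ₃ = proj₂ (All.head (All.tail (All.tail hC))) ; S⊆W = Layer.S⊆W L ; wS = Layer.wS L }
    where
    open Layer L using (hC)
    c₁ = α₁ , β₁
    c₂ = α₂ , β₂
    c₃ = α₃ , β₃

yes-χ : {a b : Fin N} → a ≡ b → χ (a == b) ≡ 1
yes-χ {b = b} refl = cong χ (==-refl b)

no-χ : {a b : Fin N} → a ≢ b → χ (a == b) ≡ 0
no-χ ne = cong χ (==-≢ ne)

eval₂ : ∀ {A B C D E i n₁ n₂ n₃ n₄ n₅} j → A ≡ n₁ → B ≡ n₂ → C ≡ n₃ → D ≡ n₄ → E ≡ n₅ → i ≡ 1 →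
        A + (B + (C + (D + (E + j * i)))) ≡ 3 → n₁ + (n₂ + (n₃ + (n₄ + (n₅ + j)))) ≡ 3
eval₂ {n₁ = n₁} {n₂} {n₃} {n₄} {n₅} j refl refl refl refl refl refl h =
  trans (cong (λ t → n₁ + (n₂ + (n₃ + (n₄ + (n₅ + t))))) (sym (*-identityʳ j))) h

eval₃ : ∀ {A B C D E F i n₁ n₂ n₃ n₄ n₅ n₆} j → A ≡ n₁ → B ≡ n₂ → C ≡ n₃ → D ≡ n₄ → E ≡ n₅ → F ≡ n₆ → i ≡ 1 →
        A + (B + (C + (D + (E + (F + j * i))))) ≡ 3 → n₁ + (n₂ + (n₃ + (n₄ + (n₅ + (n₆ + j))))) ≡ 3
eval₃ {n₁ = n₁} {n₂} {n₃} {n₄} {n₅} {n₆} j refl refl refl refl refl refl refl h =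
  trans (cong (λ t → n₁ + (n₂ + (n₃ + (n₄ + (n₅ + (n₆ + t)))))) (sym (*-identityʳ j))) h

data Layer₂ (p q b α₁ α₂ : Fin N) (j : ℕ) : Set where
  rung₁ : b ≡ q → α₁ ≡ p → α₂ ≡ q → j ≡ 1 → Layer₂ p q b α₁ α₂ j
  rung₂ : b ≡ q → α₁ ≡ q → α₂ ≡ p → j ≡ 1 → Layer₂ p q b α₁ α₂ j
  neck  : b ≡ p → α₁ ≡ q → α₂ ≡ q → j ≡ 1 → Layer₂ p q b α₁ α₂ j

layer₂ : {p q b g α₁ α₂ : Fin N} (j : ℕ) → p ≢ q → g ≢ p → g ≢ q →
  χ (p == p) + (χ (b == p) + (χ (g == p) + (χ (α₁ == p) + (χ (α₂ == p) + j * inc p (p , q))))) ≡ 3 →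
  χ (p == q) + (χ (b == q) + (χ (g == q) + (χ (α₁ == q) + (χ (α₂ == q) + j * inc q (p , q))))) ≡ 3 →
  (b ≡ p) ⊎ (b ≡ q) → (α₁ ≡ p) ⊎ (α₁ ≡ q) → (α₂ ≡ p) ⊎ (α₂ ≡ q) → Layer₂ p q b α₁ α₂ j
layer₂ {p = p} {q} {b} {g} {α₁} {α₂} j p≢q g≢p g≢q Dp Dq = go
  where
  pp = yes-χ {a = p} {p} refl
  qq = yes-χ {a = q} {q} refl
  pq = no-χ {a = p} {q} p≢q
  qp = no-χ {a = q} {p} (p≢q ∘ sym)
  gp = no-χ {a = g} {p} g≢p
  gq = no-χ {a = g} {q} g≢q
  ip = inc-self {v = p} {q} (p≢q ∘ sym)
  iq : inc q (p , q) ≡ 1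
  iq = cong₂ _+_ pq qq
  go : (b ≡ p) ⊎ (b ≡ q) → (α₁ ≡ p) ⊎ (α₁ ≡ q) → (α₂ ≡ p) ⊎ (α₂ ≡ q) → Layer₂ p q b α₁ α₂ j
  go (inj₂ refl) (inj₁ refl) (inj₂ refl) = rung₁ refl refl refl (suc-injective (suc-injective (eval₂ j pp qp gp pp qp ip Dp)))
  go (inj₂ refl) (inj₂ refl) (inj₁ refl) = rung₂ refl refl refl (suc-injective (suc-injective (eval₂ j pp qp gp qp pp ip Dp)))
  go (inj₁ refl) (inj₂ refl) (inj₂ refl) = neck refl refl refl (suc-injective (suc-injective (eval₂ j pp pp gp qp qp ip Dp)))
  go (inj₂ refl) (inj₁ refl) (inj₁ refl) with suc-injective (suc-injective (suc-injective (eval₂ j pp qp gp pp pp ip Dp)))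
  ... | refl with eval₂ 0 pq qq gq pq pq iq Dq
  ... | ()
  go (inj₂ refl) (inj₂ refl) (inj₂ refl) with suc-injective (suc-injective (suc-injective (eval₂ j pq qq gq qq qq iq Dq)))
  ... | refl with eval₂ 0 pp qp gp qp qp ip Dp
  ... | ()
  go (inj₁ refl) (inj₁ refl) (inj₂ refl) with suc-injective (suc-injective (suc-injective (eval₂ j pp pp gp pp qp ip Dp)))
  ... | refl with eval₂ 0 pq pq gq pq qq iq Dq
  ... | ()
  go (inj₁ refl) (inj₂ refl) (inj₁ refl) with suc-injective (suc-injective (suc-injective (eval₂ j pp pp gp qp pp ip Dp)))
  ... | refl with eval₂ 0 pq pq gq qq pq iq Dq
  ... | ()
  go (inj₁ refl) (inj₁ refl) (inj₁ refl) with suc-injective (suc-injective (suc-injective (eval₂ j pp pp gp pp pp ip Dp)))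
  ... | ()

-- `apart` satisfies the degree equations but separates the root from `S`; connectedness excludes it
-- where the layer is used.
data Layer₃ (p q b α₁ α₂ α₃ : Fin N) (j : ℕ) : Set where
  neck₁ : b ≡ q → α₁ ≡ p → α₂ ≡ q → α₃ ≡ q → j ≡ 0 → Layer₃ p q b α₁ α₂ α₃ j
  neck₂ : b ≡ q → α₁ ≡ q → α₂ ≡ p → α₃ ≡ q → j ≡ 0 → Layer₃ p q b α₁ α₂ α₃ j
  neck₃ : b ≡ q → α₁ ≡ q → α₂ ≡ q → α₃ ≡ p → j ≡ 0 → Layer₃ p q b α₁ α₂ α₃ j
  apart : b ≡ p → α₁ ≡ q → α₂ ≡ q → α₃ ≡ q → j ≡ 0 → Layer₃ p q b α₁ α₂ α₃ j

layer₃ : {p q b α₁ α₂ α₃ : Fin N} (j : ℕ) → p ≢ q →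
  χ (p == p) + (χ (p == p) + (χ (b == p) + (χ (α₁ == p) + (χ (α₂ == p) + (χ (α₃ == p) + j * inc p (p , q)))))) ≡ 3 →
  χ (p == q) + (χ (p == q) + (χ (b == q) + (χ (α₁ == q) + (χ (α₂ == q) + (χ (α₃ == q) + j * inc q (p , q)))))) ≡ 3 →
  (b ≡ p) ⊎ (b ≡ q) → (α₁ ≡ p) ⊎ (α₁ ≡ q) → (α₂ ≡ p) ⊎ (α₂ ≡ q) → (α₃ ≡ p) ⊎ (α₃ ≡ q) → Layer₃ p q b α₁ α₂ α₃ j
layer₃ {p = p} {q} {b} {α₁} {α₂} {α₃} j p≢q Dp Dq = go
  where
  pp = yes-χ {a = p} {p} refl
  qq = yes-χ {a = q} {q} refl
  pq = no-χ {a = p} {q} p≢q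
  qp = no-χ {a = q} {p} (p≢q ∘ sym)
  ip = inc-self {v = p} {q} (p≢q ∘ sym)
  iq : inc q (p , q) ≡ 1
  iq = cong₂ _+_ pq qq
  go : (b ≡ p) ⊎ (b ≡ q) → (α₁ ≡ p) ⊎ (α₁ ≡ q) → (α₂ ≡ p) ⊎ (α₂ ≡ q) → (α₃ ≡ p) ⊎ (α₃ ≡ q) → Layer₃ p q b α₁ α₂ α₃ j
  go (inj₂ refl) (inj₁ refl) (inj₂ refl) (inj₂ refl) = neck₁ refl refl refl refl (suc-injective (suc-injective (suc-injective (eval₃ j pp pp qp pp qp qp ip Dp))))
  go (inj₂ refl) (inj₂ refl) (inj₁ refl) (inj₂ refl) = neck₂ refl refl refl refl (suc-injective (suc-injective (suc-injective (eval₃ j pp pp qp qp pp qp ip Dp))))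
  go (inj₂ refl) (inj₂ refl) (inj₂ refl) (inj₁ refl) = neck₃ refl refl refl refl (suc-injective (suc-injective (suc-injective (eval₃ j pp pp qp qp qp pp ip Dp))))
  go (inj₁ refl) (inj₂ refl) (inj₂ refl) (inj₂ refl) = apart refl refl refl refl (suc-injective (suc-injective (suc-injective (eval₃ j pp pp pp qp qp qp ip Dp))))
  go (inj₂ refl) (inj₂ refl) (inj₂ refl) (inj₂ refl) with suc-injective (suc-injective (suc-injective (eval₃ j pq pq qq qq qq qq iq Dq)))
  ... | ()
  go (inj₂ refl) (inj₁ refl) (inj₁ refl) (inj₂ refl) with suc-injective (suc-injective (suc-injective (eval₃ j pp pp qp pp pp qp ip Dp)))
  ... | ()
  go (inj₂ refl) (inj₁ refl) (inj₂ refl) (inj₁ refl) with suc-injective (suc-injective (suc-injective (eval₃ j pp pp qp pp qp pp ip Dp)))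
  ... | ()
  go (inj₂ refl) (inj₂ refl) (inj₁ refl) (inj₁ refl) with suc-injective (suc-injective (suc-injective (eval₃ j pp pp qp qp pp pp ip Dp)))
  ... | ()
  go (inj₂ refl) (inj₁ refl) (inj₁ refl) (inj₁ refl) with suc-injective (suc-injective (suc-injective (eval₃ j pp pp qp pp pp pp ip Dp)))
  ... | ()
  go (inj₁ refl) (inj₁ refl) _ _ with suc-injective (suc-injective (suc-injective (eval₃ j pp pp pp pp (refl {x = χ (α₂ == p)}) (refl {x = χ (α₃ == p)}) ip Dp)))
  ... | ()
  go (inj₁ refl) (inj₂ refl) (inj₁ refl) _ with suc-injective (suc-injective (suc-injective (eval₃ j pp pp pp qp pp (refl {x = χ (α₃ == p)}) ip Dp)))
  ... | ()
  go (inj₁ refl) (inj₂ refl) (inj₂ refl) (inj₁ refl) with suc-injective (suc-injective (suc-injective (eval₃ j pp pp pp qp qp pp ip Dp)))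
  ... | ()

spokes-rot : (x b₁ b₂ b₃ : Fin N) (R : EList N) →
             (x , b₁) ∷ (x , b₂) ∷ (x , b₃) ∷ R ≋ (x , b₂) ∷ (x , b₃) ∷ (x , b₁) ∷ R
spokes-rot x b₁ b₂ b₃ R = ≋-sym (≋-third (x , b₂) (x , b₃) (x , b₁))

supported-rot : ∀ a₁ a₂ a₃ → Supported a₁ a₂ a₃ → Supported a₂ a₃ a₁
supported-rot a₁ a₂ a₃ (s₁ , s₂ , s₃) = s₂ , s₃ , s₁

layer-rot : {x w : Fin N} {W S : VSub N} {b₁ b₂ b₃ : Fin N} {RA C R R′ : EList N} →
            Layer x w W S b₁ b₂ b₃ RA C R R′ → Layer x w W S b₂ b₃ b₁ RA C R R′
layer-rot {x = x} {b₁ = b₁} {b₂} {b₃} {R = R} L = record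
  { pole = Pole-≋ (spokes-rot x b₁ b₂ b₃ R) (Layer.pole L) ; S⊆W = Layer.S⊆W L ; wS = Layer.wS L
  ; eqR = Layer.eqR L ; inA = Layer.inA L ; inR = Layer.inR L ; hC = Layer.hC L }

pole-spokes : {x w : Fin N} {W : VSub N} {b₁ b₂ b₃ : Fin N} {R : EList N} →
  Pole x w W ((x , b₁) ∷ (x , b₂) ∷ (x , b₃) ∷ R) → (W b₁ ≡ true) × (W b₂ ≡ true) × (W b₃ ≡ true)
pole-spokes {x = x} {W = W} {b₁} {b₂} {b₃} Π with inU (Pole.cubic Π) | nl (Pole.cubic Π)
... | (_ , h₁) ∷ (_ , h₂) ∷ (_ , h₃) ∷ _ | n₁ ∷ n₂ ∷ n₃ ∷ _ =
  ⊕-≢ {W = W} {x} {b₁} h₁ (n₁ ∘ sym) , ⊕-≢ {W = W} {x} {b₂} h₂ (n₂ ∘ sym) , ⊕-≢ {W = W} {x} {b₃} h₃ (n₃ ∘ sym)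

two-links : (C : EList N) → length C ≡ 2 → ∃ λ α₁ → ∃ λ β₁ → ∃ λ α₂ → ∃ λ β₂ → C ≡ (α₁ , β₁) ∷ (α₂ , β₂) ∷ []
two-links ((α₁ , β₁) ∷ (α₂ , β₂) ∷ []) refl = α₁ , β₁ , α₂ , β₂ , refl

three-links : (C : EList N) → length C ≡ 3 →
  ∃ λ α₁ → ∃ λ β₁ → ∃ λ α₂ → ∃ λ β₂ → ∃ λ α₃ → ∃ λ β₃ → C ≡ (α₁ , β₁) ∷ (α₂ , β₂) ∷ (α₃ , β₃) ∷ []
three-links ((α₁ , β₁) ∷ (α₂ , β₂) ∷ (α₃ , β₃) ∷ []) refl = α₁ , β₁ , α₂ , β₂ , α₃ , β₃ , refl

module LayerCut {N} {x w : Fin N} {W S : VSub N} {b₁ b₂ b₃ : Fin N} {RA C R R′ : EList N}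
                (L : Layer x w W S b₁ b₂ b₃ RA C R R′) (full : δ ((x , b₁) ∷ (x , b₂) ∷ (x , b₃) ∷ R) S ≡ 3)
                (sa : Some (W ∩ ∁ S)) where
  open Layer L

  E : EList N
  E = (x , b₁) ∷ (x , b₂) ∷ (x , b₃) ∷ R

  A : VSub N
  A = W ∩ ∁ S

  G : Cubic′ E (W ⊕ x)
  G = Pole.cubic pole

  xW : W x ≡ false
  xW = Pole.xW pole

  xS : S x ≡ false
  xS = ¬true⇒false λ h → true≢false (S⊆W x h) xW

  spoke-ends : (W b₁ ≡ true) × (W b₂ ≡ true) × (W b₃ ≡ true)
  spoke-ends = pole-spokes pole

  noX : deg R x ≡ 0
  noX with nl G
  ... | n₁ ∷ n₂ ∷ n₃ ∷ _ = root-deg⁻ R b₁ b₂ b₃ x (n₁ ∘ sym) (n₂ ∘ sym) (n₃ ∘ sym) (d3 G x (⊕-new W x))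

  links : All (λ { (α , β) → A α ≡ true × A β ≡ false }) C
  links = All.zipWith (λ { {a , b} ((ia , na) , (oa , sb)) → ∧-true (⊕-≢ {W = W} {x} {a} ia na) (cong not oa) , ∧-false₂ {W b} (cong not sb) })
    (all-++ˡ C (All.zipWith (λ { ((ia , _) , (na , _)) → ia , na })
      (Inside-≋ eqR (All.tail (All.tail (All.tail (inU G)))) , deg-avoid (C ++ (RA ++ R′)) (trans (sym (deg-≋ x eqR)) noX))) , hC)

  inner : All (λ { (a , b) → A a ≡ true × A b ≡ true }) RA
  inner = All.zipWith (λ { {a , b} (((ia , na) , (ib , nb)) , (oa , ob)) → ∧-true (⊕-≢ {W = W} {x} {a} ia na) oa , ∧-true (⊕-≢ {W = W} {x} {b} ib nb) ob })
    (all-++ˡ RA (all-++ʳ C (All.zipWith (λ { ((ia , ib) , (na , nb)) → (ia , na) , (ib , nb) })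
      (Inside-≋ eqR (All.tail (All.tail (All.tail (inU G)))) , deg-avoid (C ++ (RA ++ R′)) (trans (sym (deg-≋ x eqR)) noX)))) , inA)

  δ-three-parts : (X : VSub N) → δ RA X ≡ 0 → δ R′ X ≡ 0 → All (λ e → cr X e ≡ 1) C → X x ≡ false →
                  δ E X ≡ χ (X b₁) + (χ (X b₂) + (χ (X b₃) + length C))
  δ-three-parts X hA hR hC′ hx = trans (spokes-δ x b₁ b₂ b₃ R X hx) (cong (λ t → χ (X b₁) + (χ (X b₂) + (χ (X b₃) + t)))
    (trans (δ-≋ X eqR) (trans (δ-++ C (RA ++ R′) X) (trans (cong₂ _+_ (δ-all-cross {X = X} C hC′)
      (trans (δ-++ RA R′ X) (cong₂ _+_ hA hR))) (+-identityʳ (length C))))))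

  δS : δ E S ≡ χ (S b₁) + (χ (S b₂) + (χ (S b₃) + length C))
  δS = δ-three-parts S (δ-zero false RA (All.map (λ { (p , q) → not-true⁻ p , not-true⁻ q }) inA)) (δ-zero true R′ inR)
    (All.map (λ { (p , q) → cong₂ (λ s t → χ (s xor t)) p q }) hC) xS

  δA : δ E A ≡ χ (A b₁) + (χ (A b₂) + (χ (A b₃) + length C))
  δA = δ-three-parts A (δ-zero true RA inner) (δ-zero false R′ (All.map (λ { {a , b} (p , q) → ∧-false₂ {W a} (cong not p) , ∧-false₂ {W b} (cong not q) }) inR))
    (All.map (λ { (p , q) → cong₂ (λ s t → χ (s xor t)) p q }) links) (∧-false₁ xW)

  counts : χ (S b₁) + (χ (S b₂) + (χ (S b₃) + length C)) ≡ 3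
  counts = trans (sym δS) full

  A-not : ∀ {b} → W b ≡ true → A b ≡ not (S b)
  A-not {b} h = cong (_∧ not (S b)) h

  δA′ : δ E A ≡ χ (not (S b₁)) + (χ (not (S b₂)) + (χ (not (S b₃)) + length C))
  δA′ = trans δA (cong₂ _+_ (cong χ (A-not (proj₁ spoke-ends))) (cong₂ _+_ (cong χ (A-not (proj₁ (proj₂ spoke-ends))))
    (cong (λ t → χ t + length C) (A-not (proj₂ (proj₂ spoke-ends))))))

  -- A layer with a single vertex would have three boundary edges; together with the three edges
  -- leaving `S` this gives 2 |C| = 3.
  even : ∀ p q r k → χ p + (χ q + (χ r + k)) ≡ 3 → χ (not p) + (χ (not q) + (χ (not r) + k)) ≢ 3
  even true true true zero _ ()
  even true true false zero ()
  even true true false (suc zero) _ ()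
  even true false true (suc zero) _ ()
  even true false false (suc (suc zero)) _ ()
  even false true true (suc zero) _ ()
  even false true false (suc (suc zero)) _ ()
  even false false true (suc (suc zero)) _ ()
  even false false false (suc (suc (suc zero))) _ ()

  several : Two A
  several with two-or-one A (proj₁ sa) (proj₂ sa)
  ... | inj₁ t = t
  ... | inj₂ one = ⊥-elim (even (S b₁) (S b₂) (S b₃) (length C) counts (trans (sym δA′)
      (δ-single G A (proj₁ sa) (⊕-old {W = W} {x} {proj₁ sa} (∧-left (proj₂ sa))) (proj₂ sa) λ v hv → one v (∧-right {(W ⊕ x) v} hv))))

  many : 4 ≤ χ (not (S b₁)) + (χ (not (S b₂)) + (χ (not (S b₃)) + length C))
  many = ≤-trans (Pole.far pole A (∧-false₁ xW) (∧-false₂ {W w} (cong not wS)) (two-mono (λ v h → ∧-true (∧-left {W v} h) h) several)) (≤-reflexive δA′)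

  data Passing : Set where
    none   : S b₁ ≡ false → S b₂ ≡ false → S b₃ ≡ false → length C ≡ 3 → Passing
    first  : S b₂ ≡ false → S b₃ ≡ false → S b₁ ≡ true → length C ≡ 2 → Passing
    second : S b₃ ≡ false → S b₁ ≡ false → S b₂ ≡ true → length C ≡ 2 → Passing
    third  : S b₁ ≡ false → S b₂ ≡ false → S b₃ ≡ true → length C ≡ 2 → Passing

  -- If t strands pass, then |C| = 3 - t and the layer has 2 (3 - t) boundary edges; `far` demands
  -- 4, so t ≤ 1.
  passing : Passing
  passing = go (S b₁) (S b₂) (S b₃) refl refl refl counts many
    where
    go : ∀ p q r → S b₁ ≡ p → S b₂ ≡ q → S b₃ ≡ r → χ p + (χ q + (χ r + length C)) ≡ 3 →
         4 ≤ χ (not p) + (χ (not q) + (χ (not r) + length C)) → Passing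
    go false false false e f g h k = none e f g h
    go true false false e f g h k = first f g e (suc-injective h)
    go false true false e f g h k = second g e f (suc-injective h)
    go false false true e f g h k = third e f g (suc-injective h)
    go true true r e f g h k = ⊥-elim (few r (length C) (suc-injective (suc-injective h)) k)
      where few : ∀ r l → χ r + l ≡ 1 → 4 ≤ χ (not r) + l → ⊥
            few true zero _ ()
            few false (suc zero) _ (s≤s (s≤s ()))
    go true false true e f g h k with length C | suc-injective (suc-injective h)
    go true false true e f g h (s≤s (s≤s ())) | _ | refl
    go false true true e f g h k with length C | suc-injective (suc-injective h)
    go false true true e f g h (s≤s (s≤s ())) | _ | refl

-- From a rooted graph to a play of the game

module Trace {N} (x w : Fin N) (K : Fin N → Set) (P Q c n : ℕ) (IH : SmallerGraphs N P Q c n) where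
  open Game K P Q c

  spokes : Fin N → Fin N → Fin N → EList N → EList N
  spokes b₁ b₂ b₃ R = (x , b₁) ∷ (x , b₂) ∷ (x , b₃) ∷ R

  -- `size W ∸ 1` leaves out the target, which is never processed. The rooted graph has size W + 1
  -- vertices; its being below `n` puts the contracted layers within reach of `IH`.
  Goal : ℕ → Set
  Goal k = ∀ W b₁ b₂ b₃ R a₁ a₂ a₃ s → size W ≤ k → size W + 1 < n → (∀ v → W v ≡ true → v ≢ w → K v) →
    Pole x w W (spokes b₁ b₂ b₃ R) → Supported a₁ a₂ a₃ →
    ∃ λ z → Play R (strands b₁ b₂ b₃ a₁ a₂ a₃) s (size W ∸ 1) z × z ≤ val R W (strands b₁ b₂ b₃ a₁ a₂ a₃) s

  module Moves (k : ℕ) (rec : Goal k) {W S : VSub N} (le : size W ≤ suc k) (lt : size W + 1 < n)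
               (KW : ∀ v → W v ≡ true → v ≢ w → K v) (S⊆W : ∀ v → S v ≡ true → W v ≡ true) (wS : S w ≡ true) (xW : W x ≡ false)
               (sa : Some (W ∩ ∁ S)) where

    A : VSub N
    A = W ∩ ∁ S

    xS : S x ≡ false
    xS = ¬true⇒false λ h → true≢false (S⊆W x h) xW

    sizes : size W ≡ size S + size A
    sizes = trans (size-split W S) (cong (_+ size A) (size-cong λ v → bool-ext (∧-right {W v}) (λ h → ∧-true (S⊆W v h) h)))

    S≥1 : 1 ≤ size S
    S≥1 = size-pos {U = S} {w} wS

    A≥1 : 1 ≤ size A
    A≥1 = size-pos {U = A} {proj₁ sa} (proj₂ sa)

    S<W : size S < size W
    S<W = ≤-trans (≤-reflexive (+-comm 1 (size S))) (≤-trans (+-monoʳ-≤ (size S) A≥1) (≤-reflexive (sym sizes)))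

    rest : size A + (size S ∸ 1) ≡ size W ∸ 1
    rest = trans (sym (+-∸-assoc (size A) S≥1)) (cong (_∸ 1) (trans (+-comm (size A) (size S)) (sym sizes)))

    Out : EList N → Strands N → ℕ → Set
    Out R σ s = ∃ λ z → Move R σ s (size W ∸ 1) z × z ≤ val R W σ s

    continue : ∀ b₁ b₂ b₃ R a₁ a₂ a₃ s → Pole x w S (spokes b₁ b₂ b₃ R) → Supported a₁ a₂ a₃ →
      ∃ λ z → Play R (strands b₁ b₂ b₃ a₁ a₂ a₃) s (size S ∸ 1) z × z ≤ val R S (strands b₁ b₂ b₃ a₁ a₂ a₃) s
    continue b₁ b₂ b₃ R a₁ a₂ a₃ s = rec S b₁ b₂ b₃ R a₁ a₂ a₃ s (≤-pred (≤-trans S<W le))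
      (≤-<-trans (+-monoˡ-≤ 1 (<⇒≤ S<W)) lt) (λ v hv → KW v (S⊆W v hv))

    module Big {E₀ : EList N} (max : ∀ T → Valid w W E₀ T → size T ≤ size S) (large : 3 + size S ≤ size W) where

      A≥3 : 3 ≤ size A
      A≥3 = +-cancelˡ-≤ (size S) 3 (size A) (≤-trans (≤-reflexive (+-comm (size S) 3)) (≤-trans large (≤-reflexive sizes)))

      finish : ∀ {b₁ b₂ b₃ β₁ β₂ β₃ R R′ a₁ a₂ a₃ s u} X → R ≋ X ++ R′ → u ≡ 2 + size A → Pole x w S (spokes β₁ β₂ β₃ R′) →
               BigStep P Q c u R R′ W S (strands b₁ b₂ b₃ a₁ a₂ a₃) s β₁ β₂ β₃ → Out R (strands b₁ b₂ b₃ a₁ a₂ a₃) s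
      finish {b₁} {b₂} {b₃} {β₁} {β₂} {β₃} {R} {R′} {a₁} {a₂} {a₃} {s} X eqX refl Π B
        with continue β₁ β₂ β₃ R′ (BigStep.x₁ B) (BigStep.x₂ B) (BigStep.x₃ B) 0 Π (BigStep.support B)
      ... | z , play , zle = z , subst (λ m → Move R (strands b₁ b₂ b₃ a₁ a₂ a₃) s m z) rest
              (big {X = X} {σ′ = BigStep.σ′ B} {k = size A} eqX (BigStep.support B) (BigStep.double B)
                (≤-trans (≤-reflexive (cong (λ t → Q * (a₁ + a₂ + a₃) + P * t) (+-comm (size A) 2))) (BigStep.profit B)) play)
          , ≤-trans zle (BigStep.value B)

      module _ {E : EList N} (h : E ≋ E₀) (Π : Pole x w W E) (T : Cut₃ w W S E) where
        module Ct = Contract Π T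

        size-piece : size Ct.U″ ≡ 2 + size A
        size-piece = Ct.size″

        piece-large : 5 ≤ size Ct.U″
        piece-large = ≤-trans (s≤s (s≤s A≥3)) (≤-reflexive (sym size-piece))

        piece-small : size Ct.U″ < n
        piece-small = ≤-<-trans (≤-trans (≤-reflexive (trans size-piece (+-comm 2 (size A))))
          (≤-trans (≤-reflexive (sym (+-assoc (size A) 1 1))) (+-monoˡ-≤ 1 (≤-trans (≤-reflexive (+-comm (size A) 1))
            (≤-trans (+-monoˡ-≤ (size A) S≥1) (≤-reflexive (sym sizes))))))) lt

        piece-essential : Essential4 Ct.E″ Ct.U″
        piece-essential = Ct.essential″ (Maximal.no-small-extension Π S⊆W wS
          (λ { T (v₁ , v₂ , v₃ , v₄) → max T (v₁ , v₂ , v₃ , trans (δ-≋ T (≋-sym h)) v₄) }) large)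

      big-move₃ : ∀ {b₁ b₂ b₃ α₁ α₂ α₃ β₁ β₂ β₃ RA R R′ a₁ a₂ a₃} s → spokes b₁ b₂ b₃ R ≋ E₀ →
        Layer x w W S b₁ b₂ b₃ RA ((α₁ , β₁) ∷ (α₂ , β₂) ∷ (α₃ , β₃) ∷ []) R R′ →
        S b₁ ≡ false → S b₂ ≡ false → S b₃ ≡ false → Supported a₁ a₂ a₃ → Out R (strands b₁ b₂ b₃ a₁ a₂ a₃) s
      big-move₃ {b₁} {b₂} {b₃} {α₁} {α₂} {α₃} {β₁} {β₂} {β₃} {RA} {R} {R′} s h L h₁ h₂ h₃ sup with Layer.hC L
      ... | (p₁ , q₁) ∷ (p₂ , q₂) ∷ (p₃ , q₃) ∷ [] = finish ((α₁ , β₁) ∷ (α₂ , β₂) ∷ (α₃ , β₃) ∷ RA) (Layer.eqR L) (size-piece h Π T)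
          (Contract.pole Π T)
          (BigSteps.big₃ w W S S⊆W wS RA R′ (Layer.inA L) (Layer.inR L) x xW P Q c n IH {R} {Contract.E″ Π T}
            (Contract.cubic″ Π T) (piece-essential h Π T) (piece-large h Π T) (piece-small h Π T) s
            (≋-prep₃ _ _ _ (≋-++-comm RA ((α₁ , w) ∷ (α₂ , w) ∷ (α₃ , w) ∷ []))) (Layer.eqR L) p₁ p₂ p₃ q₁ q₂ q₃ h₁ h₂ h₃ sup)
        where
        Π = Layer.pole L
        T = Layers.cut₃ L xS h₁ h₂ h₃

      big-move₂ : ∀ {b₁ b₂ b₃ α₁ α₂ β₁ β₂ RA R R′ a₁ a₂ a₃} s → spokes b₁ b₂ b₃ R ≋ E₀ →
        Layer x w W S b₁ b₂ b₃ RA ((α₁ , β₁) ∷ (α₂ , β₂) ∷ []) R R′ →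
        S b₁ ≡ false → S b₂ ≡ false → S b₃ ≡ true → Supported a₁ a₂ a₃ → Out R (strands b₁ b₂ b₃ a₁ a₂ a₃) s
      big-move₂ {b₁} {b₂} {b₃} {α₁} {α₂} {β₁} {β₂} {RA} {R} {R′} s h L h₁ h₂ h₃ sup with Layer.hC L
      ... | (p₁ , q₁) ∷ (p₂ , q₂) ∷ [] = finish ((α₁ , β₁) ∷ (α₂ , β₂) ∷ RA) (Layer.eqR L) (size-piece h Π T)
          (Contract.pole Π T)
          (BigSteps.big₂ w W S S⊆W wS RA R′ (Layer.inA L) (Layer.inR L) x xW P Q c n IH {R} {Contract.E″ Π T}
            (Contract.cubic″ Π T) (piece-essential h Π T) (piece-large h Π T) (piece-small h Π T) s
            (≋-prep₂ _ _ (≋-trans (≋-++-comm RA ((α₁ , w) ∷ (α₂ , w) ∷ (x , w) ∷ [])) (≋-third (α₁ , w) (α₂ , w) (x , w))))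
            (Layer.eqR L) p₁ p₂ q₁ q₂ h₁ h₂ h₃ sup)
        where
        Π = Layer.pole L
        T = Layers.cut₂ L xS h₁ h₂ h₃

    module Small (A≡2 : size A ≡ 2) {p q : Fin N} (p≢q : p ≢ q) (hp : A p ≡ true) (hq : A q ≡ true) where

      only : ∀ v → A v ≡ true → (v ≡ p) ⊎ (v ≡ q)
      only v hv with v ≟ p | v ≟ q
      ... | yes e | _ = inj₁ e
      ... | no _ | yes e = inj₂ e
      ... | no np | no nq = ⊥-elim (true≢false (⊖₂-in A hv np nq) (size-zero (suc-injective (suc-injective (trans (sym (size-⊖₂ A hp hq p≢q)) A≡2))) v))

      S≐ : S ≐ W ⊖ p ⊖ q
      S≐ v = bool-ext (λ h → ⊖₂-in W (S⊆W v h) (differ h (sp p hp)) (differ h (sp q hq)))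
        (λ h → go v (⊖₂-mem W {p} {q} {v} h) (S v) refl)
        where
        sp : ∀ u → A u ≡ true → S u ≡ false
        sp u h = not-true⁻ (∧-right {W u} h)
        go : ∀ v → W v ≡ true × v ≢ p × v ≢ q → ∀ b → S v ≡ b → S v ≡ true
        go v _ true e = e
        go v (hv , np , nq) false e with only v (∧-true hv (cong not e))
        ... | inj₁ k = ⊥-elim (np k)
        ... | inj₂ k = ⊥-elim (nq k)

      Sp : S p ≡ false
      Sp = not-true⁻ (∧-right {W p} hp)
      Sq : S q ≡ false
      Sq = not-true⁻ (∧-right {W q} hq)
      Wp : W p ≡ true
      Wp = ∧-left hp
      Wq : W q ≡ true
      Wq = ∧-left hq
      Kp : K p
      Kp = KW p Wp (differ wS Sp ∘ sym)
      Kq : K q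
      Kq = KW q Wq (differ wS Sq ∘ sym)

      two-more : 2 + (size S ∸ 1) ≡ size W ∸ 1
      two-more = trans (cong (_+ (size S ∸ 1)) (sym A≡2)) rest

      in-S : ∀ {v} → S v ≡ true → (W ⊖ p ⊖ q) v ≡ true
      in-S {v} h = trans (sym (S≐ v)) h

      rung-move : ∀ {g p′ q′ R R′ a₁ a₂ a₃} s → R ≋ (p , q) ∷ (p , p′) ∷ (q , q′) ∷ R′ →
        Pole x w S (spokes q′ p′ g R′) → S p′ ≡ true → S q′ ≡ true → S g ≡ true → Supported a₁ a₂ a₃ → Out R (strands p q g a₁ a₂ a₃) s
      rung-move {g} {p′} {q′} {R} {R′} {a₁} {a₂} {a₃} s eq Π hp′ hq′ hg (s₁ , s₂ , s₃)
        with continue q′ p′ g R′ a₁ a₂ (a₃ + s) a₃ Π (s₁ , ≤-trans s₂ (+-monoʳ-≤ a₂ (m≤m+n a₃ s)) , ≤-trans s₃ (+-monoˡ-≤ a₁ (m≤m+n a₃ s)))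
      ... | z , play , zle = z , subst (λ m → Move R (strands p q g a₁ a₂ a₃) s m z) two-more (rung eq Kp Kq play)
          , ≤-trans zle (≤-trans (≤-reflexive (val-cong R′ S≐ (strands q′ p′ g a₁ a₂ (a₃ + s)) a₃))
              (rung-val eq Wp Wq p≢q (in-S hp′) (in-S hq′) (in-S hg) a₁ a₂ a₃ s))

      neck-sup : ∀ {a₁ a₂ a₃} → Supported a₁ a₂ a₃ → Supported (a₁ + a₂) (a₁ + a₂) a₃
      neck-sup {a₁} {a₂} {a₃} (s₁ , _) = ≤-trans s₁ (m≤m+n _ _) , ≤-trans s₁ (m≤m+n _ _) , ≤-trans s₁ (m≤n+m _ a₃)

      neck-move : ∀ {g β γ R R′ a₁ a₂ a₃} s → R ≋ (p , q) ∷ (q , β) ∷ (q , γ) ∷ R′ → deg R′ q ≡ 0 →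
        Pole x w S (spokes β γ g R′) → S β ≡ true → S γ ≡ true → S g ≡ true → Supported a₁ a₂ a₃ → Out R (strands p p g a₁ a₂ a₃) s
      neck-move {g} {β} {γ} {R} {R′} {a₁} {a₂} {a₃} s eq d Π hβ hγ hg sup
        with continue β γ g R′ (a₁ + a₂) (a₁ + a₂) a₃ 0 Π (neck-sup {a₁} {a₂} {a₃} sup)
      ... | z , play , zle = z , subst (λ m → Move R (strands p p g a₁ a₂ a₃) s m z) two-more (neck {X = (p , q) ∷ (q , β) ∷ (q , γ) ∷ []} eq play)
          , ≤-trans zle (≤-trans (≤-reflexive (val-cong R′ S≐ (strands β γ g (a₁ + a₂) (a₁ + a₂) a₃) 0))
              (neck-val eq d Wp Wq p≢q (in-S hβ) (in-S hγ) (in-S hg) a₁ a₂ a₃ s))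

      neck-move′ : ∀ {α β γ R R′ a₁ a₂ a₃} s → R ≋ (p , α) ∷ (q , β) ∷ (q , γ) ∷ R′ → deg R′ q ≡ 0 →
        Pole x w S (spokes β γ α R′) → S α ≡ true → S β ≡ true → S γ ≡ true → Supported a₁ a₂ a₃ → Out R (strands p p q a₁ a₂ a₃) s
      neck-move′ {α} {β} {γ} {R} {R′} {a₁} {a₂} {a₃} s eq d Π hα hβ hγ sup
        with continue β γ α R′ (a₁ + a₂) (a₁ + a₂) a₃ 0 Π (neck-sup {a₁} {a₂} {a₃} sup)
      ... | z , play , zle = z , subst (λ m → Move R (strands p p q a₁ a₂ a₃) s m z) two-more (neck {X = (p , α) ∷ (q , β) ∷ (q , γ) ∷ []} eq play)
          , ≤-trans zle (≤-trans (≤-reflexive (val-cong R′ S≐ (strands β γ α (a₁ + a₂) (a₁ + a₂) a₃) 0))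
              (neck-val′ eq d Wp Wq p≢q (in-S hα) (in-S hβ) (in-S hγ) a₁ a₂ a₃ s))

      module _ {b₁ b₂ b₃ : Fin N} {RA C R R′ : EList N} (L : Layer x w W S b₁ b₂ b₃ RA C R R′) where
        open Layer L

        private
          G : Cubic′ (spokes b₁ b₂ b₃ (C ++ (RA ++ R′))) (W ⊕ x)
          G = Cubic-≋ (≋-prep₃ _ _ _ eqR) (Pole.cubic pole)

          inAll : Inside (W ⊕ x) (C ++ (RA ++ R′))
          inAll = All.tail (All.tail (All.tail (inU G)))

          noX : deg (C ++ (RA ++ R′)) x ≡ 0
          noX with nl G
          ... | n₁ ∷ n₂ ∷ n₃ ∷ _ = root-deg⁻ _ b₁ b₂ b₃ x (n₁ ∘ sym) (n₂ ∘ sym) (n₃ ∘ sym) (d3 G x (⊕-new W x))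

          end-in : ∀ v → (W ⊕ x) v ≡ true → v ≢ x → S v ≡ false → (v ≡ p) ⊎ (v ≡ q)
          end-in v h nx f = only v (∧-true (⊕-≢ {W = W} {x} {v} h nx) (cong not f))

        copies-RA : ∃ λ j → RA ≋ copies j p q
        copies-RA = all-copies p q RA (all-++ˡ RA (all-++ʳ C (All.tail (All.tail (All.tail (nl G))))))
          (All.zipWith (λ { {a , b} ((ia , ib) , ((na , nb) , (oa , ob))) → end-in a ia na (not-true⁻ oa) , end-in b ib nb (not-true⁻ ob) })
            (all-++ˡ RA (all-++ʳ C inAll) , All.zipWith id (all-++ˡ RA (all-++ʳ C (deg-avoid (C ++ (RA ++ R′)) noX)) , inA)))

        ends-C : All (λ { (α , β) → (α ≡ p) ⊎ (α ≡ q) }) C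
        ends-C = All.zipWith (λ { {a , b} ((ia , ib) , ((na , nb) , (sa , sb))) → end-in a ia na sa })
            (all-++ˡ C inAll , All.zipWith id (all-++ˡ C (deg-avoid (C ++ (RA ++ R′)) noX) , hC))

        deg-R′ : ∀ {v} → S v ≡ false → deg R′ v ≡ 0
        deg-R′ h = inside-deg h R′ inR

        piece-degree : ∀ j → RA ≋ copies j p q → ∀ v → A v ≡ true → deg (spokes b₁ b₂ b₃ (C ++ (copies j p q ++ R′))) v ≡ 3
        piece-degree j e v hv = trans (deg-≋ v (≋-prep₃ _ _ _ (≋-++ˡ C (≋-sym (≋-++ʳ R′ e))))) (d3 G v (⊕-old {W = W} {x} {v} (∧-left hv)))

      A≢x : ∀ {v} → A v ≡ true → x ≢ v
      A≢x h = differ {X = W} (∧-left h) xW ∘ sym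

      small₂ : ∀ {b₂ b₃ α₁ α₂ β₁ β₂ RA R R′ a₁ a₂ a₃} s →
        Layer x w W S p b₂ b₃ RA ((α₁ , β₁) ∷ (α₂ , β₂) ∷ []) R R′ → (b₂ ≡ p) ⊎ (b₂ ≡ q) → S b₃ ≡ true → Supported a₁ a₂ a₃ →
        Out R (strands p b₂ b₃ a₁ a₂ a₃) s
      small₂ {b₂} {b₃} {α₁} {α₂} {β₁} {β₂} {RA} {R} {R′} s L hb₂ h₃ sup with copies-RA L | ends-C L | Layer.hC L
      ... | j , eRA | e₁ ∷ e₂ ∷ [] | (k₁ , l₁) ∷ (k₂ , l₂) ∷ [] =
        go (layer₂ {g = b₃} j p≢q (differ {X = S} h₃ Sp) (differ {X = S} h₃ Sq) Dp Dq hb₂ e₁ e₂)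
        where
        Dp = trans (sym (deg-cut₂ x p b₂ b₃ α₁ α₂ β₁ β₂ p q p j R′ (A≢x hp) (differ l₁ Sp) (differ l₂ Sp) (deg-R′ L Sp))) (piece-degree L j eRA p hp)
        Dq = trans (sym (deg-cut₂ x p b₂ b₃ α₁ α₂ β₁ β₂ p q q j R′ (A≢x hq) (differ l₁ Sq) (differ l₂ Sq) (deg-R′ L Sq))) (piece-degree L j eRA q hq)
        one : ∀ {E} → RA ≋ E → R ≋ (α₁ , β₁) ∷ (α₂ , β₂) ∷ (E ++ R′)
        one e = ≋-trans (Layer.eqR L) (≋-prep₂ _ _ (≋-++ʳ R′ e))
        swapped : Layer x w W S p b₂ b₃ RA ((α₂ , β₂) ∷ (α₁ , β₁) ∷ []) R R′
        swapped = record { pole = Layer.pole L ; S⊆W = S⊆W ; wS = wS ; eqR = ≋-trans (Layer.eqR L) (≋-swap _ _)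
                         ; inA = Layer.inA L ; inR = Layer.inR L ; hC = (k₂ , l₂) ∷ (k₁ , l₁) ∷ [] }
        go : Layer₂ p q b₂ α₁ α₂ j → Out R (strands p b₂ b₃ _ _ _) s
        go (rung₁ refl refl refl refl) = rung-move s (≋-trans (one eRA) (≋-third _ _ _))
          (Contract.pole (Layer.pole L) (Layers.cut₂ swapped xS Sp Sq h₃)) l₁ l₂ h₃ sup
        go (rung₂ refl refl refl refl) = rung-move s (≋-trans (one eRA) (≋-trans (≋-swap _ _) (≋-third _ _ _)))
          (Contract.pole (Layer.pole L) (Layers.cut₂ L xS Sp Sq h₃)) l₂ l₁ h₃ sup
        go (neck refl refl refl refl) = neck-move s (≋-trans (one eRA) (≋-third _ _ _)) (deg-R′ L Sq)
          (Contract.pole (Layer.pole L) (Layers.cut₂ L xS Sp Sp h₃)) l₁ l₂ h₃ sup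

      small₃ : ∀ {b₃ α₁ α₂ α₃ β₁ β₂ β₃ RA R R′ a₁ a₂ a₃} s →
        Layer x w W S p p b₃ RA ((α₁ , β₁) ∷ (α₂ , β₂) ∷ (α₃ , β₃) ∷ []) R R′ → (b₃ ≡ p) ⊎ (b₃ ≡ q) → Supported a₁ a₂ a₃ →
        Out R (strands p p b₃ a₁ a₂ a₃) s
      small₃ {b₃} {α₁} {α₂} {α₃} {β₁} {β₂} {β₃} {RA} {R} {R′} s L hb₃ sup with copies-RA L | ends-C L | Layer.hC L
      ... | j , eRA | e₁ ∷ e₂ ∷ e₃ ∷ [] | (k₁ , l₁) ∷ (k₂ , l₂) ∷ (k₃ , l₃) ∷ [] =
        go (layer₃ j p≢q Dp Dq hb₃ e₁ e₂ e₃)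
        where
        Dp = trans (sym (deg-cut₃ x p p b₃ α₁ α₂ α₃ β₁ β₂ β₃ p q p j R′ (A≢x hp) (differ l₁ Sp) (differ l₂ Sp) (differ l₃ Sp) (deg-R′ L Sp))) (piece-degree L j eRA p hp)
        Dq = trans (sym (deg-cut₃ x p p b₃ α₁ α₂ α₃ β₁ β₂ β₃ p q q j R′ (A≢x hq) (differ l₁ Sq) (differ l₂ Sq) (differ l₃ Sq) (deg-R′ L Sq))) (piece-degree L j eRA q hq)
        layer : ∀ {c₁ c₂ c₃} → R ≋ c₁ ∷ c₂ ∷ c₃ ∷ (RA ++ R′) → All (λ { (α , β) → S α ≡ false × S β ≡ true }) (c₁ ∷ c₂ ∷ c₃ ∷ []) →
                Layer x w W S p p b₃ RA (c₁ ∷ c₂ ∷ c₃ ∷ []) R R′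
        layer e h = record { pole = Layer.pole L ; S⊆W = S⊆W ; wS = wS ; eqR = e ; inA = Layer.inA L ; inR = Layer.inR L ; hC = h }
        eR = Layer.eqR L
        empty : ∀ {E c₁ c₂ c₃} → RA ≋ [] → R ≋ c₁ ∷ c₂ ∷ c₃ ∷ (RA ++ R′) → E ≡ c₁ ∷ c₂ ∷ c₃ ∷ R′ → R ≋ E
        empty e f refl = ≋-trans f (≋-prep₃ _ _ _ (≋-++ʳ R′ e))
        go : Layer₃ p q b₃ α₁ α₂ α₃ j → Out R (strands p p b₃ _ _ _) s
        go (neck₁ refl refl refl refl refl) = neck-move′ s (empty eRA eR refl) (deg-R′ L Sq)
            (Contract.pole (Layer.pole L) (Layers.cut₃ (layer (≋-trans eR (≋-trans (≋-swap _ _) (≋-prep _ (≋-swap _ _)))) ((k₂ , l₂) ∷ (k₃ , l₃) ∷ (k₁ , l₁) ∷ [])) xS Sp Sp Sq)) l₁ l₂ l₃ sup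
        go (neck₂ refl refl refl refl refl) = neck-move′ s (empty eRA (≋-trans eR (≋-swap _ _)) refl) (deg-R′ L Sq)
            (Contract.pole (Layer.pole L) (Layers.cut₃ (layer (≋-trans eR (≋-prep _ (≋-swap _ _))) ((k₁ , l₁) ∷ (k₃ , l₃) ∷ (k₂ , l₂) ∷ [])) xS Sp Sp Sq)) l₂ l₁ l₃ sup
        go (neck₃ refl refl refl refl refl) = neck-move′ s (empty eRA (≋-trans eR (≋-third _ _ _)) refl) (deg-R′ L Sq)
            (Contract.pole (Layer.pole L) (Layers.cut₃ L xS Sp Sp Sq)) l₃ l₁ l₂ sup
        -- All strands enter at `p` and all outgoing edges start at `q`, so `W` without `p` has no
        -- leaving edge.
        go (apart refl refl refl refl refl) =
          ⊥-elim (<⇒≱ (s≤s z≤n) (≤-trans (Pole.near (Layer.pole L) X Xx (trans (⊖-keep W (differ wS Sp)) (S⊆W w wS))) (≤-reflexive cut)))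
          where
          X : VSub N
          X = W ⊖ p
          Xx : X x ≡ false
          Xx = ⊖-out {U = W} xW
          Xp : X p ≡ false
          Xp = ⊖-self W p
          Xq : X q ≡ true
          Xq = ⊖-in {U = W} Wq (p≢q ∘ sym)
          XS : ∀ {v} → S v ≡ true → X v ≡ true
          XS {v} h = ⊖-in {U = W} (S⊆W v h) (differ h Sp)
          cut : δ (spokes p p p R) X ≡ 0
          cut = trans (spokes-δ x p p p R X Xx) (cong₂ _+_ (cong χ Xp) (cong₂ _+_ (cong χ Xp) (cong₂ _+_ (cong χ Xp)
            (trans (δ-≋ X (empty eRA eR refl)) (δ-zero true ((q , β₁) ∷ (q , β₂) ∷ (q , β₃) ∷ R′)
              ((Xq , XS l₁) ∷ (Xq , XS l₂) ∷ (Xq , XS l₃) ∷ All.map (λ { (h , k) → XS h , XS k }) (Layer.inR L)))))))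

    module Peel {b₁ b₂ b₃ : Fin N} {RA C R R′ : EList N} (L : Layer x w W S b₁ b₂ b₃ RA C R R′)
                (full : δ (spokes b₁ b₂ b₃ R) S ≡ 3) (max : ∀ T → Valid w W (spokes b₁ b₂ b₃ R) T → size T ≤ size S) where

      module LC = LayerCut L full sa

      A≥2 : 2 ≤ size A
      A≥2 with LC.several
      ... | a , b , ne , ha , hb = size-two {U = A} ne ha hb

      in-A : ∀ {b} → W b ≡ true → S b ≡ false → A b ≡ true
      in-A h e = ∧-true h (cong not e)

      -- Two vertices give a rung or a neck, three or more give a contraction with at least five
      -- vertices; a single one is excluded by `LC.several`.
      sizeA : size A ≡ 2 ⊎ 3 + size S ≤ size W
      sizeA with m≤n⇒m<n∨m≡n A≥2
      ... | inj₁ h = inj₂ (≤-trans (≤-reflexive (+-comm 3 (size S))) (≤-trans (+-monoʳ-≤ (size S) h) (≤-reflexive (sym sizes))))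
      ... | inj₂ e = inj₁ (sym e)

      one-passes′ : ∀ c₁ c₂ c₃ α₁ β₁ α₂ β₂ a₁ a₂ a₃ s → spokes c₁ c₂ c₃ R ≋ spokes b₁ b₂ b₃ R →
        Layer x w W S c₁ c₂ c₃ RA ((α₁ , β₁) ∷ (α₂ , β₂) ∷ []) R R′ →
        S c₁ ≡ false → S c₂ ≡ false → S c₃ ≡ true → Supported a₁ a₂ a₃ →
        (q : Fin N) → A q ≡ true → q ≢ c₁ → A c₁ ≡ true → A c₂ ≡ true → Out R (strands c₁ c₂ c₃ a₁ a₂ a₃) s
      one-passes′ c₁ c₂ c₃ α₁ β₁ α₂ β₂ a₁ a₂ a₃ s eq L′ h₁ h₂ h₃ sup q Aq ne A₁ A₂ = [
          (λ e → Small.small₂ e {c₁} {q} (ne ∘ sym) A₁ Aq {c₂} {c₃} {α₁} {α₂} {β₁} {β₂} {RA} {R} {R′} {a₁} {a₂} {a₃} s L′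
            (Small.only e {c₁} {q} (ne ∘ sym) A₁ Aq c₂ A₂) h₃ sup) ,
          (λ large → Big.big-move₂ {spokes b₁ b₂ b₃ R} max large {c₁} {c₂} {c₃} {α₁} {α₂} {β₁} {β₂} {RA} {R} {R′} {a₁} {a₂} {a₃} s eq L′ h₁ h₂ h₃ sup) ]′ sizeA

      one-passes : ∀ {c₁ c₂ c₃ a₁ a₂ a₃} s → spokes c₁ c₂ c₃ R ≋ spokes b₁ b₂ b₃ R → Layer x w W S c₁ c₂ c₃ RA C R R′ →
        length C ≡ 2 → S c₁ ≡ false → S c₂ ≡ false → S c₃ ≡ true → Supported a₁ a₂ a₃ → Out R (strands c₁ c₂ c₃ a₁ a₂ a₃) s
      one-passes {c₁} {c₂} {c₃} {a₁} {a₂} {a₃} s eq L′ l h₁ h₂ h₃ sup =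
        let α₁ , β₁ , α₂ , β₂ , e = two-links C l
            q , Aq , ne = size-pick≢ A c₁ A≥2
            W₁ , W₂ , _ = pole-spokes (Layer.pole L′)
        in one-passes′ c₁ c₂ c₃ α₁ β₁ α₂ β₂ a₁ a₂ a₃ s eq (subst (λ C → Layer x w W S c₁ c₂ c₃ RA C R R′) e L′) h₁ h₂ h₃ sup
             q Aq ne (in-A W₁ h₁) (in-A W₂ h₂)

      twin′ : ∀ c c₃ α₁ β₁ α₂ β₂ α₃ β₃ a₁ a₂ a₃ s → size A ≡ 2 → Layer x w W S c c c₃ RA ((α₁ , β₁) ∷ (α₂ , β₂) ∷ (α₃ , β₃) ∷ []) R R′ →
        Supported a₁ a₂ a₃ → (q : Fin N) → A q ≡ true → q ≢ c → A c ≡ true → A c₃ ≡ true → Out R (strands c c c₃ a₁ a₂ a₃) s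
      twin′ c c₃ α₁ β₁ α₂ β₂ α₃ β₃ a₁ a₂ a₃ s e L′ sup q Aq ne A₁ A₃ =
        Small.small₃ e {c} {q} (ne ∘ sym) A₁ Aq {c₃} {α₁} {α₂} {α₃} {β₁} {β₂} {β₃} {RA} {R} {R′} {a₁} {a₂} {a₃} s L′
          (Small.only e {c} {q} (ne ∘ sym) A₁ Aq c₃ A₃) sup

      twin : ∀ {c c₃ a₁ a₂ a₃} s → size A ≡ 2 → Layer x w W S c c c₃ RA C R R′ →
        length C ≡ 3 → S c ≡ false → S c₃ ≡ false → Supported a₁ a₂ a₃ → Out R (strands c c c₃ a₁ a₂ a₃) s
      twin {c} {c₃} {a₁} {a₂} {a₃} s e L′ l h h₃ sup =
        let α₁ , β₁ , α₂ , β₂ , α₃ , β₃ , eC = three-links C l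
            q , Aq , ne = size-pick≢ A c A≥2
            W₁ , _ , W₃ = pole-spokes (Layer.pole L′)
        in twin′ c c₃ α₁ β₁ α₂ β₂ α₃ β₃ a₁ a₂ a₃ s e (subst (λ C → Layer x w W S c c c₃ RA C R R′) eC L′) sup
             q Aq ne (in-A W₁ h) (in-A W₃ h₃)

      Result : Strands N → ℕ → Set
      Result σ s = ∃ λ z → Play R σ s (size W ∸ 1) z × z ≤ val R W σ s

      turn : ∀ i σ s → Out R (rot i σ) s → Result σ s
      turn i σ s (z , M , h) = z , step i M , ≤-trans h (≤-reflexive (val-rot i R W σ s))

      rot₁ : spokes b₂ b₃ b₁ R ≋ spokes b₁ b₂ b₃ R
      rot₁ = ≋-sym (spokes-rot x b₁ b₂ b₃ R)
      rot₂ : spokes b₃ b₁ b₂ R ≋ spokes b₁ b₂ b₃ R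
      rot₂ = spokes-rot x b₃ b₁ b₂ R

      -- When the layer has two vertices, two of the three strands share an end; a rotation makes
      -- them the first two.
      none-passes : ∀ {a₁ a₂ a₃} s → length C ≡ 3 → S b₁ ≡ false → S b₂ ≡ false → S b₃ ≡ false → Supported a₁ a₂ a₃ →
                    size A ≡ 2 ⊎ 3 + size S ≤ size W → Dec (b₁ ≡ b₂) → Dec (b₂ ≡ b₃) → Dec (b₃ ≡ b₁) → Result (strands b₁ b₂ b₃ a₁ a₂ a₃) s
      none-passes {a₁} {a₂} {a₃} s l h₁ h₂ h₃ sup (inj₂ large) _ _ _ = 
        let α₁ , β₁ , α₂ , β₂ , α₃ , β₃ , eC = three-links C l
        in turn r₀ (strands b₁ b₂ b₃ a₁ a₂ a₃) s (Big.big-move₃ max large {b₁} {b₂} {b₃} {α₁} {α₂} {α₃} {β₁} {β₂} {β₃} {RA} {R} {R′} {a₁} {a₂} {a₃} s ≋-refl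
             (subst (λ C → Layer x w W S b₁ b₂ b₃ RA C R R′) eC L) h₁ h₂ h₃ sup)
      none-passes {a₁} {a₂} {a₃} s l h₁ h₂ h₃ sup (inj₁ e) (yes refl) _ _ = turn r₀ (strands b₁ b₁ b₃ a₁ a₂ a₃) s (twin s e L l h₁ h₃ sup)
      none-passes {a₁} {a₂} {a₃} s l h₁ h₂ h₃ sup (inj₁ e) _ (yes refl) _ = turn r₁ (strands b₁ b₂ b₂ a₁ a₂ a₃) s
        (twin s e (layer-rot L) l h₂ h₁ (supported-rot a₁ a₂ a₃ sup))
      none-passes {a₁} {a₂} {a₃} s l h₁ h₂ h₃ sup (inj₁ e) _ _ (yes refl) = turn r₂ (strands b₁ b₂ b₁ a₁ a₂ a₃) s
        (twin s e (layer-rot (layer-rot L)) l h₃ h₂ (supported-rot a₂ a₃ a₁ (supported-rot a₁ a₂ a₃ sup)))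
      none-passes {a₁} {a₂} {a₃} s l h₁ h₂ h₃ sup (inj₁ e) (no n₁) (no n₂) (no n₃) = ⊥-elim (<⇒≱ three (≤-reflexive e))
        where
        A₁ = in-A (proj₁ LC.spoke-ends) h₁
        A₂ = in-A (proj₁ (proj₂ LC.spoke-ends)) h₂
        A₃ = in-A (proj₂ (proj₂ LC.spoke-ends)) h₃
        three : 2 < size A
        three = ≤-trans (s≤s (size-two {U = A ⊖ b₁} n₂ (⊖-in {U = A} A₂ (n₁ ∘ sym)) (⊖-in {U = A} A₃ n₃)))
          (≤-reflexive (sym (size-⊖ A b₁ A₁)))

      result : ∀ {a₁ a₂ a₃} s → Supported a₁ a₂ a₃ → LC.Passing → Result (strands b₁ b₂ b₃ a₁ a₂ a₃) s
      result s sup (LC.none h₁ h₂ h₃ l) = none-passes s l h₁ h₂ h₃ sup sizeA (b₁ ≟ b₂) (b₂ ≟ b₃) (b₃ ≟ b₁)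
      result {a₁} {a₂} {a₃} s sup (LC.third h₁ h₂ h₃ l) = turn r₀ (strands b₁ b₂ b₃ a₁ a₂ a₃) s (one-passes s ≋-refl L l h₁ h₂ h₃ sup)
      result {a₁} {a₂} {a₃} s sup (LC.first h₂ h₃ h₁ l) = turn r₁ (strands b₁ b₂ b₃ a₁ a₂ a₃) s
        (one-passes s rot₁ (layer-rot L) l h₂ h₃ h₁ (supported-rot a₁ a₂ a₃ sup))
      result {a₁} {a₂} {a₃} s sup (LC.second h₃ h₁ h₂ l) = turn r₂ (strands b₁ b₂ b₃ a₁ a₂ a₃) s
        (one-passes s rot₂ (layer-rot (layer-rot L)) l h₃ h₁ h₂ (supported-rot a₂ a₃ a₁ (supported-rot a₁ a₂ a₃ sup)))

  finished : ∀ {W b₁ b₂ b₃ R} a₁ a₂ a₃ s → size W ≡ 1 → Pole x w W (spokes b₁ b₂ b₃ R) →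
             ∃ λ z → Play R (strands b₁ b₂ b₃ a₁ a₂ a₃) s (size W ∸ 1) z × z ≤ val R W (strands b₁ b₂ b₃ a₁ a₂ a₃) s
  finished {W} {b₁} {b₂} {b₃} {R} a₁ a₂ a₃ s e Π rewrite e = a₁ + a₂ + a₃ , end ,
    ≤-trans (+-mono-≤ (+-mono-≤ (times a₁ (only (proj₁ W₃))) (times a₂ (only (proj₁ (proj₂ W₃))))) (times a₃ (only (proj₂ (proj₂ W₃)))))
      (m≤m+n _ _)
    where
    W₃ = pole-spokes Π
    only : ∀ {b} → W b ≡ true → 1 ≤ m₁ R W b
    only {b} h = μ-empty R λ { (v , hv) → true≢false hv (size-zero (suc-injective (trans (sym (size-⊖ W b h)) e)) v) }
    times : ∀ a {m} → 1 ≤ m → a ≤ a * m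
    times a h = ≤-trans (≤-reflexive (sym (*-identityʳ a))) (*-monoʳ-≤ a h)

  start-valid : ∀ {W E} → Pole x w W E → 2 ≤ size W → Valid w W E (single w)
  start-valid {W} {E} Π h with size-pick≢ W w h
  ... | v , hv , ne = (λ u e → subst (λ t → W t ≡ true) (sym (==-≡ e)) (Pole.wW Π)) , ==-refl w ,
    (v , ∧-true hv (cong not (==-≢ ne))) ,
    δ-single (Pole.cubic Π) (single w) w (⊕-old {W = W} {x} {w} (Pole.wW Π)) (==-refl w) (λ u e → ==-≡ (∧-right {(W ⊕ x) u} e))

  trace : ∀ k → Goal k
  trace-step : ∀ k W b₁ b₂ b₃ R a₁ a₂ a₃ s → size W ≤ suc k → size W + 1 < n → (∀ v → W v ≡ true → v ≢ w → K v) →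
    (Π : Pole x w W (spokes b₁ b₂ b₃ R)) → Supported a₁ a₂ a₃ → 
    (∃ λ S → Valid w W (spokes b₁ b₂ b₃ R) S × (∀ T → Valid w W (spokes b₁ b₂ b₃ R) T → size T ≤ size S)) →
    ∃ λ z → Play R (strands b₁ b₂ b₃ a₁ a₂ a₃) s (size W ∸ 1) z × z ≤ val R W (strands b₁ b₂ b₃ a₁ a₂ a₃) s

  trace zero W b₁ b₂ b₃ R a₁ a₂ a₃ s le lt KW Π sup = ⊥-elim (<⇒≱ (size-pos {U = W} (Pole.wW Π)) le)
  trace (suc k) W b₁ b₂ b₃ R a₁ a₂ a₃ s le lt KW Π sup = go (m≤n⇒m<n∨m≡n (size-pos {U = W} (Pole.wW Π)))
    where
    go : 1 < size W ⊎ 1 ≡ size W → ∃ λ z → Play R (strands b₁ b₂ b₃ a₁ a₂ a₃) s (size W ∸ 1) z × z ≤ val R W (strands b₁ b₂ b₃ a₁ a₂ a₃) s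
    go (inj₂ e) = finished a₁ a₂ a₃ s (sym e) Π
    go (inj₁ h) = trace-step k W b₁ b₂ b₃ R a₁ a₂ a₃ s le lt KW Π sup
      (maximal (valid-cong w W (spokes b₁ b₂ b₃ R)) (valid? w W (spokes b₁ b₂ b₃ R)) (single w , start-valid Π h))

  trace-step k W b₁ b₂ b₃ R a₁ a₂ a₃ s le lt KW Π sup (S , (S⊆W , wS , sa , full) , max) = go (partitioned S R)
    where
    go : Partition S R → ∃ λ z → Play R (strands b₁ b₂ b₃ a₁ a₂ a₃) s (size W ∸ 1) z × z ≤ val R W (strands b₁ b₂ b₃ a₁ a₂ a₃) s
    go (partition RA C R′ eq inA inR hC) = Moves.Peel.result k (trace k) le lt KW S⊆W wS (Pole.xW Π) sa L full max s sup (LayerCut.passing L full sa)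
      where
      L : Layer x w W S b₁ b₂ b₃ RA C R R′
      L = record { pole = Π ; S⊆W = S⊆W ; wS = wS ; eqR = eq ; inA = inA ; inR = inR ; hC = hC }

-- Ladders

put : Bool → Edge N → EList N → EList N
put true e E = e ∷ E
put false e E = E

-- Restriction to a vertex set removes the edge that a split has added, so that a ladder of the
-- split graph becomes one of the original graph.
keep : VSub N → EList N → EList N
keep k [] = []
keep k ((a , b) ∷ E) = put (k a ∧ k b) (a , b) (keep k E)

put-≋ : (t : Bool) (e : Edge N) {E F : EList N} → E ≋ F → put t e E ≋ put t e F
put-≋ true e h = ≋-prep e h
put-≋ false e h = h

keep-≋ : (k : VSub N) {E F : EList N} → E ≋ F → keep k E ≋ keep k F
keep-≋ k ≋-refl = ≋-refl
keep-≋ k (≋-prep (a , b) h) = put-≋ (k a ∧ k b) (a , b) (keep-≋ k h)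
keep-≋ k (≋-swap (a , b) (c , d)) with k a ∧ k b | k c ∧ k d
... | true | true = ≋-swap (a , b) (c , d)
... | true | false = ≋-refl
... | false | true = ≋-refl
... | false | false = ≋-refl
keep-≋ k (≋-flip a b) rewrite ∧-comm (k a) (k b) with k b ∧ k a
... | true = ≋-flip a b
... | false = ≋-refl
keep-≋ k (≋-trans h l) = ≋-trans (keep-≋ k h) (keep-≋ k l)

keep-in : (k : VSub N) {a b : Fin N} (E : EList N) → k a ≡ true → k b ≡ true → keep k ((a , b) ∷ E) ≡ (a , b) ∷ keep k E
keep-in k {a} {b} E ha hb = cong (λ t → put t (a , b) (keep k E)) (∧-true ha hb)

keep-out : (k : VSub N) {a b : Fin N} (E : EList N) → k a ≡ false → keep k ((a , b) ∷ E) ≡ keep k E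
keep-out k {a} {b} E ha = cong (λ t → put t (a , b) (keep k E)) (∧-false₁ ha)

keep-++ : (k : VSub N) (E F : EList N) → keep k (E ++ F) ≡ keep k E ++ keep k F
keep-++ k [] F = refl
keep-++ k ((a , b) ∷ E) F rewrite keep-++ k E F with k a ∧ k b
... | true = refl
... | false = refl

keep-rest : (k : VSub N) (E : EList N) → ∃ λ D → E ≋ keep k E ++ D
keep-rest k [] = [] , ≋-refl
keep-rest k ((a , b) ∷ E) with keep-rest k E | k a ∧ k b
... | D , eq | true = D , ≋-prep _ eq
... | D , eq | false = (a , b) ∷ D , ≋-trans (≋-prep _ eq) (≋-sym (≋-shift (keep k E) (a , b) D))

opaque
  unfolding deg
  rung-deg₁ : (p q p′ q′ : Fin N) (R : EList N) → 2 ≤ deg ((p , q) ∷ (p , p′) ∷ (q , q′) ∷ R) p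
  rung-deg₁ p q p′ q′ R rewrite ==-refl p = s≤s (≤-trans (s≤s z≤n) (m≤n+m _ (χ (q == p))))

  rung-deg₂ : (p q p′ q′ : Fin N) (R : EList N) → 2 ≤ deg ((p , q) ∷ (p , p′) ∷ (q , q′) ∷ R) q
  rung-deg₂ p q p′ q′ R rewrite ==-refl q = +-mono-≤ (m≤n+m 1 (χ (p == q))) (≤-trans (s≤s z≤n) (m≤n+m _ (χ (p == q) + χ (p′ == q))))

  rung-deg₃ : (p q p′ q′ : Fin N) (R : EList N) → suc (deg R p′) ≤ deg ((p , q) ∷ (p , p′) ∷ (q , q′) ∷ R) p′
  rung-deg₃ p q p′ q′ R rewrite ==-refl p′ = ≤-trans (+-mono-≤ (m≤n+m 1 (χ (p == p′))) (m≤n+m (deg R p′) (inc p′ (q , q′)))) (m≤n+m _ (inc p′ (p , q)))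

  rung-deg₄ : (p q p′ q′ : Fin N) (R : EList N) → suc (deg R q′) ≤ deg ((p , q) ∷ (p , p′) ∷ (q , q′) ∷ R) q′
  rung-deg₄ p q p′ q′ R rewrite ==-refl q′ = ≤-trans (+-monoˡ-≤ (deg R q′) (m≤n+m 1 (χ (q == q′)))) (≤-trans (m≤n+m _ (inc q′ (p , p′))) (m≤n+m _ (inc q′ (p , q))))

  deg-tail : (e : Edge N) (R : EList N) (v : Fin N) → deg R v ≤ deg (e ∷ R) v
  deg-tail e R v = m≤n+m (deg R v) (inc v e)

  χ-≢ : {a b : Fin N} → χ (a == b) ≡ 0 → a ≢ b
  χ-≢ {a = a} k refl rewrite ==-refl a with k
  ... | ()

  split-two : ∀ a b c d r → 1 + a + (1 + b + (c + d + r)) ≤ 2 → a ≡ 0 × b ≡ 0 × d ≡ 0 × r ≡ 0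
  split-two zero zero zero zero zero _ = refl , refl , refl , refl
  split-two zero zero zero zero (suc r) (s≤s (s≤s ()))
  split-two zero zero zero (suc d) r (s≤s (s≤s ()))
  split-two zero zero (suc c) d r (s≤s (s≤s ()))
  split-two zero (suc b) c d r (s≤s (s≤s ()))
  split-two (suc zero) b c d r (s≤s (s≤s ()))
  split-two (suc (suc a)) b c d r (s≤s (s≤s ()))

  -- A vertex of degree at most 2 on a rung has no further edges.
  rung-full₁ : (p q p′ q′ : Fin N) (R : EList N) → deg ((p , q) ∷ (p , p′) ∷ (q , q′) ∷ R) p ≤ 2 →
               q ≢ p × p′ ≢ p × q′ ≢ p × deg R p ≡ 0
  rung-full₁ p q p′ q′ R h rewrite ==-refl p with split-two (χ (q == p)) (χ (p′ == p)) (χ (q == p)) (χ (q′ == p)) (sumE (inc p) R) h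
  ... | a , b , d , r = χ-≢ a , χ-≢ b , χ-≢ d , r

rung-flip : (p q p′ q′ : Fin N) {R : EList N} → (p , q) ∷ (p , p′) ∷ (q , q′) ∷ R ≋ (q , p) ∷ (q , q′) ∷ (p , p′) ∷ R
rung-flip p q p′ q′ = ≋-trans (≋-flip p q) (≋-prep _ (≋-swap _ _))

deg-sub : {R₀ R : EList N} (X : EList N) → R₀ ≋ X ++ R → ∀ v → deg R v ≤ deg R₀ v
deg-sub {R = R} X h v = ≤-trans (m≤n+m (deg R v) (deg X v)) (≤-reflexive (trans (sym (deg-++ X R v)) (sym (deg-≋ v h))))

ladder-≋ : {K : Fin N → Set} {R R₁ : EList N} {p q : Fin N} {j : ℕ} → R ≋ R₁ → Ladder K R₁ p q j → Ladder K R p q j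
ladder-≋ h [] = []
ladder-≋ h (rung e kp kq L) = rung (≋-trans h e) kp kq L

ladder-++ : {K : Fin N → Set} {R : EList N} {p q : Fin N} {j : ℕ} (D : EList N) → Ladder K R p q j → Ladder K (R ++ D) p q j
ladder-++ D [] = []
ladder-++ D (rung e kp kq L) = rung (≋-++ʳ D e) kp kq (ladder-++ D L)

-- One rung is lost: the links of the last rung lead to vertices that need not lie in `K`.
ladder-keep : {K : Fin N → Set} (k : VSub N) {R : EList N} {p q : Fin N} {j : ℕ} →
  (∀ v → K v → 2 ≤ deg R v → k v ≡ true) → Ladder K R p q (suc j) → Ladder K (keep k R) p q j
ladder-keep k {j = zero} h L = []
ladder-keep {K = K} k {j = suc j} h (rung {R} {R′} {p} {q} {p′} {q′} eq kp kq (rung {R′ = R″} {p′ = p″} {q′ = q″} eq′ kp′ kq′ L)) =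
  rung (≋-trans (keep-≋ k eq) (≡⇒≋ (trans (keep-in k ((p , p′) ∷ (q , q′) ∷ R′) hp hq) (cong ((p , q) ∷_) (trans (keep-in k ((q , q′) ∷ R′) hp hp′)
    (cong ((p , p′) ∷_) (keep-in k R′ hq hq′))))))) kp kq
    (ladder-keep k (λ v kv d → h v kv (≤-trans d (deg-sub (_ ∷ _ ∷ _ ∷ []) eq v))) (rung eq′ kp′ kq′ L))
  where
  at : ∀ v {d} → d ≤ deg ((p , q) ∷ (p , p′) ∷ (q , q′) ∷ R′) v → d ≤ deg R v
  at v l = ≤-trans l (≤-reflexive (sym (deg-≋ v eq)))
  at′ : ∀ v → 2 ≤ deg ((q′ , p′) ∷ (q′ , p″) ∷ (p′ , q″) ∷ R″) v → 2 ≤ deg R v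
  at′ v l = ≤-trans l (≤-trans (≤-reflexive (sym (deg-≋ v eq′))) (deg-sub (_ ∷ _ ∷ _ ∷ []) eq v))
  hp : k p ≡ true
  hp = h p kp (at p (rung-deg₁ p q p′ q′ R′))
  hq : k q ≡ true
  hq = h q kq (at q (rung-deg₂ p q p′ q′ R′))
  hp′ : k p′ ≡ true
  hp′ = h p′ kq′ (at′ p′ (rung-deg₂ q′ p′ p″ q″ R″))
  hq′ : k q′ ≡ true
  hq′ = h q′ kp′ (at′ q′ (rung-deg₁ q′ p′ p″ q″ R″))

-- The vertex set V has been cut down to the part of a ladder from the rung pq on.
record Standing (T : EList N) (V : VSub N) (p q : Fin N) : Set where
  field
    dp : deg T p ≤ 2
    dq : deg T q ≤ 2
    Vp : V p ≡ true
    Vq : V q ≡ true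
    d≤3 : ∀ v → deg T v ≤ 3
    alive : ∀ v → 3 ≤ deg T v → V v ≡ true

module Rung {N} {T T′ : EList N} {V : VSub N} {p q p′ q′ : Fin N} (St : Standing T V p q)
            (eq : T ≋ (p , q) ∷ (p , p′) ∷ (q , q′) ∷ T′) where
  open Standing St

  private
    fp = rung-full₁ p q p′ q′ T′ (≤-trans (≤-reflexive (sym (deg-≋ p eq))) dp)
    fq = rung-full₁ q p q′ p′ T′ (≤-trans (≤-reflexive (sym (deg-≋ q (≋-trans eq (rung-flip p q p′ q′))))) dq)
    q≢p = proj₁ fp
    p′≢p = proj₁ (proj₂ fp)
    q′≢p = proj₁ (proj₂ (proj₂ fp))
    dT′p = proj₂ (proj₂ (proj₂ fp))
    q′≢q = proj₁ (proj₂ fq)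
    p′≢q = proj₁ (proj₂ (proj₂ fq))
    dT′q = proj₂ (proj₂ (proj₂ fq))

    positive-≢ : ∀ {v u} → deg T′ u ≡ 0 → 1 ≤ deg T′ v → v ≢ u
    positive-≢ h l refl rewrite h with l
    ... | ()

  module _ {p″ q″ : Fin N} {T″ : EList N} (eq′ : T′ ≋ (q′ , p′) ∷ (q′ , q″) ∷ (p′ , p″) ∷ T″) where

    private
      dq′ : 3 ≤ deg T q′
      dq′ = ≤-trans (s≤s (≤-trans (rung-deg₁ q′ p′ q″ p″ T″) (≤-reflexive (sym (deg-≋ q′ eq′)))))
        (≤-trans (rung-deg₄ p q p′ q′ T′) (≤-reflexive (sym (deg-≋ q′ eq))))
      dp′ : 3 ≤ deg T p′
      dp′ = ≤-trans (s≤s (≤-trans (rung-deg₂ q′ p′ q″ p″ T″) (≤-reflexive (sym (deg-≋ p′ eq′)))))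
        (≤-trans (rung-deg₃ p q p′ q′ T′) (≤-reflexive (sym (deg-≋ p′ eq))))
      Vq′ = alive q′ dq′
      Vp′ = alive p′ dp′

    -- Removing a rung isolates `p` and `q` and takes one from the degrees of `q′` and `p′`, so the
    -- next rung is met under the same conditions.
    next : Standing T′ (V ⊖ p ⊖ q) q′ p′
    next = record
      { dp = ≤-pred (≤-trans (rung-deg₄ p q p′ q′ T′) (≤-trans (≤-reflexive (sym (deg-≋ q′ eq))) (d≤3 q′)))
      ; dq = ≤-pred (≤-trans (rung-deg₃ p q p′ q′ T′) (≤-trans (≤-reflexive (sym (deg-≋ p′ eq))) (d≤3 p′)))
      ; Vp = ⊖₂-in V Vq′ q′≢p q′≢q ; Vq = ⊖₂-in V Vp′ p′≢p p′≢q
      ; d≤3 = λ v → ≤-trans (deg-sub (_ ∷ _ ∷ _ ∷ []) eq v) (d≤3 v)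
      ; alive = λ v l → ⊖₂-in V (alive v (≤-trans l (deg-sub (_ ∷ _ ∷ _ ∷ []) eq v)))
          (positive-≢ dT′p (≤-trans (s≤s z≤n) l)) (positive-≢ dT′q (≤-trans (s≤s z≤n) l)) }

    private
      p′≢q′ : p′ ≢ q′
      p′≢q′ = proj₁ (rung-full₁ q′ p′ q″ p″ T″ (≤-trans (≤-reflexive (sym (deg-≋ q′ eq′))) (Standing.dp next)))

      V₂ = V ⊖ p ⊖ p′

      perm : V₂ ⊖ q ⊖ q′ ≐ V ⊖ p ⊖ q ⊖ q′ ⊖ p′
      perm v = trans (⊖-cong {U = V ⊖ p ⊖ p′ ⊖ q} {V ⊖ p ⊖ q ⊖ p′} q′ (⊖-comm (V ⊖ p) p′ q) v) (⊖-comm (V ⊖ p ⊖ q) p′ q′ v)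

      V₃ = V ⊖ p ⊖ q ⊖ q′ ⊖ p′

      q′∉ : V₃ q′ ≡ false
      q′∉ = ⊖-out {U = V ⊖ p ⊖ q ⊖ q′} (⊖-self (V ⊖ p ⊖ q) q′)
      p′∉ : V₃ p′ ≡ false
      p′∉ = ⊖-self (V ⊖ p ⊖ q ⊖ q′) p′
      Vq₂ : V₂ q ≡ true
      Vq₂ = ⊖₂-in V Vq q≢p (p′≢q ∘ sym)
      Vq′₂ : V₂ q′ ≡ true
      Vq′₂ = ⊖₂-in V Vq′ q′≢p (p′≢q′ ∘ sym)

      used : μₑ (p , q) ((q , q′) ∷ T′) V ≡ μ T′ (V ⊖ p ⊖ q)
      used = trans (μₑ-live {U = V} {p} {q} ((q , q′) ∷ T′) Vp Vq) (μ-dead {U = V ⊖ p ⊖ q} {q} {q′} T′ (⊖-self (V ⊖ p) q))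

      beyond : μ T′ V₃ ≡ μ T″ V₃
      beyond = trans (μ-≋ eq′ V₃) (trans (μ-dead {U = V₃} {q′} {p′} ((q′ , q″) ∷ (p′ , p″) ∷ T″) q′∉)
        (trans (μ-dead {U = V₃} {q′} {q″} ((p′ , p″) ∷ T″) q′∉) (μ-dead {U = V₃} {p′} {p″} T″ p′∉)))

      unused : μₑ (p , p′) ((q , q′) ∷ T′) V ≡ μ T″ V₃
      unused = trans (μₑ-live {U = V} {p} {p′} ((q , q′) ∷ T′) Vp Vp′) (trans (μ-star₁ q q′ T′ {V₂} dT′q Vq₂)
        (trans (μₑ-live {U = V₂} {q} {q′} T′ Vq₂ Vq′₂) (trans (μ-cong T′ {V₂ ⊖ q ⊖ q′} {V₃} perm) beyond)))

      at-p : deg ((q , q′) ∷ T′) p ≡ 0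
      at-p = deg-zero-∷ {E = T′} q≢p q′≢p dT′p

    -- A matching uses the rung pq or both links behind it.
    fibonacci : μ T V ≡ μ T′ (V ⊖ p ⊖ q) + μ T″ (V ⊖ p ⊖ q ⊖ q′ ⊖ p′)
    fibonacci = trans (μ-≋ eq V) (trans (μ-star₂ p q p′ ((q , q′) ∷ T′) {V} at-p Vp) (cong₂ _+_ used unused))

-- Two rungs double the count, as a₀ = a₁ + a₂ = 2 a₂ + a₃. The third identity keeps a₂ positive: a₂
-- = 0 would give a₃ = 0 and then a₀ = 0. For this look-ahead four rungs are held in reserve.
ladder-growth : {K : Fin N → Set} (m : ℕ) {T : EList N} {V : VSub N} {p q : Fin N} → Standing T V p q →
                Ladder K T p q (4 + m * 2) → 1 ≤ μ T V → 2 ^ m ≤ μ T V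
ladder-growth zero St L h = h
ladder-growth (suc m) {T} {V} {p} {q} St (rung {R′ = T₁} e₀ _ _ (rung {R′ = T₂} e₁ kp kq L@(rung {R′ = T₃} e₂ _ _ (rung {R′ = T₄} e₃ _ _ _)))) h =
  grow (Rung.fibonacci St e₀ e₁) (Rung.fibonacci St₁ e₁ e₂) (Rung.fibonacci St₂ e₂ e₃) h (ladder-growth m St₂ L)
  where
  St₁ = Rung.next St e₀ e₁
  St₂ = Rung.next St₁ e₁ e₂
  grow : ∀ {a₀ a₁ a₂ a₃ a₄} → a₀ ≡ a₁ + a₂ → a₁ ≡ a₂ + a₃ → a₂ ≡ a₃ + a₄ → 1 ≤ a₀ → (1 ≤ a₂ → 2 ^ m ≤ a₂) → 2 ^ suc m ≤ a₀
  grow {a₂ = zero} {zero} refl refl e () ih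
  grow {a₂ = zero} {suc a₃} refl refl () _ ih
  grow {a₂ = suc a₂} {a₃} refl refl e _ ih = ≤-trans (*-monoʳ-≤ 2 (ih (s≤s z≤n))) (lin a₃ ≤-refl (alg (suc a₂) a₃))
    where alg : ∀ a b → 2 * a + 0 + b ≡ a + b + a + 0
          alg = solve-∀

opaque
  unfolding deg
  deg-lt : {E R : EList N} {a b : Fin N} → E ≋ (a , b) ∷ R → suc (deg R b) ≤ deg E b
  deg-lt {E = E} {R} {a} {b} eq = ≤-trans (le (==-refl b)) (≤-reflexive (sym (deg-≋ b eq)))
    where le : (b == b) ≡ true → suc (deg R b) ≤ deg ((a , b) ∷ R) b
          le e rewrite e = +-monoˡ-≤ (deg R b) (m≤n+m 1 (χ (a == b)))

  deg-rung : {a b p q p′ q′ : Fin N} (R : EList N) → q ≢ p → p′ ≢ p → q′ ≢ p → a ≢ p → b ≢ p →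
             deg ((p , q) ∷ (p , p′) ∷ (q , q′) ∷ (a , b) ∷ R) p ≡ 2 + deg R p
  deg-rung {p = p} R n₁ n₂ n₃ n₄ n₅ rewrite ==-refl p | ==-≢ n₁ | ==-≢ n₂ | ==-≢ n₃ | ==-≢ n₄ | ==-≢ n₅ = refl

cubic-deg : {E : EList N} {U : VSub N} → Cubic′ E U → ∀ v → deg E v ≤ 3
cubic-deg {E = E} {U} G v with bool-cases (U v)
... | inj₁ h = ≤-reflexive (d3 G v h)
... | inj₂ h = ≤-trans (≤-reflexive (inside-deg h E (inU G))) z≤n

module LadderSplit {N} {E F F₂ : EList N} {U : VSub N} (G : Cubic′ E U) (C : Essential4 E U) (h : 5 ≤ size U)
  {a b p q p′ q′ α β : Fin N} (eqE : E ≋ (a , b) ∷ F) (a≢p : a ≢ p) (b≢p : b ≢ p) (a≢q : a ≢ q) (b≢q : b ≢ q)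
  (eqF : F ≋ (p , α) ∷ (p , q) ∷ (p , p′) ∷ (q , β) ∷ (q , q′) ∷ F₂)
  (dp : deg F₂ p ≡ 0) (dq : deg F₂ q ≡ 0) where

  private
    eq₅ : E ≋ (p , α) ∷ (p , q) ∷ (p , p′) ∷ (q , β) ∷ (q , q′) ∷ (a , b) ∷ F₂
    eq₅ = ≋-trans eqE (≋-trans (≋-prep _ eqF) (≋-sym (≋-shift ((p , α) ∷ (p , q) ∷ (p , p′) ∷ (q , β) ∷ (q , q′) ∷ []) (a , b) F₂)))

    G₅ = Cubic-≋ eq₅ G

    Up : U p ≡ true
    Up = proj₁ (All.head (inU G₅))
    Uα : U α ≡ true
    Uα = proj₂ (All.head (inU G₅))
    Uq : U q ≡ true
    Uq = proj₂ (All.head (All.tail (inU G₅)))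
    Uβ : U β ≡ true
    Uβ = proj₂ (All.head (All.tail (All.tail (All.tail (inU G₅)))))
    p≢q : p ≢ q
    p≢q = All.head (All.tail (nl G₅))
    α≢p : α ≢ p
    α≢p = All.head (nl G₅) ∘ sym
    p′≢p : p′ ≢ p
    p′≢p = All.head (All.tail (All.tail (nl G₅))) ∘ sym
    β≢q : β ≢ q
    β≢q = All.head (All.tail (All.tail (All.tail (nl G₅)))) ∘ sym
    q′≢q : q′ ≢ q
    q′≢q = All.head (All.tail (All.tail (All.tail (All.tail (nl G₅))))) ∘ sym

    α≢q : α ≢ q
    α≢q refl = no-parallel G C h eq₅
    p′≢q : p′ ≢ q
    p′≢q refl = no-parallel G C h (≋-trans eq₅ (≋-trans (≋-swap _ _) (≋-prep _ (≋-swap _ _))))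
    α≢p′ : α ≢ p′
    α≢p′ refl = no-parallel G C h (≋-trans eq₅ (≋-prep _ (≋-swap _ _)))
    q-first : E ≋ (q , β) ∷ (q , p) ∷ (q , q′) ∷ (p , α) ∷ (p , p′) ∷ (a , b) ∷ F₂
    q-first = ≋-trans eq₅ (≋-trans (≋-shift ((p , α) ∷ (p , q) ∷ (p , p′) ∷ []) (q , β) ((q , q′) ∷ (a , b) ∷ F₂))
      (≋-prep _ (≋-trans (≋-swap _ _) (≋-trans (≋-flip p q) (≋-prep _ (≋-third _ _ _))))))
    β≢p : β ≢ p
    β≢p refl = no-parallel G C h q-first
    q′≢p : q′ ≢ p
    q′≢p refl = no-parallel G C h (≋-trans q-first (≋-trans (≋-swap _ _) (≋-prep _ (≋-swap _ _))))
    β≢q′ : β ≢ q′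
    β≢q′ refl = no-parallel G C h (≋-trans q-first (≋-prep _ (≋-swap _ _)))

    α≢β : α ≢ β
    α≢β refl = no-triangle G C h (≋-trans q-first (≋-trans (≋-prep _ (≋-prep _ (≋-swap _ _)))
      (≋-trans (≋-flip q α) (≋-prep₂ _ _ (≋-prep _ ≋-refl)))))
    p′≢q′ : p′ ≢ q′
    p′≢q′ refl = no-triangle G C h (≋-trans q-first (≋-trans (≋-prep _ (≋-prep _ (≋-prep _ (≋-swap _ _))))
      (≋-trans (≋-shift ((q , β) ∷ (q , p) ∷ []) (q , p′) _) (≋-trans (≋-flip q p′) (≋-prep _ (≋-trans (≋-swap _ _) (≋-prep _ (≋-swap _ _))))))))
    α≢q′ : α ≢ q′
    α≢q′ refl = no-triangle G C h (≋-trans q-first (≋-trans (≋-shift ((q , β) ∷ (q , p) ∷ []) (q , α) _)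
      (≋-trans (≋-flip q α) (≋-prep _ (≋-trans (≋-swap _ _) (≋-prep _ (≋-swap _ _)))))))
    β≢p′ : β ≢ p′
    β≢p′ refl = no-triangle G C h (≋-trans q-first (≋-trans (≋-prep _ (≋-prep _ (≋-trans (≋-swap _ _) (≋-prep _ (≋-swap _ _)))))
      (≋-trans (≋-flip q β) (≋-prep₂ _ _ (≋-swap _ _)))))

    V : VSub N
    V = U ⊖ p ⊖ q

    split : Splittable E U p q α p′ β q′ ((a , b) ∷ F₂)
    split = record { cubic = G ; eq = eq₅ ; du = deg-zero-∷ {E = F₂} a≢p b≢p dp ; dv = deg-zero-∷ {E = F₂} a≢q b≢q dq
                   ; x≢v = α≢q ; w≢v = p′≢q ; c≢u = β≢p ; d≢u = q′≢p }

    -- The foot `p`, `q` of the ladder is split off, joining α-β and p′-q′, and p′q′ and `ab` are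
    -- avoided. The matching obtained lies in `F₂` or contains αβ; it lifts to `F` through `pq`, or
    -- through `pα` and `qβ`.
    avoiding : 1 ≤ μ F₂ V + μₑ (α , β) F₂ V
    avoiding = ≤-trans (two-avoidable (Split.cubic′ split α≢β p′≢q′) (Split.bridgeless′ split C α≢β p′≢q′) (p′ , q′) (a , b) ((α , β) ∷ F₂)
        (≋-sym (≋-third (p′ , q′) (a , b) (α , β)))) (≤-reflexive (μ-∷ (α , β) F₂ V))

    below : ∀ {u v R} X → E ≋ (u , v) ∷ R → R ≋ X ++ F₂ → deg F₂ v ≤ 2
    below X e f = ≤-pred (≤-trans (s≤s (deg-sub X f _)) (≤-trans (deg-lt e) (cubic-deg G _)))

    dq′ : deg F₂ q′ ≤ 2
    dq′ = below ((q , β) ∷ (q , p) ∷ (p , α) ∷ (p , p′) ∷ (a , b) ∷ []) (≋-trans q-first (≋-third _ _ _)) ≋-refl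
    dp′ : deg F₂ p′ ≤ 2
    dp′ = below ((p , α) ∷ (p , q) ∷ (q , β) ∷ (q , q′) ∷ (a , b) ∷ []) (≋-trans eq₅ (≋-third _ _ _)) ≋-refl
    dα : deg F₂ α ≤ 2
    dα = below ((p , q) ∷ (p , p′) ∷ (q , β) ∷ (q , q′) ∷ (a , b) ∷ []) eq₅ ≋-refl
    dβ : deg F₂ β ≤ 2
    dβ = below ((q , p) ∷ (q , q′) ∷ (p , α) ∷ (p , p′) ∷ (a , b) ∷ []) q-first ≋-refl

    standing : ∀ {V′} → V′ q′ ≡ true → V′ p′ ≡ true → (∀ v → 3 ≤ deg F₂ v → V′ v ≡ true) → Standing F₂ V′ q′ p′
    standing hq hp al = record { dp = dq′ ; dq = dp′ ; Vp = hq ; Vq = hp ; alive = al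
      ; d≤3 = λ v → ≤-trans (deg-sub ((p , α) ∷ (p , q) ∷ (p , p′) ∷ (q , β) ∷ (q , q′) ∷ (a , b) ∷ []) eq₅ v) (cubic-deg G v) }

    alive-U : ∀ v → 3 ≤ deg F₂ v → U v ≡ true
    alive-U v l with bool-cases (U v)
    ... | inj₁ e = e
    ... | inj₂ e with ≤-trans l (≤-trans (deg-sub ((p , α) ∷ (p , q) ∷ (p , p′) ∷ (q , β) ∷ (q , q′) ∷ (a , b) ∷ []) eq₅ v) (≤-reflexive (inside-deg e E (inU G))))
    ... | ()

    too-few : ∀ {u v k} → deg F₂ u ≤ k → suc k ≤ deg F₂ v → v ≢ u
    too-few l k refl = <⇒≱ k l

    alive-V : ∀ v → 3 ≤ deg F₂ v → V v ≡ true
    alive-V v l = ⊖₂-in U (alive-U v l) (too-few (≤-reflexive dp) (≤-trans (s≤s z≤n) l)) (too-few (≤-reflexive dq) (≤-trans (s≤s z≤n) l))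

    Vp′ : V p′ ≡ true
    Vp′ = ⊖₂-in U (proj₂ (All.head (All.tail (All.tail (inU G₅))))) p′≢p p′≢q
    Vq′ : V q′ ≡ true
    Vq′ = ⊖₂-in U (proj₂ (All.head (All.tail (All.tail (All.tail (All.tail (inU G₅))))))) q′≢p q′≢q

    with-rung : μ F₂ V ≤ μ F U
    with-rung = ≤-trans (μ-use {R = F₂} {U} {p} {q} ≋-refl Up Uq)
      (μ-sub ((p , α) ∷ (p , p′) ∷ (q , β) ∷ (q , q′) ∷ []) U (≋-trans eqF (≋-prep _ (≋-sym (≋-shift ((p , p′) ∷ (q , β) ∷ (q , q′) ∷ []) (p , q) F₂)))))

    without-rung : μ F₂ (V ⊖ α ⊖ β) ≤ μ F U
    without-rung = ≤-trans (≤-reflexive (μ-cong F₂ (⊖-cong {U = U ⊖ p ⊖ q ⊖ α} {U ⊖ p ⊖ α ⊖ q} β (⊖-comm (U ⊖ p) q α))))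
      (≤-trans (μ-use {R = F₂} {U ⊖ p ⊖ α} {q} {β} ≋-refl (⊖₂-in U Uq (p≢q ∘ sym) (α≢q ∘ sym)) (⊖₂-in U Uβ β≢p (α≢β ∘ sym)))
        (≤-trans (μ-use {R = (q , β) ∷ F₂} {U} {p} {α} ≋-refl Up Uα)
          (μ-sub ((p , q) ∷ (p , p′) ∷ (q , q′) ∷ []) U (≋-trans eqF (≋-trans (≋-prep _ (≋-prep _ (≋-prep _ (≋-swap _ _))))
            (≋-trans (≋-sym (≋-shift ((p , q) ∷ (p , p′) ∷ (q , q′) ∷ []) (p , α) ((q , β) ∷ F₂))) (≋-prep _ (≋-prep _ (≋-prep _ ≋-refl)))))))))

  bound : {K : Fin N → Set} (m : ℕ) → Ladder K F₂ q′ p′ (4 + m * 2) → 2 ^ m ≤ μ F U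
  bound m L = go (1 ≤? μ F₂ V)
    where
    go : Dec (1 ≤ μ F₂ V) → 2 ^ m ≤ μ F U
    go (yes l) = ≤-trans (ladder-growth m (standing Vq′ Vp′ alive-V) L l) with-rung
    go (no n) = ≤-trans (ladder-growth m (standing (⊖₂-in V Vq′ (α≢q′ ∘ sym) (β≢q′ ∘ sym)) (⊖₂-in V Vp′ (α≢p′ ∘ sym) (β≢p′ ∘ sym))
        (λ v k → ⊖₂-in V (alive-V v k) (too-few dα k) (too-few dβ k))) L
        (subst (1 ≤_) (trans (cong (_+ μₑ (α , β) F₂ V) zero′) (μₑ-live F₂ (⊖₂-in U Uα α≢p α≢q) (⊖₂-in U Uβ β≢p β≢q))) avoiding)) without-rung
      where zero′ : μ F₂ V ≡ 0
            zero′ = n≤0⇒n≡0 (≤-pred (≰⇒> n))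

module _ {N} {E F F′ : EList N} {U : VSub N} (G : Cubic′ E U) (C : Essential4 E U) (h : 5 ≤ size U)
  {a b p q p′ q′ : Fin N} (eqE : E ≋ (a , b) ∷ F) (a≢p : a ≢ p) (b≢p : b ≢ p) (a≢q : a ≢ q) (b≢q : b ≢ q)
  (eqF : F ≋ (p , q) ∷ (p , p′) ∷ (q , q′) ∷ F′) {K : Fin N → Set} (m : ℕ) (L : Ladder K F′ q′ p′ (5 + m * 2)) where

  private
    eq₀ : E ≋ (p , q) ∷ (p , p′) ∷ (q , q′) ∷ (a , b) ∷ F′
    eq₀ = ≋-trans eqE (≋-trans (≋-prep _ eqF) (≋-sym (≋-shift ((p , q) ∷ (p , p′) ∷ (q , q′) ∷ []) (a , b) F′)))
    G₀ = Cubic-≋ eq₀ G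
    q≢p : q ≢ p
    q≢p = All.head (nl G₀) ∘ sym
    p′≢p : p′ ≢ p
    p′≢p = All.head (All.tail (nl G₀)) ∘ sym
    q′≢q : q′ ≢ q
    q′≢q = All.head (All.tail (All.tail (nl G₀))) ∘ sym
    p′≢q : p′ ≢ q
    p′≢q refl = no-parallel G C h eq₀
    q′≢p : q′ ≢ p
    q′≢p refl = no-parallel G C h (≋-trans eq₀ (≋-trans (≋-prep _ (≋-trans (≋-swap _ _) (≋-flip q p))) ≋-refl))
    dp : deg F′ p ≡ 1
    dp = suc-injective (suc-injective (trans (sym (deg-rung F′ q≢p p′≢p q′≢p a≢p b≢p)) (d3 G₀ p (proj₁ (All.head (inU G₀))))))
    dq : deg F′ q ≡ 1
    dq = suc-injective (suc-injective (trans (sym (deg-rung F′ (q≢p ∘ sym) q′≢q p′≢q a≢q b≢q))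
      (trans (deg-≋ q (≋-sym (rung-flip p q p′ q′))) (d3 G₀ q (proj₂ (All.head (inU G₀)))))))

  -- The edges `pα` and `qβ` leading into the ladder are stripped from `F′`; the fifth spare rung
  -- pays for the one lost in `ladder-keep`.
  ladder-bound : 2 ^ m ≤ μ F U
  ladder-bound with extract′ F′ p (All.tail (All.tail (All.tail (All.tail (nl G₀))))) dp
  ... | α , F₁ , e₁ , α≢p , nl₁ , d₁ = go (extract′ F₁ q nl₁ (trans (sym (deg-other F₁ (q≢p ∘ sym) α≢q)) (trans (sym (deg-≋ q e₁)) dq)))
    where
    α≢q : α ≢ q
    α≢q refl = no-parallel G C h (≋-trans eq₀ (≋-prep _ (≋-trans (≋-prep₂ _ _ (≋-trans (≋-prep _ e₁) (≋-swap _ _))) (≋-third _ _ _))))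
    go : (∃ λ β → ∃ λ F₂ → F₁ ≋ (q , β) ∷ F₂ × β ≢ q × NL F₂ × deg F₂ q ≡ 0) → 2 ^ m ≤ μ F U
    go (β , F₂ , e₂ , β≢q , _ , d₂) = LadderSplit.bound G C h eqE a≢p b≢p a≢q b≢q
      (≋-trans eqF (≋-trans (≋-prep₃ _ _ _ (≋-trans e₁ (≋-prep _ e₂)))
        (≋-trans (≋-shift ((p , q) ∷ (p , p′) ∷ (q , q′) ∷ []) (p , α) ((q , β) ∷ F₂)) (≋-prep₃ _ _ _ (≋-swap _ _)))))
      dF₂p d₂ m ladder
      where
      dF₂p : deg F₂ p ≡ 0
      dF₂p = proj₂ (deg-∷-zero (q , β) {F₂} (trans (sym (deg-≋ p e₂)) d₁))
      k : VSub N
      k v = not (v == p) ∧ not (v == q)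
      kp : k p ≡ false
      kp = ∧-false₁ (cong not (==-refl p))
      kq : k q ≡ false
      kq = ∧-false₂ {not (q == p)} (cong not (==-refl q))
      other : ∀ {u v} → deg F′ u ≡ 1 → 2 ≤ deg F′ v → v ≢ u
      other d l refl = <⇒≱ l (≤-reflexive d)
      kept : keep k F′ ≋ keep k F₂
      kept = ≋-trans (keep-≋ k (≋-trans e₁ (≋-prep _ e₂))) (≡⇒≋ (trans (keep-out k {p} {α} ((q , β) ∷ F₂) kp) (keep-out k {q} {β} F₂ kq)))
      ladder : Ladder K F₂ q′ p′ (4 + m * 2)
      ladder = ladder-≋ (proj₂ (keep-rest k F₂)) (ladder-++ (proj₁ (keep-rest k F₂)) (ladder-≋ (≋-sym kept)
        (ladder-keep k (λ v _ l → ∧-true (cong not (==-≢ (other dp l))) (cong not (==-≢ (other dq l)))) L)))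

Cubic-≐ : {E : EList N} {U U′ : VSub N} → U ≐ U′ → Cubic′ E U → Cubic′ E U′
Cubic-≐ h G = record
  { inU = All.map (λ { {a , b} (p , q) → trans (sym (h a)) p , trans (sym (h b)) q }) (inU G)
  ; nl = nl G ; d3 = λ v hv → d3 G v (trans (h v) hv) }

⊖-⊕ : (U : VSub N) (x : Fin N) → U x ≡ true → U ≐ (U ⊖ x) ⊕ x
⊖-⊕ U x h v = go (v ≟ x)
  where
  go : Dec (v ≡ x) → U v ≡ ((U ⊖ x) ⊕ x) v
  go (yes e) = trans (trans (cong U e) h) (sym (trans (cong ((U ⊖ x) ⊕ x) e) (⊕-new (U ⊖ x) x)))
  go (no ne) = bool-ext (λ k → ⊕-old {W = U ⊖ x} {x} {v} (⊖-in {U = U} k ne))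
    (λ k → ⊖-mem {U = U} {x} {v} (⊕-≢ {W = U ⊖ x} {x} {v} k ne))

-- The bound on the number of layers, for 2 ^ m and tri κ / 2 above the total weight.
layers : (m κ : ℕ) → ℕ
layers m κ = m * (suc (6 + m * 2) + (6 * κ + 3) + 2) + ((6 + m * 2) + (6 * κ + 3) + 1)

module SplitTrace {N} (P Q c : ℕ) {E F : EList N} {U : VSub N} (C : Essential4 E U) (h₅ : 5 ≤ size U)
  (IH : SmallerGraphs N P Q c (size U)) {u v x w y z : Fin N} {R : EList N} (sp : Splittable E U u v x w y z R)
  (eqE : E ≋ (u , x) ∷ F) (eqF : F ≋ (u , v) ∷ (u , w) ∷ (v , y) ∷ (v , z) ∷ R)
  (x≢y : x ≢ y) (x≢z : x ≢ z) (x≢w : x ≢ w) (w≢z : w ≢ z) where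

  private
    module Sp = Split sp

    G′ : Cubic′ Sp.E′ Sp.U′
    G′ = Sp.cubic′ x≢y w≢z

    U′x : Sp.U′ x ≡ true
    U′x = proj₁ (All.head (inU G′))
    U′w : Sp.U′ w ≡ true
    U′w = proj₁ (All.head (All.tail (inU G′)))

    dRx : deg R x ≡ 2
    dRx = suc-injective (trans (cong suc (sym (deg-other R (x≢w ∘ sym) (x≢z ∘ sym))))
      (trans (sym (deg-one ((w , z) ∷ R) (x≢y ∘ sym))) (d3 G′ x U′x)))

    star : Star₂ R x
    star = star₂ R x Sp.nlR dRx

    open Star₂ star using () renaming (y₁ to s₁; y₂ to s₂; R to R″; eq to eqR; d₀ to dR″)

    W : VSub N
    W = Sp.U′ ⊖ x

    R₀ : EList N
    R₀ = (w , z) ∷ R″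

    kernel : VSub N
    kernel = W ⊖ w

    K : Fin N → Set
    K v = kernel v ≡ true

    eqP : Sp.E′ ≋ (x , y) ∷ (x , s₁) ∷ (x , s₂) ∷ R₀
    eqP = ≋-prep _ (≋-trans (≋-prep _ eqR) (≋-trans (≋-swap _ _) (≋-prep _ (≋-swap _ _))))

    Ww : W w ≡ true
    Ww = ⊖-in {U = Sp.U′} U′w (x≢w ∘ sym)

    -- With `u`, `v` outside like `x` and `w`, the edges vy and vz cross exactly when the new edges
    -- do. So sets avoiding both `x` and `w` inherit the bound 4, which makes `w` the target.
    cut-far : ∀ X → X x ≡ false → X w ≡ false → δ E (assign X u v false) ≡ δ Sp.E′ X
    cut-far X hx hw = trans (Sp.δ-assign X false) (trans (cong₂ (λ s t → χ s + (χ t + (χ (X y) + (χ (X z) + δ R X)))) hx hw)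
      (sym (trans (δ-two (x , y) (w , z) R X) (cong₂ (λ s t → χ (s xor X y) + (χ (t xor X z) + δ R X)) hx hw))))

    pole′ : Pole x w W Sp.E′
    pole′ = record
      { xW = ⊖-self Sp.U′ x ; wW = Ww ; cubic = Cubic-≐ (⊖-⊕ Sp.U′ x U′x) G′
      ; far = λ X hx hw t → ≤-trans (C (assign X u v false)
            (two-mono (λ a h → Sp.mem₁ X false a (∧-true (⊖-mem {U = Sp.U′} {x} {a} (∧-left h)) (∧-right {W a} h))) t)
            (u , v , Sp.u≢v , ∧-true Sp.hu (cong not (assign₁ X u v false)) , ∧-true Sp.hv (cong not (assign₂ X u v false))))
          (≤-reflexive (cut-far X hx hw))
      ; near = λ X hx hw → Sp.bridgeless′ C x≢y w≢z X (w , ∧-true U′w hw) (x , ∧-true U′x (cong not hx)) }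

    pole : Pole x w W ((x , y) ∷ (x , s₁) ∷ (x , s₂) ∷ R₀)
    pole = Pole-≋ eqP pole′

    dR₀ : deg R₀ x ≡ 0
    dR₀ = deg-zero-∷ {E = R″} (x≢w ∘ sym) (x≢z ∘ sym) dR″

    size-U : size U ≡ 3 + size W
    size-U = trans (size-⊖₂ U Sp.hu Sp.hv Sp.u≢v) (cong (2 +_) (size-⊖ Sp.U′ x U′x))

    W-small : size W + 1 < size U
    W-small = ≤-trans (≤-reflexive (cong suc (+-comm (size W) 1))) (≤-trans (n≤1+n _) (≤-reflexive (sym size-U)))

  open Game K P Q c

  f : ℕ
  f = μ ((w , z) ∷ R) Sp.U′

  private
    -- Weight 0 on the strand to `y` expresses that the new edge xy is avoided.
    f-val : f ≡ val R₀ W (strands y s₁ s₂ 0 1 1) 0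
    f-val = trans (μ-≋ (≋-trans (≋-prep _ eqR) (≋-trans (≋-swap _ _) (≋-prep _ (≋-swap _ _)))) Sp.U′)
      (trans (μ-star₂ x s₁ s₂ R₀ dR₀ U′x) (trans (cong₂ _+_
        (μₑ-live R₀ U′x (proj₂ (All.head (All.tail (inU (Cubic-≋ eqP G′))))))
        (μₑ-live R₀ U′x (proj₂ (All.head (All.tail (All.tail (inU (Cubic-≋ eqP G′))))))))
        (alg (m₁ R₀ W s₁) (m₁ R₀ W s₂))))
      where alg : ∀ a b → a + b ≡ 0 + 1 * a + 1 * b + 0
            alg = solve-∀

    opaque
      traced : ∃ λ t → Play R₀ (strands y s₁ s₂ 0 1 1) 0 (size W ∸ 1) t × t ≤ val R₀ W (strands y s₁ s₂ 0 1 1) 0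
      traced = Trace.trace x w K P Q c (size U) IH (size W) W y s₁ s₂ R₀ 0 1 1 0 ≤-refl W-small
        (λ a ha ne → ⊖-in {U = W} ha ne) pole (s≤s z≤n , s≤s z≤n , s≤s z≤n)

    end-weight : ℕ
    end-weight = proj₁ traced

    game : Play R₀ (strands y s₁ s₂ 0 1 1) 0 (size W ∸ 1) end-weight
    game = proj₁ (proj₂ traced)

    end≤f : end-weight ≤ f
    end≤f = ≤-trans (proj₂ (proj₂ traced)) (≤-reflexive (sym f-val))

  two≤f : 2 ≤ f
  two≤f = ≤-trans (total≤ game) end≤f

  private
    outside : ∀ {a p} → U a ≡ true → W a ≡ false → K p → a ≢ p
    outside _ h k refl = true≢false (⊖-mem {U = W} k) h

    W-u : W u ≡ false
    W-u = ⊖-out {U = Sp.U′} {x} {u} (⊖-out {U = U ⊖ u} {v} {u} (⊖-self U u))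
    W-x : W x ≡ false
    W-x = ⊖-self Sp.U′ x

    rest : ∃ λ D → F ≋ keep kernel R₀ ++ D
    rest with keep-rest kernel R″
    ... | D , e = D ++ X , ≋-trans eqF (≋-trans (≋-++ˡ ((u , v) ∷ (u , w) ∷ (v , y) ∷ (v , z) ∷ []) (≋-trans eqR ≋-refl))
        (≋-trans (≋-++-comm X R″) (≋-trans (≋-++ʳ X e) (≋-trans (≡⇒≋ (++-assoc (keep kernel R″) D X))
          (≡⇒≋ (cong (_++ (D ++ X)) (sym (keep-out kernel {w} {z} R″ (⊖-self W w)))))))))
      where X = (u , v) ∷ (u , w) ∷ (v , y) ∷ (v , z) ∷ (x , s₁) ∷ (x , s₂) ∷ []

    -- A ladder met on the way is, up to its last rung, a ladder of E away from ux.
    long-ladder : ∀ m R p q → Sub R₀ R → Ladder K R p q (7 + m * 2) → 2 ^ m ≤ μ F U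
    long-ladder m R p q (Y , e) L = go (ladder-keep kernel (λ a ka _ → ka) L)
      where
      D = proj₁ rest
      Y′ = keep kernel Y
      kept : F ≋ keep kernel R ++ (Y′ ++ D)
      kept = ≋-trans (proj₂ rest) (≋-trans (≋-++ʳ D (≋-trans (keep-≋ kernel e) (≋-trans (≡⇒≋ (keep-++ kernel Y R)) (≋-++-comm Y′ (keep kernel R)))))
        (≡⇒≋ (++-assoc (keep kernel R) Y′ D)))
      go : Ladder K (keep kernel R) p q (6 + m * 2) → 2 ^ m ≤ μ F U
      go (rung e₁ kp kq L′) = ladder-bound cubic C h₅ eqE (outside Sp.hu W-u kp) (outside Sp.hx W-x kp) (outside Sp.hu W-u kq) (outside Sp.hx W-x kq)
        (≋-trans kept (≋-++ʳ (Y′ ++ D) e₁)) m (ladder-++ (Y′ ++ D) L′)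
        where open Splittable sp using (cubic)

  -- At most `m` doublings lead from the initial total 2 to `M`, and a ladder with more than 6 + 2 m
  -- rungs already gives `M` matchings of `F`; otherwise `play-bound` limits the layers and `value`
  -- gives the linear bound.
  profit : ∀ M m κ → 2 * M ≤ tri κ → M ≤ 2 ^ m → M ≤ μ F U ⊎ (M ≤ f ⊎ 2 * Q + P * (size U ∸ 4) ≤ Q * f + (c + 2 * P) * layers m κ)
  profit M m κ hκ hm = go (M ≤? μ F U) (M ≤? end-weight)
    where
    sub3 : ∀ s → 3 + s ∸ 4 ≡ s ∸ 1
    sub3 zero = refl
    sub3 (suc s) = refl
    few : ¬ (M ≤ μ F U) → ¬ (M ≤ end-weight) → len game ≤ layers m κ
    few n k = Bound.play-bound K P Q c R₀ M (6 + m * 2) κ hκ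
      (λ R p q s L → n (≤-trans hm (long-ladder m R p q s L))) m game (≰⇒> k) (s≤s z≤n , s≤s z≤n , s≤s z≤n)
      (≤-trans hm (m≤n*m (2 ^ m) 2))
    go : Dec (M ≤ μ F U) → Dec (M ≤ end-weight) → M ≤ μ F U ⊎ (M ≤ f ⊎ 2 * Q + P * (size U ∸ 4) ≤ Q * f + (c + 2 * P) * layers m κ)
    go (yes l) _ = inj₁ l
    go (no n) (yes l) = inj₂ (inj₁ (≤-trans l end≤f))
    go (no n) (no k) = inj₂ (inj₂ (≤-trans (≤-reflexive (cong₂ (λ s t → s + P * t) (*-comm 2 Q) (trans (cong (_∸ 4) size-U) (sub3 (size W)))))
      (≤-trans (value game) (+-mono-≤ (*-monoʳ-≤ Q end≤f) (*-monoʳ-≤ (c + 2 * P) (few n k))))))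

-- Arbitrary slope

module OneEdge {N} (P Q c₀ : ℕ) {E F : EList N} {U : VSub N} (G : Cubic′ E U) (C : Essential4 E U) (h₅ : 5 ≤ size U)
  (IH : SmallerGraphs N P Q c₀ (size U)) {u x : Fin N} (eqE : E ≋ (u , x) ∷ F) where

  private
    M₁ : Nbhd₁ E U u x [] F
    M₁ = nbhd₁ G C h₅ u x [] F eqE (deg-[] u)

    nb : Nbhd E U u x [] F
    nb = nbhd₂ G C h₅ M₁ (deg-[] u) (deg-[] _) (deg-[] _)

    open Nbhd nb

    module V = Voorhoeve {S = []} G C eqE nb

    other : F ≋ (u , w) ∷ (u , v) ∷ (w , p) ∷ (w , q) ∷ V.Rw
    other = ≋-trans eqF (≋-trans (≋-swap _ _) (≋-prep₂ _ _ (≋-trans (≋-shift ((v , c) ∷ (v , d) ∷ []) (w , p) ((w , q) ∷ R))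
      (≋-prep _ (≋-shift ((v , c) ∷ (v , d) ∷ []) (w , q) R)))))

    Profit : ℕ → ℕ → ℕ → ℕ → Set
    Profit M m κ f = M ≤ μ F U ⊎ (M ≤ f ⊎ 2 * Q + P * (size U ∸ 4) ≤ Q * f + (c₀ + 2 * P) * layers m κ)

    Outcome : ℕ → Set
    Outcome f = 2 ≤ f × (∀ M m κ → 2 * M ≤ tri κ → M ≤ 2 ^ m → Profit M m κ f)

    outcome : ∀ {v x w y z R} (sp : Splittable E U u v x w y z R) → E ≋ (u , x) ∷ F → F ≋ (u , v) ∷ (u , w) ∷ (v , y) ∷ (v , z) ∷ R →
              x ≢ y → x ≢ z → x ≢ w → w ≢ z → Outcome (μ ((w , z) ∷ R) (U ⊖ u ⊖ v))
    outcome sp e f n₁ n₂ n₃ n₄ = SplitTrace.two≤f P Q c₀ C h₅ IH sp e f n₁ n₂ n₃ n₄ , SplitTrace.profit P Q c₀ C h₅ IH sp e f n₁ n₂ n₃ n₄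

    o₁ : Outcome V.f₁
    o₁ = outcome V.split₁ eqE eqF x≢c x≢d x≢w (d≢w ∘ sym)
    o₂ : Outcome V.f₂
    o₂ = outcome V.split₂ eqE (≋-trans eqF (≋-prep₂ _ _ (≋-swap _ _))) x≢d x≢c x≢w (c≢w ∘ sym)
    o₃ : Outcome V.f₃
    o₃ = outcome V.split₃ eqE other x≢p x≢q x≢v (q≢v ∘ sym)
    o₄ : Outcome V.f₄
    o₄ = outcome V.split₄ eqE (≋-trans other (≋-prep₂ _ _ (≋-swap _ _))) x≢q x≢p x≢v (p≢v ∘ sym)

  -- Each fᵢ is at least 2, since the total of a play never decreases. The resulting μ ≥ 3 settles
  -- the small graphs in the base case.
  eight : 8 ≤ 3 * μ F U
  eight = ≤-trans (+-mono-≤ (+-mono-≤ (proj₁ o₁) (proj₁ o₂)) (+-mono-≤ (proj₁ o₃) (proj₁ o₄))) (≤-reflexive (sym V.voorhoeve))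

  one-step : ∀ M m κ → 2 * M ≤ tri κ → M ≤ 2 ^ m →
    M ≤ 3 * μ F U ⊎ 4 * (2 * Q + P * (size U ∸ 4)) ≤ Q * (3 * μ F U) + 4 * ((c₀ + 2 * P) * layers m κ)
  one-step M m κ hκ hm = go (proj₂ o₁ M m κ hκ hm) (proj₂ o₂ M m κ hκ hm) (proj₂ o₃ M m κ hκ hm) (proj₂ o₄ M m κ hκ hm)
    where
    Z = 2 * Q + P * (size U ∸ 4)
    L = (c₀ + 2 * P) * layers m κ
    at-once : M ≤ μ F U → M ≤ 3 * μ F U
    at-once l = ≤-trans l (m≤n*m (μ F U) 3)
    sum : ∀ {f} → f ≤ (V.f₁ + V.f₂) + (V.f₃ + V.f₄) → M ≤ f → M ≤ 3 * μ F U
    sum le l = ≤-trans l (≤-trans le (≤-reflexive (sym V.voorhoeve)))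
    go : Profit M m κ V.f₁ → Profit M m κ V.f₂ → Profit M m κ V.f₃ → Profit M m κ V.f₄ → M ≤ 3 * μ F U ⊎ 4 * Z ≤ Q * (3 * μ F U) + 4 * L
    go (inj₁ l) _ _ _ = inj₁ (at-once l)
    go _ (inj₁ l) _ _ = inj₁ (at-once l)
    go _ _ (inj₁ l) _ = inj₁ (at-once l)
    go _ _ _ (inj₁ l) = inj₁ (at-once l)
    go (inj₂ (inj₁ l)) _ _ _ = inj₁ (sum (≤-trans (m≤m+n V.f₁ V.f₂) (m≤m+n _ _)) l)
    go _ (inj₂ (inj₁ l)) _ _ = inj₁ (sum (≤-trans (m≤n+m V.f₂ V.f₁) (m≤m+n _ _)) l)
    go _ _ (inj₂ (inj₁ l)) _ = inj₁ (sum (≤-trans (m≤m+n V.f₃ V.f₄) (m≤n+m _ (V.f₁ + V.f₂))) l)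
    go _ _ _ (inj₂ (inj₁ l)) = inj₁ (sum (≤-trans (m≤n+m V.f₄ V.f₃) (m≤n+m _ (V.f₁ + V.f₂))) l)
    go (inj₂ (inj₂ k₁)) (inj₂ (inj₂ k₂)) (inj₂ (inj₂ k₃)) (inj₂ (inj₂ k₄)) = inj₂ (≤-trans (lin 0 (+-mono-≤ (+-mono-≤ k₁ k₂) (+-mono-≤ k₃ k₄))
      (alg Z Q L V.f₁ V.f₂ V.f₃ V.f₄)) (≤-reflexive (cong (λ t → Q * t + 4 * L) (sym V.voorhoeve))))
      where alg : ∀ z q l a b c d → 4 * z + ((q * a + l + (q * b + l)) + (q * c + l + (q * d + l))) + 0 ≡
                  q * ((a + b) + (c + d)) + 4 * l + ((z + z) + (z + z))
            alg = solve-∀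

-- Parameters that keep the number of layers sublinear

2^-big : ∀ r → suc r ≤ 2 ^ r
2^-big zero = ≤-refl
2^-big (suc r) = ≤-trans (+-mono-≤ (≤-trans (s≤s z≤n) (2^-big r)) (2^-big r)) (+-monoʳ-≤ (2 ^ r) (m≤m+n (2 ^ r) 0))

fourth eighth : ℕ → ℕ
fourth y = (y * y) * (y * y)
eighth y = fourth y * fourth y

eighth-< : ∀ {a b} → a < b → eighth a < eighth b
eighth-< h = *-mono-< h₄ h₄
  where h₂ = *-mono-< h h
        h₄ = *-mono-< h₂ h₂

y≤fourth : ∀ {y} → 1 ≤ y → y ≤ fourth y
y≤fourth {y} h = ≤-trans (≤-reflexive (sym (*-identityʳ y))) (≤-trans (*-mono-≤ (≤-trans (≤-reflexive (sym (*-identityʳ y))) (*-monoʳ-≤ y h)) (≤-trans h (≤-trans (≤-reflexive (sym (*-identityʳ y))) (*-monoʳ-≤ y h)))) ≤-refl)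

2^-eighth : ∀ r → 2 ^ (r * 8) ≡ eighth (2 ^ r)
2^-eighth zero = refl
2^-eighth (suc r) rewrite 2^-eighth r = alg (2 ^ r)
  where alg : ∀ y → 2 * (2 * (2 * (2 * (2 * (2 * (2 * (2 * (((y * y) * (y * y)) * ((y * y) * (y * y)))))))))) ≡
              ((2 * y) * (2 * y) * ((2 * y) * (2 * y))) * ((2 * y) * (2 * y) * ((2 * y) * (2 * y)))
        alg = solve-∀

-- Eighth powers leave room for crude estimates: with y = 2 ^ r and M ≤ y ^ 8 the number of layers
-- is of order r y ^ 4, and even y ^ 5 is far below M.
scale : ∀ M → ∃ λ r → M ≤ eighth (2 ^ r) × (∀ j → r ≡ suc j → eighth (2 ^ j) < M)
scale M = go M (≤-trans (n≤1+n M) (≤-trans (2^-big M) (≤-trans (y≤fourth pos) (≤-trans (≤-reflexive (sym (*-identityʳ _))) (*-monoʳ-≤ (fourth (2 ^ M)) (≤-trans pos (y≤fourth pos)))))))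
  where
  pos : 1 ≤ 2 ^ M
  pos = ≤-trans (s≤s z≤n) (2^-big M)
  go : ∀ k → M ≤ eighth (2 ^ k) → ∃ λ r → M ≤ eighth (2 ^ r) × (∀ j → r ≡ suc j → eighth (2 ^ j) < M)
  go zero h = zero , h , λ j ()
  go (suc k) h with M ≤? eighth (2 ^ k)
  ... | yes l = go k l
  ... | no n = suc k , h , λ { j refl → ≰⇒> n }

tri-sq : ∀ n → 2 * tri n + n ≡ n * n
tri-sq zero = refl
tri-sq (suc n) = trans (alg (tri n) n) (trans (cong (λ t → t + (2 * n + 1)) (tri-sq n)) (alg₂ n))
  where alg : ∀ t n → 2 * (t + n) + suc n ≡ (2 * t + n) + (2 * n + 1)
        alg = solve-∀
        alg₂ : ∀ n → n * n + (2 * n + 1) ≡ suc n * suc n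
        alg₂ = solve-∀

tri-large : ∀ s → 2 * (s * s) ≤ tri (suc (2 * s))
tri-large s = *-cancelˡ-≤ 2 (lin (2 * s) (≤-reflexive (sym (tri-sq (suc (2 * s))))) (alg s (tri (suc (2 * s)))))
  where alg : ∀ s t → 2 * (2 * (s * s)) + (2 * t + suc (2 * s)) + 2 * s ≡ 2 * t + suc (2 * s) * suc (2 * s)
        alg = solve-∀

-- r ≤ y absorbs the logarithm; 412 = 8 · 46 + 44.
layers≤ : ∀ r {y s} → r ≤ y → 1 ≤ y → y ≤ s → layers (r * 8) (suc (2 * s)) ≤ 412 * (y * s)
layers≤ r {y} {s} r≤y y≥1 y≤s = begin
  layers (r * 8) (suc (2 * s))                       ≡⟨ alg r s ⟩
  8 * r * (18 + 16 * r + 12 * s) + (16 + 16 * r + 12 * s)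
    ≤⟨ +-mono-≤ (*-mono-≤ (*-monoʳ-≤ 8 r≤y) (≤-trans (+-monoˡ-≤ (12 * s) (+-mono-≤ (*-monoʳ-≤ 18 s≥1) (*-monoʳ-≤ 16 (≤-trans r≤y y≤s)))) ≤-refl))
         (≤-trans (+-monoˡ-≤ (12 * s) (+-mono-≤ (*-monoʳ-≤ 16 s≥1) (*-monoʳ-≤ 16 (≤-trans r≤y y≤s)))) (≤-reflexive (alg₂ s))) ⟩
  8 * y * (18 * s + 16 * s + 12 * s) + 44 * s       ≤⟨ +-monoʳ-≤ (8 * y * (18 * s + 16 * s + 12 * s)) (*-monoʳ-≤ 44 (≤-trans (≤-reflexive (sym (*-identityˡ s))) (*-monoˡ-≤ s y≥1))) ⟩
  8 * y * (18 * s + 16 * s + 12 * s) + 44 * (y * s) ≡⟨ alg₃ y s ⟩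
  412 * (y * s) ∎
  where
  open ≤-Reasoning
  s≥1 : 1 ≤ s
  s≥1 = ≤-trans y≥1 y≤s
  alg : ∀ r s → r * 8 * (suc (6 + r * 8 * 2) + (6 * suc (2 * s) + 3) + 2) + ((6 + r * 8 * 2) + (6 * suc (2 * s) + 3) + 1) ≡
                8 * r * (18 + 16 * r + 12 * s) + (16 + 16 * r + 12 * s)
  alg = solve-∀
  alg₂ : ∀ s → 16 * s + 16 * s + 12 * s ≡ 44 * s
  alg₂ = solve-∀
  alg₃ : ∀ y s → 8 * y * (18 * s + 16 * s + 12 * s) + 44 * (y * s) ≡ 412 * (y * s)
  alg₃ = solve-∀

-- Parameters for the threshold A n + 6. The 6 becomes the surplus 2 after division by the 3 of
-- Voorhoeve's identity.
Few : ℕ → ℕ → ℕ → Set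
Few A D n = ∃ λ m → ∃ λ κ → 2 * (A * n + 6) ≤ tri κ × A * n + 6 ≤ 2 ^ m × D * layers m κ ≤ n

opaque
  -- The number of layers grows like √n log n.
  sublinear : ∀ A D → ∃ λ n₀ → ∀ n → n₀ ≤ n → Few (suc A) D n
  sublinear A D = eighth C′ , λ n h → go n h (scale (suc A * n + 6))
    where
    -- For n beyond C′ ^ 8 the factor y ≥ C′ outweighs all constants; 256 = 2 ^ 8 is the loss
    -- between consecutive values of (2 ^ r) ^ 8.
    C′ : ℕ
    C′ = 256 * (suc A * (D * 412) + 6)
    go : ∀ n → eighth C′ ≤ n → (∃ λ r → suc A * n + 6 ≤ eighth (2 ^ r) × (∀ j → r ≡ suc j → eighth (2 ^ j) < suc A * n + 6)) →
         Few (suc A) D n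
    go n h (r , hr , last) = r * 8 , suc (2 * s) , ≤-trans (*-monoʳ-≤ 2 hr) (tri-large s) , ≤-trans hr (≤-reflexive (sym (2^-eighth r))) , few r refl
      where
      y s M L : ℕ
      y = 2 ^ r
      s = fourth y
      M = suc A * n + 6
      L = layers (r * 8) (suc (2 * s))
      y≥1 : 1 ≤ y
      y≥1 = ≤-trans (s≤s z≤n) (2^-big r)
      L≤ : L ≤ 412 * (y * s)
      L≤ = layers≤ r (≤-trans (n≤1+n r) (2^-big r)) y≥1 (y≤fourth y≥1)
      n≤M : n ≤ M
      n≤M = ≤-trans (m≤m+n n (A * n)) (m≤m+n (suc A * n) 6)
      C′≤y : C′ ≤ y
      C′≤y = ≮⇒≥ λ l → <⇒≱ (eighth-< l) (≤-trans h (≤-trans n≤M hr))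
      main : 256 * (suc A * (D * L) + 6) ≤ eighth y
      main = begin
        256 * (suc A * (D * L) + 6)                       ≤⟨ *-monoʳ-≤ 256 (+-mono-≤ (*-monoʳ-≤ (suc A) (*-monoʳ-≤ D L≤)) (*-monoʳ-≤ 6 (*-mono-≤ y≥1 (≤-trans y≥1 (y≤fourth y≥1))))) ⟩
        256 * (suc A * (D * (412 * (y * s))) + 6 * (y * s)) ≡⟨ alg A D (y * s) ⟩
        C′ * (y * s)                                       ≤⟨ *-monoˡ-≤ (y * s) C′≤y ⟩
        y * (y * s)                                        ≡⟨ sym (*-assoc y y s) ⟩
        (y * y) * s                                        ≤⟨ *-monoˡ-≤ s (≤-trans (≤-reflexive (sym (*-identityʳ (y * y)))) (*-monoʳ-≤ (y * y) (*-mono-≤ y≥1 y≥1))) ⟩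
        eighth y                                           ∎
        where
        open ≤-Reasoning
        alg : ∀ A D t → 256 * (suc A * (D * (412 * t)) + 6 * t) ≡ 256 * (suc A * (D * 412) + 6) * t
        alg = solve-∀
      few : ∀ k → k ≡ r → D * L ≤ n
      few zero refl = ⊥-elim (<⇒≱ (≤-trans (s≤s (s≤s z≤n)) (*-monoʳ-≤ 256 (m≤n+m 6 (suc A * (D * 412))))) C′≤y)
      few (suc j) refl = <⇒≤ (*-cancelˡ-< (suc A) (D * L) n (+-cancelʳ-< 6 _ _ (≤-<-trans
        (*-cancelˡ-≤ 256 (≤-trans main (≤-reflexive (alg (2 ^ j))))) (last j refl))))
        where
        alg : ∀ y → ((2 * y) * (2 * y) * ((2 * y) * (2 * y))) * ((2 * y) * (2 * y) * ((2 * y) * (2 * y))) ≡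
                    256 * (((y * y) * (y * y)) * ((y * y) * (y * y)))
        alg = solve-∀

Bound-for : ℕ → ℕ → ℕ → Set
Bound-for P Q c = ∀ N n → SmallerGraphs N P Q c n

beyond-four : ∀ {n} → 5 ≤ n → n ≡ 4 + (n ∸ 4)
beyond-four h = sym (m+[n∸m]≡n (≤-trans (n≤1+n 4) h))

base-large : ∀ n₀ n μ → 4 * n + 6 ≤ 3 * μ → n + 2 * (7 + n₀) ≤ (7 + n₀) * μ
base-large n₀ n μ l = *-cancelˡ-≤ 3 (lin (25 * n + 4 * (n₀ * n)) (*-monoʳ-≤ (7 + n₀) l) (alg n₀ n μ))
  where alg : ∀ n₀ n μ → 3 * (n + 2 * (7 + n₀)) + (7 + n₀) * (3 * μ) + (25 * n + 4 * (n₀ * n)) ≡ 3 * ((7 + n₀) * μ) + (7 + n₀) * (4 * n + 6)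
        alg = solve-∀

base-main : ∀ n₀ n k μ L → n ≡ 4 + k → 32 * L ≤ n → 4 * (2 * (7 + n₀) + 1 * k) ≤ (7 + n₀) * (3 * μ) + 4 * (2 * L) → n + 2 * (7 + n₀) ≤ (7 + n₀) * μ
base-main n₀ n k μ L refl h l = *-cancelˡ-≤ 12 (lin (3 * k + 8 * n₀ + 4) (+-mono-≤ (*-monoʳ-≤ 4 l) h) (alg n₀ k μ L))
    where alg : ∀ n₀ k μ L → 12 * ((4 + k) + 2 * (7 + n₀)) + (4 * ((7 + n₀) * (3 * μ) + 4 * (2 * L)) + (4 + k)) + (3 * k + 8 * n₀ + 4) ≡
                12 * ((7 + n₀) * μ) + (4 * (4 * (2 * (7 + n₀) + 1 * k)) + 32 * L)
          alg = solve-∀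

module Base (n₀ : ℕ) (small : ∀ n → n₀ ≤ n → Few 4 32 n) where

  -- Up to Q vertices μ ≥ 3 suffices, as n + 2 Q ≤ 3 Q; beyond that n ≥ n₀ holds. The 7 gives 8 Q +
  -- 12 ≥ 64, the slack needed in `base-main`.
  Q : ℕ
  Q = 7 + n₀

  three : ∀ m → 8 ≤ 3 * m → 3 ≤ m
  three zero ()
  three (suc zero) (s≤s (s≤s (s≤s ())))
  three (suc (suc zero)) (s≤s (s≤s (s≤s (s≤s (s≤s (s≤s ()))))))
  three (suc (suc (suc m))) _ = s≤s (s≤s (s≤s z≤n))

  module _ {N} {E F : EList N} {U : VSub N} (G : Cubic′ E U) (C : Essential4 E U) (h₅ : 5 ≤ size U)
           (IH : SmallerGraphs N 1 Q 0 (size U)) {u x : Fin N} (eq : E ≋ (u , x) ∷ F) where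

    goal : Dec (size U ≤ Q) → size U + 2 * Q ≤ Q * μ F U
    goal (yes l) = ≤-trans (+-monoˡ-≤ (2 * Q) l) (≤-trans (*-monoˡ-≤ Q (three (μ F U) (OneEdge.eight 1 Q 0 G C h₅ IH eq))) (≤-reflexive (*-comm (μ F U) Q)))
    goal (no k) = by-layers (small (size U) (≤-trans (m≤n+m n₀ 7) (<⇒≤ (≰⇒> k))))
      where
      by-layers : Few 4 32 (size U) → size U + 2 * Q ≤ Q * μ F U
      by-layers (m , κ , hκ , hm , hL) = either (OneEdge.one-step 1 Q 0 G C h₅ IH eq (4 * size U + 6) m κ hκ hm)
        where
        either : 4 * size U + 6 ≤ 3 * μ F U ⊎ 4 * (2 * Q + 1 * (size U ∸ 4)) ≤ Q * (3 * μ F U) + 4 * (2 * layers m κ) → size U + 2 * Q ≤ Q * μ F U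
        either (inj₁ l) = base-large n₀ (size U) (μ F U) l
        either (inj₂ l) = base-main n₀ (size U) (size U ∸ 4) (μ F U) (layers m κ) (beyond-four h₅) hL l

  -- In contrast to `Improve`, the hypothesis for smaller graphs is the very bound being proved,
  -- with `n` as induction variable.
  all : Bound-for 1 Q 0
  all N (suc n) E U h₅ lt G C e R eq = ≤-trans (≤-reflexive (cong (_+ 2 * Q) (+-identityʳ (size U))))
    (≤-trans (goal G C h₅ (λ E′ U′ h l → all N n E′ U′ h (≤-trans l (≤-pred lt))) eq (size U ≤? Q)) (m≤m+n (Q * μ R U) 0))

-- The slope gained is 16 / 12 but only 15 / 12 = 5 / 4 is claimed; the difference of P n / 12 ≥ n /
-- 12 pays for the layers.
improved-main : ∀ P′ Q c n₀ n k μ L → n ≡ 4 + k → 16 * (c + 2 * suc P′) * L ≤ n →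
  4 * (2 * Q + suc P′ * k) ≤ Q * (3 * μ) + 4 * ((c + 2 * suc P′) * L) →
  5 * suc P′ * n + 2 * (4 * Q) ≤ 4 * Q * μ + (64 * suc P′ + 5 * suc P′ * n₀ + 8 * Q)
improved-main P′ Q c n₀ n k μ L refl h l = *-cancelˡ-≤ 3 (lin (8 * Q + 124 * suc P′ + P′ * (4 + k) + 4 * suc P′ + 15 * (suc P′ * n₀) + 24 * Q)
      (+-mono-≤ (*-monoʳ-≤ 4 l) h) (alg P′ Q c n₀ k μ L))
    where alg : ∀ P′ Q c n₀ k μ L → 3 * (5 * suc P′ * (4 + k) + 2 * (4 * Q)) + (4 * (Q * (3 * μ) + 4 * ((c + 2 * suc P′) * L)) + (4 + k)) +
                  (8 * Q + 124 * suc P′ + P′ * (4 + k) + 4 * suc P′ + 15 * (suc P′ * n₀) + 24 * Q) ≡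
                3 * (4 * Q * μ + (64 * suc P′ + 5 * suc P′ * n₀ + 8 * Q)) + (4 * (4 * (2 * Q + suc P′ * k)) + 16 * (c + 2 * suc P′) * L)
          alg = solve-∀

improved-large : ∀ P′ Q′ c′ n μ → (4 + 4 * P′) * n + 6 ≤ 3 * μ → 5 * suc P′ * n + 2 * (4 * suc Q′) ≤ 4 * suc Q′ * μ + c′
improved-large P′ Q′ c′ n μ l = *-cancelˡ-≤ 3 (lin (n + P′ * n + 16 * (Q′ * n) + 16 * (Q′ * (P′ * n)) + 3 * c′) (*-monoʳ-≤ (4 * suc Q′) l) (alg P′ Q′ n μ c′))
    where alg : ∀ P′ Q′ n μ c′ → 3 * (5 * suc P′ * n + 2 * (4 * suc Q′)) + 4 * suc Q′ * (3 * μ) + (n + P′ * n + 16 * (Q′ * n) + 16 * (Q′ * (P′ * n)) + 3 * c′) ≡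
                3 * (4 * suc Q′ * μ + c′) + 4 * suc Q′ * ((4 + 4 * P′) * n + 6)
          alg = solve-∀

module Improve (P′ Q′ c n₀ : ℕ) (H : Bound-for (suc P′) (suc Q′) c)
               (small : ∀ n → n₀ ≤ n → Few (4 + 4 * P′) (16 * (c + 2 * suc P′)) n) where

  -- 64 P covers the four vertices subtracted in the one-step bound, multiplied by 16 P; the other
  -- summands cover the graphs with fewer than `n₀` vertices.
  P Q c′ : ℕ
  P = suc P′
  Q = suc Q′
  c′ = 64 * P + 5 * P * n₀ + 8 * Q

  module _ {N} {E F : EList N} {U : VSub N} (G : Cubic′ E U) (C : Essential4 E U) (h₅ : 5 ≤ size U)
           {u x : Fin N} (eq : E ≋ (u , x) ∷ F) where

    goal : Dec (n₀ ≤ size U) → 5 * P * size U + 2 * (4 * Q) ≤ 4 * Q * μ F U + c′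
    goal (no k) = ≤-trans (+-mono-≤ (*-monoʳ-≤ (5 * P) (<⇒≤ (≰⇒> k))) (≤-reflexive (sym (*-assoc 2 4 Q))))
      (≤-trans (+-monoˡ-≤ (8 * Q) (m≤n+m (5 * P * n₀) (64 * P))) (m≤n+m c′ (4 * Q * μ F U)))
    goal (yes k) = by-layers (small (size U) k)
      where
      by-layers : Few (4 + 4 * P′) (16 * (c + 2 * P)) (size U) → 5 * P * size U + 2 * (4 * Q) ≤ 4 * Q * μ F U + c′
      by-layers (m , κ , hκ , hm , hL) = either (OneEdge.one-step P Q c G C h₅ (H N (size U)) eq ((4 + 4 * P′) * size U + 6) m κ hκ hm)
        where
        either : (4 + 4 * P′) * size U + 6 ≤ 3 * μ F U ⊎ 4 * (2 * Q + P * (size U ∸ 4)) ≤ Q * (3 * μ F U) + 4 * ((c + 2 * P) * layers m κ) →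
                 5 * P * size U + 2 * (4 * Q) ≤ 4 * Q * μ F U + c′
        either (inj₁ l) = improved-large P′ Q′ c′ (size U) (μ F U) l
        either (inj₂ l) = improved-main P′ Q c n₀ (size U) (size U ∸ 4) (μ F U) (layers m κ) (beyond-four h₅) hL l

  all : Bound-for (5 * P) (4 * Q) c′
  all N n E U h₅ lt G C e R eq = goal G C h₅ eq (n₀ ≤? size U)

opaque
  base : ∃ λ Q → 1 ≤ Q × Bound-for 1 Q 0
  base = Base.Q n₀ small , s≤s z≤n , Base.all n₀ small
    where
    n₀ : ℕ
    n₀ = proj₁ (sublinear 3 32)
    small : ∀ n → n₀ ≤ n → Few 4 32 n
    small = proj₂ (sublinear 3 32)

  improve : ∀ {P Q c} → 1 ≤ P → 1 ≤ Q → Bound-for P Q c → ∃ λ c′ → Bound-for (5 * P) (4 * Q) c′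
  improve {suc P′} {suc Q′} {c} _ _ H = Improve.c′ P′ Q′ c n₀ H small , Improve.all P′ Q′ c n₀ H small
    where
    n₀ : ℕ
    n₀ = proj₁ (sublinear (3 + 4 * P′) (16 * (c + 2 * suc P′)))
    small : ∀ n → n₀ ≤ n → Few (4 + 4 * P′) (16 * (c + 2 * suc P′)) n
    small = proj₂ (sublinear (3 + 4 * P′) (16 * (c + 2 * suc P′)))

-- Repeated improvement multiplies the slope P / Q by 5 / 4.
arbitrary-slope : ∀ K → ∃ λ c → ∀ {N} (E : EList N) (U : VSub N) → 5 ≤ size U → Cubic′ E U → Essential4 E U →
                  ∀ e R → E ≋ e ∷ R → K * size U ≤ μ R U + c
arbitrary-slope K with base
... | zero , () , _
... | Q₀@(suc Q₁) , _ , H₀ = go (iterate (4 * Q₀ * K))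
  where
  -- P / Q ≥ (1 + j / 4) / Q₀, Bernoulli's inequality for the powers of 5 / 4; being linear in j, it
  -- shows that 4 Q₀ K improvements reach slope K.
  Level : ℕ → Set
  Level j = ∃ λ P → ∃ λ Q → ∃ λ c → 1 ≤ P × 1 ≤ Q × (4 + j) * Q ≤ 4 * Q₀ * P × Bound-for P Q c
  iterate : ∀ j → Level j
  iterate zero = 1 , Q₀ , 0 , s≤s z≤n , s≤s z≤n , ≤-reflexive (alg Q₀) , H₀
    where alg : ∀ q → 4 * q ≡ 4 * q * 1
          alg = solve-∀
  iterate (suc j) with iterate j
  ... | P , Q , c , hP , hQ , h , H with improve hP hQ H
  ... | c′ , H′ = 5 * P , 4 * Q , c′ , ≤-trans hP (m≤n*m P 5) , ≤-trans hQ (m≤n*m Q 4) ,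
    lin (j * Q) (*-monoʳ-≤ 5 h) (alg j Q Q₀ P) , H′
    where alg : ∀ j q q₀ p → (4 + suc j) * (4 * q) + 5 * (4 * q₀ * p) + j * q ≡ 4 * q₀ * (5 * p) + 5 * ((4 + j) * q)
          alg = solve-∀
  go : Level (4 * Q₀ * K) → ∃ λ c → ∀ {N} (E : EList N) (U : VSub N) → 5 ≤ size U → Cubic′ E U → Essential4 E U →
       ∀ e R → E ≋ e ∷ R → K * size U ≤ μ R U + c
  go (P , zero , c , hP , () , h , H)
  go (P , suc Q , c , hP , hQ , h , H) = c , λ {N} E U h₅ G C e R eq → *-cancelˡ-≤ (suc Q) (bound (size U) (μ R U) (H N (suc (size U)) E U h₅ ≤-refl G C e R eq))
    where
    slope : K * suc Q ≤ P
    slope = *-cancelˡ-≤ (4 * Q₀) (lin (4 * suc Q) h (alg K Q Q₁ P))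
      where alg : ∀ k q q₁ p → 4 * suc q₁ * (k * suc q) + 4 * suc q₁ * p + 4 * suc q ≡ 4 * suc q₁ * p + (4 + 4 * suc q₁ * k) * suc q
            alg = solve-∀
    bound : ∀ n μ → P * n + 2 * suc Q ≤ suc Q * μ + c → suc Q * (K * n) ≤ suc Q * (μ + c)
    bound n μ l = ≤-trans (≤-reflexive (alg K Q n)) (≤-trans (*-monoˡ-≤ n slope) (≤-trans (m≤m+n (P * n) (2 * suc Q))
      (≤-trans l (≤-trans (+-monoʳ-≤ (suc Q * μ) (m≤n*m c (suc Q))) (≤-reflexive (sym (*-distribˡ-+ (suc Q) μ c)))))))
      where alg : ∀ k q n → suc q * (k * n) ≡ k * suc q * n
            alg = solve-∀

-- From multigraphs to lists of edges

sumF-zero : {f : Fin N → ℕ} → (∀ i → f i ≡ 0) → sumF f ≡ 0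
sumF-zero {zero} h = refl
sumF-zero {suc N} h = cong₂ _+_ (h zero) (sumF-zero (h ∘ suc))

ifn-zero : ∀ b → ifn b 0 ≡ 0
ifn-zero true = refl
ifn-zero false = refl

sumF-at : (a : Fin N) (X : VSub N) → sumF (λ v → ifn (X v) (χ (a == v))) ≡ χ (X a)
sumF-at zero X = trans (cong₂ _+_ (one (X zero)) (sumF-zero λ i → ifn-zero (X (suc i)))) (+-identityʳ _)
  where one : ∀ b → ifn b 1 ≡ χ b
        one true = refl
        one false = refl
sumF-at (suc a) X = trans (cong (_+ sumF (λ v → ifn (X (suc v)) (χ (a == v)))) (ifn-zero (X zero))) (sumF-at a (X ∘ suc))

opaque
  unfolding deg δ size
  handshake : (E : EList N) (X : VSub N) → sumF (λ v → ifn (X v) (deg E v)) ≡ sumE (λ { (a , b) → χ (X a) + χ (X b) }) E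
  handshake [] X = sumF-zero λ v → ifn-zero (X v)
  handshake ((a , b) ∷ E) X = trans (sumF-cong λ v → trans (ifn-+ (X v) (inc v (a , b)) (deg E v)) (cong (_+ ifn (X v) (deg E v)) (ifn-+ (X v) (χ (a == v)) (χ (b == v)))))
    (trans (sumF-+ (λ v → ifn (X v) (χ (a == v)) + ifn (X v) (χ (b == v))) (λ v → ifn (X v) (deg E v)))
      (cong₂ _+_ (trans (sumF-+ (λ v → ifn (X v) (χ (a == v))) (λ v → ifn (X v) (χ (b == v)))) (cong₂ _+_ (sumF-at a X) (sumF-at b X))) (handshake E X)))

  cubic-sum : (E : EList N) (X : VSub N) → (∀ v → X v ≡ true → deg E v ≡ 3) → sumF (λ v → ifn (X v) (deg E v)) ≡ 3 * size X
  cubic-sum E X h = trans (sumF-cong λ v → at v (X v) refl) (trans (sumF-+ (χ ∘ X) (λ v → χ (X v) + χ (X v))) (trans (cong (size X +_) (sumF-+ (χ ∘ X) (χ ∘ X)))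
      (cong (λ t → size X + (size X + t)) (sym (+-identityʳ (size X))))))
    where at : ∀ v b → X v ≡ b → ifn (X v) (deg E v) ≡ χ (X v) + (χ (X v) + χ (X v))
          at v true e rewrite e = h v e
          at v false e rewrite e = refl

edgeList : ∀ {k} → (Fin k → Edge N) → EList N
edgeList {k = zero} f = []
edgeList {k = suc k} f = f zero ∷ edgeList (f ∘ suc)

others : ∀ {k} → (Fin k → Edge N) → Fin k → EList N
others f zero = edgeList (f ∘ suc)
others f (suc e) = f zero ∷ others (f ∘ suc) e

edge-others : ∀ {k} (f : Fin k → Edge N) (e : Fin k) → edgeList f ≋ f e ∷ others f e
edge-others f zero = ≋-refl
edge-others f (suc e) = ≋-trans (≋-prep _ (edge-others (f ∘ suc) e)) (≋-swap _ _)

sumE-edgeList : ∀ {k} (φ : Edge N → ℕ) (f : Fin k → Edge N) → sumE φ (edgeList f) ≡ sumF (φ ∘ f)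
sumE-edgeList {k = zero} φ f = refl
sumE-edgeList {k = suc k} φ f = cong (φ (f zero) +_) (sumE-edgeList φ (f ∘ suc))

all-edgeList : ∀ {k} {P : Edge N → Set} (f : Fin k → Edge N) → (∀ i → P (f i)) → All P (edgeList f)
all-edgeList {k = zero} f h = []
all-edgeList {k = suc k} f h = h zero ∷ all-edgeList (f ∘ suc) (h ∘ suc)

filter-length : ∀ {k} {A : Set} {P : A → Set} (P? : ∀ a → Dec (P a)) (g : Fin k → A) →
                length (filter P? (List.tabulate g)) ≡ sumF (λ i → χ (does (P? (g i))))
filter-length {zero} P? g = refl
filter-length {suc k} P? g with does (P? (g zero))
... | true = cong suc (filter-length P? (g ∘ suc))
... | false = filter-length P? (g ∘ suc)

filter-length-map : {A B : Set} {P : B → Set} (P? : ∀ b → Dec (P b)) (g : A → B) (xs ys : List A) (h : A → B) →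
  length (filter P? (map g xs ++ map h ys)) ≡ length (filter (P? ∘ g) xs) + length (filter (P? ∘ h) ys)
filter-length-map P? g [] [] h = refl
filter-length-map P? g [] (y ∷ ys) h with does (P? (h y))
... | true = cong suc (filter-length-map P? g [] ys h)
... | false = filter-length-map P? g [] ys h
filter-length-map P? g (x ∷ xs) ys h with does (P? (g x))
... | true = cong suc (filter-length-map P? g xs ys h)
... | false = filter-length-map P? g xs ys h

-- M, as a set of edges among the f i, is a perfect matching of U.
Matches : ∀ {k} → (Fin k → Edge N) → VSub N → Vec Bool k → Set
Matches f U M = ∀ v → sumF (λ i → ifn (lookup M i) (inc v (f i))) ≡ χ (U v)

Loopless : ∀ {k} → (Fin k → Edge N) → Set
Loopless f = ∀ i → proj₁ (f i) ≢ proj₂ (f i)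

opaque
  unfolding _⊖_
  χ-⊖₂ : (U : VSub N) {a b : Fin N} → a ≢ b → U a ≡ true → U b ≡ true → ∀ v → inc v (a , b) + χ ((U ⊖ a ⊖ b) v) ≡ χ (U v)
  χ-⊖₂ U {a} {b} ne ha hb v with v ≟ a | v ≟ b
  ... | yes refl | yes refl = ⊥-elim (ne refl)
  ... | yes refl | no nb rewrite ==-refl v | ==-≢ (nb ∘ sym) | ha = refl
  ... | no na | yes refl rewrite ==-refl v | ==-≢ (na ∘ sym) | hb = refl
  ... | no na | no nb rewrite ==-≢ (na ∘ sym) | ==-≢ (nb ∘ sym) with U v
  ... | true = refl
  ... | false = refl

extend : ∀ {k} (f : Fin (suc k) → Edge N) → Loopless f → {U : VSub N} → U (proj₁ (f zero)) ≡ true → U (proj₂ (f zero)) ≡ true →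
         ∀ {M} → Matches (f ∘ suc) (U ⊖ proj₁ (f zero) ⊖ proj₂ (f zero)) M → Matches f U (true ∷ M)
extend f nl {U} ha hb m v = trans (cong (inc v (f zero) +_) (m v)) (χ-⊖₂ U (nl zero) ha hb v)

size-zero⁻ : {U : VSub N} → isz (size U) ≡ 0 ⊎ (isz (size U) ≡ 1 × (∀ v → U v ≡ false))
size-zero⁻ {U = U} = go (size U) refl
  where go : ∀ s → size U ≡ s → isz s ≡ 0 ⊎ (isz s ≡ 1 × (∀ v → U v ≡ false))
        go zero e = inj₂ (refl , size-zero e)
        go (suc s) e = inj₁ refl

-- The list of all edge sets branches on the first edge just as `μ` does, so no bijection between
-- matchings and list entries has to be set up.
branches : ∀ {k} {a b : Fin N} (F : EList N) (U : VSub N) {P : Vec Bool (suc k) → Set} (P? : ∀ M → Dec (P M)) →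
  (U a ≡ true → U b ≡ true → μ F (U ⊖ a ⊖ b) ≤ length (filter (P? ∘ (true ∷_)) (allVecs k))) →
  μ F U ≤ length (filter (P? ∘ (false ∷_)) (allVecs k)) → μ ((a , b) ∷ F) U ≤ length (filter P? (allVecs (suc k)))
branches {k = k} {a} {b} F U P? h₁ h₂ = ≤-trans (≤-reflexive (μ-step a b F U)) (≤-trans (≤-reflexive (+-comm (μ F U) _))
  (≤-trans (+-mono-≤ (used (U a) (U b) refl refl) h₂) (≤-reflexive (sym (filter-length-map P? (true ∷_) (allVecs k) (allVecs k) (false ∷_))))))
  where
  used : ∀ p q → U a ≡ p → U b ≡ q → ifn (p ∧ q) (μ F (U ⊖ a ⊖ b)) ≤ length (filter (P? ∘ (true ∷_)) (allVecs k))
  used true true e f = h₁ e f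
  used true false e f = z≤n
  used false q e f = z≤n

count≥ : ∀ {k} (f : Fin k → Edge N) → Loopless f → (U : VSub N) {P : Vec Bool k → Set} (P? : ∀ M → Dec (P M)) →
         (∀ M → Matches f U M → P M) → μ (edgeList f) U ≤ length (filter P? (allVecs k))
count≥ {k = zero} f nl U {P} P? h = ≤-trans (≤-reflexive (μ-[] U)) (go size-zero⁻)
  where
  go : isz (size U) ≡ 0 ⊎ (isz (size U) ≡ 1 × (∀ v → U v ≡ false)) → isz (size U) ≤ length (filter P? ([] ∷ []))
  go (inj₁ e) = ≤-trans (≤-reflexive e) z≤n
  go (inj₂ (e , z)) with P? []
  ... | yes _ = ≤-reflexive e
  ... | no n = ⊥-elim (n (h [] λ v → sym (cong χ (z v))))
count≥ {k = suc k} f nl U P? h = branches (edgeList (f ∘ suc)) U P?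
  (λ ha hb → count≥ (f ∘ suc) (nl ∘ suc) (U ⊖ proj₁ (f zero) ⊖ proj₂ (f zero)) (P? ∘ (true ∷_)) λ M m → h (true ∷ M) (extend f nl ha hb {M} m))
  (count≥ (f ∘ suc) (nl ∘ suc) U (P? ∘ (false ∷_)) λ M m → h (false ∷ M) m)

count-avoiding : ∀ {k} (f : Fin k → Edge N) → Loopless f → (e : Fin k) (U : VSub N) {P : Vec Bool k → Set} (P? : ∀ M → Dec (P M)) →
                 (∀ M → Matches f U M → lookup M e ≡ false → P M) → μ (others f e) U ≤ length (filter P? (allVecs k))
count-avoiding {k = suc k} f nl zero U P? h = ≤-trans
  (count≥ (f ∘ suc) (nl ∘ suc) U (P? ∘ (false ∷_)) λ M m → h (false ∷ M) m refl)
  (≤-trans (m≤n+m _ (length (filter (P? ∘ (true ∷_)) (allVecs k)))) (≤-reflexive (sym (filter-length-map P? (true ∷_) (allVecs k) (allVecs k) (false ∷_)))))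
count-avoiding {k = suc k} f nl (suc e) U P? h = branches (others (f ∘ suc) e) U P?
  (λ ha hb → count-avoiding (f ∘ suc) (nl ∘ suc) e (U ⊖ proj₁ (f zero) ⊖ proj₂ (f zero)) (P? ∘ (true ∷_)) λ M m → h (true ∷ M) (extend f nl ha hb {M} m))
  (count-avoiding (f ∘ suc) (nl ∘ suc) e U (P? ∘ (false ∷_)) λ M m → h (false ∷ M) m)

-- The conclusion does not mention y′, so the edge closing a cycle needs no separate treatment in
-- `edges-distinct`.
joins-unique : (G : Multigraph) {e : Fin (m G)} {x y x′ y′ : Fin (n G)} → Joins G e x y → Joins G e x′ y′ → x ≡ x′ ⊎ y ≡ x′
joins-unique G (inj₁ (a , b)) (inj₁ (c , d)) = inj₁ (trans (sym a) c)
joins-unique G (inj₁ (a , b)) (inj₂ (c , d)) = inj₂ (trans (sym b) d)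
joins-unique G (inj₂ (a , b)) (inj₁ (c , d)) = inj₂ (trans (sym a) c)
joins-unique G (inj₂ (a , b)) (inj₂ (c , d)) = inj₁ (trans (sym b) d)

joins-≢ : (G : Multigraph) {e : Fin (m G)} {x y : Fin (n G)} → Joins G e x y → x ≢ y
joins-≢ G {e} (inj₁ (a , b)) refl = noLoop G e (trans a (sym b))
joins-≢ G {e} (inj₂ (a , b)) refl = noLoop G e (trans a (sym b))

module FromMultigraph (G : Multigraph) (cub : Cubic G) where

  ends : Fin (m G) → Edge (n G)
  ends e = src G e , tgt G e

  E : EList (n G)
  E = edgeList ends

  everything : VSub (n G)
  everything _ = true

  χ-∨ : ∀ p q → (p ≡ true → q ≡ true → ⊥) → χ (p ∨ q) ≡ χ p + χ q
  χ-∨ true true h = ⊥-elim (h refl refl)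
  χ-∨ true false h = refl
  χ-∨ false q h = refl

  χ-incident : ∀ v e → χ ((src G e == v) ∨ (tgt G e == v)) ≡ inc v (ends e)
  χ-incident v e = χ-∨ (src G e == v) (tgt G e == v) λ p q → noLoop G e (trans (==-≡ p) (sym (==-≡ q)))

  opaque
    unfolding deg δ size
    degree-deg : ∀ v → deg E v ≡ degree G v
    degree-deg v = trans (sumE-edgeList (inc v) ends) (sym (trans (filter-length (incident? G v) id) (sumF-cong (χ-incident v))))

    cutSize-δ : ∀ X → δ E X ≡ cutSize G X
    cutSize-δ X = trans (sumE-edgeList (cr X) ends) (sym (trans (filter-length (crosses? G X) id) (sumF-cong λ e → pt (X (src G e)) (X (tgt G e)))))
      where pt : ∀ a b → χ (not (does (a Boolₚ.≟ b))) ≡ χ (a xor b)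
            pt true true = refl
            pt true false = refl
            pt false true = refl
            pt false false = refl

    size-everything : size everything ≡ n G
    size-everything = go (n G)
      where go : ∀ k → sumF {k} (λ _ → 1) ≡ k
            go zero = refl
            go (suc k) = cong suc (go k)

  cubic′ : Cubic′ E everything
  cubic′ = record { inU = all-edgeList ends (λ _ → refl , refl) ; nl = all-edgeList ends (noLoop G)
                  ; d3 = λ v _ → trans (degree-deg v) (cub v) }

  mdeg-sum : ∀ M v → mdeg G M v ≡ sumF (λ e → ifn (lookup M e) (inc v (ends e)))
  mdeg-sum M v = trans (filter-length (λ e → inM? G M e ×-dec incident? G v e) id) (sumF-cong λ e → pt (lookup M e) e)
    where pt : ∀ b e → χ (b ∧ ((src G e == v) ∨ (tgt G e == v))) ≡ ifn b (inc v (ends e))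
          pt true e = χ-incident v e
          pt false e = refl

  matchings≤ : ∀ e → μ (others ends e) everything ≤ pmAvoidingCount G e
  matchings≤ e = count-avoiding ends (noLoop G) e everything (λ M → isPM? G M ×-dec ¬? (inM? G M e))
    λ M h avoid → (λ v → trans (mdeg-sum M v) (h v)) , λ t → subst Bool.T avoid t

  inner : VSub (n G) → VSub (m G)
  inner X e = X (src G e) ∧ X (tgt G e)

  at : Fin (n G) → VSub (m G)
  at v e = (src G e == v) ∨ (tgt G e == v)

  opaque
    unfolding _⊖_
    inner-⊖ : ∀ X v → inner X ∩ ∁ (at v) ≐ inner (X ⊖ v)
    inner-⊖ X v e = pt (X (src G e)) (X (tgt G e)) (src G e == v) (tgt G e == v)
      where pt : ∀ a b p q → (a ∧ b) ∧ not (p ∨ q) ≡ (a ∧ not p) ∧ (b ∧ not q)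
            pt false b p q = refl
            pt true false true q = refl
            pt true false false q = refl
            pt true true true q = refl
            pt true true false q = refl

  opaque
    unfolding δ deg size
    inner-count : ∀ X → 3 * size X ≡ size (inner X) + size (inner X) + δ E X
    inner-count X = trans (sym (cubic-sum E X λ v _ → d3 cubic′ v refl)) (trans (handshake E X)
      (trans (sumE-edgeList _ ends) (trans (sumF-cong λ e → pt (X (src G e)) (X (tgt G e)))
        (trans (sumF-+ (λ e → χ (inner X e) + χ (inner X e)) (cr X ∘ ends)) (cong₂ _+_ (sumF-+ (χ ∘ inner X) (χ ∘ inner X)) (sym (sumE-edgeList (cr X) ends)))))))
      where pt : ∀ a b → χ a + χ b ≡ χ (a ∧ b) + χ (a ∧ b) + χ (a xor b)
            pt true true = refl
            pt true false = refl
            pt false true = refl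
            pt false false = refl

  size-inner : ∀ X v → size (inner X) ≡ size (inner X ∩ at v) + size (inner (X ⊖ v))
  size-inner X v = trans (size-split (inner X) (at v)) (cong (size (inner X ∩ at v) +_) (size-cong (inner-⊖ X v)))

  -- Deleting a vertex with at most one inner edge preserves |X| ≤ number of inner edges, and the
  -- remaining vertices keep an inner edge; so the process ends in a nonempty set of minimum degree
  -- 2.
  prune : ∀ k X → size X ≤ k → 1 ≤ size (inner X) → size X ≤ size (inner X) →
          ∃ λ Y → (∀ v → Y v ≡ true → X v ≡ true) × Some Y × (∀ v → Y v ≡ true → 2 ≤ size (inner Y ∩ at v))
  prune k X le one more = go (any? λ v → (X v Boolₚ.≟ true) ×-dec (size (inner X ∩ at v) ≤? 1))
    where
    e = proj₁ (size-pick (inner X) one)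
    he = proj₂ (size-pick (inner X) one)
    go : Dec (∃ λ v → X v ≡ true × size (inner X ∩ at v) ≤ 1) →
         ∃ λ Y → (∀ v → Y v ≡ true → X v ≡ true) × Some Y × (∀ v → Y v ≡ true → 2 ≤ size (inner Y ∩ at v))
    go (no none) = X , (λ v h → h) , (src G e , ∧-left he) , λ v hv → ≰⇒> λ l → none (v , hv , l)
    go (yes (v , hv , l)) = again k le
      where
      two : 1 ≤ size (X ⊖ v)
      two = ≤-pred (≤-trans (size-two {U = X} (noLoop G e) (∧-left he) (∧-right {X (src G e)} he)) (≤-reflexive (size-⊖ X v hv)))
      more′ : size (X ⊖ v) ≤ size (inner (X ⊖ v))
      more′ = ≤-pred (≤-trans (≤-reflexive (sym (size-⊖ X v hv))) (≤-trans more (≤-trans (≤-reflexive (size-inner X v)) (+-monoˡ-≤ (size (inner (X ⊖ v))) l))))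
      again : ∀ k → size X ≤ k → ∃ λ Y → (∀ v → Y v ≡ true → X v ≡ true) × Some Y × (∀ v → Y v ≡ true → 2 ≤ size (inner Y ∩ at v))
      again zero le = ⊥-elim (<⇒≱ (size-pos {U = X} hv) le)
      again (suc k) le with prune k (X ⊖ v) (≤-pred (≤-trans (≤-reflexive (sym (size-⊖ X v hv))) le)) (≤-trans two more′) more′
      ... | Y , Y⊆X , some , rich = Y , (λ u h → ⊖-mem {U = X} (Y⊆X u h)) , some , rich

  module Walk (Y : VSub (n G)) (rich : ∀ v → Y v ≡ true → 2 ≤ size (inner Y ∩ at v)) where

    record Dart : Set where
      field
        from to : Fin (n G)
        edge : Fin (m G)
        joins : Joins G edge from to
        inFrom : Y from ≡ true
        inTo : Y to ≡ true
    open Dart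

    leaving : ∀ v e → (inner Y ∩ at v) e ≡ true → ∃ λ d → from d ≡ v × edge d ≡ e
    leaving v e h = go (src G e ≟ v) (tgt G e ≟ v) (∧-right {inner Y e} h)
      where
      hs = ∧-left {Y (src G e)} (∧-left h)
      ht = ∧-right {Y (src G e)} (∧-left h)
      go : (p : Dec (src G e ≡ v)) (q : Dec (tgt G e ≡ v)) → does p ∨ does q ≡ true → ∃ λ d → from d ≡ v × edge d ≡ e
      go (yes p) _ _ = record { from = src G e ; to = tgt G e ; edge = e ; joins = inj₁ (refl , refl) ; inFrom = hs ; inTo = ht } , p , refl
      go (no _) (yes q) _ = record { from = tgt G e ; to = src G e ; edge = e ; joins = inj₂ (refl , refl) ; inFrom = ht ; inTo = hs } , q , refl
      go (no _) (no _) ()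

    -- Minimum degree 2 lets the walk leave by another edge than it came by. Parallel edges count as
    -- different, so cycles of length 2 are found too.
    next : (d : Dart) → ∃ λ d′ → from d′ ≡ to d × edge d′ ≢ edge d
    next d with size-pick≢ (inner Y ∩ at (to d)) (edge d) (rich (to d) (inTo d))
    ... | e , he , ne with leaving (to d) e he
    ... | d′ , p , q = d′ , p , λ k → ne (trans (sym q) k)

    module From (d₀ : Dart) where

      walk : ℕ → Dart
      walk zero = d₀
      walk (suc t) = proj₁ (next (walk t))

      vtx : ℕ → Fin (n G)
      vtx t = from (walk t)

      edg : ℕ → Fin (m G)
      edg t = edge (walk t)

      joined : ∀ t → Joins G (edg t) (vtx t) (vtx (suc t))
      joined t = subst (Joins G (edg t) (vtx t)) (sym (proj₁ (proj₂ (next (walk t))))) (joins (walk t))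

      turns : ∀ t → edg (suc t) ≢ edg t
      turns t = proj₂ (proj₂ (next (walk t)))

      module Close (i k : ℕ) (closed : vtx (i + suc (suc k)) ≡ vtx i)
                   (distinct : ∀ a b → a < b → b < suc (suc k) → vtx (i + a) ≢ vtx (i + b)) where

        injective : {A : Set} (g : ℕ → A) → (∀ a b → a < b → b < suc (suc k) → g a ≢ g b) →
                    {p q : Fin (suc (suc k))} → g (toℕ p) ≡ g (toℕ q) → p ≡ q
        injective g h {p} {q} e with <-cmp (toℕ p) (toℕ q)
        ... | tri< l _ _ = ⊥-elim (h _ _ l (toℕ<n q) e)
        ... | tri≈ _ r _ = toℕ-injective r
        ... | tri> _ _ l = ⊥-elim (h _ _ l (toℕ<n p) (sym e))

        -- With distinct vertices an edge could recur only at two consecutive steps, which `turns`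
        -- forbids.
        edges-distinct : ∀ a b → a < b → b < suc (suc k) → edg (i + a) ≢ edg (i + b)
        edges-distinct a b l h e with joins-unique G (joined (i + a)) (subst (λ t → Joins G t (vtx (i + b)) (vtx (suc (i + b)))) (sym e) (joined (i + b)))
        ... | inj₁ r = distinct a b l h r
        ... | inj₂ r with m≤n⇒m<n∨m≡n l
        ... | inj₁ l′ = distinct (suc a) b l′ h (trans (cong vtx (+-suc i a)) r)
        ... | inj₂ refl = turns (i + a) (trans (cong edg (sym (+-suc i a))) (sym e))

        wraps : ∀ p → vtx (i + toℕ (cycSucc {suc k} p)) ≡ vtx (suc (i + toℕ p))
        wraps p with m≤n⇒m<n∨m≡n (toℕ<n p)
        ... | inj₁ l = trans (cong (λ t → vtx (i + t)) (trans (toℕ-fromℕ< _) (m<n⇒m%n≡m l))) (cong vtx (+-suc i (toℕ p)))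
        ... | inj₂ e = trans (cong (λ t → vtx (i + t)) (trans (toℕ-fromℕ< _) (trans (cong (_% suc (suc k)) e) (n%n≡0 (suc (suc k))))))
          (trans (cong vtx (+-identityʳ i)) (trans (sym closed) (trans (cong (λ t → vtx (i + t)) (sym e)) (cong vtx (+-suc i (toℕ p))))))

        cycle : (∀ t → Bool.T (Y (vtx t))) → HasCycleIn G Y
        cycle hY = k , (λ p → vtx (i + toℕ p)) , (λ p → edg (i + toℕ p)) ,
          injective (λ a → vtx (i + a)) distinct , injective (λ a → edg (i + a)) edges-distinct ,
          (λ p → hY (i + toℕ p)) , λ p → subst (Joins G (edg (i + toℕ p)) (vtx (i + toℕ p))) (sym (wraps p)) (joined (i + toℕ p))

      -- A shortest closed stretch of the walk is a cycle.
      close : ∀ fuel i g → g ≤ fuel → 1 ≤ g → vtx (i + g) ≡ vtx i → (∀ t → Bool.T (Y (vtx t))) → HasCycleIn G Y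
      close zero i (suc g) () _ _ _
      close zero i zero _ () _ _
      close (suc fuel) i g le pos e hY = go (any? {g} λ a → any? {g} λ b → (toℕ a <? toℕ b) ×-dec (vtx (i + toℕ a) ≟ vtx (i + toℕ b)))
        where
        go : Dec (∃ λ (a : Fin g) → ∃ λ (b : Fin g) → toℕ a < toℕ b × vtx (i + toℕ a) ≡ vtx (i + toℕ b)) → HasCycleIn G Y
        go (yes (a , b , l , r)) = close fuel (i + toℕ a) (toℕ b ∸ toℕ a) (≤-pred (≤-trans (s≤s (m∸n≤m (toℕ b) (toℕ a))) (≤-trans (toℕ<n b) le)))
          (m<n⇒0<n∸m l) (trans (cong vtx (trans (+-assoc i (toℕ a) _) (cong (i +_) (m+[n∸m]≡n (<⇒≤ l))))) (sym r)) hY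
        go (no none) = start g refl e
          where
          distinct : ∀ a b → a < b → b < g → vtx (i + a) ≢ vtx (i + b)
          distinct a b l h r = none (fromℕ< (<-trans l h) , fromℕ< h , subst₂ _<_ (sym (toℕ-fromℕ< _)) (sym (toℕ-fromℕ< h)) l ,
            trans (cong (λ t → vtx (i + t)) (toℕ-fromℕ< _)) (trans r (cong (λ t → vtx (i + t)) (sym (toℕ-fromℕ< h)))))
          start : ∀ g′ → g ≡ g′ → vtx (i + g) ≡ vtx i → HasCycleIn G Y
          start zero refl _ = ⊥-elim (<⇒≱ pos z≤n)
          start (suc zero) refl r = ⊥-elim (joins-≢ G (joined i) (trans (sym r) (cong vtx (+-comm i 1))))
          start (suc (suc k)) refl r = Close.cycle i k r distinct hY

    found : Some Y → HasCycleIn G Y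
    found (v , hv) with size-pick (inner Y ∩ at v) (≤-trans (s≤s z≤n) (rich v hv))
    ... | e , he with leaving v e he
    ... | d₀ , _ , _ with pigeonhole ≤-refl (From.vtx d₀ ∘ toℕ {suc (n G)})
    ... | i , j , l , r = From.close d₀ (toℕ j ∸ toℕ i) (toℕ i) (toℕ j ∸ toℕ i) ≤-refl (m<n⇒0<n∸m l)
      (trans (cong (From.vtx d₀) (m+[n∸m]≡n (<⇒≤ l))) (sym r)) λ t → subst Bool.T (sym (Dart.inFrom (From.walk d₀ t))) tt

  HasCycle-mono : {X Y : VSub (n G)} → (∀ v → Y v ≡ true → X v ≡ true) → HasCycleIn G Y → HasCycleIn G X
  HasCycle-mono {X} {Y} h (k , vs , es , i , j , hY , js) = k , vs , es , i , j , (λ p → go (vs p) (Y (vs p)) refl (hY p)) , js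
    where go : ∀ v b → Y v ≡ b → Bool.T b → Bool.T (X v)
          go v true e _ = subst Bool.T (sym (h v e)) tt

  -- From 3 |X| = 2 e + δ with δ ≤ 3 and |X| ≥ 2 it follows that the number e of inner edges is at
  -- least |X|; pruning then leaves minimum degree 2.
  has-cycle : ∀ X → 2 ≤ size X → δ E X ≤ 3 → HasCycleIn G X
  has-cycle X two few = go (prune (size X) X ≤-refl (≤-trans (≤-trans (n≤1+n 1) two) more) more)
    where
    more : size X ≤ size (inner X)
    more = ≮⇒≥ λ l → <⇒≱ two (≤-pred (lin 0 (+-mono-≤ (≤-reflexive (inner-count X)) (+-mono-≤ few (+-mono-≤ l l))) (alg (size X) (size (inner X)) (δ E X))))
      where alg : ∀ s t d → suc s + (t + t + d + (3 + (s + s))) + 0 ≡ 2 + (3 * s + (d + (suc t + suc t)))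
            alg = solve-∀
    go : (∃ λ Y → (∀ v → Y v ≡ true → X v ≡ true) × Some Y × (∀ v → Y v ≡ true → 2 ≤ size (inner Y ∩ at v))) → HasCycleIn G X
    go (Y , Y⊆X , some , rich) = HasCycle-mono Y⊆X (Walk.found Y rich some)

  essential4 : CyclicallyEdgeConnected 4 G → Essential4 E everything
  essential4 C X (a , b , ab , ha , hb) (c , d , cd , hc , hd) with 4 ≤? δ E X
  ... | yes l = l
  ... | no k = ≤-trans (C X (has-cycle X (size-two {U = X} ab ha hb) few , has-cycle (∁ X) (size-two {U = ∁ X} cd hc hd)
      (≤-trans (≤-reflexive (δ-∁ E X)) few))) (≤-reflexive (sym (cutSize-δ X)))
    where few : δ E X ≤ 3
          few = ≤-pred (≰⇒> k)

  -- Graphs with at most four vertices are absorbed in the constant K * 4.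
  linear-bound : ∀ K c → (∀ {N} (E : EList N) (U : VSub N) → 5 ≤ size U → Cubic′ E U → Essential4 E U →
                   ∀ e R → E ≋ e ∷ R → K * size U ≤ μ R U + c) → CyclicallyEdgeConnected 4 G →
                 ∀ e → K * n G ≤ pmAvoidingCount G e + (c + K * 4)
  linear-bound K c B C e with 5 ≤? n G
  ... | no h = ≤-trans (*-monoʳ-≤ K (≤-pred (≰⇒> h))) (≤-trans (m≤n+m (K * 4) c) (m≤n+m _ (pmAvoidingCount G e)))
  ... | yes h = ≤-trans (≤-reflexive (cong (K *_) (sym size-everything))) (≤-trans
      (B E everything (≤-trans h (≤-reflexive (sym size-everything))) cubic′ (essential4 C) (ends e) (others ends e) (edge-others ends e))
      (≤-trans (+-monoˡ-≤ c (matchings≤ e)) (+-monoʳ-≤ (pmAvoidingCount G e) (m≤m+n c (K * 4)))))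

-- Passage to rational slopes and constants

ratio : ℕ → ℚ
ratio k = (ℤ.+ k) ℚ./ 1

whole : ℕ → ℚᵘ
whole k = mkℚᵘ (ℤ.+ k) 0

ratio-whole : ∀ k → ℚ.toℚᵘ (ratio k) ≃ᵘ whole k
ratio-whole k = ℚₚ.toℚᵘ-fromℚᵘ (whole k)

ratio-* : ∀ a b → ratio a ℚ.* ratio b ≡ ratio (a * b)
ratio-* a b = ℚₚ.toℚᵘ-injective (ℚᵘₚ.≃-trans (ℚₚ.toℚᵘ-homo-* (ratio a) (ratio b))
  (ℚᵘₚ.≃-trans (ℚᵘₚ.*-cong (ratio-whole a) (ratio-whole b))
    (ℚᵘₚ.≃-trans (*≡* (cong (ℤ._* (ℤ.+ 1)) (sym (ℤₚ.pos-* a b)))) (ℚᵘₚ.≃-sym (ratio-whole (a * b))))))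

ratio-+ : ∀ a b → ratio (a + b) ≡ ratio a ℚ.+ ratio b
ratio-+ a b = ℚₚ.toℚᵘ-injective (ℚᵘₚ.≃-trans (ratio-whole (a + b)) (ℚᵘₚ.≃-sym (ℚᵘₚ.≃-trans (ℚₚ.toℚᵘ-homo-+ (ratio a) (ratio b))
  (ℚᵘₚ.≃-trans (ℚᵘₚ.+-cong (ratio-whole a) (ratio-whole b))
    (*≡* (cong (ℤ._* (ℤ.+ 1)) (cong₂ ℤ._+_ (ℤₚ.*-identityʳ (ℤ.+ a)) (ℤₚ.*-identityʳ (ℤ.+ b)))))))))

ratio-mono : ∀ {a b} → a ≤ b → ratio a ℚ.≤ ratio b
ratio-mono {a} {b} h = ℚₚ.toℚᵘ-cancel-≤ (ℚᵘₚ.≤-respˡ-≃ (ℚᵘₚ.≃-sym (ratio-whole a)) (ℚᵘₚ.≤-respʳ-≃ (ℚᵘₚ.≃-sym (ratio-whole b))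
  (*≤*ᵘ (ℤₚ.*-monoʳ-≤-nonNeg (ℤ.+ 1) (ℤ.+≤+ h)))))

-- Denominators are at least 1, so a nonnegative fraction is bounded by its numerator.
below-natural : (α : ℚ) → ∃ λ K → α ℚ.≤ ratio K
below-natural (mkℚ (ℤ.+ p) d co) = p , ℚₚ.toℚᵘ-cancel-≤ (ℚᵘₚ.≤-respʳ-≃ (ℚᵘₚ.≃-sym (ratio-whole p))
  (*≤*ᵘ (ℤₚ.*-monoˡ-≤-nonNeg (ℤ.+ p) (ℤ.+≤+ (s≤s z≤n)))))
below-natural (mkℚ ℤ.-[1+ p ] d co) = 0 , ℚₚ.toℚᵘ-cancel-≤ (ℚᵘₚ.≤-respʳ-≃ (ℚᵘₚ.≃-sym (ratio-whole 0)) (*≤*ᵘ ℤ.-≤+))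

move-right : ∀ {p q r} → p ℚ.≤ q ℚ.+ r → p ℚ.- r ℚ.≤ q
move-right {p} {q} {r} h = ℚₚ.≤-trans (ℚₚ.+-monoˡ-≤ (ℚ.- r) h) (ℚₚ.≤-reflexive
  (trans (ℚₚ.+-assoc q r (ℚ.- r)) (trans (cong (q ℚ.+_) (ℚₚ.+-inverseʳ r)) (ℚₚ.+-identityʳ q))))

Avoidance : ℚ → ℚ → Set
Avoidance α β = (G : Multigraph) → Cubic G → CyclicallyEdgeConnected 4 G → (e : Fin (m G)) → α ℚ.* ratio (n G) ℚ.- β ℚ.≤ ratio (pmAvoidingCount G e)

avoidance : ∀ {α K} b → α ℚ.≤ ratio K →
            (∀ G → Cubic G → CyclicallyEdgeConnected 4 G → ∀ e → K * n G ≤ pmAvoidingCount G e + b) → Avoidance α (ratio b)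
avoidance {α} {K} b h bound G cub C e = move-right {α ℚ.* ratio (n G)} {ratio (pmAvoidingCount G e)} {ratio b} (ℚₚ.≤-trans
  (ℚₚ.*-monoʳ-≤-nonNeg (ratio (n G)) {{ℚ.nonNegative (ratio-mono {0} {n G} z≤n)}} h)
  (ℚₚ.≤-trans (ℚₚ.≤-reflexive (ratio-* K (n G))) (ℚₚ.≤-trans (ratio-mono (bound G cub C e)) (ℚₚ.≤-reflexive (ratio-+ (pmAvoidingCount G e) b)))))

-- The successor in the constant makes β positive.
linear-avoidance : ∀ K → ∃ λ b → ∀ G → Cubic G → CyclicallyEdgeConnected 4 G → ∀ e → K * n G ≤ pmAvoidingCount G e + suc b
linear-avoidance K = conclude (arbitrary-slope K)
  where
  conclude : (∃ λ c → ∀ {N} (E : EList N) (U : VSub N) → 5 ≤ size U → Cubic′ E U → Essential4 E U →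
                  ∀ e R → E ≋ e ∷ R → K * size U ≤ μ R U + c) →
             ∃ λ b → ∀ G → Cubic G → CyclicallyEdgeConnected 4 G → ∀ e → K * n G ≤ pmAvoidingCount G e + suc b
  conclude (c , bound) = c + K * 4 , λ G cub C e → ≤-trans (FromMultigraph.linear-bound G cub K c bound C e)
    (+-monoʳ-≤ (pmAvoidingCount G e) (n≤1+n (c + K * 4)))

theorem32 : (α : ℚ) → 0ℚ ℚ.< α →
    Σ ℚ λ β → 0ℚ ℚ.< β ×
    ((G : Multigraph) → Cubic G → CyclicallyEdgeConnected 4 G →
    (e : Fin (m G)) →
    α ℚ.* ((ℤ.+ n G) ℚ./ 1) ℚ.- β ℚ.≤ (ℤ.+ pmAvoidingCount G e) ℚ./ 1)
theorem32 α _ = bounded (below-natural α)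
  where
  Bounded : Set
  Bounded = Σ ℚ λ β → 0ℚ ℚ.< β × Avoidance α β
  bounded : (∃ λ K → α ℚ.≤ ratio K) → Bounded
  bounded (K , h) = shifted (linear-avoidance K)
    where
    shifted : (∃ λ b → ∀ G → Cubic G → CyclicallyEdgeConnected 4 G → ∀ e → K * n G ≤ pmAvoidingCount G e + suc b) → Bounded
    shifted (b , bound) = ratio (suc b) , ℚₚ.<-≤-trans (ℚ.*<* (ℤ.+<+ (s≤s z≤n))) (ratio-mono {1} {suc b} (s≤s z≤n)) , avoidance {α} {K} (suc b) h bound
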